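{- Let $G$ be a simple graph that is DP $4$-critical. Then one of the following holds: (1) $G$ is a $4$-Ore graph on at most $10$ vertices; (2) $|E(G)| \geq \frac{8|V(G)|+1}{5}$.
   Context: A (DP-)cover of a multigraph $G$ is a pair $(H,L)$ where $H$ is a graph and $L: V(G)\to 2^{V(H)}$ is such that $\{L(u):u\in V(G)\}$ partitions $V(H)$, each $L(u)$ is an independent set in $H$, and for distinct $u,v\in V(G)$ joined by $s$ edges, $E_H(L(u),L(v))$ is a union of $s$ matchings (possibly non-perfect or empty). An $(H,L)$-coloring of $G$ is an independent set of $H$ containing exactly one vertex of $L(v)$ for each $v\in V(G)$. The DP chromatic number $\chi_{\mathrm{DP}}(G)$ is the least $k$ such that $G$ has an $(H,L)$-coloring for every cover with $|L(u)|\ge k$ for all $u$. $G$ is DP $k$-critical if $\chi_{\mathrm{DP}}(G)=k$ and $\chi_{\mathrm{DP}}(G')\le k-1$ for every proper subgraph $G'$ of $G$. For a graph $G$ and vertex $u$, a split of $u$ into $u_1,u_2$ is obtained by partitioning $N_G(u)$ into two nonempty sets $U_1,U_2$, deleting $u$, and adding new vertices $u_1,u_2$ with $N(u_i)=U_i$. A DHGO-composition of graphs $G_1,G_2$ is obtained by deleting an edge $xy$ of $G_1$, splitting a vertex $z$ of $G_2$ into $z_1,z_2$, and identifying $x$ with $z_1$ and $y$ with $z_2$. A graph is $4$-Ore if it is $K_4$ or a DHGO-composition of two $4$-Ore graphs. -}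

module Defs where

open import Data.Nat using (ℕ; zero; suc; _+_; _*_; _≤_; _<_; _<ᵇ_)
open import Data.Bool using (Bool; true; false; _∧_; if_then_else_)
open import Data.Fin using (Fin; toℕ)
open import Data.List using (List; map; allFin)
open import Data.Nat.ListAction using (sum)
open import Data.Product using (Σ; ∃; ∃-syntax; _×_; _,_)
open import Data.Sum using (_⊎_)
open import Relation.Nullary using (¬_)
open import Relation.Binary.PropositionalEquality using (_≡_; _≢_)

record Graph : Set where
  field
    n      : ℕ
    adj    : Fin n → Fin n → Bool
    sym    : ∀ i j → adj i j ≡ adj j i
    irrefl : ∀ i → adj i i ≡ false
open Graph public

countTrue : List Bool → ℕ
countTrue = sum ∘′ map (λ b → if b then 1 else 0)
  where
  _∘′_ : {A B C : Set} → (B → C) → (A → B) → A → C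
  (f ∘′ g) x = f (g x)

numEdges : Graph → ℕ
numEdges G =
  sum (map (λ i → countTrue (map (λ j → adj G i j ∧ (toℕ i <ᵇ toℕ j)) (allFin (n G))))
           (allFin (n G)))

-- DP covers.  A cover (H,L) of G with list sizes f : L(u) = {u} × Fin (f u),
-- and H's edge relation is the Boolean function M (on pairs (u,c)).

record IsCover (G : Graph) (f : Fin (n G) → ℕ)
               (M : (u : Fin (n G)) → Fin (f u) → (v : Fin (n G)) → Fin (f v) → Bool) : Set where
  field
    M-sym      : ∀ u c v d → M u c v d ≡ M v d u c
    M-indep    : ∀ u c d → M u c u d ≡ false
    M-nonadj   : ∀ u v c d → u ≢ v → adj G u v ≡ false → M u c v d ≡ false
    M-matching : ∀ u v c d d' → adj G u v ≡ true →
                 M u c v d ≡ true → M u c v d' ≡ true → d ≡ d'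

HasCoverColoring : (G : Graph) (f : Fin (n G) → ℕ)
  (M : (u : Fin (n G)) → Fin (f u) → (v : Fin (n G)) → Fin (f v) → Bool) → Set
HasCoverColoring G f M =
  Σ ((u : Fin (n G)) → Fin (f u)) λ φ → ∀ u v → M u (φ u) v (φ v) ≡ false

DPColorable : Graph → ℕ → Set
DPColorable G k =
  (f : Fin (n G) → ℕ) → (∀ u → k ≤ f u) →
  (M : (u : Fin (n G)) → Fin (f u) → (v : Fin (n G)) → Fin (f v) → Bool) →
  IsCover G f M → HasCoverColoring G f M

ChiDP≡ : Graph → ℕ → Set
ChiDP≡ G k = DPColorable G k × (∀ j → j < k → ¬ DPColorable G j)

record Subgraph (G : Graph) : Set where
  field
    sub      : Graph
    ι        : Fin (n sub) → Fin (n G)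
    ι-inj    : ∀ i j → ι i ≡ ι j → i ≡ j
    ι-adj    : ∀ i j → adj sub i j ≡ true → adj G (ι i) (ι j) ≡ true
open Subgraph public

IsProper : {G : Graph} → Subgraph G → Set
IsProper {G} S =
  ¬ ((∀ v → ∃[ i ] ι S i ≡ v) ×
     (∀ i j → adj G (ι S i) (ι S j) ≡ true → adj (sub S) i j ≡ true))

DPCritical : Graph → ℕ → Set
DPCritical G k =
  ChiDP≡ G k ×
  ((S : Subgraph G) → IsProper S → ∃[ j ] (j + 1 ≤ k × ChiDP≡ (sub S) j))

IsK4 : Graph → Set
IsK4 G = n G ≡ 4 × (∀ i j → i ≢ j → adj G i j ≡ true)

-- G is (isomorphic to) a DHGO-composition of G₁ and G₂:
-- delete edge xy of G₁, split z of G₂ into z₁ (neighbours U₁) and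
-- z₂ (neighbours U₂), identify x with z₁ and y with z₂.
-- V(G) = α(V(G₁)) ⊔ β(V(G₂) ∖ {z}) (α, β injective, disjoint, covering).
-- U₁ = {c ∈ N(z) : part c = true}, U₂ = {c ∈ N(z) : part c = false}.
-- logical equivalence
infix 3 _⇔ₚ_
_⇔ₚ_ : Set → Set → Set
A ⇔ₚ B = (A → B) × (B → A)

record DHGO (G₁ G₂ G : Graph) : Set where
  field
    x y      : Fin (n G₁)
    xy-edge  : adj G₁ x y ≡ true
    z        : Fin (n G₂)
    part     : Fin (n G₂) → Bool
    U₁-ne    : ∃[ c ] (adj G₂ z c ≡ true × part c ≡ true)
    U₂-ne    : ∃[ c ] (adj G₂ z c ≡ true × part c ≡ false)
    α        : Fin (n G₁) → Fin (n G)
    β        : Fin (n G₂) → Fin (n G)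
    α-inj    : ∀ a b → α a ≡ α b → a ≡ b
    β-inj    : ∀ c d → c ≢ z → d ≢ z → β c ≡ β d → c ≡ d
    αβ-disj  : ∀ a c → c ≢ z → α a ≢ β c
    cover    : ∀ w → (∃[ a ] α a ≡ w) ⊎ (∃[ c ] (c ≢ z × β c ≡ w))
    adj-αα   : ∀ a b → adj G (α a) (α b) ≡ true ⇔ₚ
                 (adj G₁ a b ≡ true × ¬ ((a ≡ x × b ≡ y) ⊎ (a ≡ y × b ≡ x)))
    adj-ββ   : ∀ c d → c ≢ z → d ≢ z → adj G (β c) (β d) ≡ adj G₂ c d
    adj-αβ   : ∀ a c → c ≢ z → adj G (α a) (β c) ≡ true ⇔ₚ
                 ((a ≡ x × adj G₂ z c ≡ true × part c ≡ true) ⊎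
                  (a ≡ y × adj G₂ z c ≡ true × part c ≡ false))

data Ore4 : Graph → Set where
  ore-K4   : ∀ {G} → IsK4 G → Ore4 G
  ore-comp : ∀ {G₁ G₂ G} → Ore4 G₁ → Ore4 G₂ → DHGO G₁ G₂ G → Ore4 G

-- Potential method.  A vertex with a list of 0, 1, 2 or 3 colours has potential −3, 1, 4 or 8, a bundle of
-- k ≥ 1 parallel edges costs 6k − 1, and ρ(B) is the potential of the vertices of B minus the cost of the edges
-- inside B.  The induction shows, for covers of multigraphs with arbitrary lists on A, that A is colourable
-- unless some nonempty B ⊆ A has ρ(B) ≤ −3, or has full lists and ρ(B) ≤ −1, or spans a 4-Ore graph on 4, 7 or
-- 10 vertices.  Colouring a set S takes at most 4 from the potential of the rest for every edge leaving S, whereas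
-- joining sets gains 5 for each such edge; so in a minimal counterexample proper subsets have large potential,
-- and an edge can be added or two vertices identified without losing colourability.  Hence the vertices whose
-- degree equals their list size span a forest, and counting edges makes ρ(A) too small.
-- For a DP 4-critical G with full lists, a maximal set of negative potential is all of G, because a colouring of a
-- smaller one could be extended or would reveal a larger one; then 8 |V| − 5 |E| ≤ −1.
module Submission where

open import Defs using (Graph; adj; numEdges; IsCover; HasCoverColoring; DPColorable; Subgraph; IsProper; DPCritical; DHGO; Ore4; ore-K4; ore-comp)
open import Data.Bool using (Bool; true; false; _∧_; _∨_; not; if_then_else_; T)
import Data.Bool.Properties as Boolp
open import Data.Empty using (⊥; ⊥-elim)
open import Data.Fin as Fin using (Fin; zero; suc)
open import Data.Fin.Patterns using (0F; 1F; 2F; 3F)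
import Data.Fin.Properties as Finp
open import Data.Integer as ℤ using (ℤ; +_; -[1+_]; _+_; _*_; _-_; -_; _≤_; +≤+; -≤+; 0ℤ; 1ℤ)
import Data.Integer.Properties as ℤp
open import Data.Integer.Tactic.RingSolver using (solve-∀)
import Data.List as List
import Data.List.Properties as Listp
open import Data.Nat as ℕ using (ℕ; zero; suc)
import Data.Nat.ListAction as ListAction
import Data.Nat.Properties as ℕp
open import Data.Product using (Σ; ∃-syntax; _×_; _,_; proj₁; proj₂)
open import Data.Sum using (_⊎_; inj₁; inj₂; [_,_]′)
open import Data.Unit using (tt)
open import Data.Vec as Vec using (Vec; []; _∷_)
import Data.Vec.Properties as Vecp
open import Function using (_∘_; case_of_)
open import Relation.Nullary using (¬_; Dec; yes; no; does)
open import Relation.Nullary.Decidable using (_⊎-dec_; _×-dec_; _→-dec_; ¬?; toWitness; ⌊_⌋; dec-true; dec-false; map′)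
open import Relation.Binary.PropositionalEquality using (_≡_; _≢_; refl; sym; trans; cong; cong₂; subst; subst₂; module ≡-Reasoning)

-- The constants come from extremal covers. With full lists a 4-Ore graph on n vertices has (5n -
-- 2)/3 edges, hence potential (10 - n)/3: nonnegative exactly for n = 4, 7, 10, so these graphs
-- need an outcome of their own. The smallest uncolourable covers meet the bounds: -3 for an empty
-- list, for two one-colour lists joined by an edge and for two two-colour lists joined by a double
-- edge; -1 for two full lists joined by a triple edge. Colouring a part first forces arbitrary
-- lists; added edges and identifications force multigraphs. The threshold `μ` is -2 if some list is
-- not full and 0 otherwise, so one argument serves both bounds; proper subsets get potential at
-- least `μ + 6`. The obstacle is that for `μ = 0` this is just too little for adding an edge: K₄
-- and the 7-vertex 4-Ore graphs minus an edge have potential 7 and 6. On a cycle of low vertices,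
-- edges are added between the outer neighbours of consecutive vertices, and the sets that block
-- them are glued by submodularity until they surround the cycle. For triangles this gains too
-- little, which is why diamonds are contracted as well.

-- A reflective checker for linear arithmetic over the integers

module LinearArithmetic where
  open import Data.Vec.N-ary using (N-ary; _$ⁿ_)
  open import Data.List as List using (List; []; _∷_)
  open import Data.List.Relation.Unary.All using (All; []; _∷_)
  open import Data.Maybe using (Maybe; just; nothing)

  infixl 6 _⊕_ _⊖_
  infixl 7 _⊙_
  infix 8 #_

  data Ex (n : ℕ) : Set where
    var  : Fin n → Ex n
    #_   : ℕ → Ex n
    _⊕_ _⊖_ : Ex n → Ex n → Ex n
    _⊙_  : ℕ → Ex n → Ex n

  ⟦_⟧ : ∀ {n} → Ex n → Vec ℤ n → ℤ
  ⟦ var i ⟧ ρ = Vec.lookup ρ i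
  ⟦ # k ⟧ ρ = + k
  ⟦ a ⊕ b ⟧ ρ = ⟦ a ⟧ ρ + ⟦ b ⟧ ρ
  ⟦ a ⊖ b ⟧ ρ = ⟦ a ⟧ ρ - ⟦ b ⟧ ρ
  ⟦ k ⊙ a ⟧ ρ = + k * ⟦ a ⟧ ρ

  infix 5 _≼_ _≐_
  infixr 4 _⟹_

  data Prob (n : ℕ) : Set where
    _≼_ _≐_ : Ex n → Ex n → Prob n
    contra : Prob n
    _⟹_ : Prob n → Prob n → Prob n

  ⟦_⟧ᵖ : ∀ {n} → Prob n → Vec ℤ n → Set
  ⟦ a ≼ b ⟧ᵖ ρ = ⟦ a ⟧ ρ ≤ ⟦ b ⟧ ρ
  ⟦ a ≐ b ⟧ᵖ ρ = ⟦ a ⟧ ρ ≡ ⟦ b ⟧ ρ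
  ⟦ contra ⟧ᵖ ρ = ⊥
  ⟦ p ⟹ q ⟧ᵖ ρ = ⟦ p ⟧ᵖ ρ → ⟦ q ⟧ᵖ ρ

  Form : ℕ → Set
  Form n = ℤ × Vec ℤ n

  dot : ∀ {n} → Vec ℤ n → Vec ℤ n → ℤ
  dot [] [] = 0ℤ
  dot (a ∷ as) (x ∷ xs) = a * x + dot as xs

  ⟦_⟧ᶠ : ∀ {n} → Form n → Vec ℤ n → ℤ
  ⟦ c , as ⟧ᶠ ρ = c + dot as ρ

  lincomb : ∀ {n} → ℤ → Vec ℤ n → ℤ → Vec ℤ n → Vec ℤ n
  lincomb k [] l [] = []
  lincomb k (a ∷ as) l (b ∷ bs) = (k * a + l * b) ∷ lincomb k as l bs

  comb : ∀ {n} → ℤ → Form n → ℤ → Form n → Form n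
  comb k (c , as) l (d , bs) = (k * c + l * d) , lincomb k as l bs

  dot-lincomb : ∀ {n} k (as : Vec ℤ n) l bs ρ → dot (lincomb k as l bs) ρ ≡ k * dot as ρ + l * dot bs ρ
  dot-lincomb k [] l [] [] = lemma k l
    where
    lemma : ∀ k l → 0ℤ ≡ k * 0ℤ + l * 0ℤ
    lemma = solve-∀
  dot-lincomb k (a ∷ as) l (b ∷ bs) (x ∷ ρ) rewrite dot-lincomb k as l bs ρ = lemma k a l b x (dot as ρ) (dot bs ρ)
    where
    lemma : ∀ k a l b x p q → (k * a + l * b) * x + (k * p + l * q) ≡ k * (a * x + p) + l * (b * x + q)
    lemma = solve-∀

  comb-correct : ∀ {n} k (f : Form n) l g ρ → ⟦ comb k f l g ⟧ᶠ ρ ≡ k * ⟦ f ⟧ᶠ ρ + l * ⟦ g ⟧ᶠ ρ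
  comb-correct k (c , as) l (d , bs) ρ rewrite dot-lincomb k as l bs ρ = lemma k c l d (dot as ρ) (dot bs ρ)
    where
    lemma : ∀ k c l d p q → k * c + l * d + (k * p + l * q) ≡ k * (c + p) + l * (d + q)
    lemma = solve-∀

  zeros : ∀ {n} → Vec ℤ n
  zeros = Vec.replicate _ 0ℤ

  unit : ∀ {n} → Fin n → Vec ℤ n
  unit zero = 1ℤ ∷ zeros
  unit (suc i) = 0ℤ ∷ unit i

  dot-zeros : ∀ {n} (ρ : Vec ℤ n) → dot zeros ρ ≡ 0ℤ
  dot-zeros [] = refl
  dot-zeros (x ∷ ρ) rewrite dot-zeros ρ = ℤp.+-identityʳ (0ℤ * x)

  dot-unit : ∀ {n} i (ρ : Vec ℤ n) → dot (unit i) ρ ≡ Vec.lookup ρ i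
  dot-unit zero (x ∷ ρ) rewrite dot-zeros ρ = trans (ℤp.+-identityʳ _) (ℤp.*-identityˡ x)
  dot-unit (suc i) (x ∷ ρ) rewrite dot-unit i ρ = ℤp.+-identityˡ _

  norm : ∀ {n} → Ex n → Form n
  norm (var i) = 0ℤ , unit i
  norm (# k) = + k , zeros
  norm (a ⊕ b) = comb 1ℤ (norm a) 1ℤ (norm b)
  norm (a ⊖ b) = comb 1ℤ (norm a) (- 1ℤ) (norm b)
  norm (k ⊙ a) = comb (+ k) (norm a) 0ℤ (norm a)

  norm-correct : ∀ {n} (e : Ex n) ρ → ⟦ norm e ⟧ᶠ ρ ≡ ⟦ e ⟧ ρ
  norm-correct (var i) ρ = trans (ℤp.+-identityˡ _) (dot-unit i ρ)
  norm-correct (# k) ρ = trans (cong (λ t → + k + t) (dot-zeros ρ)) (ℤp.+-identityʳ _)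
  norm-correct (a ⊕ b) ρ rewrite comb-correct 1ℤ (norm a) 1ℤ (norm b) ρ | norm-correct a ρ | norm-correct b ρ =
    cong₂ _+_ (ℤp.*-identityˡ (⟦ a ⟧ ρ)) (ℤp.*-identityˡ (⟦ b ⟧ ρ))
  norm-correct (a ⊖ b) ρ rewrite comb-correct 1ℤ (norm a) (- 1ℤ) (norm b) ρ | norm-correct a ρ | norm-correct b ρ =
    cong₂ _+_ (ℤp.*-identityˡ (⟦ a ⟧ ρ)) (ℤp.-1*i≡-i (⟦ b ⟧ ρ))
  norm-correct (k ⊙ a) ρ rewrite comb-correct (+ k) (norm a) 0ℤ (norm a) ρ | norm-correct a ρ = ℤp.+-identityʳ _

  Holds : ∀ {n} → Vec ℤ n → Form n → Set
  Holds ρ f = 0ℤ ≤ ⟦ f ⟧ᶠ ρ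

  difference : ∀ {n} → Ex n → Ex n → Form n
  difference a b = norm (b ⊖ a)

  difference-holds : ∀ {n} (a b : Ex n) ρ → ⟦ a ⟧ ρ ≤ ⟦ b ⟧ ρ → Holds ρ (difference a b)
  difference-holds a b ρ h = subst (0ℤ ≤_) (sym (norm-correct (b ⊖ a) ρ)) (ℤp.i≤j⇒0≤j-i h)

  record Split (n : ℕ) : Set where
    constructor mkSplit
    field
      pos neg : List (ℕ × Form n)
      nul     : List (Form n)
  open Split

  -- A form with head coefficient a > 0 (or a < 0) is stored as |a| and its tail.
  insert : ∀ {n} → Form (suc n) → Split n → Split n
  insert (c , (+ zero) ∷ as) s = record s { nul = (c , as) ∷ nul s }
  insert (c , (+ suc k) ∷ as) s = record s { pos = (suc k , c , as) ∷ pos s }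
  insert (c , -[1+ k ] ∷ as) s = record s { neg = (suc k , c , as) ∷ neg s }

  split : ∀ {n} → List (Form (suc n)) → Split n
  split [] = mkSplit [] [] []
  split (f ∷ fs) = insert f (split fs)

  trivial : ∀ {n} → Form n → Bool
  trivial (+ _ , as) = allZero as
    where
    allZero : ∀ {n} → Vec ℤ n → Bool
    allZero [] = true
    allZero ((+ zero) ∷ as) = allZero as
    allZero (_ ∷ as) = false
  trivial _ = false

  -- Forms that hold under every assignment are dropped, because each further elimination step would
  -- multiply them.
  consUnlessTrivial : ∀ {n} → Form n → List (Form n) → List (Form n)
  consUnlessTrivial f fs = if trivial f then fs else f ∷ fs

  cross₁ : ∀ {n} → ℕ × Form n → List (ℕ × Form n) → List (Form n) → List (Form n)
  cross₁ p [] acc = acc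
  cross₁ (k , f) ((l , g) ∷ qs) acc = consUnlessTrivial (comb (+ l) f (+ k) g) (cross₁ (k , f) qs acc)

  cross : ∀ {n} → List (ℕ × Form n) → List (ℕ × Form n) → List (Form n) → List (Form n)
  cross [] qs acc = acc
  cross (p ∷ ps) qs acc = cross₁ p qs (cross ps qs acc)

  fourierMotzkin : ∀ {n} → List (Form (suc n)) → List (Form n)
  fourierMotzkin fs = let s = split fs in cross (pos s) (neg s) (nul s)

  -- A pivot is an equation with head coefficient s·k, where s = ±1 and k > 0.
  Pivot : ℕ → Set
  Pivot n = ℤ × ℕ × Form n

  pivot : ∀ {n} → List (Form (suc n)) → Maybe (Pivot n)
  pivot [] = nothing
  pivot ((c , (+ zero) ∷ as) ∷ fs) = pivot fs
  pivot ((c , (+ suc k) ∷ as) ∷ fs) = just (1ℤ , suc k , c , as)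
  pivot ((c , -[1+ k ] ∷ as) ∷ fs) = just (- 1ℤ , suc k , c , as)

  -- The form is multiplied by `k > 0` and never by the signed head coefficient, so the same formula
  -- is valid for inequalities and for equations.
  eliminate : ∀ {n} → Pivot n → Form (suc n) → Form n
  eliminate (s , k , e) (d , b ∷ bs) = comb (+ k) (d , bs) (- (s * b)) e

  eliminateAll : ∀ {n} → Pivot n → List (Form (suc n)) → List (Form n)
  eliminateAll p [] = []
  eliminateAll p (f ∷ fs) = consUnlessTrivial (eliminate p f) (eliminateAll p fs)

  eliminateEqs : ∀ {n} → Pivot n → List (Form (suc n)) → List (Form n)
  eliminateEqs p [] = []
  eliminateEqs p (f ∷ fs) = eliminate p f ∷ eliminateEqs p fs

  tails : ∀ {n} → List (Form (suc n)) → List (Form n)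
  tails [] = []
  tails ((c , (+ zero) ∷ as) ∷ fs) = (c , as) ∷ tails fs
  tails ((c , _ ∷ as) ∷ fs) = tails fs

  nonzero negative : List (Form 0) → Bool
  nonzero [] = false
  nonzero ((+ zero , []) ∷ es) = nonzero es
  nonzero ((_ , []) ∷ es) = true
  negative [] = false
  negative ((-[1+ _ ] , []) ∷ fs) = true
  negative ((+ _ , []) ∷ fs) = negative fs

  refute : ∀ n → List (Form n) → List (Form n) → Bool
  refute zero es fs = nonzero es ∨ negative fs
  refute (suc n) es fs with pivot es
  ... | just p = refute n (eliminateEqs p es) (eliminateAll p fs)
  ... | nothing = refute n (tails es) (fourierMotzkin fs)

  module _ {n : ℕ} (x : ℤ) (ρ : Vec ℤ n) where
    PosHolds NegHolds : ℕ × Form n → Set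
    PosHolds (k , f) = 0ℤ ≤ + k * x + ⟦ f ⟧ᶠ ρ
    NegHolds (k , f) = 0ℤ ≤ - (+ k * x) + ⟦ f ⟧ᶠ ρ

    record SplitHolds (s : Split n) : Set where
      field
        pos-holds : All PosHolds (pos s)
        neg-holds : All NegHolds (neg s)
        nul-holds : All (Holds ρ) (nul s)
    open SplitHolds

    insert-holds : ∀ f s → Holds (x ∷ ρ) f → SplitHolds s → SplitHolds (insert f s)
    insert-holds (c , (+ zero) ∷ as) s h hs = record
      { pos-holds = pos-holds hs ; neg-holds = neg-holds hs
      ; nul-holds = subst (λ t → 0ℤ ≤ c + t) (ℤp.+-identityˡ (dot as ρ)) h ∷ nul-holds hs }
    insert-holds (c , (+ suc k) ∷ as) s h hs = record
      { pos-holds = subst (0ℤ ≤_) (lemma c (+ suc k * x) (dot as ρ)) h ∷ pos-holds hs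
      ; neg-holds = neg-holds hs ; nul-holds = nul-holds hs }
      where
      lemma : ∀ c y d → c + (y + d) ≡ y + (c + d)
      lemma = solve-∀
    insert-holds (c , -[1+ k ] ∷ as) s h hs = record
      { pos-holds = pos-holds hs
      ; neg-holds = subst (0ℤ ≤_) eq h ∷ neg-holds hs
      ; nul-holds = nul-holds hs }
      where
      lemma : ∀ c k y d → c + (- k * y + d) ≡ - (k * y) + (c + d)
      lemma = solve-∀
      eq : c + (-[1+ k ] * x + dot as ρ) ≡ - (+ suc k * x) + (c + dot as ρ)
      eq = lemma c (+ suc k) x (dot as ρ)

    split-holds : ∀ fs → All (Holds (x ∷ ρ)) fs → SplitHolds (split fs)
    split-holds [] [] = record { pos-holds = [] ; neg-holds = [] ; nul-holds = [] }
    split-holds (f ∷ fs) (h ∷ hs) = insert-holds f (split fs) h (split-holds fs hs)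

    combine-holds : ∀ k f l g → PosHolds (k , f) → NegHolds (l , g) → Holds ρ (comb (+ l) f (+ k) g)
    combine-holds k f l g hf hg = subst (0ℤ ≤_)
      (trans (lemma (+ l) (+ k) x (⟦ f ⟧ᶠ ρ) (⟦ g ⟧ᶠ ρ)) (sym (comb-correct (+ l) f (+ k) g ρ)))
      (ℤp.+-mono-≤ (mul l hf) (mul k hg))
      where
      mul : ∀ k {x} → 0ℤ ≤ x → 0ℤ ≤ + k * x
      mul k {x} h = subst (_≤ + k * x) (ℤp.*-zeroʳ (+ k)) (ℤp.*-monoˡ-≤-nonNeg (+ k) h)
      lemma : ∀ l k x f g → l * (k * x + f) + k * (- (l * x) + g) ≡ l * f + k * g
      lemma = solve-∀

    cons-holds : ∀ f fs → Holds ρ f → All (Holds ρ) fs → All (Holds ρ) (consUnlessTrivial f fs)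
    cons-holds f fs h hs with trivial f
    ... | true = hs
    ... | false = h ∷ hs

    cross₁-holds : ∀ p qs acc → PosHolds p → All NegHolds qs → All (Holds ρ) acc → All (Holds ρ) (cross₁ p qs acc)
    cross₁-holds p [] acc hp [] ha = ha
    cross₁-holds (k , f) ((l , g) ∷ qs) acc hp (hq ∷ hqs) ha =
      cons-holds _ _ (combine-holds k f l g hp hq) (cross₁-holds (k , f) qs acc hp hqs ha)

    cross-holds : ∀ ps qs acc → All PosHolds ps → All NegHolds qs → All (Holds ρ) acc → All (Holds ρ) (cross ps qs acc)
    cross-holds [] qs acc [] hqs ha = ha
    cross-holds (p ∷ ps) qs acc (hp ∷ hps) hqs ha = cross₁-holds p qs _ hp hqs (cross-holds ps qs acc hps hqs ha)

  Vanishes : ∀ {n} → Vec ℤ n → Form n → Set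
  Vanishes ρ f = ⟦ f ⟧ᶠ ρ ≡ 0ℤ

  module _ {n : ℕ} (x : ℤ) (ρ : Vec ℤ n) where
    PivotHolds : Pivot n → Set
    PivotHolds (s , k , e) = (s * s ≡ 1ℤ) × (s * + k * x + ⟦ e ⟧ᶠ ρ ≡ 0ℤ)

    pivot-holds : ∀ es {p} → pivot es ≡ just p → All (Vanishes (x ∷ ρ)) es → PivotHolds p
    pivot-holds ((c , (+ zero) ∷ as) ∷ es) eq (h ∷ hs) = pivot-holds es eq hs
    pivot-holds ((c , (+ suc k) ∷ as) ∷ es) refl (h ∷ hs) = refl , trans (lemma c (+ suc k) x (dot as ρ)) h
      where
      lemma : ∀ c k x d → 1ℤ * k * x + (c + d) ≡ c + (k * x + d)
      lemma = solve-∀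
    pivot-holds ((c , -[1+ k ] ∷ as) ∷ es) refl (h ∷ hs) = refl , trans (lemma c (+ suc k) x (dot as ρ)) h
      where
      lemma : ∀ c k x d → - 1ℤ * k * x + (c + d) ≡ c + (- k * x + d)
      lemma = solve-∀

    -- The added multiple of the equation vanishes under the assignment, and `s * s ≡ 1` makes the
    -- head coefficients cancel.
    eliminate-value : ∀ p f → PivotHolds p → ⟦ eliminate p f ⟧ᶠ ρ ≡ + proj₁ (proj₂ p) * ⟦ f ⟧ᶠ (x ∷ ρ)
    eliminate-value (s , k , e) (d , b ∷ bs) (unit , h) = begin
      ⟦ eliminate (s , k , e) (d , b ∷ bs) ⟧ᶠ ρ ≡⟨ comb-correct (+ k) (d , bs) (- (s * b)) e ρ ⟩
      + k * (d + dot bs ρ) + - (s * b) * E ≡⟨ lemma₁ (+ k) (d + dot bs ρ) s b E x ⟩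
      + k * (d + dot bs ρ) + s * s * b * (+ k * x) - s * b * (s * + k * x + E)
        ≡⟨ cong₂ (λ u v → + k * (d + dot bs ρ) + u * b * (+ k * x) - s * b * v) unit h ⟩
      + k * (d + dot bs ρ) + 1ℤ * b * (+ k * x) - s * b * 0ℤ ≡⟨ lemma₂ (+ k) d (dot bs ρ) s b x ⟩
      + k * (d + (b * x + dot bs ρ)) ∎
      where
      open ≡-Reasoning
      E : ℤ
      E = ⟦ e ⟧ᶠ ρ
      lemma₁ : ∀ k D s b E x → k * D + - (s * b) * E ≡ k * D + s * s * b * (k * x) - s * b * (s * k * x + E)
      lemma₁ = solve-∀
      lemma₂ : ∀ k d B s b x → k * (d + B) + 1ℤ * b * (k * x) - s * b * 0ℤ ≡ k * (d + (b * x + B))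
      lemma₂ = solve-∀

    eliminateEqs-vanish : ∀ p es → PivotHolds p → All (Vanishes (x ∷ ρ)) es → All (Vanishes ρ) (eliminateEqs p es)
    eliminateEqs-vanish p [] hp [] = []
    eliminateEqs-vanish p (f ∷ fs) hp (h ∷ hs) =
      trans (eliminate-value p f hp) (trans (cong (λ t → + proj₁ (proj₂ p) * t) h) (ℤp.*-zeroʳ (+ proj₁ (proj₂ p)))) ∷ eliminateEqs-vanish p fs hp hs

    eliminateAll-hold : ∀ p fs → PivotHolds p → All (Holds (x ∷ ρ)) fs → All (Holds ρ) (eliminateAll p fs)
    eliminateAll-hold p [] hp [] = []
    eliminateAll-hold p (f ∷ fs) hp (h ∷ hs) = cons-holds x ρ _ _
      (subst (0ℤ ≤_) (sym (eliminate-value p f hp))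
        (subst (_≤ + k * ⟦ f ⟧ᶠ (x ∷ ρ)) (ℤp.*-zeroʳ (+ k)) (ℤp.*-monoˡ-≤-nonNeg (+ k) h)))
      (eliminateAll-hold p fs hp hs)
      where
      k : ℕ
      k = proj₁ (proj₂ p)

    tails-vanish : ∀ es → All (Vanishes (x ∷ ρ)) es → All (Vanishes ρ) (tails es)
    tails-vanish [] [] = []
    tails-vanish ((c , (+ zero) ∷ as) ∷ es) (h ∷ hs) = subst (λ t → c + t ≡ 0ℤ) (ℤp.+-identityˡ (dot as ρ)) h ∷ tails-vanish es hs
    tails-vanish ((c , (+ suc _) ∷ as) ∷ es) (h ∷ hs) = tails-vanish es hs
    tails-vanish ((c , -[1+ _ ] ∷ as) ∷ es) (h ∷ hs) = tails-vanish es hs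

  nonzero-sound : ∀ es → nonzero es ≡ true → All (Vanishes []) es → ⊥
  nonzero-sound ((+ zero , []) ∷ es) eq (h ∷ hs) = nonzero-sound es eq hs
  nonzero-sound ((+ suc _ , []) ∷ es) eq (() ∷ hs)
  nonzero-sound ((-[1+ _ ] , []) ∷ es) eq (() ∷ hs)

  negative-sound : ∀ fs → T (negative fs) → All (Holds []) fs → ⊥
  negative-sound ((-[1+ _ ] , []) ∷ fs) t (() ∷ hs)
  negative-sound ((+ _ , []) ∷ fs) t (h ∷ hs) = negative-sound fs t hs

  refute-sound : ∀ n es fs → T (refute n es fs) → (ρ : Vec ℤ n) → All (Vanishes ρ) es → All (Holds ρ) fs → ⊥
  refute-sound zero es fs t [] hes hs with nonzero es in eq
  ... | true = nonzero-sound es eq hes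
  ... | false = negative-sound fs t hs
  refute-sound (suc n) es fs t (x ∷ ρ) hes hs with pivot es in eq
  ... | just p = refute-sound n _ _ t ρ (eliminateEqs-vanish x ρ p es hp hes) (eliminateAll-hold x ρ p fs hp hs)
    where hp = pivot-holds x ρ es eq hes
  ... | nothing = refute-sound n _ _ t ρ (tails-vanish x ρ es hes)
    (cross-holds x ρ _ _ _ (SplitHolds.pos-holds s) (SplitHolds.neg-holds s) (SplitHolds.nul-holds s))
    where s = split-holds x ρ fs hs

  Facts : ℕ → Set
  Facts n = List (Form n) × List (Form n)

  FactsHold : ∀ {n} → Vec ℤ n → Facts n → Set
  FactsHold ρ (es , fs) = All (Vanishes ρ) es × All (Holds ρ) fs

  -- Only hypotheses that are themselves atomic (in)equalities are used.
  assume : ∀ {n} → Prob n → Facts n → Facts n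
  assume (a ≼ b) (es , fs) = es , difference a b ∷ fs
  assume (a ≐ b) (es , fs) = difference a b ∷ es , fs
  assume _ fs = fs

  check : ∀ {n} → Prob n → Facts n → Bool
  -- Over the integers the negation of `a ≤ b` is `b + 1 ≤ a`. Integrality enters only here; the
  -- refutation itself is rational.
  check (a ≼ b) (es , fs) = refute _ es (difference (b ⊕ # 1) a ∷ fs)
  check (a ≐ b) fs = check (a ≼ b) fs ∧ check (b ≼ a) fs
  check contra (es , fs) = refute _ es fs
  check (p ⟹ q) fs = check q (assume p fs)

  assume-holds : ∀ {n} (p : Prob n) fs ρ → ⟦ p ⟧ᵖ ρ → FactsHold ρ fs → FactsHold ρ (assume p fs)
  assume-holds (a ≼ b) fs ρ h (hes , hs) = hes , difference-holds a b ρ h ∷ hs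
  assume-holds (a ≐ b) fs ρ h (hes , hs) =
    trans (norm-correct (b ⊖ a) ρ) (ℤp.i≡j⇒i-j≡0 (sym h)) ∷ hes , hs
  assume-holds contra fs ρ h hs = hs
  assume-holds (_ ⟹ _) fs ρ h hs = hs

  T-∧ : ∀ {a b} → T (a ∧ b) → T a × T b
  T-∧ {true} {true} _ = tt , tt

  check-sound : ∀ {n} (p : Prob n) fs → T (check p fs) → ∀ ρ → FactsHold ρ fs → ⟦ p ⟧ᵖ ρ
  check-sound (a ≼ b) fs t ρ (hes , hs) with ⟦ a ⟧ ρ ℤ.≤? ⟦ b ⟧ ρ
  ... | yes h = h
  ... | no ¬h = ⊥-elim (refute-sound _ _ _ t ρ hes (difference-holds (b ⊕ # 1) a ρ
    (subst (_≤ ⟦ a ⟧ ρ) (ℤp.+-comm 1ℤ (⟦ b ⟧ ρ)) (ℤp.i<j⇒suc[i]≤j (ℤp.≰⇒> ¬h))) ∷ hs))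
  check-sound (a ≐ b) fs t ρ hs =
    ℤp.≤-antisym (check-sound (a ≼ b) fs (proj₁ ts) ρ hs) (check-sound (b ≼ a) fs (proj₂ ts) ρ hs)
    where ts = T-∧ {check (a ≼ b) fs} t
  check-sound contra fs t ρ (hes , hs) = refute-sound _ _ _ t ρ hes hs
  check-sound (p ⟹ q) fs t ρ hs h = check-sound q _ t ρ (assume-holds p fs ρ h hs)

  opaque
    -- Equations are substituted, inequalities eliminated by Fourier–Motzkin; the goal is decided while type checking.
    lin : ∀ {n} (ρ : Vec ℤ n) (f : N-ary n (Ex n) (Prob n)) →
          let p = f $ⁿ Vec.map var (Vec.allFin n) in {_ : T (check p ([] , []))} → ⟦ p ⟧ᵖ ρ
    lin ρ f {t} = check-sound _ ([] , []) t ρ ([] , [])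

open LinearArithmetic using (lin; #_; _⊕_; _⊖_; _⊙_; _≼_; _≐_; contra; _⟹_; T-∧)

-- Sums, sets and edge weights

true≢false : ∀ {b} {A : Set} → b ≡ true → b ≡ false → A
true≢false refl ()

does-true : ∀ {P : Set} (d : Dec P) → does d ≡ true → P
does-true (yes p) _ = p

does-false : ∀ {P : Set} (d : Dec P) → does d ≡ false → ¬ P
does-false (no ¬p) _ = ¬p

infixr 7 _▹_
_▹_ : Bool → ℤ → ℤ
b ▹ x = if b then x else 0ℤ

▹-true : ∀ {b} x → b ≡ true → b ▹ x ≡ x
▹-true x refl = refl

▹-false : ∀ {b} x → b ≡ false → b ▹ x ≡ 0ℤ
▹-false x refl = refl

opaque
  ∑ : ∀ {n} → (Fin n → ℤ) → ℤ
  ∑ {zero} f = 0ℤ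
  ∑ {suc n} f = f zero + ∑ (f ∘ suc)

  ∑-cong : ∀ {n} {f g : Fin n → ℤ} → (∀ i → f i ≡ g i) → ∑ f ≡ ∑ g
  ∑-cong {zero} h = refl
  ∑-cong {suc n} h = cong₂ _+_ (h zero) (∑-cong (h ∘ suc))

  ∑-mono : ∀ {n} {f g : Fin n → ℤ} → (∀ i → f i ≤ g i) → ∑ f ≤ ∑ g
  ∑-mono {zero} h = ℤp.≤-refl
  ∑-mono {suc n} h = ℤp.+-mono-≤ (h zero) (∑-mono (h ∘ suc))

  ∑-zero : ∀ {n} → ∑ {n} (λ _ → 0ℤ) ≡ 0ℤ
  ∑-zero {zero} = refl
  ∑-zero {suc n} = trans (ℤp.+-identityˡ _) (∑-zero {n})

  ∑-+ : ∀ {n} (f g : Fin n → ℤ) → ∑ (λ i → f i + g i) ≡ ∑ f + ∑ g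
  ∑-+ {zero} f g = refl
  ∑-+ {suc n} f g rewrite ∑-+ (f ∘ suc) (g ∘ suc) = lemma (f zero) (g zero) _ _
    where
    lemma : ∀ a b c d → a + b + (c + d) ≡ a + c + (b + d)
    lemma = solve-∀

  ∑-* : ∀ {n} k (f : Fin n → ℤ) → ∑ (λ i → k * f i) ≡ k * ∑ f
  ∑-* {zero} k f = sym (ℤp.*-zeroʳ k)
  ∑-* {suc n} k f rewrite ∑-* k (f ∘ suc) = sym (ℤp.*-distribˡ-+ k (f zero) _)

  ∑-swap : ∀ {n m} (f : Fin n → Fin m → ℤ) → ∑ (λ i → ∑ (f i)) ≡ ∑ (λ j → ∑ (λ i → f i j))
  ∑-swap {zero} {m} f = sym (∑-zero {m})
  ∑-swap {suc n} {m} f rewrite ∑-swap (f ∘ suc) = sym (∑-+ (f zero) (λ j → ∑ (λ i → f (suc i) j)))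

_≡ᵇ_ : ∀ {n} → Fin n → Fin n → Bool
u ≡ᵇ v = does (u Finp.≟ v)

≡ᵇ-refl : ∀ {n} (v : Fin n) → (v ≡ᵇ v) ≡ true
≡ᵇ-refl v = dec-true (v Finp.≟ v) refl

≡ᵇ-≢ : ∀ {n} {u v : Fin n} → u ≢ v → (u ≡ᵇ v) ≡ false
≡ᵇ-≢ {u = u} {v} ne = dec-false (u Finp.≟ v) ne

≡ᵇ-sym : ∀ {n} (u v : Fin n) → (u ≡ᵇ v) ≡ (v ≡ᵇ u)
≡ᵇ-sym u v with u Finp.≟ v
... | yes refl = sym (≡ᵇ-refl u)
... | no ne = sym (≡ᵇ-≢ (ne ∘ sym))

≡ᵇ⇒≡ : ∀ {n} {u v : Fin n} → (u ≡ᵇ v) ≡ true → u ≡ v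
≡ᵇ⇒≡ {u = u} {v} h with u Finp.≟ v
... | yes eq = eq
... | no _ = true≢false h refl

≡ᵇ⇒≢ : ∀ {n} {u v : Fin n} → (u ≡ᵇ v) ≡ false → u ≢ v
≡ᵇ⇒≢ {u = u} h refl = true≢false (≡ᵇ-refl u) h

opaque
  unfolding ∑

  ∑-point : ∀ {n} (a : Fin n) (f : Fin n → ℤ) → ∑ (λ v → (v ≡ᵇ a) ▹ f v) ≡ f a
  ∑-point {suc n} zero f = trans (cong (λ t → f zero + t)
    (trans (∑-cong (λ i → ▹-false (f (suc i)) (≡ᵇ-≢ {u = suc i} {zero} (λ ())))) (∑-zero {n}))) (ℤp.+-identityʳ _)
  ∑-point {suc n} (suc a) f = trans (ℤp.+-identityˡ _)
    (∑-point a (f ∘ suc))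

  ∑-find : ∀ {n} (f : Fin n → ℤ) → 1ℤ ≤ ∑ f → ∃[ i ] 1ℤ ≤ f i
  ∑-find {zero} f (+≤+ ())
  ∑-find {suc n} f h with 1ℤ ℤ.≤? f zero
  ... | yes p = zero , p
  ... | no ¬p with ∑-find (f ∘ suc) (lin (f zero ∷ ∑ (f ∘ suc) ∷ [])
                     (λ a s → # 1 ≼ a ⊕ s ⟹ # 1 ⊕ a ≼ # 1 ⟹ # 1 ≼ s) h (ℤp.i<j⇒suc[i]≤j (ℤp.≰⇒> ¬p)))
  ...   | i , q = suc i , q

VSet : ℕ → Set
VSet n = Fin n → Bool

infix 4 _∈_ _∉_ _⊆_
-- A record instead of the bare equation `A v ≡ true`, so that `A` and `v` can be recovered by
-- unification.
record _∈_ {n} (v : Fin n) (A : VSet n) : Set where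
  constructor mk∈
  field un∈ : A v ≡ true
open _∈_ public

record _∉_ {n} (v : Fin n) (A : VSet n) : Set where
  constructor mk∉
  field un∉ : A v ≡ false
open _∉_ public

_⊆_ Disjoint : ∀ {n} → VSet n → VSet n → Set
A ⊆ B = ∀ {v} → v ∈ A → v ∈ B
Disjoint A B = ∀ {v} → v ∈ A → v ∉ B

absurd∈ : ∀ {n} {A : VSet n} {v} {X : Set} → v ∈ A → v ∉ A → X
absurd∈ (mk∈ a) (mk∉ b) = true≢false a b

opaque
  dec∈ : ∀ {n} (v : Fin n) (A : VSet n) → (v ∈ A) ⊎ (v ∉ A)
  dec∈ v A with A v in eq
  ... | true = inj₁ (mk∈ eq)
  ... | false = inj₂ (mk∉ eq)

infixl 6 _∪_
infixl 7 _∩_ _∖_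
_∪_ _∩_ _∖_ : ∀ {n} → VSet n → VSet n → VSet n
(A ∪ B) v = A v ∨ B v
(A ∩ B) v = A v ∧ B v
(A ∖ B) v = A v ∧ not (B v)

⟨_⟩ : ∀ {n} → Fin n → VSet n
⟨ a ⟩ v = v ≡ᵇ a

module _ {n : ℕ} {A B : VSet n} {v : Fin n} where
  ∪ˡ : v ∈ A → v ∈ A ∪ B
  ∪ˡ (mk∈ h) = mk∈ (cong (_∨ B v) h)

  ∪ʳ : v ∈ B → v ∈ A ∪ B
  ∪ʳ (mk∈ h) with A v in eq
  ... | true = mk∈ (cong (_∨ B v) eq)
  ... | false = mk∈ (trans (cong (_∨ B v) eq) h)

  ∪-elim : v ∈ A ∪ B → (v ∈ A) ⊎ (v ∈ B)
  ∪-elim (mk∈ h) with A v in eq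
  ... | true = inj₁ (mk∈ eq)
  ... | false = inj₂ (mk∈ h)

  ∩-intro : v ∈ A → v ∈ B → v ∈ A ∩ B
  ∩-intro (mk∈ a) (mk∈ b) = mk∈ (cong₂ _∧_ a b)

  ∩ˡ : v ∈ A ∩ B → v ∈ A
  ∩ˡ (mk∈ h) with A v in eq
  ... | true = mk∈ eq

  ∩ʳ : v ∈ A ∩ B → v ∈ B
  ∩ʳ (mk∈ h) with A v | B v in eq
  ... | true | true = mk∈ eq

  ∖-intro : v ∈ A → v ∉ B → v ∈ A ∖ B
  ∖-intro (mk∈ a) (mk∉ b) = mk∈ (cong₂ (λ x y → x ∧ not y) a b)

  ∖ˡ : v ∈ A ∖ B → v ∈ A
  ∖ˡ (mk∈ h) with A v in eq
  ... | true = mk∈ eq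

  ∖ʳ : v ∈ A ∖ B → v ∉ B
  ∖ʳ (mk∈ h) with A v | B v in eq
  ... | true | false = mk∉ eq

∈⟨⟩ : ∀ {n} {a : Fin n} → a ∈ ⟨ a ⟩
∈⟨⟩ {a = a} = mk∈ (≡ᵇ-refl a)

⟨⟩-elim : ∀ {n} {a v : Fin n} → v ∈ ⟨ a ⟩ → v ≡ a
⟨⟩-elim (mk∈ h) = ≡ᵇ⇒≡ h

∉⟨⟩ : ∀ {n} {a v : Fin n} → v ≢ a → v ∉ ⟨ a ⟩
∉⟨⟩ ne = mk∉ (≡ᵇ-≢ ne)

∉⟨⟩-elim : ∀ {n} {a v : Fin n} → v ∉ ⟨ a ⟩ → v ≢ a
∉⟨⟩-elim (mk∉ h) = ≡ᵇ⇒≢ h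

∈-≢ : ∀ {n} {A : VSet n} {u v} → u ∈ A → v ∉ A → u ≢ v
∈-≢ a b refl = absurd∈ a b

not-in : ∀ {n} {A : VSet n} {v} → (v ∈ A → ⊥) → v ∉ A
not-in {A = A} {v} h with dec∈ v A
... | inj₁ p = ⊥-elim (h p)
... | inj₂ p = p

⟨⟩-⊆ : ∀ {n} {a : Fin n} {B : VSet n} → a ∈ B → ⟨ a ⟩ ⊆ B
⟨⟩-⊆ {B = B} a∈ h = subst (_∈ B) (sym (⟨⟩-elim h)) a∈

⟨⟩-disjoint : ∀ {n} {a : Fin n} {B : VSet n} → a ∉ B → Disjoint ⟨ a ⟩ B
⟨⟩-disjoint {B = B} a∉ h = subst (_∉ B) (sym (⟨⟩-elim h)) a∉

disjoint-⟨⟩ : ∀ {n} {a : Fin n} {B : VSet n} → a ∉ B → Disjoint B ⟨ a ⟩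
disjoint-⟨⟩ a∉ h = ∉⟨⟩ (∈-≢ h a∉)

opaque
  ∑S : ∀ {n} → VSet n → (Fin n → ℤ) → ℤ
  ∑S A f = ∑ (λ v → A v ▹ f v)

module _ {n : ℕ} where
  private
    variable
      A B C : VSet n
      f g : Fin n → ℤ

  opaque
    unfolding ∑S

    S-mono : (∀ {v} → v ∈ A → f v ≤ g v) → ∑S A f ≤ ∑S A g
    S-mono {A} {f} {g} h = ∑-mono go
      where
      go : ∀ v → A v ▹ f v ≤ A v ▹ g v
      go v with A v in eq
      ... | true = h (mk∈ eq)
      ... | false = ℤp.≤-refl

    S-ext⊆ : A ⊆ B → B ⊆ A → ∑S A f ≡ ∑S B f
    S-ext⊆ {A} {B} {f} ab ba = ∑-cong (λ v → cong (_▹ f v) (go v))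
      where
      go : ∀ v → A v ≡ B v
      go v with A v in a | B v in b
      ... | true | true = refl
      ... | false | false = refl
      ... | true | false = absurd∈ (ab (mk∈ a)) (mk∉ b)
      ... | false | true = absurd∈ (ba (mk∈ b)) (mk∉ a)

    S-+ : ∀ (A : VSet n) (f g : Fin n → ℤ) → ∑S A (λ v → f v + g v) ≡ ∑S A f + ∑S A g
    S-+ A f g = trans (∑-cong go) (∑-+ _ _)
      where
      go : ∀ v → A v ▹ (f v + g v) ≡ A v ▹ f v + A v ▹ g v
      go v with A v
      ... | true = refl
      ... | false = refl

    S-* : ∀ (A : VSet n) k (f : Fin n → ℤ) → ∑S A (λ v → k * f v) ≡ k * ∑S A f
    S-* A k f = trans (∑-cong go) (∑-* k _)
      where
      go : ∀ v → A v ▹ (k * f v) ≡ k * (A v ▹ f v)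
      go v with A v
      ... | true = refl
      ... | false = sym (ℤp.*-zeroʳ k)

    S-split : ∀ (A B : VSet n) f → ∑S A f ≡ ∑S (A ∩ B) f + ∑S (A ∖ B) f
    S-split A B f = trans (∑-cong go) (∑-+ _ _)
      where
      go : ∀ v → A v ▹ f v ≡ (A ∩ B) v ▹ f v + (A ∖ B) v ▹ f v
      go v with A v | B v
      ... | true | true = sym (ℤp.+-identityʳ _)
      ... | true | false = sym (ℤp.+-identityˡ _)
      ... | false | _ = refl

    S-∪ : Disjoint A B → ∀ (f : Fin n → ℤ) → ∑S (A ∪ B) f ≡ ∑S A f + ∑S B f
    S-∪ {A} {B} d f = trans (∑-cong go) (∑-+ _ _)
      where
      go : ∀ v → (A ∪ B) v ▹ f v ≡ A v ▹ f v + B v ▹ f v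
      go v with A v in a | B v in b
      ... | true | true = absurd∈ (mk∈ b) (d (mk∈ a))
      ... | true | false = sym (ℤp.+-identityʳ _)
      ... | false | true = sym (ℤp.+-identityˡ _)
      ... | false | false = refl

    S-point : ∀ (a : Fin n) f → ∑S ⟨ a ⟩ f ≡ f a
    S-point = ∑-point

    S-zero : ∑S A (λ _ → 0ℤ) ≡ 0ℤ
    S-zero {A} = trans (∑-cong go) (∑-zero {n})
      where
      go : ∀ v → A v ▹ 0ℤ ≡ 0ℤ
      go v with A v
      ... | true = refl
      ... | false = refl

    S-find : 1ℤ ≤ ∑S A f → ∃[ v ] v ∈ A × 1ℤ ≤ f v
    S-find {A} {f} h with ∑-find _ h
    ... | v , p with A v in eq
    ...   | true = v , mk∈ eq , p
    ...   | false = case p of λ { (+≤+ ()) }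

    S-swap : ∀ (A B : VSet n) (c : Fin n → Fin n → ℤ) → ∑S A (λ u → ∑S B (c u)) ≡ ∑S B (λ v → ∑S A (λ u → c u v))
    S-swap A B c = trans (∑-cong (λ u → push (A u) B (c u)))
      (trans (∑-swap (λ u v → A u ▹ B v ▹ c u v))
        (∑-cong (λ v → sym (trans (push (B v) A (λ u → c u v)) (∑-cong (λ u → comm (B v) (A u) (c u v)))))))
      where
      push : ∀ b B (f : Fin n → ℤ) → b ▹ ∑S B f ≡ ∑ (λ v → b ▹ B v ▹ f v)
      push true B f = refl
      push false B f = sym (∑-zero {n})
      comm : ∀ a b x → a ▹ b ▹ x ≡ b ▹ a ▹ x
      comm true true x = refl
      comm true false x = refl
      comm false true x = refl
      comm false false x = refl

  S-cong : (∀ {v} → v ∈ A → f v ≡ g v) → ∑S A f ≡ ∑S A g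
  S-cong h = ℤp.≤-antisym (S-mono (ℤp.≤-reflexive ∘ h)) (S-mono (ℤp.≤-reflexive ∘ sym ∘ h))

  S-nonneg : (∀ {v} → v ∈ A → 0ℤ ≤ f v) → 0ℤ ≤ ∑S A f
  S-nonneg {A} {f} h = subst (_≤ ∑S A f) (S-zero {A}) (S-mono h)

  S-⊆ : A ⊆ B → (∀ {v} → v ∈ B → 0ℤ ≤ f v) → ∑S A f ≤ ∑S B f
  S-⊆ {A} {B} {f} ab h = lin (∑S B f ∷ ∑S (B ∩ A) f ∷ ∑S (B ∖ A) f ∷ ∑S A f ∷ [])
    (λ b i d a → b ≐ i ⊕ d ⟹ a ≐ i ⟹ # 0 ≼ d ⟹ a ≼ b)
    (S-split B A f) (S-ext⊆ {A} {B ∩ A} (λ a → ∩-intro (ab a) a) ∩ʳ) (S-nonneg {B ∖ A} {f} (h ∘ ∖ˡ))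

  S-term : ∀ {v} → v ∈ A → (∀ {w} → w ∈ A → 0ℤ ≤ f w) → f v ≤ ∑S A f
  S-term {A} {f} {v} v∈ h = subst (_≤ ∑S A f) (S-point v f)
    (S-⊆ (⟨⟩-⊆ v∈) h)

opaque
  ∣_∣ : ∀ {n} → VSet n → ℤ
  ∣ A ∣ = ∑S A (λ _ → 1ℤ)

-- Two weights share this theory: edge multiplicities, which bound the number of blocked colours,
-- and edge costs, which enter the potential.
record Weight (n : ℕ) : Set where
  field
    wt       : Fin n → Fin n → ℤ
    wt-sym   : ∀ u v → wt u v ≡ wt v u
    wt-irr   : ∀ v → wt v v ≡ 0ℤ
    wt-nonneg : ∀ u v → 0ℤ ≤ wt u v

module Weights {n : ℕ} (c : Weight n) where
  open Weight c public

  _<ᵛ_ : Fin n → Fin n → Bool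
  u <ᵛ v = Fin.toℕ u ℕ.<ᵇ Fin.toℕ v

  opaque
    D : VSet n → VSet n → ℤ
    D A B = ∑S A (λ u → ∑S B (wt u))

    -- Each pair is taken once, in increasing order, so that `e` of the whole vertex set is directly
    -- comparable with `numEdges`.
    e : VSet n → ℤ
    e A = ∑S A (λ u → ∑S A (λ v → (u <ᵛ v) ▹ wt u v))

  private
    variable
      A B C : VSet n

  wt≥0 : ∀ {u v} → 0ℤ ≤ wt u v
  wt≥0 {u} {v} = wt-nonneg u v

  opaque
    unfolding D e

    D-nonneg : 0ℤ ≤ D A B
    D-nonneg = S-nonneg (λ _ → S-nonneg (λ _ → wt≥0))

    D-sym : ∀ A B → D A B ≡ D B A
    D-sym A B = trans (S-swap A B wt) (S-cong {A = B} (λ {v} _ → S-cong {A = A} (λ {u} _ → wt-sym u v)))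

    D-∪ˡ : Disjoint A B → ∀ C → D (A ∪ B) C ≡ D A C + D B C
    D-∪ˡ d C = S-∪ d (λ u → ∑S C (wt u))

    D-∪ʳ : ∀ C → Disjoint A B → D C (A ∪ B) ≡ D C A + D C B
    D-∪ʳ {A} {B} C d = trans (S-cong {A = C} (λ {u} _ → S-∪ d (wt u))) (S-+ C (λ u → ∑S A (wt u)) (λ u → ∑S B (wt u)))

    D-pointˡ : ∀ a B → D ⟨ a ⟩ B ≡ ∑S B (wt a)
    D-pointˡ a B = S-point a (λ u → ∑S B (wt u))

    D-⊆ : ∀ {A A' B B'} → A ⊆ A' → B ⊆ B' → D A B ≤ D A' B'
    D-⊆ {A} {A'} {B} {B'} a b = ℤp.≤-trans (S-⊆ {A = A} a (λ _ → S-nonneg (λ _ → wt≥0)))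
      (S-mono {A = A'} (λ {u} _ → S-⊆ {A = B} b (λ _ → wt≥0)))

    D-ext : ∀ {A A' B B'} → A ⊆ A' → A' ⊆ A → B ⊆ B' → B' ⊆ B → D A B ≡ D A' B'
    D-ext {A} {A'} {B} {B'} a a' b b' = ℤp.≤-antisym (D-⊆ {A} {A'} {B} {B'} a b) (D-⊆ {A'} {A} {B'} {B} a' b')

    -- Every unordered pair occurs in both orders on the right, and the diagonal is zero. The
    -- remaining facts about `e` in this module are derived from those about `D` by this identity.
    e-double : ∀ A → + 2 * e A ≡ D A A
    e-double A = sym (begin
      D A A ≡⟨ S-cong {A = A} (λ {u} _ → trans (S-cong {A = A} (λ {v} _ → trich u v)) (S-+ A _ _)) ⟩
      ∑S A (λ u → ∑S A (λ v → (u <ᵛ v) ▹ wt u v) + ∑S A (λ v → (v <ᵛ u) ▹ wt v u)) ≡⟨ S-+ A _ _ ⟩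
      e A + ∑S A (λ u → ∑S A (λ v → (v <ᵛ u) ▹ wt v u)) ≡⟨ cong (λ t → e A + t) (S-swap A A _) ⟩
      e A + e A ≡⟨ lemma (e A) ⟩
      + 2 * e A ∎)
      where
      open ≡-Reasoning
      lemma : ∀ x → x + x ≡ + 2 * x
      lemma = solve-∀
      <ᵇ-trich : ∀ i j → ((i ℕ.<ᵇ j) ≡ true × (j ℕ.<ᵇ i) ≡ false) ⊎ ((i ℕ.<ᵇ j) ≡ false × (j ℕ.<ᵇ i) ≡ true) ⊎ i ≡ j
      <ᵇ-trich zero zero = inj₂ (inj₂ refl)
      <ᵇ-trich zero (suc j) = inj₁ (refl , refl)
      <ᵇ-trich (suc i) zero = inj₂ (inj₁ (refl , refl))
      <ᵇ-trich (suc i) (suc j) with <ᵇ-trich i j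
      ... | inj₁ p = inj₁ p
      ... | inj₂ (inj₁ p) = inj₂ (inj₁ p)
      ... | inj₂ (inj₂ p) = inj₂ (inj₂ (cong suc p))
      trich : ∀ u v → wt u v ≡ (u <ᵛ v) ▹ wt u v + (v <ᵛ u) ▹ wt v u
      trich u v with <ᵇ-trich (Fin.toℕ u) (Fin.toℕ v)
      ... | inj₁ (p , q) rewrite p | q = sym (ℤp.+-identityʳ _)
      ... | inj₂ (inj₁ (p , q)) rewrite p | q = trans (wt-sym u v) (sym (ℤp.+-identityˡ _))
      ... | inj₂ (inj₂ p) with Finp.toℕ-injective p
      ... | refl rewrite wt-irr u with Fin.toℕ u ℕ.<ᵇ Fin.toℕ u
      ... | true = refl
      ... | false = refl

  e-∪ : Disjoint A B → e (A ∪ B) ≡ e A + e B + D A B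
  e-∪ {A} {B} d = lin
    (e (A ∪ B) ∷ e A ∷ e B ∷ D A B ∷ D B A ∷ D A A ∷ D B B ∷ D (A ∪ B) (A ∪ B) ∷ D A (A ∪ B) ∷ D B (A ∪ B) ∷ [])
    (λ u a b ab ba aa bb uu au bu → 2 ⊙ u ≐ uu ⟹ 2 ⊙ a ≐ aa ⟹ 2 ⊙ b ≐ bb ⟹ uu ≐ au ⊕ bu ⟹ au ≐ aa ⊕ ab ⟹
      bu ≐ ba ⊕ bb ⟹ ab ≐ ba ⟹ u ≐ a ⊕ b ⊕ ab)
    (e-double (A ∪ B)) (e-double A) (e-double B) (D-∪ˡ d (A ∪ B)) (D-∪ʳ A d) (D-∪ʳ B d) (D-sym A B)

  e-ext : A ⊆ B → B ⊆ A → e A ≡ e B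
  e-ext {A} {B} a b = lin (e A ∷ e B ∷ D A A ∷ D B B ∷ [])
    (λ x y p q → 2 ⊙ x ≐ p ⟹ 2 ⊙ y ≐ q ⟹ p ≐ q ⟹ x ≐ y)
    (e-double A) (e-double B) (D-ext a b a b)

  e-point : ∀ a → e ⟨ a ⟩ ≡ 0ℤ
  e-point a = lin (e ⟨ a ⟩ ∷ D ⟨ a ⟩ ⟨ a ⟩ ∷ [])
    (λ x p → 2 ⊙ x ≐ p ⟹ p ≐ # 0 ⟹ x ≐ # 0)
    (e-double ⟨ a ⟩) (trans (D-pointˡ a ⟨ a ⟩) (trans (S-point a (wt a)) (wt-irr a)))

-- Lists, covers and potentials

opaque
  -- `P` and `Q` need not be complementary; each vertex only has to supply one of them. This makes
  -- all case distinctions constructive, including those whose alternatives carry data.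
  search : ∀ {n} (A : VSet n) {P Q : Fin n → Set} → (∀ v → P v ⊎ Q v) → (∃[ v ] v ∈ A × P v) ⊎ (∀ {v} → v ∈ A → Q v)
  search {zero} A d = inj₂ λ { {()} }
  search {suc n} A {P} {Q} d with search (A ∘ suc) (d ∘ suc)
  ... | inj₁ (v , mk∈ v∈ , p) = inj₁ (suc v , mk∈ v∈ , p)
  ... | inj₂ h with dec∈ zero A | d zero
  ...   | inj₁ z | inj₁ p = inj₁ (zero , z , p)
  ...   | inj₁ z | inj₂ q = inj₂ λ { {zero} _ → q ; {suc v} (mk∈ v∈) → h (mk∈ v∈) }
  ...   | inj₂ z | _ = inj₂ λ { {zero} y → absurd∈ y z ; {suc v} (mk∈ v∈) → h (mk∈ v∈) }

  dec≤ : ∀ (a b : ℤ) → (a ≤ b) ⊎ (b + 1ℤ ≤ a)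
  dec≤ a b with a ℤ.≤? b
  ... | yes h = inj₁ h
  ... | no ¬h = inj₂ (subst (_≤ a) (ℤp.+-comm 1ℤ b) (ℤp.i<j⇒suc[i]≤j (ℤp.≰⇒> ¬h)))

Colour : Set
Colour = Fin 3

All₃ : VSet 3
All₃ _ = true

private
  allᵇ : (Bool → Bool) → Bool
  allᵇ f = f true ∧ f false

  allᵇ-sound : ∀ f → T (allᵇ f) → ∀ b → T (f b)
  allᵇ-sound f t true = proj₁ (T-∧ {f true} t)
  allᵇ-sound f t false = proj₂ (T-∧ {f true} t)

  all³ : (Bool → Bool → Bool → Bool) → Bool
  all³ f = allᵇ λ a → allᵇ λ b → allᵇ λ c → f a b c

  all³-sound : ∀ f → T (all³ f) → ∀ a b c → T (f a b c)
  all³-sound f t a b c = allᵇ-sound (f a b)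
    (allᵇ-sound (λ b → allᵇ (f a b)) (allᵇ-sound (λ a → allᵇ λ b → allᵇ (f a b)) t a) b) c

  infixr 3 _⇒ᵇ_
  _⇒ᵇ_ : Bool → Bool → Bool
  a ⇒ᵇ b = not a ∨ b

  ⇒ᵇ-elim : ∀ a {b} → T (a ⇒ᵇ b) → T a → T b
  ⇒ᵇ-elim true t _ = t

χ : Bool → ℤ
χ b = b ▹ 1ℤ

opaque
  unfolding ∣_∣ ∑S ∑

  card₃ : ∀ (L : VSet 3) → ∣ L ∣ ≡ χ (L 0F) + (χ (L 1F) + (χ (L 2F) + 0ℤ))
  card₃ L = refl

  ∑S-All₃ : ∀ (X : VSet 3) (f : Colour → ℤ) → ∑S All₃ (λ c → X c ▹ f c) ≡ ∑S X f
  ∑S-All₃ X f = refl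

opaque
  unfolding ∣_∣

  card-sum : ∀ {n} (A : VSet n) → ∣ A ∣ ≡ ∑S A (λ _ → 1ℤ)
  card-sum A = refl

  card-∪ : ∀ {n} {A B : VSet n} → Disjoint A B → ∣ A ∪ B ∣ ≡ ∣ A ∣ + ∣ B ∣
  card-∪ d = S-∪ d _

  card-mono : ∀ {n} {A B : VSet n} → A ⊆ B → ∣ A ∣ ≤ ∣ B ∣
  card-mono {A = A} {B} ab = S-⊆ {A = A} {B} ab (λ _ → +≤+ ℕ.z≤n)

  card-point : ∀ {n} (a : Fin n) → ∣ ⟨ a ⟩ ∣ ≡ 1ℤ
  card-point a = S-point a _

  card-nonneg : ∀ {n} {A : VSet n} → 0ℤ ≤ ∣ A ∣
  card-nonneg {A = A} = S-nonneg {A = A} (λ _ → +≤+ ℕ.z≤n)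

  card-split : ∀ {n} (A B : VSet n) → ∣ A ∣ ≡ ∣ A ∩ B ∣ + ∣ A ∖ B ∣
  card-split A B = S-split A B _

  card-find : ∀ {n} {A : VSet n} → 1ℤ ≤ ∣ A ∣ → ∃[ v ] v ∈ A
  card-find {A = A} h = let (v , v∈ , _) = S-find {A = A} h in v , v∈

card-∪≤ : ∀ {n} (A B : VSet n) → ∣ A ∪ B ∣ ≤ ∣ A ∣ + ∣ B ∣
card-∪≤ A B = lin (∣ A ∪ B ∣ ∷ ∣ (A ∪ B) ∩ A ∣ ∷ ∣ (A ∪ B) ∖ A ∣ ∷ ∣ A ∣ ∷ ∣ B ∣ ∷ [])
  (λ u i d a b → u ≐ i ⊕ d ⟹ i ≼ a ⟹ d ≼ b ⟹ u ≼ a ⊕ b)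
  (card-split (A ∪ B) A) (card-mono (∩ʳ {A = A ∪ B}))
  (card-mono (λ q → [ (λ x → absurd∈ x (∖ʳ {A = A ∪ B} q)) , (λ y → y) ]′ (∪-elim {A = A} (∖ˡ {A = A ∪ B} q))))

card-pos : ∀ {n} {A : VSet n} {v} → v ∈ A → 1ℤ ≤ ∣ A ∣
card-pos {A = A} {v} v∈ = subst (_≤ ∣ A ∣) (card-point v) (card-mono (⟨⟩-⊆ v∈))

card-remove : ∀ {n} {A : VSet n} {a} → a ∈ A → ∣ A ∣ ≡ ∣ A ∖ ⟨ a ⟩ ∣ + 1ℤ
card-remove {A = A} {a} h = lin (∣ A ∣ ∷ ∣ A ∩ ⟨ a ⟩ ∣ ∷ ∣ A ∖ ⟨ a ⟩ ∣ ∷ ∣ ⟨ a ⟩ ∣ ∷ [])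
  (λ x i d o → x ≐ i ⊕ d ⟹ o ≐ # 1 ⟹ i ≼ o ⟹ o ≼ i ⟹ x ≐ d ⊕ # 1)
  (card-split A ⟨ a ⟩) (card-point a) (card-mono (∩ʳ {A = A})) (card-mono (λ q → ∩-intro (⟨⟩-⊆ h q) q))

-- For `h = 2` and `h = 3` colours the value is `4 h - 4`, the form used in the final edge count;
-- for `h = 0` and `h = 1` it is one more than that.
pot : Bool → Bool → Bool → ℤ
pot true true true = + 8
pot true true false = + 4
pot true false true = + 4
pot false true true = + 4
pot true false false = + 1
pot false true false = + 1
pot false false true = + 1
pot false false false = - (+ 3)

opaque
  p : VSet 3 → ℤ
  p L = pot (L 0F) (L 1F) (L 2F)

  p-def : ∀ L → p L ≡ pot (L 0F) (L 1F) (L 2F)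
  p-def L = refl

Full : VSet 3 → Set
Full L = ∀ {c} → c ∈ L

private
  sz : Bool → Bool → Bool → ℤ
  sz a b c = χ a + (χ b + (χ c + 0ℤ))

  includes : Bool → Bool → Bool → Bool → Bool → Bool → Bool
  includes a b c a' b' c' = (a ⇒ᵇ a') ∧ (b ⇒ᵇ b') ∧ (c ⇒ᵇ c')

  sub-T : ∀ (L L' : VSet 3) → L ⊆ L' → T (includes (L 0F) (L 1F) (L 2F) (L' 0F) (L' 1F) (L' 2F))
  sub-T L L' h = ∧-T (go 0F) (∧-T (go 1F) (go 2F))
    where
    ∧-T : ∀ {a b} → T a → T b → T (a ∧ b)
    ∧-T {true} _ q = q
    go : ∀ c → T (L c ⇒ᵇ L' c)
    go c with L c in eq
    ... | false = tt
    ... | true rewrite un∈ (h (mk∈ eq)) = tt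

private
  -- A pair of nested lists is six Booleans, so a property of such pairs reduces to evaluating 64
  -- closed cases.
  bySub : ∀ (P : Bool → Bool → Bool → Bool → Bool → Bool → Bool) →
          T (all³ λ a b c → all³ λ x y z → includes a b c x y z ⇒ᵇ P a b c x y z) →
          ∀ {L' L : VSet 3} → L' ⊆ L → T (P (L' 0F) (L' 1F) (L' 2F) (L 0F) (L 1F) (L 2F))
  bySub P t {L'} {L} h = ⇒ᵇ-elim (includes (L' 0F) (L' 1F) (L' 2F) (L 0F) (L 1F) (L 2F))
    (all³-sound (λ x y z → includes (L' 0F) (L' 1F) (L' 2F) x y z ⇒ᵇ P (L' 0F) (L' 1F) (L' 2F) x y z)
      (all³-sound (λ a b c → all³ λ x y z → includes a b c x y z ⇒ᵇ P a b c x y z) t (L' 0F) (L' 1F) (L' 2F))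
      (L 0F) (L 1F) (L 2F))
    (sub-T L' L h)

  from≤ : ∀ {x y} → x ≤ y → T ⌊ x ℤ.≤? y ⌋
  from≤ {x} {y} q with x ℤ.≤? y
  ... | yes _ = tt
  ... | no ¬q = ⊥-elim (¬q q)

  to≤ : ∀ x y → T ⌊ x ℤ.≤? y ⌋ → x ≤ y
  to≤ x y t with x ℤ.≤? y
  ... | yes q = q

opaque
  unfolding p

  p-drop : ∀ {L' L : VSet 3} → L' ⊆ L → p L ≤ p L' + + 4 * (∣ L ∣ - ∣ L' ∣)
  p-drop {L'} {L} h rewrite card₃ L | card₃ L' = to≤ _ _ (bySub
    (λ a b c x y z → ⌊ pot x y z ℤ.≤? pot a b c + + 4 * (sz x y z - sz a b c) ⌋) tt {L'} {L} h)

  -- Successive losses are 4, 3 and 4, and two consecutive ones always include the 3. The saved unit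
  -- is what makes the case of two edges in `gap₃` work.
  p-drop₂ : ∀ {L' L : VSet 3} → L' ⊆ L → ∣ L ∣ ≤ ∣ L' ∣ + + 2 → p L ≤ p L' + + 7
  p-drop₂ {L'} {L} h h2 rewrite card₃ L | card₃ L' = to≤ _ _
    (⇒ᵇ-elim ⌊ sz (L 0F) (L 1F) (L 2F) ℤ.≤? sz (L' 0F) (L' 1F) (L' 2F) + + 2 ⌋
      (bySub (λ a b c x y z → ⌊ sz x y z ℤ.≤? sz a b c + + 2 ⌋ ⇒ᵇ ⌊ pot x y z ℤ.≤? pot a b c + + 7 ⌋) tt {L'} {L} h)
      (from≤ h2))

  p-mono : ∀ {L' L : VSet 3} → L' ⊆ L → p L' ≤ p L
  p-mono {L'} {L} h = to≤ _ _ (bySub (λ a b c x y z → ⌊ pot a b c ℤ.≤? pot x y z ⌋) tt {L'} {L} h)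

data CardView (L : VSet 3) : Set where
  full : Full L → ∣ L ∣ ≡ + 3 → p L ≡ + 8 → CardView L
  two  : ∃[ c ] c ∉ L → ∣ L ∣ ≡ + 2 → p L ≡ + 4 → CardView L
  one  : ∃[ c ] c ∉ L → ∣ L ∣ ≡ + 1 → p L ≡ + 1 → CardView L
  none : ∃[ c ] c ∉ L → ∣ L ∣ ≡ 0ℤ → p L ≡ - (+ 3) → CardView L

opaque
  cardView : ∀ L → CardView L
  cardView L with L 0F in a | L 1F in b | L 2F in c | card₃ L | p-def L
  ... | true | true | true | e | q = full (λ { {0F} → mk∈ a ; {1F} → mk∈ b ; {2F} → mk∈ c }) e q
  ... | true | true | false | e | q = two (2F , mk∉ c) e q
  ... | true | false | true | e | q = two (1F , mk∉ b) e q
  ... | false | true | true | e | q = two (0F , mk∉ a) e q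
  ... | true | false | false | e | q = one (2F , mk∉ c) e q
  ... | false | true | false | e | q = one (2F , mk∉ c) e q
  ... | false | false | true | e | q = one (0F , mk∉ a) e q
  ... | false | false | false | e | q = none (2F , mk∉ c) e q

  full? : ∀ (L : VSet 3) → Full L ⊎ ((p L ≤ + 4) × (∣ L ∣ ≤ + 2) × ∃[ c ] c ∉ L)
  full? L with cardView L
  ... | full f _ _ = inj₁ f
  ... | two c e q rewrite e | q = inj₂ (ℤp.≤-refl , ℤp.≤-refl , c)
  ... | one c e q rewrite e | q = inj₂ (+≤+ (ℕ.s≤s ℕ.z≤n) , +≤+ (ℕ.s≤s ℕ.z≤n) , c)
  ... | none c e q rewrite e | q = inj₂ (-≤+ , +≤+ ℕ.z≤n , c)

full-card : ∀ {L} → Full L → ∣ L ∣ ≡ + 3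
full-card {L} f with cardView L
... | full _ e _ = e
... | two (c , c∉) _ _ = absurd∈ f c∉
... | one (c , c∉) _ _ = absurd∈ f c∉
... | none (c , c∉) _ _ = absurd∈ f c∉

full-p : ∀ {L} → Full L → p L ≡ + 8
full-p {L} f with cardView L
... | full _ _ q = q
... | two (c , c∉) _ _ = absurd∈ f c∉
... | one (c , c∉) _ _ = absurd∈ f c∉
... | none (c , c∉) _ _ = absurd∈ f c∉

card≤3 : ∀ (L : VSet 3) → ∣ L ∣ ≤ + 3
card≤3 L = subst (∣ L ∣ ≤_) (full-card {All₃} (mk∈ refl)) (card-mono (λ _ → mk∈ refl))

p≤8 : ∀ L → p L ≤ + 8
p≤8 L with full? L
... | inj₁ f = ℤp.≤-reflexive (full-p f)
... | inj₂ (h , _) = ℤp.≤-trans h (+≤+ (ℕ.s≤s (ℕ.s≤s (ℕ.s≤s (ℕ.s≤s ℕ.z≤n)))))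

cost : ℕ → ℤ
cost zero = 0ℤ
cost (suc k) = + 6 * + (suc k) - 1ℤ

-- A union of `m u v` matchings is encoded by the degree bound `M-deg`, which holds in both
-- directions by symmetry. For bipartite graphs the two are equivalent by König's edge colouring
-- theorem. All lists are subsets of the same three colours.
record Cover (n : ℕ) : Set where
  field
    m     : Fin n → Fin n → ℕ
    m-sym : ∀ u v → m u v ≡ m v u
    m-irr : ∀ v → m v v ≡ 0
    M     : Fin n → Colour → Fin n → VSet 3
    M-sym : ∀ {u c v d} → d ∈ M u c v → c ∈ M v d u
    M-deg : ∀ u c v → ∣ M u c v ∣ ≤ + m u v

cost≥0 : ∀ k → 0ℤ ≤ cost k
cost≥0 zero = ℤp.≤-refl
cost≥0 (suc k) = lin (+ suc k ∷ []) (λ x → # 1 ≼ x ⟹ # 0 ≼ 6 ⊙ x ⊖ # 1) (+≤+ (ℕ.s≤s ℕ.z≤n))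

cost≥5m : ∀ k → + 5 * + k ≤ cost k
cost≥5m zero = ℤp.≤-refl
cost≥5m (suc k) = lin (+ suc k ∷ []) (λ x → # 1 ≼ x ⟹ 5 ⊙ x ≼ 6 ⊙ x ⊖ # 1) (+≤+ (ℕ.s≤s ℕ.z≤n))

cost≡6m-1 : ∀ k → 1ℤ ≤ + k → cost k ≡ + 6 * + k - 1ℤ
cost≡6m-1 zero (+≤+ ())
cost≡6m-1 (suc k) _ = refl

module Covers {n : ℕ} (Γ : Cover n) where
  open Cover Γ public

  multiplicity edgeCost : Weight n
  multiplicity = record
    { wt = λ u v → + m u v ; wt-sym = λ u v → cong +_ (m-sym u v)
    ; wt-irr = λ v → cong +_ (m-irr v) ; wt-nonneg = λ u v → +≤+ ℕ.z≤n }
  edgeCost = record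
    { wt = λ u v → cost (m u v) ; wt-sym = λ u v → cong cost (m-sym u v)
    ; wt-irr = λ v → cong cost (m-irr v) ; wt-nonneg = λ u v → cost≥0 (m u v) }

  module Mu = Weights multiplicity
  module Co = Weights edgeCost

  deg : Fin n → VSet n → ℤ
  deg v A = ∑S A (λ u → + m v u)

  D-deg : ∀ A B → Mu.D A B ≡ ∑S A (λ v → deg v B)
  D-deg A B = opaque-D
    where
    opaque
      unfolding Mu.D
      opaque-D : Mu.D A B ≡ ∑S A (λ v → deg v B)
      opaque-D = refl

  5D≤ : ∀ A B → + 5 * Mu.D A B ≤ Co.D A B
  5D≤ A B = aux
    where
    opaque
      unfolding Mu.D Co.D
      aux : + 5 * Mu.D A B ≤ Co.D A B
      aux = subst (_≤ Co.D A B)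
        (trans (S-cong {A = A} (λ {u} _ → S-* B (+ 5) (λ v → + m u v))) (S-* A (+ 5) (λ u → ∑S B (λ v → + m u v))))
        (S-mono {A = A} (λ {u} _ → S-mono {A = B} (λ {v} _ → cost≥5m (m u v))))

  5e≤ : ∀ A → + 5 * Mu.e A ≤ Co.e A
  5e≤ A = lin (Mu.e A ∷ Co.e A ∷ Mu.D A A ∷ Co.D A A ∷ [])
    (λ x y a b → 2 ⊙ x ≐ a ⟹ 2 ⊙ y ≐ b ⟹ 5 ⊙ a ≼ b ⟹ 5 ⊙ x ≼ y)
    (Mu.e-double A) (Co.e-double A) (5D≤ A A)

  Lists : Set
  Lists = Fin n → VSet 3

  private
    variable
      L L' : Lists
      A B S Z : VSet n

  ρ : Lists → VSet n → ℤ
  ρ L A = ∑S A (λ v → p (L v)) - Co.e A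

  ρ-∪ : Disjoint A B → ∀ L → ρ L (A ∪ B) ≡ ρ L A + ρ L B - Co.D A B
  ρ-∪ {A} {B} d L = lin
    (∑S (A ∪ B) P ∷ ∑S A P ∷ ∑S B P ∷ Co.e (A ∪ B) ∷ Co.e A ∷ Co.e B ∷ Co.D A B ∷ [])
    (λ pab pa pb eab ea eb d → pab ≐ pa ⊕ pb ⟹ eab ≐ ea ⊕ eb ⊕ d ⟹ pab ⊖ eab ≐ (pa ⊖ ea) ⊕ (pb ⊖ eb) ⊖ d)
    (S-∪ d P) (Co.e-∪ d)
    where
    P : Fin n → ℤ
    P v = p (L v)

  ρ-point : ∀ L a → ρ L ⟨ a ⟩ ≡ p (L a)
  ρ-point L a = lin (∑S ⟨ a ⟩ (λ v → p (L v)) ∷ Co.e ⟨ a ⟩ ∷ p (L a) ∷ [])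
    (λ x y z → x ≐ z ⟹ y ≐ # 0 ⟹ x ⊖ y ≐ z) (S-point a (λ v → p (L v))) (Co.e-point a)

  ρ-ext : A ⊆ B → B ⊆ A → ρ L A ≡ ρ L B
  ρ-ext {A} {B} {L} a b = cong₂ _-_ (S-ext⊆ {A = A} {B} a b) (Co.e-ext a b)

  ρ-insert : ∀ L {a} → a ∉ B → ρ L (⟨ a ⟩ ∪ B) ≡ p (L a) + ρ L B - ∑S B (λ v → cost (m a v))
  ρ-insert {B} L {a} a∉ = trans (ρ-∪ (⟨⟩-disjoint a∉) L)
    (cong₂ _-_ (cong (λ t → t + ρ L B) (ρ-point L a)) (Co.D-pointˡ a B))

  ρ-lists : (∀ {v} → v ∈ A → p (L v) ≤ p (L' v)) → ρ L A ≤ ρ L' A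
  ρ-lists {A} {L} {L'} h = lin (∑S A (λ v → p (L v)) ∷ ∑S A (λ v → p (L' v)) ∷ Co.e A ∷ [])
    (λ x y z → x ≼ y ⟹ x ⊖ z ≼ y ⊖ z) (S-mono h)

  -- The vertex terms on both sides agree, and an edge between the two set differences is paid for
  -- only in the union.
  ρ-submodular : ∀ L U W → ρ L (U ∪ W) + ρ L (U ∩ W) ≤ ρ L U + ρ L W
  ρ-submodular L U W = lin
    (ρ L (U ∪ W) ∷ ρ L (U ∩ W) ∷ ρ L U ∷ ρ L W ∷ ρ L (W ∖ U) ∷ ρ L (U ∩ W ∪ W ∖ U) ∷ ρ L (U ∪ W ∖ U) ∷
      Co.D U (W ∖ U) ∷ Co.D (U ∩ W) (W ∖ U) ∷ [])
    (λ uw i u w w' iw uw' d d' → uw ≐ uw' ⟹ uw' ≐ u ⊕ w' ⊖ d ⟹ w ≐ iw ⟹ iw ≐ i ⊕ w' ⊖ d' ⟹ d' ≼ d ⟹ uw ⊕ i ≼ u ⊕ w)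
    (ρ-ext uw⊆ ⊆uw) (ρ-∪ (λ u → not-in (λ w → absurd∈ u (∖ʳ {A = W} w))) L)
    (ρ-ext w⊆ ⊆w) (ρ-∪ (λ u → not-in (λ w → absurd∈ (∩ˡ {A = U} u) (∖ʳ {A = W} w))) L)
    (Co.D-⊆ {A = U ∩ W} {U} {W ∖ U} {W ∖ U} (∩ˡ {A = U}) (λ h → h))
    where
    uw⊆ : U ∪ W ⊆ U ∪ W ∖ U
    uw⊆ {v} h with dec∈ v U
    ... | inj₁ u = ∪ˡ {A = U} u
    ... | inj₂ u with ∪-elim {A = U} h
    ...   | inj₁ u' = absurd∈ u' u
    ...   | inj₂ w = ∪ʳ {A = U} (∖-intro w u)
    ⊆uw : U ∪ W ∖ U ⊆ U ∪ W
    ⊆uw h with ∪-elim {A = U} h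
    ... | inj₁ u = ∪ˡ {A = U} u
    ... | inj₂ w = ∪ʳ {A = U} (∖ˡ {A = W} w)
    w⊆ : W ⊆ U ∩ W ∪ W ∖ U
    w⊆ {v} w with dec∈ v U
    ... | inj₁ u = ∪ˡ {A = U ∩ W} (∩-intro u w)
    ... | inj₂ u = ∪ʳ {A = U ∩ W} (∖-intro w u)
    ⊆w : U ∩ W ∪ W ∖ U ⊆ W
    ⊆w h with ∪-elim {A = U ∩ W} h
    ... | inj₁ i = ∩ʳ {A = U} i
    ... | inj₂ w = ∖ˡ {A = W} w

  M-zero : ∀ {u v c d} → m u v ≡ 0 → d ∉ M u c v
  M-zero {u} {v} {c} {d} eq = not-in (λ h → lin (∣ M u c v ∣ ∷ + m u v ∷ [])
    (λ x y → x ≼ y ⟹ # 1 ≼ x ⟹ y ≐ # 0 ⟹ contra) (M-deg u c v) (card-pos h) (cong +_ eq))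

  record Colouring (L : Lists) (A : VSet n) : Set where
    field
      col    : Fin n → Colour
      col∈   : ∀ {v} → v ∈ A → col v ∈ L v
      proper : ∀ {u v} → u ∈ A → v ∈ A → col v ∉ M u (col u) v
  open Colouring public

  restrict : (∀ {v} → v ∈ B → L' v ⊆ L v) → B ⊆ A → Colouring L' A → Colouring L B
  restrict h ba φ = record
    { col = col φ ; col∈ = λ v → h v (col∈ φ (ba v)) ; proper = λ u v → proper φ (ba u) (ba v) }

  blockers : VSet n → (Fin n → Colour) → Fin n → Colour → ℤ
  blockers S φ v c = ∑S S (λ s → M s (φ s) v c ▹ 1ℤ)

  blocked : VSet n → (Fin n → Colour) → Fin n → VSet 3
  blocked S φ v c = ⌊ 1ℤ ℤ.≤? blockers S φ v c ⌋

  residual : Lists → VSet n → (Fin n → Colour) → Lists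
  residual L S φ v = L v ∖ blocked S φ v

  blocked-intro : ∀ {S φ v c s} → s ∈ S → c ∈ M s (φ s) v → c ∈ blocked S φ v
  blocked-intro {S} {φ} {v} {c} {s} s∈ c∈ with 1ℤ ℤ.≤? blockers S φ v c in eq
  ... | yes _ = mk∈ (cong ⌊_⌋ eq)
  ... | no ¬h = ⊥-elim (¬h (subst (_≤ blockers S φ v c) (▹-true 1ℤ (un∈ c∈))
        (S-term {A = S} s∈ (λ {w} _ → ▹-nonneg (M w (φ w) v c)))))
    where
    ▹-nonneg : ∀ b → 0ℤ ≤ b ▹ 1ℤ
    ▹-nonneg true = +≤+ ℕ.z≤n
    ▹-nonneg false = ℤp.≤-refl

  blocked-elim : ∀ {S φ v c} → c ∈ blocked S φ v → ∃[ s ] s ∈ S × c ∈ M s (φ s) v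
  blocked-elim {S} {φ} {v} {c} (mk∈ h) with 1ℤ ℤ.≤? blockers S φ v c
  blocked-elim {S} {φ} {v} {c} (mk∈ ()) | no _
  ... | yes q with S-find {A = S} q
  ...   | s , s∈ , r = s , s∈ , mk∈ (▹-pos (M s (φ s) v c) r)
    where
    ▹-pos : ∀ b → 1ℤ ≤ b ▹ 1ℤ → b ≡ true
    ▹-pos true _ = refl
    ▹-pos false (+≤+ ())

  residual-free : ∀ {L S φ v c s} → c ∈ residual L S φ v → s ∈ S → c ∉ M s (φ s) v
  residual-free {L} {S} {φ} {v} c∈ s∈ = not-in (λ h → absurd∈ (blocked-intro s∈ h) (∖ʳ {A = L v} c∈))

  residual-⊆ : ∀ {L S φ v} → residual L S φ v ⊆ L v
  residual-⊆ {L} {v = v} = ∖ˡ {A = L v}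

  -- Double counting of pairs: each blocked colour has at least one blocker, and the colour of `s`
  -- blocks at most `m s v` colours of `v`.
  blocked-card : ∀ S φ v → ∣ blocked S φ v ∣ ≤ deg v S
  blocked-card S φ v = begin
    ∣ blocked S φ v ∣ ≡⟨ card-sum _ ⟩
    ∑S (blocked S φ v) (λ _ → 1ℤ) ≤⟨ S-mono {A = blocked S φ v} (λ {c} h → wit c h) ⟩
    ∑S (blocked S φ v) (blockers S φ v) ≤⟨ S-⊆ {A = blocked S φ v} {All₃} (λ _ → mk∈ refl) (λ {c} _ → S-nonneg {A = S} (λ {s} _ → ▹-nonneg (M s (φ s) v c))) ⟩
    ∑S All₃ (blockers S φ v) ≡⟨ S-swap′ ⟩
    ∑S S (λ s → ∣ M s (φ s) v ∣) ≤⟨ S-mono {A = S} (λ {s} _ → ℤp.≤-trans (M-deg s (φ s) v) (ℤp.≤-reflexive (cong +_ (m-sym s v)))) ⟩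
    deg v S ∎
    where
    open ℤp.≤-Reasoning
    ▹-nonneg : ∀ b → 0ℤ ≤ b ▹ 1ℤ
    ▹-nonneg true = +≤+ ℕ.z≤n
    ▹-nonneg false = ℤp.≤-refl
    wit : ∀ c → c ∈ blocked S φ v → 1ℤ ≤ blockers S φ v c
    wit c (mk∈ h) with 1ℤ ℤ.≤? blockers S φ v c
    ... | yes q = q
    ... | no _ = true≢false h refl
    opaque
      unfolding ∣_∣ ∑S ∑
      -- `S-swap` needs both index sets in the same `Fin n`; here one ranges over colours, so the
      -- three summands are written out.
      S-swap′ : ∑S All₃ (blockers S φ v) ≡ ∑S S (λ s → ∣ M s (φ s) v ∣)
      S-swap′ = begin-equality
        blockers S φ v 0F + (blockers S φ v 1F + (blockers S φ v 2F + 0ℤ))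
          ≡⟨ cong (λ t → blockers S φ v 0F + t) (cong (λ t → blockers S φ v 1F + t) (ℤp.+-identityʳ _)) ⟩
        blockers S φ v 0F + (blockers S φ v 1F + blockers S φ v 2F)
          ≡⟨ cong (λ t → blockers S φ v 0F + t) (sym (S-+ S _ _)) ⟩
        blockers S φ v 0F + ∑S S (λ s → χ (M s (φ s) v 1F) + χ (M s (φ s) v 2F))
          ≡⟨ sym (S-+ S _ _) ⟩
        ∑S S (λ s → χ (M s (φ s) v 0F) + (χ (M s (φ s) v 1F) + χ (M s (φ s) v 2F)))
          ≡⟨ S-cong {A = S} (λ {s} _ → cong (λ t → χ (M s (φ s) v 0F) + (χ (M s (φ s) v 1F) + t)) (sym (ℤp.+-identityʳ _))) ⟩
        ∑S S (λ s → ∣ M s (φ s) v ∣) ∎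

  residual-card : ∀ L S φ v → ∣ L v ∣ ≤ ∣ residual L S φ v ∣ + deg v S
  residual-card L S φ v = lin
    (∣ L v ∣ ∷ ∣ L v ∩ blocked S φ v ∣ ∷ ∣ residual L S φ v ∣ ∷ ∣ blocked S φ v ∣ ∷ deg v S ∷ [])
    (λ l i r b d → l ≐ i ⊕ r ⟹ i ≼ b ⟹ b ≼ d ⟹ l ≼ r ⊕ d)
    (card-split (L v) (blocked S φ v)) (card-mono (∩ʳ {A = L v})) (blocked-card S φ v)

  combine : (φ : Colouring L S) → Disjoint S Z → Colouring (residual L S (col φ)) Z → Colouring L (S ∪ Z)
  combine {L} {S} {Z} φ dis ψ = record { col = both ; col∈ = both∈ ; proper = both-proper }
    where
    both : Fin n → Colour
    both v = if S v then col φ v else col ψ v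
    inS : ∀ {v} → v ∈ S → both v ≡ col φ v
    inS {v} (mk∈ h) rewrite h = refl
    inT : ∀ {v} → v ∈ Z → both v ≡ col ψ v
    inT {v} h with S v in eq
    ... | true = absurd∈ h (dis (mk∈ eq))
    ... | false = refl
    both∈ : ∀ {v} → v ∈ S ∪ Z → both v ∈ L v
    both∈ {v} h with ∪-elim {A = S} h
    ... | inj₁ s = subst (_∈ L v) (sym (inS s)) (col∈ φ s)
    ... | inj₂ t = subst (_∈ L v) (sym (inT t)) (∖ˡ {A = L v} (col∈ ψ t))
    both-proper : ∀ {u v} → u ∈ S ∪ Z → v ∈ S ∪ Z → both v ∉ M u (both u) v
    both-proper {u} {v} hu hv with ∪-elim {A = S} hu | ∪-elim {A = S} hv
    ... | inj₁ su | inj₁ sv rewrite inS su | inS sv = proper φ su sv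
    ... | inj₁ su | inj₂ tv rewrite inS su | inT tv = residual-free {L} (col∈ ψ tv) su
    ... | inj₂ tu | inj₁ sv rewrite inT tu | inS sv = not-in (λ h → absurd∈ (M-sym h) (residual-free {L} (col∈ ψ tu) sv))
    ... | inj₂ tu | inj₂ tv rewrite inT tu | inT tv = proper ψ tu tv

  colourPoint : ∀ {a c} → c ∈ L a → Colouring L ⟨ a ⟩
  colourPoint {L} {a} {c} h = record
    { col = λ _ → c
    ; col∈ = λ v∈ → subst (λ w → c ∈ L w) (sym (⟨⟩-elim v∈)) h
    ; proper = λ {u} {v} u∈ v∈ → M-zero (trans (cong₂ m (⟨⟩-elim u∈) (⟨⟩-elim v∈)) (m-irr a)) }

  extendPoint : ∀ {a} → Colouring L B → a ∉ B → deg a B + 1ℤ ≤ ∣ L a ∣ → Colouring L (B ∪ ⟨ a ⟩)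
  extendPoint {L} {B} {a} φ a∉ h =
    let (c , c∈) = card-find {A = residual L B (col φ) a} (lin (∣ L a ∣ ∷ ∣ residual L B (col φ) a ∣ ∷ deg a B ∷ [])
          (λ l r d → d ⊕ # 1 ≼ l ⟹ l ≼ r ⊕ d ⟹ # 1 ≼ r) h (residual-card L B (col φ) a))
    in combine φ (disjoint-⟨⟩ a∉) (colourPoint c∈)

  extendPoint-col : ∀ {a} (φ : Colouring L B) (a∉ : a ∉ B) h {v} → v ∈ B → col (extendPoint {L} {B} {a} φ a∉ h) v ≡ col φ v
  extendPoint-col φ a∉ h (mk∈ v∈) rewrite v∈ = refl

  emptyColouring : (∀ {v} → v ∉ A) → Colouring L A
  emptyColouring e = record { col = λ _ → 0F ; col∈ = λ h → absurd∈ h e ; proper = λ h _ → absurd∈ h e }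

  remove-cover : ∀ {a} → A ⊆ A ∖ ⟨ a ⟩ ∪ ⟨ a ⟩
  remove-cover {A} {a} {v} h with dec∈ v ⟨ a ⟩
  ... | inj₁ q = ∪ʳ {A = A ∖ ⟨ a ⟩} q
  ... | inj₂ q = ∪ˡ {A = A ∖ ⟨ a ⟩} (∖-intro h q)

  -- Greedy colouring: Y is what remains after deleting vertices whose list is longer than their degree.
  degenerate : ∀ k L A → ∣ A ∣ ≤ + k →
    Colouring L A ⊎ (∃[ Y ] Y ⊆ A × (∃[ y ] y ∈ Y) × (∀ {v} → v ∈ Y → ∣ L v ∣ ≤ deg v Y))
  degenerate k L A h = step k h (search A (λ v → [ inj₂ , inj₁ ]′ (dec≤ ∣ L v ∣ (deg v A))))
    where
    Result : Set
    Result = Colouring L A ⊎ (∃[ Y ] Y ⊆ A × (∃[ y ] y ∈ Y) × (∀ {v} → v ∈ Y → ∣ L v ∣ ≤ deg v Y))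
    whole : (∀ {v} → v ∈ A → ∣ L v ∣ ≤ deg v A) → (∣ A ∣ ≤ 0ℤ) ⊎ (0ℤ + 1ℤ ≤ ∣ A ∣) → Result
    whole short (inj₁ z) = inj₁ (emptyColouring (λ {v} → not-in (λ v∈ → lin (∣ A ∣ ∷ []) (λ x → x ≼ # 0 ⟹ # 1 ≼ x ⟹ contra) z (card-pos v∈))))
    whole short (inj₂ pos) = inj₂ (A , (λ x → x) , card-find pos , short)
    extend : ∀ v → v ∈ A → deg v A + 1ℤ ≤ ∣ L v ∣ → Colouring L (A ∖ ⟨ v ⟩) ⊎ _ → Result
    extend v v∈ big (inj₂ (Y , Y⊆ , ne , short)) = inj₂ (Y , (λ y → ∖ˡ {A = A} (Y⊆ y)) , ne , short)
    extend v v∈ big (inj₁ φ) = inj₁ (restrict (λ _ c → c) remove-cover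
      (extendPoint φ (not-in (λ q → absurd∈ ∈⟨⟩ (∖ʳ {A = A} q)))
        (lin (deg v A ∷ deg v (A ∖ ⟨ v ⟩) ∷ ∣ L v ∣ ∷ []) (λ a b l → a ⊕ # 1 ≼ l ⟹ b ≼ a ⟹ b ⊕ # 1 ≼ l)
          big (S-⊆ {A = A ∖ ⟨ v ⟩} {A} (∖ˡ {A = A}) (λ _ → +≤+ ℕ.z≤n)))))
    step : ∀ k → ∣ A ∣ ≤ + k → (∃[ v ] v ∈ A × deg v A + 1ℤ ≤ ∣ L v ∣) ⊎ (∀ {v} → v ∈ A → ∣ L v ∣ ≤ deg v A) → Result
    step k h (inj₂ short) = whole short (dec≤ ∣ A ∣ 0ℤ)
    step zero h (inj₁ (v , v∈ , _)) = ⊥-elim (lin (∣ A ∣ ∷ []) (λ x → x ≼ # 0 ⟹ # 1 ≼ x ⟹ contra) h (card-pos v∈))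
    step (suc k) h (inj₁ (v , v∈ , big)) = extend v v∈ big (degenerate k L (A ∖ ⟨ v ⟩)
      (lin (∣ A ∣ ∷ ∣ A ∖ ⟨ v ⟩ ∣ ∷ + k ∷ []) (λ a b k → a ≼ # 1 ⊕ k ⟹ a ≐ b ⊕ # 1 ⟹ b ≼ k) h (card-remove v∈)))

opaque
  unfolding ∑S
  S-▹ : ∀ {n} (W B : VSet n) (f : Fin n → ℤ) → ∑S W (λ v → B v ▹ f v) ≡ ∑S (W ∩ B) f
  S-▹ W B f = ∑-cong go
    where
    go : ∀ v → W v ▹ B v ▹ f v ≡ (W ∩ B) v ▹ f v
    go v with W v
    ... | true = refl
    ... | false = refl

card≤1-unique : ∀ {n} {X : VSet n} {a b} → ∣ X ∣ ≤ 1ℤ → a ∈ X → b ∈ X → a ≡ b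
card≤1-unique {X = X} {a} {b} h a∈ b∈ with a Finp.≟ b
... | yes eq = eq
... | no ne = ⊥-elim (lin (∣ X ∣ ∷ ∣ X ∖ ⟨ a ⟩ ∣ ∷ ∣ X ∩ ⟨ a ⟩ ∣ ∷ [])
  (λ x d i → x ≼ # 1 ⟹ x ≐ i ⊕ d ⟹ # 1 ≼ i ⟹ # 1 ≼ d ⟹ contra)
  h (card-split X ⟨ a ⟩) (card-pos (∩-intro a∈ ∈⟨⟩)) (card-pos (∖-intro b∈ (∉⟨⟩ (ne ∘ sym)))))

avoid : (K K' : VSet 3) → ∣ K ∣ ≤ 1ℤ → ∣ K' ∣ ≤ 1ℤ → ∃[ c ] c ∉ K × c ∉ K'
avoid K K' h h' =
  let (c , c∈) = card-find {A = All₃ ∖ K ∖ K'} (lin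
        (∣ All₃ ∣ ∷ ∣ All₃ ∖ K ∣ ∷ ∣ All₃ ∩ K ∣ ∷ ∣ All₃ ∖ K ∖ K' ∣ ∷ ∣ (All₃ ∖ K) ∩ K' ∣ ∷ ∣ K ∣ ∷ ∣ K' ∣ ∷ [])
        (λ a d i dd ii k k' → a ≐ # 3 ⟹ a ≐ i ⊕ d ⟹ d ≐ ii ⊕ dd ⟹ i ≼ k ⟹ ii ≼ k' ⟹ k ≼ # 1 ⟹ k' ≼ # 1 ⟹ # 1 ≼ dd)
        (full-card (mk∈ refl)) (card-split All₃ K) (card-split (All₃ ∖ K) K') (card-mono (∩ʳ {A = All₃})) (card-mono (∩ʳ {A = All₃ ∖ K})) h h')
  in c , ∖ʳ {A = All₃} (∖ˡ {A = All₃ ∖ K} c∈) , ∖ʳ {A = All₃ ∖ K} c∈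

opaque
  ⊎-search : ∀ {n} (A B : VSet n) → (∃[ v ] v ∈ A × v ∉ B) ⊎ (A ⊆ B)
  ⊎-search A B = search A (λ v → [ inj₂ , inj₁ ]′ (dec∈ v B))

-- A small 4-Ore graph on the vertex set B; it need not be induced, and the lists play no role.
record Exceptional {n} (Γ : Cover n) (B : VSet n) : Set where
  open Cover Γ
  field
    G₀       : Graph
    ore      : Ore4 G₀
    θ        : Fin (Graph.n G₀) → Fin n
    θ-inj    : ∀ {i j} → θ i ≡ θ j → i ≡ j
    θ∈       : ∀ i → θ i ∈ B
    θ-onto   : ∀ {v} → v ∈ B → ∃[ i ] θ i ≡ v
    θ-adj    : ∀ {i j} → adj G₀ i j ≡ true → 1ℤ ≤ + m (θ i) (θ j)
    size     : (Graph.n G₀ ≡ 4) ⊎ (Graph.n G₀ ≡ 7) ⊎ (Graph.n G₀ ≡ 10)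
    edges    : + 3 * ∑ (λ i → ∑ (λ j → χ (adj G₀ i j))) ≡ + 10 * + Graph.n G₀ - + 4
    rows     : ∀ i → + 3 ≤ ∑ (λ j → χ (adj G₀ i j))
    complete : Graph.n G₀ ≡ 4 → ∀ {i j} → i ≢ j → adj G₀ i j ≡ true

Outcome : ∀ {n} (Γ : Cover n) → Covers.Lists Γ → VSet n → Set
Outcome Γ L B = (ρ L B + + 3 ≤ 0ℤ) ⊎ ((∀ {v} → v ∈ B → Full (L v)) × ρ L B + 1ℤ ≤ 0ℤ) ⊎ Exceptional Γ B
  where open Covers Γ

Out : ∀ {n} (Γ : Cover n) → Covers.Lists Γ → VSet n → Set
Out Γ L A = ∃[ B ] B ⊆ A × (∃[ b ] b ∈ B) × Outcome Γ L B

proper-card : ∀ {n} {A B : VSet n} {r} → B ⊆ A → r ∈ A → r ∉ B → ∣ B ∣ + 1ℤ ≤ ∣ A ∣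
proper-card {A = A} {B} {r} ba r∈ r∉ = subst (_≤ ∣ A ∣)
  (trans (card-∪ (disjoint-⟨⟩ r∉)) (cong (λ t → ∣ B ∣ + t) (card-point r)))
  (card-mono (λ h → [ ba , ⟨⟩-⊆ r∈ ]′ (∪-elim {A = B} h)))

upd : ∀ {n} → (Fin n → VSet 3) → Fin n → VSet 3 → Fin n → VSet 3
upd L u X v = if v ≡ᵇ u then X else L v

upd-at : ∀ {n} {L : Fin n → VSet 3} {u X} → upd L u X u ≡ X
upd-at {u = u} rewrite ≡ᵇ-refl u = refl

upd-off : ∀ {n} {L : Fin n → VSet 3} {u v X} → v ≢ u → upd L u X v ≡ L v
upd-off {u = u} {v} ne rewrite ≡ᵇ-≢ ne = refl

upd-elim : ∀ {n} {L : Fin n → VSet 3} {u X} (P : VSet 3 → Set) → ∀ v → P X → P (L v) → P (upd L u X v)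
upd-elim {u = u} P v x l with v ≡ᵇ u
... | true = x
... | false = l

upd-⊆ : ∀ {n} {L : Fin n → VSet 3} {u X} → X ⊆ L u → ∀ v → upd L u X v ⊆ L v
upd-⊆ {L = L} {u} xs v h with v ≡ᵇ u in eq
... | true = subst (λ w → _ ∈ L w) (sym (≡ᵇ⇒≡ eq)) (xs h)
... | false = h

-- Potentials of residual lists and one step of the induction

module Potentials {n : ℕ} (Γ : Cover n) where
  open Covers Γ public

  private
    variable
      L L' : Lists
      A B S W : VSet n

  ρ-diff : (f : Fin n → ℤ) → (∀ {v} → v ∈ W → p (L v) ≤ p (L' v) + f v) → ρ L W ≤ ρ L' W + ∑S W f
  ρ-diff {W} {L} {L'} f h = lin
    (∑S W (λ v → p (L v)) ∷ ∑S W (λ v → p (L' v)) ∷ Co.e W ∷ ∑S W f ∷ ∑S W (λ v → p (L' v) + f v) ∷ [])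
    (λ a b e f s → a ≼ s ⟹ s ≐ b ⊕ f ⟹ a ⊖ e ≼ b ⊖ e ⊕ f)
    (S-mono h) (S-+ W (λ v → p (L' v)) f)

  ρ-residual : ∀ L S φ W → ρ L W ≤ ρ (residual L S φ) W + + 4 * Mu.D W S
  ρ-residual L S φ W = subst (λ t → ρ L W ≤ ρ (residual L S φ) W + t)
    (trans (S-* W (+ 4) (λ v → deg v S)) (cong (λ t → + 4 * t) (sym (D-deg W S))))
    (ρ-diff {L' = residual L S φ} (λ v → + 4 * deg v S) (λ {v} _ → drop v))
    where
    drop : ∀ v → p (L v) ≤ p (residual L S φ v) + + 4 * deg v S
    drop v = lin (p (L v) ∷ p (residual L S φ v) ∷ deg v S ∷ ∣ L v ∣ ∷ ∣ residual L S φ v ∣ ∷ [])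
      (λ x y d l r → x ≼ y ⊕ 4 ⊙ (l ⊖ r) ⟹ l ≼ r ⊕ d ⟹ x ≼ y ⊕ 4 ⊙ d)
      (p-drop (residual-⊆ {L})) (residual-card L S φ v)

  ρ-upd : ∀ {u X} d → 0ℤ ≤ d → p (L u) ≤ p X + d → ρ L W ≤ ρ (upd L u X) W + d
  ρ-upd {L} {W} {u} {X} d d≥0 h = lin
    (ρ L W ∷ ρ (upd L u X) W ∷ ∑S W (λ v → ⟨ u ⟩ v ▹ d) ∷ ∑S (W ∩ ⟨ u ⟩) (λ _ → d) ∷ ∑S ⟨ u ⟩ (λ _ → d) ∷ d ∷ [])
    (λ a b s i o d → a ≼ b ⊕ s ⟹ s ≐ i ⟹ i ≼ o ⟹ o ≐ d ⟹ a ≼ b ⊕ d)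
    (ρ-diff {L' = upd L u X} (λ v → ⟨ u ⟩ v ▹ d) (λ {v} _ → at v))
    (S-▹ W ⟨ u ⟩ (λ _ → d)) (S-⊆ {A = W ∩ ⟨ u ⟩} {⟨ u ⟩} (∩ʳ {A = W}) (λ _ → d≥0)) (S-point u (λ _ → d))
    where
    at : ∀ v → p (L v) ≤ p (upd L u X v) + ⟨ u ⟩ v ▹ d
    at v with v ≡ᵇ u in eq
    ... | true = subst (λ w → p (L w) ≤ p X + d) (sym (≡ᵇ⇒≡ eq)) h
    ... | false = ℤp.≤-reflexive (sym (ℤp.+-identityʳ _))

  ρ-upd-off : ∀ {u X} → u ∉ W → ρ (upd L u X) W ≡ ρ L W
  ρ-upd-off {W} {L} {u} u∉ = cong₂ _-_ (S-cong {A = W} (λ {v} v∈ → cong p (upd-off {L = L} (∈-≢ v∈ u∉)))) refl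

  deg≥0 : ∀ {v A} → 0ℤ ≤ deg v A
  deg≥0 {v} {A} = S-nonneg {A = A} (λ _ → +≤+ ℕ.z≤n)

  deg-⊆ : ∀ {v} → A ⊆ B → deg v A ≤ deg v B
  deg-⊆ {A} {B} ab = S-⊆ {A = A} {B} ab (λ _ → +≤+ ℕ.z≤n)

  deg-∪≤ : ∀ v A B → deg v (A ∪ B) ≤ deg v A + deg v B
  deg-∪≤ v A B = lin (deg v (A ∪ B) ∷ deg v ((A ∪ B) ∩ A) ∷ deg v ((A ∪ B) ∖ A) ∷ deg v A ∷ deg v B ∷ [])
    (λ u i d a b → u ≐ i ⊕ d ⟹ i ≼ a ⟹ d ≼ b ⟹ u ≼ a ⊕ b)
    (S-split (A ∪ B) A (λ w → + m v w)) (deg-⊆ (∩ʳ {A = A ∪ B}))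
    (deg-⊆ (λ q → [ (λ x → absurd∈ x (∖ʳ {A = A ∪ B} q)) , (λ y → y) ]′ (∪-elim {A = A} (∖ˡ {A = A ∪ B} q))))

  deg-term : ∀ {v u} → u ∈ A → + m v u ≤ deg v A
  deg-term {A} u∈ = S-term {A = A} u∈ (λ _ → +≤+ ℕ.z≤n)

  M-pos : ∀ {u c v d} → d ∈ M u c v → 1ℤ ≤ + m u v
  M-pos {u} {c} {v} h = ℤp.≤-trans (card-pos h) (M-deg u c v)

  ρ-join : ∀ L → Disjoint S W → ρ L (S ∪ W) ≤ ρ L S + ρ L W - + 5 * Mu.D W S
  ρ-join {S} {W} L d = lin (ρ L (S ∪ W) ∷ ρ L S ∷ ρ L W ∷ Co.D S W ∷ Mu.D S W ∷ Mu.D W S ∷ [])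
    (λ x s w c t t' → x ≐ s ⊕ w ⊖ c ⟹ 5 ⊙ t ≼ c ⟹ t ≐ t' ⟹ x ≼ s ⊕ w ⊖ 5 ⊙ t')
    (ρ-∪ d L) (5D≤ S W) (Mu.D-sym S W)

-- Only multiplicities inside `W` enter, so an added edge or a contraction cannot be seen by a set
-- that it does not touch.
ρ-agree : ∀ {n} (Γ Γ' : Cover n) L W → (∀ {u v} → u ∈ W → v ∈ W → Cover.m Γ u v ≡ Cover.m Γ' u v) →
          Covers.ρ Γ L W ≡ Covers.ρ Γ' L W
ρ-agree Γ Γ' L W same = lin (∑S W (λ v → p (L v)) ∷ P.Co.e W ∷ P'.Co.e W ∷ P.Co.D W W ∷ P'.Co.D W W ∷ [])
  (λ s e e' d d' → 2 ⊙ e ≐ d ⟹ 2 ⊙ e' ≐ d' ⟹ d ≐ d' ⟹ s ⊖ e ≐ s ⊖ e')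
  (P.Co.e-double W) (P'.Co.e-double W) D≡
  where
  module P = Covers Γ
  module P' = Covers Γ'
  opaque
    unfolding Weights.D
    D≡ : P.Co.D W W ≡ P'.Co.D W W
    D≡ = S-cong {A = W} (λ {u} u∈ → S-cong {A = W} (λ {v} v∈ → cong cost (same u∈ v∈)))

-- One step of the induction for the theorem "every cover is colourable on A or has an outcome inside A",
-- in continuation style: R is the goal, reached from any colouring of A and from any outcome.
module Step {n : ℕ} (Γ : Cover n) (L : Covers.Lists Γ) (A : VSet n) (R : Set)
            (IH : ∀ (Γ' : Cover n) L' B → ∣ B ∣ + 1ℤ ≤ ∣ A ∣ → Covers.Colouring Γ' L' B ⊎ Out Γ' L' B)
            (out : Out Γ L A → R) (done : Covers.Colouring Γ L A → R) where
  open Potentials Γ public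

  private
    variable
      S B W : VSet n

  -- Two of the three outcomes for the smaller lists are outcomes for `L` too: a list that is full
  -- in `L'` is full in `L`, and an exceptional graph is a matter of multiplicities alone. Only a
  -- set of potential at most -3 with respect to `L'` is left to the caller.
  shrink : ∀ L' B {r} → (∀ {v} → L' v ⊆ L v) → B ⊆ A → r ∈ A → r ∉ B → (Colouring L' B → R) →
           (∀ W {w} → W ⊆ B → w ∈ W → ρ L' W + + 3 ≤ 0ℤ → R) → R
  shrink L' B sub ba r∈ r∉ kc kw with IH Γ L' B (proper-card ba r∈ r∉)
  ... | inj₁ φ = kc φ
  ... | inj₂ (W , wb , (w , w∈) , inj₁ a) = kw W wb w∈ a
  ... | inj₂ (W , wb , ne , inj₂ (inj₁ (f , b))) = out (W , ba ∘ wb , ne , inj₂ (inj₁ ((λ v → sub (f v)) ,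
        ℤp.≤-trans (ℤp.+-monoˡ-≤ 1ℤ (ρ-lists {A = W} {L} {L'} (λ v∈ → p-mono (λ _ → f v∈)))) b)))
  ... | inj₂ (W , wb , ne , inj₂ (inj₂ x)) = out (W , ba ∘ wb , ne , inj₂ (inj₂ x))

  small-out : ∀ {w} → W ⊆ A → w ∈ W → ρ L W + + 3 ≤ 0ℤ → R
  small-out {W} wa w∈ h = out (W , wa , (_ , w∈) , inj₁ h)

  colourOf : ∀ {r} → B ⊆ A → r ∈ A → r ∉ B → (Colouring L B → R) → R
  colourOf {B} ba r∈ r∉ k = shrink L B (λ c → c) ba r∈ r∉ k (λ W wb w∈ h → small-out (ba ∘ wb) w∈ h)

  module Gap (μ : ℤ) (μ≥ : 0ℤ ≤ μ + + 2) (low : ∀ {B b} → B ⊆ A → b ∈ B → ρ L B + 1ℤ ≤ μ → R) where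

    -- If the rest of `A` cannot be coloured after `S`, then some `W` drops to -3. It lost at most 4
    -- per edge to `S`, while the union pays 5 per edge; the difference of 1 per edge is the term
    -- `Mu.D W S` in the last bound.
    module Extension {S s r} (sa : S ⊆ A) (s∈ : s ∈ S) (r∈ : r ∈ A) (r∉ : r ∉ S)
                     (k : (φ : Colouring L S) (W : VSet n) {w : Fin n} → W ⊆ A ∖ S → w ∈ W → ρ (residual L S (col φ)) W + + 3 ≤ 0ℤ →
                          ρ L W + + 3 ≤ + 4 * Mu.D W S → ρ L (S ∪ W) + + 3 + Mu.D W S ≤ ρ L S → R) where
      extension : R
      extension = colourOf sa r∈ r∉ λ φ →
        shrink (residual L S (col φ)) (A ∖ S) (residual-⊆ {L}) (∖ˡ {A = A}) (sa s∈) (not-in (λ h → absurd∈ s∈ (∖ʳ {A = A} h)))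
          (λ ψ → done (restrict (λ _ c → c) split (combine φ (λ s∈ → not-in (λ h → absurd∈ s∈ (∖ʳ {A = A} h))) ψ)))
          (λ W wb w∈ h → k φ W wb w∈ h (small φ W h) (joined φ W wb h))
        where
        split : A ⊆ S ∪ A ∖ S
        split {v} h with dec∈ v S
        ... | inj₁ q = ∪ˡ {A = S} q
        ... | inj₂ q = ∪ʳ {A = S} (∖-intro h q)
        small : ∀ φ W → ρ (residual L S (col φ)) W + + 3 ≤ 0ℤ → ρ L W + + 3 ≤ + 4 * Mu.D W S
        small φ W h = lin (ρ L W ∷ ρ (residual L S (col φ)) W ∷ Mu.D W S ∷ [])
          (λ a b t → a ≼ b ⊕ 4 ⊙ t ⟹ b ⊕ # 3 ≼ # 0 ⟹ a ⊕ # 3 ≼ 4 ⊙ t) (ρ-residual L S (col φ) W) h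
        joined : ∀ φ W → W ⊆ A ∖ S → ρ (residual L S (col φ)) W + + 3 ≤ 0ℤ → ρ L (S ∪ W) + + 3 + Mu.D W S ≤ ρ L S
        joined φ W wb h = lin (ρ L (S ∪ W) ∷ ρ L S ∷ ρ L W ∷ Mu.D W S ∷ [])
          (λ x s w t → x ≼ s ⊕ w ⊖ 5 ⊙ t ⟹ w ⊕ # 3 ≼ 4 ⊙ t ⟹ x ⊕ # 3 ⊕ t ≼ s)
          (ρ-join L (λ s∈ → not-in (λ q → absurd∈ s∈ (∖ʳ {A = A} (wb q))))) (small φ W h)
    open Extension public using (extension)

    join-⊆ : S ⊆ A → W ⊆ A ∖ S → S ∪ W ⊆ A
    join-⊆ {S} sa wb h = [ sa , (λ q → ∖ˡ {A = A} (wb q)) ]′ (∪-elim {A = S} h)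

    outside : ∀ {s} → W ⊆ A ∖ S → s ∈ S → s ∉ W
    outside wb s∈ = not-in (λ q → absurd∈ s∈ (∖ʳ {A = A} (wb q)))

    -- If `W` sends no edge to `S`, it is low by itself. Otherwise the union has potential at most
    -- `ρ L S - 4`, which is below `μ`.
    gap₁ : ∀ {s r} → S ⊆ A → s ∈ S → r ∈ A → r ∉ S → ρ L S ≤ μ + + 3 → R
    gap₁ {S} sa s∈ r∈ r∉ h = extension sa s∈ r∈ r∉ λ φ W wb w∈ _ small joined →
      case dec≤ (Mu.D W S) 0ℤ of λ
        { (inj₁ t≤) → small-out (∖ˡ {A = A} ∘ wb) w∈ (lin (ρ L W ∷ Mu.D W S ∷ []) (λ w t → w ⊕ # 3 ≼ 4 ⊙ t ⟹ t ≼ # 0 ⟹ w ⊕ # 3 ≼ # 0) small t≤)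
        ; (inj₂ t≥) → low (join-⊆ sa wb) (∪ˡ {A = S} s∈) (lin (ρ L (S ∪ W) ∷ ρ L S ∷ Mu.D W S ∷ μ ∷ [])
            (λ x s t μ → x ⊕ # 3 ⊕ t ≼ s ⟹ s ≼ μ ⊕ # 3 ⟹ # 0 ⊕ # 1 ≼ t ⟹ x ⊕ # 1 ≼ μ) joined h t≥) }

    -- With at most one edge, `W` is a proper subset of potential at most 1, which `gap₁` excludes;
    -- with two edges the union falls to `ρ L S - 5`, again below `μ`.
    gap₂ : ∀ {s r} → S ⊆ A → s ∈ S → r ∈ A → r ∉ S → ρ L S ≤ μ + + 4 → R
    gap₂ {S} sa s∈ r∈ r∉ h = extension sa s∈ r∈ r∉ λ φ W wb w∈ _ small joined →
      case dec≤ (Mu.D W S) 1ℤ of λ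
        { (inj₁ t≤) → gap₁ (∖ˡ {A = A} ∘ wb) w∈ (sa s∈) (outside wb s∈) (lin (ρ L W ∷ Mu.D W S ∷ μ ∷ [])
            (λ w t μ → w ⊕ # 3 ≼ 4 ⊙ t ⟹ t ≼ # 1 ⟹ # 0 ≼ μ ⊕ # 2 ⟹ w ≼ μ ⊕ # 3) small t≤ μ≥)
        ; (inj₂ t≥) → low (join-⊆ sa wb) (∪ˡ {A = S} s∈) (lin (ρ L (S ∪ W) ∷ ρ L S ∷ Mu.D W S ∷ μ ∷ [])
            (λ x s t μ → x ⊕ # 3 ⊕ t ≼ s ⟹ s ≼ μ ⊕ # 4 ⟹ # 1 ⊕ # 1 ≼ t ⟹ x ⊕ # 1 ≼ μ) joined h t≥) }

    -- Proper subsets have potential at least `μ + 4`, hence at least 2. Forbidding one colour at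
    -- one vertex costs at most 4 and therefore cannot bring any of them down to -3.
    recolour : ∀ {r} u c → B ⊆ A → r ∈ A → r ∉ B → ((φ : Colouring L B) → (u ∈ B → col φ u ≢ c) → R) → R
    recolour {B} u c ba r∈ r∉ k = shrink L' B (λ {v} → sub v) ba r∈ r∉
      (λ φ → k (restrict (λ {v} _ → sub v) (λ x → x) φ) (λ u∈ eq → absurd∈ (subst (_∈ ⟨ c ⟩) (sym eq) ∈⟨⟩)
        (∖ʳ {A = L u} (subst (col φ u ∈_) (upd-at {L = L} {u}) (col∈ φ u∈)))))
      (λ W wb w∈ h → gap₁ (ba ∘ wb) w∈ r∈ (not-in (λ q → absurd∈ (wb q) r∉)) (lin (ρ L W ∷ ρ L' W ∷ μ ∷ [])
        (λ a b μ → a ≼ b ⊕ # 4 ⟹ b ⊕ # 3 ≼ # 0 ⟹ # 0 ≼ μ ⊕ # 2 ⟹ a ≼ μ ⊕ # 3)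
        (ρ-upd {L = L} (+ 4) (+≤+ ℕ.z≤n) drop) h μ≥))
      where
      L' : Lists
      L' = upd L u (L u ∖ ⟨ c ⟩)
      sub : ∀ v → L' v ⊆ L v
      sub = upd-⊆ {L = L} {u} (∖ˡ {A = L u})
      drop : p (L u) ≤ p (L u ∖ ⟨ c ⟩) + + 4
      drop = lin (p (L u) ∷ p (L u ∖ ⟨ c ⟩) ∷ ∣ L u ∣ ∷ ∣ L u ∖ ⟨ c ⟩ ∣ ∷ ∣ L u ∩ ⟨ c ⟩ ∣ ∷ ∣ ⟨ c ⟩ ∣ ∷ [])
        (λ a b l d i o → a ≼ b ⊕ 4 ⊙ (l ⊖ d) ⟹ l ≐ i ⊕ d ⟹ i ≼ o ⟹ o ≐ # 1 ⟹ a ≼ b ⊕ # 4)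
        (p-drop (∖ˡ {A = L u})) (card-split (L u) ⟨ c ⟩) (card-mono (∩ʳ {A = L u})) (card-point c)

    -- Such a vertex alone has potential at most 1, which `gap₁` excludes unless it is all of `A`.
    -- So every list may be assumed to have two or three colours.
    short-list : ∀ {v} → v ∈ A → ∣ L v ∣ ≤ 1ℤ → R
    short-list {v} v∈ h with ⊎-search A ⟨ v ⟩
    ... | inj₁ (r , r∈ , r∉) = gap₁ (⟨⟩-⊆ v∈) ∈⟨⟩ r∈ r∉ (lin (ρ L ⟨ v ⟩ ∷ p (L v) ∷ μ ∷ [])
            (λ a b μ → a ≐ b ⟹ b ≼ # 1 ⟹ # 0 ≼ μ ⊕ # 2 ⟹ a ≼ μ ⊕ # 3) (ρ-point L v) small μ≥)
      where
      small : p (L v) ≤ 1ℤ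
      small with cardView (L v)
      ... | full _ e q = ⊥-elim (lin (∣ L v ∣ ∷ []) (λ x → x ≼ # 1 ⟹ x ≐ # 3 ⟹ contra) h e)
      ... | two _ e q = ⊥-elim (lin (∣ L v ∣ ∷ []) (λ x → x ≼ # 1 ⟹ x ≐ # 2 ⟹ contra) h e)
      ... | one _ e q = ℤp.≤-reflexive q
      ... | none _ e q = subst (_≤ 1ℤ) (sym q) -≤+
    ... | inj₂ av with dec≤ ∣ L v ∣ 0ℤ
    ...   | inj₂ pos = let (c , c∈) = card-find pos in done (restrict (λ _ x → x) av (colourPoint {a = v} c∈))
    ...   | inj₁ z = small-out (⟨⟩-⊆ v∈) ∈⟨⟩ (lin (ρ L ⟨ v ⟩ ∷ p (L v) ∷ [])
            (λ a b → a ≐ b ⟹ b ⊕ # 3 ≼ # 0 ⟹ a ⊕ # 3 ≼ # 0) (ρ-point L v) small)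
      where
      small : p (L v) + + 3 ≤ 0ℤ
      small with cardView (L v)
      ... | full _ e q = ⊥-elim (lin (∣ L v ∣ ∷ []) (λ x → x ≼ # 0 ⟹ x ≐ # 3 ⟹ contra) z e)
      ... | two _ e q = ⊥-elim (lin (∣ L v ∣ ∷ []) (λ x → x ≼ # 0 ⟹ x ≐ # 2 ⟹ contra) z e)
      ... | one _ e q = ⊥-elim (lin (∣ L v ∣ ∷ []) (λ x → x ≼ # 0 ⟹ x ≐ # 1 ⟹ contra) z e)
      ... | none _ e q rewrite q = ℤp.≤-refl

    lists : ∀ {v} → v ∈ A → (Full (L v) → R) → (∣ L v ∣ ≡ + 2 → p (L v) ≡ + 4 → R) → R
    lists {v} v∈ k k' with cardView (L v)
    ... | full f _ _ = k f
    ... | two _ e q = k' e q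
    ... | one _ e _ = short-list v∈ (ℤp.≤-reflexive e)
    ... | none _ e _ = short-list v∈ (subst (_≤ 1ℤ) (sym e) (+≤+ ℕ.z≤n))

-- Gap lemmas

-- The goal `R` is a parameter. An impossible configuration is always expressed as a way to reach
-- `R`, so no minimal counterexample has to be assumed and refuted.
record State (n : ℕ) : Set₁ where
  field
    Γ    : Cover n
    L    : Covers.Lists Γ
    A    : VSet n
    R    : Set
    IH   : ∀ (Γ' : Cover n) L' B → ∣ B ∣ + 1ℤ ≤ ∣ A ∣ → Covers.Colouring Γ' L' B ⊎ Out Γ' L' B
    out  : Out Γ L A → R
    done : Covers.Colouring Γ L A → R
    μ    : ℤ
    μ≥   : 0ℤ ≤ μ + + 2
    low  : ∀ {B b} → B ⊆ A → b ∈ B → Covers.ρ Γ L B + 1ℤ ≤ μ → R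
  open Step Γ L A R IH out done hiding (module Gap) public
  open Step.Gap Γ L A R IH out done μ μ≥ low hiding (module Extension) public

module Gap₃ {n : ℕ} (st : State n) where
  open State st

  private
    variable
      S B W : VSet n

  -- If S sends exactly two edges to the rest W of A, they go to different vertices v₁, v₂ of W with full
  -- lists, and for a suitable colour of v₁ neither of two colourings of S that differ at x₂ clashes at v₁.
  module TwoEdges {S W s w} (sa : S ⊆ A) (s∈ : s ∈ S) (wb : W ⊆ A ∖ S) (w∈ : w ∈ W) (cover : A ⊆ S ∪ W)
                  (h : ρ L S ≤ μ + + 5) (t=2 : Mu.D W S ≡ + 2)
                  (φ : Colouring L S) (w-low : ρ (residual L S (col φ)) W + + 3 ≤ 0ℤ) where

    L° : Lists
    L° = residual L S (col φ)

    too-low : ρ L W ≤ + 4 → R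
    too-low q = low (join-⊆ sa wb) (∪ˡ {A = S} s∈) (lin (ρ L (S ∪ W) ∷ ρ L S ∷ ρ L W ∷ Mu.D W S ∷ μ ∷ [])
      (λ x s w t μ → x ≼ s ⊕ w ⊖ 5 ⊙ t ⟹ s ≼ μ ⊕ # 5 ⟹ w ≼ # 4 ⟹ t ≐ # 2 ⟹ x ⊕ # 1 ≼ μ)
      (ρ-join L (outside wb)) h q t=2)

    degSum : ∑S W (λ v → deg v S) ≡ + 2
    degSum = trans (sym (D-deg W S)) t=2

    degSum-without : ∀ v → v ∈ W → ∑S (W ∖ ⟨ v ⟩) (λ v → deg v S) ≡ + 2 - deg v S
    degSum-without v v∈ = lin
      (∑S W f ∷ ∑S (W ∩ ⟨ v ⟩) f ∷ ∑S (W ∖ ⟨ v ⟩) f ∷ ∑S ⟨ v ⟩ f ∷ deg v S ∷ [])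
      (λ a i d o x → a ≐ # 2 ⟹ a ≐ i ⊕ d ⟹ i ≐ o ⟹ o ≐ x ⟹ d ≐ # 2 ⊖ x)
      degSum (S-split W ⟨ v ⟩ f) (S-ext⊆ {A = W ∩ ⟨ v ⟩} {⟨ v ⟩} (∩ʳ {A = W}) (λ q → ∩-intro (⟨⟩-⊆ v∈ q) q)) (S-point v f)
      where
      f : Fin n → ℤ
      f v = deg v S

    -- All other vertices of `W` lose at most 4 for each of their `2 - deg v S` edges to `S`; the
    -- loss at `v` is kept as the parameter `d`, because a bound better than 4 per edge is available
    -- there.
    drop-one : ∀ v (d : ℤ) → v ∈ W → 0ℤ ≤ d → p (L v) ≤ p (L° v) + d → ρ L W ≤ ρ L° W + d + + 4 * (+ 2 - deg v S)
    drop-one v d v∈ d≥0 q = lin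
      (ρ L W ∷ ρ L° W ∷ ∑S W f ∷ ∑S (W ∩ ⟨ v ⟩) f ∷ ∑S (W ∖ ⟨ v ⟩) f ∷ ∑S ⟨ v ⟩ (λ _ → d) ∷ ∑S (W ∖ ⟨ v ⟩) (λ v → deg v S)
        ∷ ∑S (W ∖ ⟨ v ⟩) (λ v → + 4 * deg v S) ∷ d ∷ deg v S ∷ [])
      (λ a b s i e o g g4 d x → a ≼ b ⊕ s ⟹ s ≐ i ⊕ e ⟹ i ≼ o ⟹ o ≐ d ⟹ e ≼ g4 ⟹ g4 ≐ 4 ⊙ g ⟹ g ≐ # 2 ⊖ x ⟹
        a ≼ b ⊕ d ⊕ 4 ⊙ (# 2 ⊖ x))
      (ρ-diff {L = L} {L' = L°} f (λ {u} _ → lin (p (L u) ∷ p (L° u) ∷ []) (λ a b → a ≼ b ⊕ (a ⊖ b))))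
      (S-split W ⟨ v ⟩ f)
      (ℤp.≤-trans (S-mono {A = W ∩ ⟨ v ⟩} (λ {u} u∈ → subst (λ u → f u ≤ d) (sym (⟨⟩-elim (∩ʳ {A = W} u∈)))
          (lin (p (L v) ∷ p (L° v) ∷ d ∷ []) (λ a b d → a ≼ b ⊕ d ⟹ a ⊖ b ≼ d) q)))
        (S-⊆ {A = W ∩ ⟨ v ⟩} {⟨ v ⟩} (∩ʳ {A = W}) (λ _ → d≥0)))
      (S-point v (λ _ → d))
      (S-mono {A = W ∖ ⟨ v ⟩} (λ {u} _ → lin (p (L u) ∷ p (L° u) ∷ deg u S ∷ ∣ L u ∣ ∷ ∣ L° u ∣ ∷ [])
        (λ x y d l r → x ≼ y ⊕ 4 ⊙ (l ⊖ r) ⟹ l ≼ r ⊕ d ⟹ x ⊖ y ≼ 4 ⊙ d)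
        (p-drop (residual-⊆ {L})) (residual-card L S (col φ) u)))
      (S-* (W ∖ ⟨ v ⟩) (+ 4) (λ v → deg v S)) (degSum-without v v∈)
      where
      f : Fin n → ℤ
      f u = p (L u) - p (L° u)

    -- Losing two colours at the same vertex costs only 7, so `ρ L W` is at most 4, and the two
    -- edges then bring the union below `μ`.
    double : ∀ {v} → v ∈ W → 1ℤ + 1ℤ ≤ deg v S → R
    double {v} v∈ q = too-low (lin (ρ L W ∷ ρ L° W ∷ deg v S ∷ [])
      (λ a b x → a ≼ b ⊕ # 7 ⊕ 4 ⊙ (# 2 ⊖ x) ⟹ b ⊕ # 3 ≼ # 0 ⟹ # 2 ≼ x ⟹ a ≼ # 4)
      (drop-one v (+ 7) v∈ (+≤+ ℕ.z≤n) (p-drop₂ (residual-⊆ {L}) (lin (∣ L v ∣ ∷ ∣ L° v ∣ ∷ deg v S ∷ [])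
        (λ a b x → a ≼ b ⊕ x ⟹ x ≼ # 2 ⟹ a ≼ b ⊕ # 2) (residual-card L S (col φ) v)
        (subst (deg v S ≤_) degSum (S-term {A = W} v∈ (λ _ → deg≥0)))))) w-low q)

    -- A two-colour list that loses one colour falls from 4 to 1. The total loss is again 3 + 4 = 7
    -- instead of 8.
    full-end : ∀ {v} → v ∈ W → deg v S ≡ 1ℤ → (Full (L v) → R) → R
    full-end {v} v∈ d k = lists (∖ˡ {A = A} (wb v∈)) k λ c q → too-low (lin (ρ L W ∷ ρ L° W ∷ deg v S ∷ [])
      (λ a b x → a ≼ b ⊕ # 3 ⊕ 4 ⊙ (# 2 ⊖ x) ⟹ b ⊕ # 3 ≼ # 0 ⟹ x ≐ # 1 ⟹ a ≼ # 4)
      (drop-one v (+ 3) v∈ (+≤+ ℕ.z≤n) (drop3 c q)) w-low d)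
      where
      drop3 : ∣ L v ∣ ≡ + 2 → p (L v) ≡ + 4 → p (L v) ≤ p (L° v) + + 3
      drop3 c q with cardView (L° v)
      ... | full _ _ e = lin (p (L v) ∷ p (L° v) ∷ []) (λ a b → a ≐ # 4 ⟹ b ≐ # 8 ⟹ a ≼ b ⊕ # 3) q e
      ... | two _ _ e = lin (p (L v) ∷ p (L° v) ∷ []) (λ a b → a ≐ # 4 ⟹ b ≐ # 4 ⟹ a ≼ b ⊕ # 3) q e
      ... | one _ _ e = lin (p (L v) ∷ p (L° v) ∷ []) (λ a b → a ≐ # 4 ⟹ b ≐ # 1 ⟹ a ≼ b ⊕ # 3) q e
      ... | none _ e _ = ⊥-elim (lin (∣ L v ∣ ∷ ∣ L° v ∣ ∷ deg v S ∷ [])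
              (λ a b x → a ≼ b ⊕ x ⟹ x ≐ # 1 ⟹ a ≐ # 2 ⟹ b ≐ # 0 ⟹ contra) (residual-card L S (col φ) v) d c e)

    module Ends {v₁ v₂ x₁ x₂} (v₁∈ : v₁ ∈ W) (v₂∈ : v₂ ∈ W) (v≢ : v₂ ≢ v₁) (d₁ : deg v₁ S ≡ 1ℤ) (d₂ : deg v₂ S ≡ 1ℤ)
                (x₁∈ : x₁ ∈ S) (x₂∈ : x₂ ∈ S) (m₁ : 1ℤ ≤ + m v₁ x₁) (m₂ : 1ℤ ≤ + m v₂ x₂) (f₁ : Full (L v₁)) where

      v₁∉S : v₁ ∉ S
      v₁∉S = ∖ʳ {A = A} (wb v₁∈)
      v₁∈A : v₁ ∈ A
      v₁∈A = ∖ˡ {A = A} (wb v₁∈)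
      v₂∈A : v₂ ∈ A
      v₂∈A = ∖ˡ {A = A} (wb v₂∈)

      only : ∀ {v x s} → deg v S ≡ 1ℤ → x ∈ S → 1ℤ ≤ + m v x → s ∈ S → 1ℤ ≤ + m v s → s ≡ x
      only {v} {x} {s} d x∈ mx s∈ ms with s Finp.≟ x
      ... | yes eq = eq
      ... | no ne = ⊥-elim (lin (deg v S ∷ deg v (⟨ s ⟩ ∪ ⟨ x ⟩) ∷ deg v ⟨ s ⟩ ∷ deg v ⟨ x ⟩ ∷ + m v x ∷ + m v s ∷ [])
              (λ d u a b x s → d ≐ # 1 ⟹ u ≼ d ⟹ u ≐ a ⊕ b ⟹ a ≐ s ⟹ b ≐ x ⟹ # 1 ≼ x ⟹ # 1 ≼ s ⟹ contra)
              d (deg-⊆ (λ q → [ ⟨⟩-⊆ s∈ , ⟨⟩-⊆ x∈ ]′ (∪-elim {A = ⟨ s ⟩} q)))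
              (S-∪ (disjoint-⟨⟩ (∉⟨⟩ (ne ∘ sym))) (λ u → + m v u)) (S-point s _) (S-point x _) mx ms)

      no-other : ∀ {v s} → v ∈ W → v ≢ v₁ → v ≢ v₂ → s ∈ S → 1ℤ ≤ + m v s → ⊥
      no-other {v} {s} v∈ n₁ n₂ s∈ q = lin
        (∑S (W ∖ ⟨ v₁ ⟩) f ∷ ∑S (W ∖ ⟨ v₁ ⟩ ∖ ⟨ v₂ ⟩) f ∷ ∑S ((W ∖ ⟨ v₁ ⟩) ∩ ⟨ v₂ ⟩) f ∷ deg v₁ S ∷ deg v₂ S ∷ deg v S ∷ + m v s ∷ [])
        (λ a b i d₁ d₂ d x → a ≐ # 2 ⊖ d₁ ⟹ d₁ ≐ # 1 ⟹ d₂ ≐ # 1 ⟹ a ≐ i ⊕ b ⟹ d₂ ≼ i ⟹ d ≼ b ⟹ x ≼ d ⟹ # 1 ≼ x ⟹ contra)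
        (degSum-without v₁ v₁∈) d₁ d₂ (S-split (W ∖ ⟨ v₁ ⟩) ⟨ v₂ ⟩ f)
        (S-term {A = (W ∖ ⟨ v₁ ⟩) ∩ ⟨ v₂ ⟩} (∩-intro (∖-intro v₂∈ (∉⟨⟩ v≢)) ∈⟨⟩) (λ _ → deg≥0))
        (S-term {A = W ∖ ⟨ v₁ ⟩ ∖ ⟨ v₂ ⟩} (∖-intro (∖-intro v∈ (∉⟨⟩ n₁)) (∉⟨⟩ n₂)) (λ _ → deg≥0)) (deg-term s∈) q
        where
        f : Fin n → ℤ
        f v = deg v S

      merge : (φ : Colouring L S) (ψ : Colouring L (A ∖ S)) → col ψ v₁ ∉ M x₁ (col φ x₁) v₁ →
              col ψ v₂ ∉ M x₂ (col φ x₂) v₂ → R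
      merge φ ψ c₁ c₂ = done (restrict (λ _ c → c) cover (combine φ (outside wb) (record
        { col = col ψ
        ; col∈ = λ {v} v∈ → ∖-intro (col∈ ψ (wb v∈)) (not-in (λ q → clash v∈ (blocked-elim {S} q)))
        ; proper = λ u∈ v∈ → proper ψ (wb u∈) (wb v∈) })))
        where
        clash : ∀ {v} → v ∈ W → (∃[ s ] s ∈ S × col ψ v ∈ M s (col φ s) v) → ⊥
        clash {v} v∈ (s , s∈ , q) with v Finp.≟ v₁ | v Finp.≟ v₂
        ... | yes refl | _ with only d₁ x₁∈ m₁ s∈ (M-pos (M-sym q))
        ...   | refl = absurd∈ q c₁
        clash {v} v∈ (s , s∈ , q) | no _ | yes refl with only d₂ x₂∈ m₂ s∈ (M-pos (M-sym q))
        ...   | refl = absurd∈ q c₂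
        clash {v} v∈ (s , s∈ , q) | no n₁ | no n₂ = no-other v∈ n₁ n₂ s∈ (M-pos (M-sym q))

      simple : ∀ {v x} → deg v S ≡ 1ℤ → x ∈ S → + m x v ≤ 1ℤ
      simple {v} {x} d x∈ = subst (λ k → + k ≤ 1ℤ) (m-sym v x) (subst (+ m v x ≤_) d (deg-term x∈))

      -- Fixing the colour of a full list costs 7, so a set that becomes low had potential at most
      -- 4. If it contains both ends, its union with `S` is below `μ`; if it contains only `v₁`, the
      -- union has potential at most `μ + 4` and misses `v₂`, so `gap₂` applies.
      prescribe : ∀ c → ((ψ : Colouring L (A ∖ S)) → col ψ v₁ ≡ c → R) → R
      prescribe c k = shrink L₁ (A ∖ S) (λ {v} → sub v) (∖ˡ {A = A}) (sa s∈) (not-in (λ q → absurd∈ s∈ (∖ʳ {A = A} q)))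
        (λ ψ → k (restrict (λ {v} _ → sub v) (λ q → q) ψ)
          (⟨⟩-elim (subst (col ψ v₁ ∈_) (upd-at {L = L} {v₁}) (col∈ ψ (wb v₁∈)))))
        finish
        where
        L₁ : Lists
        L₁ = upd L v₁ ⟨ c ⟩
        sub : ∀ v → L₁ v ⊆ L v
        sub = upd-⊆ {L = L} {v₁} (λ _ → f₁)
        p-one : p ⟨ c ⟩ ≡ 1ℤ
        p-one with cardView ⟨ c ⟩
        ... | full _ e _ = ⊥-elim (lin (∣ ⟨ c ⟩ ∣ ∷ []) (λ x → x ≐ # 1 ⟹ x ≐ # 3 ⟹ contra) (card-point c) e)
        ... | two _ e _ = ⊥-elim (lin (∣ ⟨ c ⟩ ∣ ∷ []) (λ x → x ≐ # 1 ⟹ x ≐ # 2 ⟹ contra) (card-point c) e)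
        ... | one _ _ q = q
        ... | none _ e _ = ⊥-elim (lin (∣ ⟨ c ⟩ ∣ ∷ []) (λ x → x ≐ # 1 ⟹ x ≐ # 0 ⟹ contra) (card-point c) e)
        finish : ∀ W' {w} → W' ⊆ A ∖ S → w ∈ W' → ρ L₁ W' + + 3 ≤ 0ℤ → R
        finish W' {w} wb' w∈' q with dec∈ v₁ W'
        ... | inj₂ v∉ = small-out (∖ˡ {A = A} ∘ wb') w∈' (subst (λ t → t + + 3 ≤ 0ℤ) (ρ-upd-off {L = L} v∉) q)
        ... | inj₁ v₁∈' with dec∈ v₂ W'
        ...   | inj₂ v₂∉ = gap₂ (join-⊆ sa wb') (∪ˡ {A = S} s∈) v₂∈A (not-in (λ q → [ (λ s → absurd∈ s (∖ʳ {A = A} (wb v₂∈))) , (λ w → absurd∈ w v₂∉) ]′ (∪-elim {A = S} q)))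
              (lin (ρ L (S ∪ W') ∷ ρ L S ∷ ρ L W' ∷ ρ L₁ W' ∷ Mu.D W' S ∷ deg v₁ S ∷ μ ∷ [])
                (λ x s w w₁ t d μ → x ≼ s ⊕ w ⊖ 5 ⊙ t ⟹ s ≼ μ ⊕ # 5 ⟹ w ≼ w₁ ⊕ # 7 ⟹ w₁ ⊕ # 3 ≼ # 0 ⟹ d ≼ t ⟹ d ≐ # 1 ⟹ x ≼ μ ⊕ # 4)
                (ρ-join L (outside wb')) h raise q dt d₁)
          where
          raise : ρ L W' ≤ ρ L₁ W' + + 7
          raise = ρ-upd {L = L} (+ 7) (+≤+ ℕ.z≤n) (subst (λ t → p (L v₁) ≤ t + + 7) (sym p-one) (p≤8 (L v₁)))
          dt : deg v₁ S ≤ Mu.D W' S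
          dt = subst (deg v₁ S ≤_) (sym (D-deg W' S)) (S-term {A = W'} v₁∈' (λ _ → deg≥0))
        ...   | inj₁ v₂∈' = low (join-⊆ sa wb') (∪ˡ {A = S} s∈)
              (lin (ρ L (S ∪ W') ∷ ρ L S ∷ ρ L W' ∷ ρ L₁ W' ∷ Mu.D W' S ∷ deg v₁ S ∷ deg v₂ S ∷ ∑S W' f ∷ ∑S (W' ∩ ⟨ v₁ ⟩) f ∷ ∑S (W' ∖ ⟨ v₁ ⟩) f ∷ μ ∷ [])
                (λ x s w w₁ t d d' u i e μ → x ≼ s ⊕ w ⊖ 5 ⊙ t ⟹ s ≼ μ ⊕ # 5 ⟹ w ≼ w₁ ⊕ # 7 ⟹ w₁ ⊕ # 3 ≼ # 0 ⟹ t ≐ u ⟹ u ≐ i ⊕ e ⟹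
                   d ≼ i ⟹ d' ≼ e ⟹ d ≐ # 1 ⟹ d' ≐ # 1 ⟹ x ⊕ # 1 ≼ μ)
                (ρ-join L (outside wb')) h (ρ-upd {L = L} (+ 7) (+≤+ ℕ.z≤n) (subst (λ t → p (L v₁) ≤ t + + 7) (sym p-one) (p≤8 (L v₁)))) q
                (D-deg W' S) (S-split W' ⟨ v₁ ⟩ f)
                (S-term {A = W' ∩ ⟨ v₁ ⟩} (∩-intro v₁∈' ∈⟨⟩) (λ _ → deg≥0)) (S-term {A = W' ∖ ⟨ v₁ ⟩} (∖-intro v₂∈' (∉⟨⟩ v≢)) (λ _ → deg≥0)) d₁ d₂)
          where
          f : Fin n → ℤ
          f v = deg v S

      contradiction : R
      contradiction = recolour x₂ (col φ x₂) sa v₁∈A v₁∉S λ φ' differ →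
        let (c , c∉ , c∉') = avoid (M x₁ (col φ x₁) v₁) (M x₁ (col φ' x₁) v₁)
                               (ℤp.≤-trans (M-deg _ _ _) (simple d₁ x₁∈)) (ℤp.≤-trans (M-deg _ _ _) (simple d₁ x₁∈))
        in prescribe c λ ψ eq → final φ' differ ψ (subst (_∉ M x₁ (col φ x₁) v₁) (sym eq) c∉)
                                                   (subst (_∉ M x₁ (col φ' x₁) v₁) (sym eq) c∉')
        where
        final : ∀ (φ' : Colouring L S) (differ : x₂ ∈ S → col φ' x₂ ≢ col φ x₂) (ψ : Colouring L (A ∖ S)) →
                col ψ v₁ ∉ M x₁ (col φ x₁) v₁ → col ψ v₁ ∉ M x₁ (col φ' x₁) v₁ → R
        final φ' differ ψ c∉ c∉' with dec∈ (col ψ v₂) (M x₂ (col φ x₂) v₂) | dec∈ (col ψ v₂) (M x₂ (col φ' x₂) v₂)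
        ... | inj₂ a | _ = merge φ ψ c∉ a
        ... | inj₁ _ | inj₂ b = merge φ' ψ c∉' b
        ... | inj₁ a | inj₁ b = ⊥-elim (differ x₂∈ (card≤1-unique
                (ℤp.≤-trans (M-deg v₂ (col ψ v₂) x₂) (subst (+ m v₂ x₂ ≤_) d₂ (deg-term x₂∈))) (M-sym b) (M-sym a)))

    resolve : R
    resolve with search W {λ v → 1ℤ + 1ℤ ≤ deg v S} {λ v → deg v S ≤ 1ℤ} (λ v → [ inj₂ , inj₁ ]′ (dec≤ (deg v S) 1ℤ))
    ... | inj₁ (v , v∈ , q) = double v∈ q
    ... | inj₂ at≤1 =
      let (v₁ , v₁∈ , p₁) = S-find {A = W} {λ v → deg v S} (subst (1ℤ ≤_) (sym degSum) (+≤+ (ℕ.s≤s ℕ.z≤n)))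
          d₁ = ℤp.≤-antisym (at≤1 v₁∈) p₁
          (v₂ , v₂∈ , p₂) = S-find {A = W ∖ ⟨ v₁ ⟩} {λ v → deg v S} (lin (∑S (W ∖ ⟨ v₁ ⟩) (λ v → deg v S) ∷ deg v₁ S ∷ [])
            (λ s d → s ≐ # 2 ⊖ d ⟹ d ≐ # 1 ⟹ # 1 ≼ s) (degSum-without v₁ v₁∈) d₁)
          v₂∈W = ∖ˡ {A = W} v₂∈
          d₂ = ℤp.≤-antisym (at≤1 v₂∈W) p₂
          (x₁ , x₁∈ , m₁) = S-find {A = S} p₁
          (x₂ , x₂∈ , m₂) = S-find {A = S} p₂
      in full-end v₁∈ d₁ λ f₁ →
           Ends.contradiction v₁∈ v₂∈W (∉⟨⟩-elim (∖ʳ {A = W} v₂∈)) d₁ d₂ x₁∈ x₂∈ m₁ m₂ f₁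

  -- Counting settles every case but one: exactly two edges between `S` and `W`, with nothing left
  -- outside the union. There the union has potential at most `μ`, one too much for `low`, and two
  -- colourings of `S` have to be compared.
  gap₃ : ∀ {s r} → S ⊆ A → s ∈ S → r ∈ A → r ∉ S → ρ L S ≤ μ + + 5 → R
  gap₃ {S} sa s∈ r∈ r∉ h = extension sa s∈ r∈ r∉ λ φ W wb w∈ low-W small joined →
    case dec≤ (Mu.D W S) 1ℤ of λ
      { (inj₁ t≤) → gap₁ (∖ˡ {A = A} ∘ wb) w∈ (sa s∈) (outside wb s∈) (lin (ρ L W ∷ Mu.D W S ∷ μ ∷ [])
          (λ w t μ → w ⊕ # 3 ≼ 4 ⊙ t ⟹ t ≼ # 1 ⟹ # 0 ≼ μ ⊕ # 2 ⟹ w ≼ μ ⊕ # 3) small t≤ μ≥)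
      ; (inj₂ t≥) → case dec≤ (Mu.D W S) (+ 2) of λ
          { (inj₂ t≥3) → low (join-⊆ sa wb) (∪ˡ {A = S} s∈) (lin (ρ L (S ∪ W) ∷ ρ L S ∷ Mu.D W S ∷ μ ∷ [])
              (λ x s t μ → x ⊕ # 3 ⊕ t ≼ s ⟹ s ≼ μ ⊕ # 5 ⟹ # 3 ≼ t ⟹ x ⊕ # 1 ≼ μ) joined h t≥3)
          ; (inj₁ t≤2) → case ⊎-search A (S ∪ W) of λ
              { (inj₁ (r , r∈ , r∉)) → gap₁ (join-⊆ sa wb) (∪ˡ {A = S} s∈) r∈ r∉ (lin (ρ L (S ∪ W) ∷ ρ L S ∷ Mu.D W S ∷ μ ∷ [])
                  (λ x s t μ → x ⊕ # 3 ⊕ t ≼ s ⟹ s ≼ μ ⊕ # 5 ⟹ # 2 ≼ t ⟹ x ≼ μ ⊕ # 3) joined h t≥)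
              ; (inj₂ cover) → TwoEdges.resolve sa s∈ wb w∈ cover h (ℤp.≤-antisym t≤2 t≥) φ low-W } } }

-- Adding an edge

opaque
  unfolding ∑
  ∑-one : ∀ k → ∑ {k} (λ _ → 1ℤ) ≡ + k
  ∑-one zero = refl
  ∑-one (suc k) = cong (λ t → 1ℤ + t) (∑-one k)

opaque
  unfolding ∑S
  S-reindex : ∀ {n k} {B : VSet n} (θ : Fin k → Fin n) → (∀ {i j} → θ i ≡ θ j → i ≡ j) → (∀ i → θ i ∈ B) →
              (∀ {v} → v ∈ B → ∃[ i ] θ i ≡ v) → ∀ f → ∑S B f ≡ ∑ (λ i → f (θ i))
  S-reindex {n} {k} {B} θ inj θ∈ onto f = sym (begin
    ∑ (λ i → f (θ i)) ≡⟨ ∑-cong (λ i → sym (∑-point (θ i) f)) ⟩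
    ∑ (λ i → ∑ (λ v → (v ≡ᵇ θ i) ▹ f v)) ≡⟨ ∑-swap _ ⟩
    ∑ (λ v → ∑ (λ i → (v ≡ᵇ θ i) ▹ f v)) ≡⟨ ∑-cong inner ⟩
    ∑S B f ∎)
    where
    open ≡-Reasoning
    inner : ∀ v → ∑ (λ i → (v ≡ᵇ θ i) ▹ f v) ≡ B v ▹ f v
    inner v with dec∈ v B
    ... | inj₂ v∉ rewrite un∉ v∉ = trans (∑-cong (λ i → ▹-false (f v) (≡ᵇ-≢ (λ eq → absurd∈ (subst (_∈ B) (sym eq) (θ∈ i)) v∉)))) (∑-zero {k})
    ... | inj₁ v∈ with onto v∈
    ...   | i₀ , refl rewrite un∈ (θ∈ i₀) = trans (∑-cong same) (∑-point i₀ (λ _ → f (θ i₀)))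
      where
      same : ∀ i → (θ i₀ ≡ᵇ θ i) ▹ f (θ i₀) ≡ (i ≡ᵇ i₀) ▹ f (θ i₀)
      same i with i Finp.≟ i₀
      ... | yes refl = ▹-true _ (≡ᵇ-refl (θ i))
      ... | no ne = ▹-false _ (≡ᵇ-≢ (λ eq → ne (sym (inj eq))))

module ExceptionalBounds {n : ℕ} {Γ : Cover n} {B : VSet n} (x : Exceptional Γ B) where
  open Exceptional x public
  open Potentials Γ

  private
    k : ℕ
    k = Graph.n G₀

  adjacencies : ℤ
  adjacencies = ∑ (λ i → ∑ (λ j → χ (adj G₀ i j)))

  exc-card : ∣ B ∣ ≡ + k
  exc-card = trans (card-sum B) (trans (S-reindex θ θ-inj θ∈ θ-onto (λ _ → 1ℤ)) (∑-one k))

  χ≤cost : ∀ i j → + 5 * χ (adj G₀ i j) ≤ cost (m (θ i) (θ j))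
  χ≤cost i j with adj G₀ i j in eq
  ... | false = cost≥0 (m (θ i) (θ j))
  ... | true = lin (+ m (θ i) (θ j) ∷ cost (m (θ i) (θ j)) ∷ []) (λ x c → # 1 ≼ x ⟹ 5 ⊙ x ≼ c ⟹ # 5 ≼ c) (θ-adj eq) (cost≥5m (m (θ i) (θ j)))

  row-cost : ∀ i → + 5 * ∑ (λ j → χ (adj G₀ i j)) ≤ ∑S B (λ v → cost (m (θ i) v))
  row-cost i = begin
    + 5 * ∑ (λ j → χ (adj G₀ i j)) ≡⟨ sym (∑-* (+ 5) _) ⟩
    ∑ (λ j → + 5 * χ (adj G₀ i j)) ≤⟨ ∑-mono (χ≤cost i) ⟩
    ∑ (λ j → cost (m (θ i) (θ j))) ≡⟨ sym (S-reindex θ θ-inj θ∈ θ-onto _) ⟩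
    ∑S B (λ v → cost (m (θ i) v)) ∎
    where open ℤp.≤-Reasoning

  exc-row : ∀ {v} → v ∈ B → + 15 ≤ ∑S B (λ u → cost (m v u))
  exc-row v∈ with θ-onto v∈
  ... | i , refl = lin (∑ (λ j → χ (adj G₀ i j)) ∷ ∑S B (λ v → cost (m (θ i) v)) ∷ [])
    (λ r c → # 3 ≼ r ⟹ 5 ⊙ r ≼ c ⟹ # 15 ≼ c) (rows i) (row-cost i)

  exc-D : + 5 * adjacencies ≤ Co.D B B
  exc-D = begin
    + 5 * adjacencies ≡⟨ sym (∑-* (+ 5) _) ⟩
    ∑ (λ i → + 5 * ∑ (λ j → χ (adj G₀ i j))) ≤⟨ ∑-mono row-cost ⟩
    ∑ (λ i → ∑S B (λ v → cost (m (θ i) v))) ≡⟨ sym (S-reindex θ θ-inj θ∈ θ-onto _) ⟩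
    ∑S B (λ u → ∑S B (λ v → cost (m u v))) ≡⟨ sym D-def ⟩
    Co.D B B ∎
    where
    open ℤp.≤-Reasoning
    opaque
      unfolding Co.D
      D-def : Co.D B B ≡ ∑S B (λ u → ∑S B (λ v → cost (m u v)))
      D-def = refl

  -- With full lists this reads `3 ρ ≤ 10 - |B|`, from the (5n - 2)/3 edges of a 4-Ore graph. The
  -- first term on the right is what shorter lists take away.
  exc-ρ : ∀ L → (+ 3 * ρ L B) ≤ + 3 * (∑S B (λ v → p (L v)) - + 8 * ∣ B ∣) + + 10 - ∣ B ∣
  exc-ρ L = lin (ρ L B ∷ ∑S B (λ v → p (L v)) ∷ Co.e B ∷ Co.D B B ∷ adjacencies ∷ ∣ B ∣ ∷ + k ∷ [])
    (λ r s e d a b k → r ≐ s ⊖ e ⟹ 2 ⊙ e ≐ d ⟹ 5 ⊙ a ≼ d ⟹ 3 ⊙ a ≐ 10 ⊙ k ⊖ # 4 ⟹ b ≐ k ⟹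
      3 ⊙ r ≼ 3 ⊙ (s ⊖ 8 ⊙ b) ⊕ # 10 ⊖ b)
    refl (Co.e-double B) exc-D edges exc-card

module _ {n : ℕ} {L : Fin n → VSet 3} {B : VSet n} where
  sum-p≤ : ∑S B (λ v → p (L v)) ≤ + 8 * ∣ B ∣
  sum-p≤ = subst (∑S B (λ v → p (L v)) ≤_) (trans (S-* B (+ 8) (λ _ → 1ℤ)) (cong (λ t → + 8 * t) (sym (card-sum B))))
    (S-mono {A = B} (λ {v} _ → p≤8 (L v)))

  sum-p-short : ∀ {v} → v ∈ B → p (L v) ≤ + 4 → ∑S B (λ v → p (L v)) + + 4 ≤ + 8 * ∣ B ∣
  sum-p-short {v} v∈ h = lin
    (∑S B f ∷ ∑S B (λ u → + 8 - f u) ∷ ∑S B (λ u → f u + (+ 8 - f u)) ∷ + 8 * ∣ B ∣ ∷ p (L v) ∷ [])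
    (λ a b s t x → s ≐ a ⊕ b ⟹ s ≐ t ⟹ # 8 ⊖ x ≼ b ⟹ x ≼ # 4 ⟹ a ⊕ # 4 ≼ t)
    (S-+ B f (λ u → + 8 - f u))
    (trans (S-cong {A = B} {f = λ u → f u + (+ 8 - f u)} {g = λ _ → + 8 * 1ℤ} (λ {u} _ → lin (f u ∷ []) (λ x → x ⊕ (# 8 ⊖ x) ≐ # 8)))
      (trans (S-* B (+ 8) (λ _ → 1ℤ)) (cong (λ t → + 8 * t) (sym (card-sum B)))))
    (S-term {A = B} {f = λ u → + 8 - f u} v∈ (λ {u} _ → lin (f u ∷ []) (λ x → x ≼ # 8 ⟹ # 0 ≼ # 8 ⊖ x) (p≤8 (L u)))) h
    where
    f : Fin n → ℤ
    f v = p (L v)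

record Permutation : Set where
  field
    to from : Colour → Colour
    from-to : ∀ c → from (to c) ≡ c
    to-from : ∀ c → to (from c) ≡ c

module AddEdge {n : ℕ} (Γ : Cover n) (y y' : Fin n) (y≢y' : y ≢ y') (π : Permutation) where
  open Permutation π
  open Cover Γ

  data Which : Set where
    forth back neither : Which

  which : Fin n → Fin n → Which
  which u v with u Finp.≟ y | v Finp.≟ y' | u Finp.≟ y' | v Finp.≟ y
  ... | yes _ | yes _ | _ | _ = forth
  ... | _ | _ | yes _ | yes _ = back
  ... | _ | _ | _ | _ = neither

  extra : Which → ℕ
  extra neither = 0
  extra _ = 1

  extraM : Which → Colour → VSet 3
  extraM forth c = ⟨ to c ⟩
  extraM back c = ⟨ from c ⟩
  extraM neither c = λ _ → false

  flip : Which → Which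
  flip forth = back
  flip back = forth
  flip neither = neither

  which-flip : ∀ u v → which v u ≡ flip (which u v)
  which-flip u v with u Finp.≟ y | v Finp.≟ y' | u Finp.≟ y' | v Finp.≟ y
  ... | yes refl | yes refl | yes eq | _ = ⊥-elim (y≢y' eq)
  ... | yes refl | yes refl | no _ | yes eq = ⊥-elim (y≢y' (sym eq))
  ... | yes refl | yes refl | no _ | no _ = refl
  ... | yes refl | no _ | yes eq | _ = ⊥-elim (y≢y' eq)
  ... | yes refl | no _ | no _ | yes _ = refl
  ... | yes refl | no _ | no _ | no _ = refl
  ... | no _ | yes refl | yes _ | yes eq = ⊥-elim (y≢y' (sym eq))
  ... | no _ | yes refl | yes _ | no _ = refl
  ... | no _ | yes refl | no _ | yes eq = ⊥-elim (y≢y' (sym eq))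
  ... | no _ | yes refl | no _ | no _ = refl
  ... | no _ | no _ | yes _ | yes _ = refl
  ... | no _ | no _ | yes _ | no _ = refl
  ... | no _ | no _ | no _ | yes _ = refl
  ... | no _ | no _ | no _ | no _ = refl

  extra-flip : ∀ w → extra (flip w) ≡ extra w
  extra-flip forth = refl
  extra-flip back = refl
  extra-flip neither = refl

  which-forth : which y y' ≡ forth
  which-forth with y Finp.≟ y | y' Finp.≟ y'
  ... | yes _ | yes _ = refl
  ... | no ne | _ = ⊥-elim (ne refl)
  ... | yes _ | no ne = ⊥-elim (ne refl)

  which-case : ∀ u v → (which u v ≡ neither) ⊎ ((u ≡ y) × (v ≡ y')) ⊎ ((u ≡ y') × (v ≡ y))
  which-case u v with u Finp.≟ y | v Finp.≟ y' | u Finp.≟ y' | v Finp.≟ y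
  ... | yes a | yes b | _ | _ = inj₂ (inj₁ (a , b))
  ... | yes _ | no _ | yes a | yes b = inj₂ (inj₂ (a , b))
  ... | no _ | _ | yes a | yes b = inj₂ (inj₂ (a , b))
  ... | yes _ | no _ | yes _ | no _ = inj₁ refl
  ... | yes _ | no _ | no _ | _ = inj₁ refl
  ... | no _ | _ | yes _ | no _ = inj₁ refl
  ... | no _ | _ | no _ | _ = inj₁ refl

  Γ⁺ : Cover n
  Γ⁺ = record
    { m = λ u v → m u v ℕ.+ extra (which u v)
    ; m-sym = λ u v → cong₂ ℕ._+_ (m-sym u v) (sym (trans (cong extra (which-flip u v)) (extra-flip (which u v))))
    ; m-irr = λ v → trans (cong (ℕ._+ extra (which v v)) (m-irr v)) (irr v)
    ; M = λ u c v → M u c v ∪ extraM (which u v) c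
    ; M-sym = λ {u} {c} {v} {d} h → [ (λ q → ∪ˡ {A = M v d u} (M-sym q)) , (λ q → ∪ʳ {A = M v d u} (flipM u c v d q)) ]′ (∪-elim {A = M u c v} h)
    ; M-deg = degree }
    where
    irr : ∀ v → extra (which v v) ≡ 0
    irr v with which-case v v
    ... | inj₁ e = cong extra e
    ... | inj₂ (inj₁ (a , b)) = ⊥-elim (y≢y' (trans (sym a) b))
    ... | inj₂ (inj₂ (a , b)) = ⊥-elim (y≢y' (trans (sym b) a))
    flipM′ : ∀ w c d → d ∈ extraM w c → c ∈ extraM (flip w) d
    flipM′ forth c d h = subst (_∈ ⟨ from d ⟩) (trans (cong from (⟨⟩-elim h)) (from-to c)) ∈⟨⟩
    flipM′ back c d h = subst (_∈ ⟨ to d ⟩) (trans (cong to (⟨⟩-elim h)) (to-from c)) ∈⟨⟩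
    flipM′ neither c d (mk∈ ())
    flipM : ∀ u c v d → d ∈ extraM (which u v) c → c ∈ extraM (which v u) d
    flipM u c v d h = subst (λ w → c ∈ extraM w d) (sym (which-flip u v)) (flipM′ (which u v) c d h)
    extra-card : ∀ w c → ∣ extraM w c ∣ ≤ + extra w
    extra-card forth c = ℤp.≤-reflexive (card-point (to c))
    extra-card back c = ℤp.≤-reflexive (card-point (from c))
    extra-card neither c = ℤp.≤-reflexive (trans (card₃ (λ _ → false)) refl)
    degree : ∀ u c v → ∣ M u c v ∪ extraM (which u v) c ∣ ≤ + (m u v ℕ.+ extra (which u v))
    degree u c v = lin (∣ X ∪ Y ∣ ∷ ∣ X ∣ ∷ ∣ Y ∣ ∷ + m u v ∷ + extra (which u v) ∷ + (m u v ℕ.+ extra (which u v)) ∷ [])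
      (λ u x y a b s → u ≼ x ⊕ y ⟹ x ≼ a ⟹ y ≼ b ⟹ s ≐ a ⊕ b ⟹ u ≼ s)
      (card-∪≤ X Y) (M-deg u c v) (extra-card (which u v) c) refl
      where
      X Y : VSet 3
      X = M u c v
      Y = extraM (which u v) c

  module P = Potentials Γ
  module P⁺ = Potentials Γ⁺

  -- Indicator of the two ordered pairs formed by `y` and `y'`; it bounds the added multiplicity and
  -- is easy to sum over a square.
  κ : Fin n → Fin n → ℤ
  κ u v = ⟨ y ⟩ u ▹ ⟨ y' ⟩ v ▹ 1ℤ + ⟨ y' ⟩ u ▹ ⟨ y ⟩ v ▹ 1ℤ

  extra≤κ : ∀ u v → + extra (which u v) ≤ κ u v
  extra≤κ u v with which-case u v
  ... | inj₁ e rewrite e = ℤp.+-mono-≤ (nn (u ≡ᵇ y) (v ≡ᵇ y')) (nn (u ≡ᵇ y') (v ≡ᵇ y))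
    where
    nn : ∀ a b → 0ℤ ≤ a ▹ b ▹ 1ℤ
    nn true true = +≤+ ℕ.z≤n
    nn true false = ℤp.≤-refl
    nn false _ = ℤp.≤-refl
  ... | inj₂ (inj₁ (refl , refl)) rewrite which-forth | ≡ᵇ-refl y | ≡ᵇ-refl y' | ≡ᵇ-≢ y≢y' = ℤp.≤-refl
  ... | inj₂ (inj₂ (refl , refl)) rewrite which-flip y y' | which-forth | ≡ᵇ-refl y | ≡ᵇ-refl y' | ≡ᵇ-≢ (y≢y' ∘ sym) = ℤp.≤-refl

  κ-total : ∀ W → ∑S W (λ u → ∑S W (κ u)) ≤ + 2
  κ-total W = lin (∑S W (λ u → ∑S W (κ u)) ∷ half y y' ∷ half y' y ∷ [])
    (λ s a b → s ≐ a ⊕ b ⟹ a ≼ # 1 ⟹ b ≼ # 1 ⟹ s ≼ # 2)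
    (trans (S-cong {A = W} (λ {u} _ → S-+ W (λ v → ⟨ y ⟩ u ▹ ⟨ y' ⟩ v ▹ 1ℤ) (λ v → ⟨ y' ⟩ u ▹ ⟨ y ⟩ v ▹ 1ℤ))) (S-+ W _ _))
    (half≤ y y') (half≤ y' y)
    where
    half : Fin n → Fin n → ℤ
    half a b = ∑S W (λ u → ∑S W (λ v → ⟨ a ⟩ u ▹ ⟨ b ⟩ v ▹ 1ℤ))
    inner≤ : ∀ b → ∑S W (λ v → ⟨ b ⟩ v ▹ 1ℤ) ≤ 1ℤ
    inner≤ b = ℤp.≤-trans (ℤp.≤-reflexive (trans (S-▹ W ⟨ b ⟩ (λ _ → 1ℤ)) (sym (card-sum (W ∩ ⟨ b ⟩)))))
      (subst (∣ W ∩ ⟨ b ⟩ ∣ ≤_) (card-point b) (card-mono (∩ʳ {A = W})))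
    pull : ∀ x b → ∑S W (λ v → x ▹ ⟨ b ⟩ v ▹ 1ℤ) ≤ x ▹ 1ℤ
    pull true b = inner≤ b
    pull false b = ℤp.≤-reflexive (S-zero {A = W})
    half≤ : ∀ a b → half a b ≤ 1ℤ
    half≤ a b = ℤp.≤-trans (S-mono {A = W} (λ {u} _ → pull (u ≡ᵇ a) b)) (inner≤ a)

  -- `δ` is the price of the new edge: 6 in general, 5 if it is the first edge between its ends. The
  -- square counts it twice, as `e-double` does.
  cost⁺ : ∀ δ → (∀ u v → cost (m u v ℕ.+ extra (which u v)) ≤ cost (m u v) + + δ * + extra (which u v)) → ∀ L W →
          P.ρ L W ≤ P⁺.ρ L W + + δ
  cost⁺ δ h L W = lin (∑S W (λ v → p (L v)) ∷ P.Co.e W ∷ P⁺.Co.e W ∷ P.Co.D W W ∷ P⁺.Co.D W W ∷ + δ * ∑S W (λ u → ∑S W (κ u)) ∷ + δ ∷ [])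
    (λ s e e⁺ d d⁺ k δ → 2 ⊙ e ≐ d ⟹ 2 ⊙ e⁺ ≐ d⁺ ⟹ d⁺ ≼ d ⊕ k ⟹ k ≼ 2 ⊙ δ ⟹ s ⊖ e ≼ s ⊖ e⁺ ⊕ δ)
    (P.Co.e-double W) (P⁺.Co.e-double W) D≤
    (ℤp.≤-trans (ℤp.*-monoˡ-≤-nonNeg (+ δ) (κ-total W)) (ℤp.≤-reflexive (ℤp.*-comm (+ δ) (+ 2))))
    where
    opaque
      unfolding Weights.D
      D≤ : P⁺.Co.D W W ≤ P.Co.D W W + + δ * ∑S W (λ u → ∑S W (κ u))
      D≤ = subst (P⁺.Co.D W W ≤_)
        (trans (S-cong {A = W} (λ {u} _ → trans (S-+ W (λ v → cost (m u v)) (λ v → + δ * κ u v)) (cong (λ t → ∑S W (λ v → cost (m u v)) + t) (S-* W (+ δ) (κ u)))))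
          (trans (S-+ W (λ u → ∑S W (λ v → cost (m u v))) (λ u → + δ * ∑S W (κ u))) (cong (λ t → P.Co.D W W + t) (S-* W (+ δ) (λ u → ∑S W (κ u))))))
        (S-mono {A = W} (λ {u} _ → S-mono {A = W} (λ {v} _ → ℤp.≤-trans (h u v) (ℤp.+-monoʳ-≤ (cost (m u v)) (ℤp.*-monoˡ-≤-nonNeg (+ δ) (extra≤κ u v))))))

  plus6 : ∀ L W → P.ρ L W ≤ P⁺.ρ L W + + 6
  plus6 = cost⁺ 6 (λ u v → go (m u v) (which u v))
    where
    go : ∀ k w → cost (k ℕ.+ extra w) ≤ cost k + + 6 * + extra w
    go zero forth = +≤+ (ℕ.s≤s (ℕ.s≤s (ℕ.s≤s (ℕ.s≤s (ℕ.s≤s ℕ.z≤n)))))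
    go zero back = go zero forth
    go zero neither = ℤp.≤-refl
    go (suc k) forth = lin (+ (suc k ℕ.+ 1) ∷ + suc k ∷ []) (λ s k → s ≐ k ⊕ # 1 ⟹ 6 ⊙ s ⊖ # 1 ≼ 6 ⊙ k ⊖ # 1 ⊕ # 6) refl
    go (suc k) back = go (suc k) forth
    go (suc k) neither = lin (+ (suc k ℕ.+ 0) ∷ + suc k ∷ []) (λ s k → s ≐ k ⊕ # 0 ⟹ 6 ⊙ s ⊖ # 1 ≼ 6 ⊙ k ⊖ # 1 ⊕ # 0) refl

  plus5 : m y y' ≡ 0 → ∀ L W → P.ρ L W ≤ P⁺.ρ L W + + 5
  plus5 z = cost⁺ 5 go
    where
    go : ∀ u v → cost (m u v ℕ.+ extra (which u v)) ≤ cost (m u v) + + 5 * + extra (which u v)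
    go u v with which-case u v
    ... | inj₁ e rewrite e = ℤp.≤-reflexive (trans (cong cost (ℕp.+-identityʳ (m u v))) (sym (ℤp.+-identityʳ _)))
    ... | inj₂ (inj₁ (refl , refl)) rewrite which-forth | z = ℤp.≤-refl
    ... | inj₂ (inj₂ (refl , refl)) rewrite which-flip y y' | which-forth | m-sym y' y | z = ℤp.≤-refl

  Misses : VSet n → Set
  Misses W = (y ∉ W) ⊎ (y' ∉ W)

  which-misses : ∀ {W u v} → Misses W → u ∈ W → v ∈ W → which u v ≡ neither
  which-misses {W} {u} {v} miss u∈ v∈ with which-case u v
  ... | inj₁ e = e
  ... | inj₂ (inj₁ (refl , refl)) = [ absurd∈ u∈ , absurd∈ v∈ ]′ miss
  ... | inj₂ (inj₂ (refl , refl)) = [ absurd∈ v∈ , absurd∈ u∈ ]′ miss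

  m-off : ∀ {u v} → which u v ≡ neither → m u v ℕ.+ extra (which u v) ≡ m u v
  m-off {u} {v} e rewrite e = ℕp.+-identityʳ (m u v)

  ρ-misses : ∀ L W → Misses W → P⁺.ρ L W ≡ P.ρ L W
  ρ-misses L W miss = ρ-agree Γ⁺ Γ L W (λ u∈ v∈ → m-off (which-misses miss u∈ v∈))

opaque
  others : ∀ (i j : Fin 4) → i ≢ j → ∃[ k ] ∃[ l ]
    (k ≢ i × k ≢ j × l ≢ i × l ≢ j × k ≢ l × (∀ x → (x ≡ i) ⊎ (x ≡ j) ⊎ (x ≡ k) ⊎ (x ≡ l)))
  others = toWitness {a? = Finp.all? λ i → Finp.all? λ j → ¬? (i Finp.≟ j) →-dec Finp.any? λ k → Finp.any? λ l →
    ¬? (k Finp.≟ i) ×-dec ¬? (k Finp.≟ j) ×-dec ¬? (l Finp.≟ i) ×-dec ¬? (l Finp.≟ j) ×-dec ¬? (k Finp.≟ l) ×-dec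
    Finp.all? λ x → (x Finp.≟ i) ⊎-dec (x Finp.≟ j) ⊎-dec (x Finp.≟ k) ⊎-dec (x Finp.≟ l)} _

module EdgeLemma {n : ℕ} (st : State n) where
  open State st
  open Gap₃ st

  -- K₄ minus the edge y y'.
  record Kite (W : VSet n) (y y' : Fin n) : Set where
    field
      a b  : Fin n
      a∈   : a ∈ W
      b∈   : b ∈ W
      a≢b  : a ≢ b
      a≢y  : a ≢ y
      a≢y' : a ≢ y'
      b≢y  : b ≢ y
      b≢y' : b ≢ y'
      all  : ∀ {v} → v ∈ W → (v ≡ y) ⊎ (v ≡ y') ⊎ (v ≡ a) ⊎ (v ≡ b)
      ya   : 1ℤ ≤ + m y a
      yb   : 1ℤ ≤ + m y b
      y'a  : 1ℤ ≤ + m y' a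
      y'b  : 1ℤ ≤ + m y' b
      ab   : 1ℤ ≤ + m a b
      yy'  : m y y' ≡ 0

  -- What is retained of a 7-vertex 4-Ore graph minus the edge `y y'`: every vertex keeps three
  -- edges of cost at least 5, and each end keeps two.
  record Heavy (W : VSet n) (y y' : Fin n) : Set where
    field
      seven : ∣ W ∣ ≡ + 7
      row   : ∀ {v} → v ∈ W → v ≢ y → v ≢ y' → + 15 ≤ ∑S W (λ u → cost (m v u))
      row-y : + 10 ≤ ∑S W (λ u → cost (m y u))
      row-y' : + 10 ≤ ∑S W (λ u → cost (m y' u))

  -- The obstruction to an extra edge `y y'`. The 4-Ore graphs on 4, 7 and 10 vertices have
  -- potentials 2, 1 and 0, and removing the edge returns 5. A set of full lists with potential at
  -- most -1 gets back at most 6, hence also 5.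
  record Linked (B W : VSet n) (y y' : Fin n) : Set where
    field
      W⊆   : W ⊆ B
      y∈   : y ∈ W
      y'∈  : y' ∈ W
      all-full : ∀ {v} → v ∈ W → Full (L v)
      kind : (Kite W y y' × ρ L W ≤ + 7) ⊎ (Heavy W y y' × ρ L W ≤ + 6) ⊎ (ρ L W ≤ + 5)

  -- A proper subset `B` is coloured as if `y` and `y'` were joined along `π`. A set that becomes
  -- low with potential at most -3 has at most 3 without the edge, and `gap₃` excludes this because
  -- `3 ≤ μ + 5`; only sets of full lists survive.
  module Add {B : VSet n} {r y y' : Fin n} (ba : B ⊆ A) (r∈ : r ∈ A) (r∉ : r ∉ B) (y∈B : y ∈ B) (y'∈B : y' ∈ B)
             (y≢y' : y ≢ y') (π : Permutation)
             (good : (φ : Colouring L B) → col φ y' ≢ Permutation.to π (col φ y) → R)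
             (link : ∀ W → Linked B W y y' → R) where
    open AddEdge Γ y y' y≢y' π

    both : (W : VSet n) → Misses W ⊎ ((y ∈ W) × (y' ∈ W))
    both W with dec∈ y W | dec∈ y' W
    ... | inj₁ a | inj₁ b = inj₂ (a , b)
    ... | inj₂ a | _ = inj₁ (inj₁ a)
    ... | inj₁ _ | inj₂ b = inj₁ (inj₂ b)

    gap : ∀ W {w} → W ⊆ B → w ∈ W → ρ L W ≤ + 3 → R
    gap W wb w∈ h = gap₃ (ba ∘ wb) w∈ r∈ (not-in (λ q → absurd∈ (wb q) r∉)) (lin (ρ L W ∷ μ ∷ [])
      (λ a μ → a ≼ # 3 ⟹ # 0 ≼ μ ⊕ # 2 ⟹ a ≼ μ ⊕ # 5) h μ≥)

    fullness : ∀ W → (∃[ v ] v ∈ W × (p (L v) ≤ + 4)) ⊎ (∀ {v} → v ∈ W → Full (L v))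
    fullness W with search W {λ v → p (L v) ≤ + 4} {λ v → Full (L v)} (λ v → [ inj₂ , (λ q → inj₁ (proj₁ q)) ]′ (full? (L v)))
    ... | inj₁ q = inj₁ q
    ... | inj₂ f = inj₂ f

    -- Either all edges of the 4-Ore graph are already present, which is an outcome, or a missing
    -- one must be the added edge; then `y` and `y'` were not adjacent before and the new edge costs
    -- only 5.
    exceptional : ∀ W {w} → W ⊆ B → w ∈ W → Exceptional Γ⁺ W → R
    exceptional W wb w∈ x with search (λ _ → true) {λ i → ∃[ j ] (adj G₀ i j ≡ true) × (m (θ i) (θ j) ≡ 0)}
                        {λ i → ∀ j → adj G₀ i j ≡ true → 1ℤ ≤ + m (θ i) (θ j)} row?
      where
      open ExceptionalBounds x
      row? : ∀ i → (∃[ j ] (adj G₀ i j ≡ true) × (m (θ i) (θ j) ≡ 0)) ⊎ (∀ j → adj G₀ i j ≡ true → 1ℤ ≤ + m (θ i) (θ j))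
      row? i with search (λ _ → true) {λ j → (adj G₀ i j ≡ true) × (m (θ i) (θ j) ≡ 0)} {λ j → adj G₀ i j ≡ true → 1ℤ ≤ + m (θ i) (θ j)} cell?
        where
        cell? : ∀ j → ((adj G₀ i j ≡ true) × (m (θ i) (θ j) ≡ 0)) ⊎ (adj G₀ i j ≡ true → 1ℤ ≤ + m (θ i) (θ j))
        cell? j with adj G₀ i j | m (θ i) (θ j)
        ... | false | _ = inj₂ (λ ())
        ... | true | zero = inj₁ (refl , refl)
        ... | true | suc k = inj₂ (λ _ → +≤+ (ℕ.s≤s ℕ.z≤n))
      ... | inj₁ (j , _ , q) = inj₁ (j , q)
      ... | inj₂ h = inj₂ (λ j → h {j} (mk∈ refl))
    ... | inj₂ old = out (W , ba ∘ wb , (_ , w∈) , inj₂ (inj₂ (record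
            { G₀ = G₀ ; ore = ore ; θ = θ ; θ-inj = θ-inj ; θ∈ = θ∈ ; θ-onto = θ-onto
            ; θ-adj = λ {i} {j} q → old {i} (mk∈ refl) j q ; size = size ; edges = edges ; rows = rows ; complete = complete })))
      where open ExceptionalBounds x
    ... | inj₁ (i , _ , j , aij , mij) with which-case (θ i) (θ j)
      where open ExceptionalBounds x
    ...   | inj₁ e = ⊥-elim (lin (+ (m (θ i) (θ j) ℕ.+ extra (which (θ i) (θ j))) ∷ []) (λ x → # 1 ≼ x ⟹ x ≐ # 0 ⟹ contra)
                (θ-adj aij) (cong +_ (trans (m-off e) mij)))
      where open ExceptionalBounds x
    ...   | inj₂ ends = new (fullness W)
      where
      open ExceptionalBounds x
      no-edge : m y y' ≡ 0
      no-edge = [ (λ { (a , b) → trans (sym (cong₂ m a b)) mij }) , (λ { (a , b) → trans (m-sym y y') (trans (sym (cong₂ m a b)) mij) }) ]′ ends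
      y∈W : y ∈ W
      y∈W = [ (λ { (a , b) → subst (_∈ W) a (θ∈ i) }) , (λ { (a , b) → subst (_∈ W) b (θ∈ j) }) ]′ ends
      y'∈W : y' ∈ W
      y'∈W = [ (λ { (a , b) → subst (_∈ W) b (θ∈ j) }) , (λ { (a , b) → subst (_∈ W) a (θ∈ i) }) ]′ ends
      four≤ : + 4 ≤ ∣ W ∣
      four≤ = subst (+ 4 ≤_) (sym exc-card) ([ (λ e → ℤp.≤-reflexive (cong +_ (sym e))) ,
        [ (λ e → subst (λ k → + 4 ≤ + k) (sym e) (+≤+ (ℕ.s≤s (ℕ.s≤s (ℕ.s≤s (ℕ.s≤s ℕ.z≤n)))))) ,
          (λ e → subst (λ k → + 4 ≤ + k) (sym e) (+≤+ (ℕ.s≤s (ℕ.s≤s (ℕ.s≤s (ℕ.s≤s ℕ.z≤n)))))) ]′ ]′ size)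
      -- Three times `(10 - |W|)/3 + 5 - s`, where 5 is the cost of the added edge and `s` the loss
      -- from lists that are not full.
      bound : ∀ s → ∑S W (λ v → p (L v)) + s ≤ + 8 * ∣ W ∣ → + 3 * ρ L W ≤ + 25 - ∣ W ∣ - + 3 * s
      bound s h = lin (ρ L W ∷ P⁺.ρ L W ∷ ∑S W (λ v → p (L v)) ∷ ∣ W ∣ ∷ s ∷ [])
        (λ r r⁺ S w s → r ≼ r⁺ ⊕ # 5 ⟹ 3 ⊙ r⁺ ≼ 3 ⊙ (S ⊖ 8 ⊙ w) ⊕ # 10 ⊖ w ⟹ S ⊕ s ≼ 8 ⊙ w ⟹ 3 ⊙ r ≼ # 25 ⊖ w ⊖ 3 ⊙ s)
        (plus5 no-edge L W) (exc-ρ L) h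
      at≤ : ∀ k c → Graph.n G₀ ≡ k → + 25 - + k ≤ + 3 * c + + 2 → ρ L W ≤ c
      at≤ k c e h = lin (ρ L W ∷ ∣ W ∣ ∷ + k ∷ c ∷ [])
        (λ r w k c → 3 ⊙ r ≼ # 25 ⊖ w ⊖ 3 ⊙ # 0 ⟹ w ≐ k ⟹ # 25 ⊖ k ≼ 3 ⊙ c ⊕ # 2 ⟹ r ≼ c)
        (bound 0ℤ (subst (_≤ + 8 * ∣ W ∣) (sym (ℤp.+-identityʳ _)) (sum-p≤ {L = L} {W}))) (trans exc-card (cong +_ e)) h
      cost-old : ∀ v → v ∈ W → v ≢ y → v ≢ y' → ∑S W (λ u → cost (m v u ℕ.+ extra (which v u))) ≡ ∑S W (λ u → cost (m v u))
      cost-old v v∈ n₁ n₂ = S-cong {A = W} (λ {u} _ → cong cost (m-off (off u)))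
        where
        off : ∀ u → which v u ≡ neither
        off u with which-case v u
        ... | inj₁ e = e
        ... | inj₂ (inj₁ (a , _)) = ⊥-elim (n₁ a)
        ... | inj₂ (inj₂ (a , _)) = ⊥-elim (n₂ a)
      cost-end : ∀ {z z'} → z ∈ W → (∀ u → u ≢ z' → which z u ≡ neither) → m z z' ≡ 0 → extra (which z z') ≡ 1 → + 10 ≤ ∑S W (λ u → cost (m z u))
      cost-end {z} {z'} z∈ off mz ez = lin (∑S W f⁺ ∷ ∑S W f ∷ ∑S W (λ u → ⟨ z' ⟩ u ▹ + 5) ∷ ∑S (W ∩ ⟨ z' ⟩) (λ _ → + 5) ∷ ∑S ⟨ z' ⟩ (λ _ → + 5) ∷ ∑S W (λ u → f u + ⟨ z' ⟩ u ▹ + 5) ∷ [])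
        (λ a b s i o t → # 15 ≼ a ⟹ a ≐ t ⟹ t ≐ b ⊕ s ⟹ s ≐ i ⟹ i ≼ o ⟹ o ≐ # 5 ⟹ # 10 ≼ b)
        (exc-row z∈) (S-cong {A = W} {f = f⁺} (λ {u} _ → same u)) (S-+ W f (λ u → ⟨ z' ⟩ u ▹ + 5)) (S-▹ W ⟨ z' ⟩ (λ _ → + 5))
        (S-⊆ {A = W ∩ ⟨ z' ⟩} {⟨ z' ⟩} (∩ʳ {A = W}) (λ _ → +≤+ ℕ.z≤n)) (S-point z' (λ _ → + 5))
        where
        f f⁺ : Fin n → ℤ
        f u = cost (m z u)
        f⁺ u = cost (m z u ℕ.+ extra (which z u))
        same : ∀ u → f⁺ u ≡ f u + ⟨ z' ⟩ u ▹ + 5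
        same u with u Finp.≟ z'
        ... | yes refl rewrite mz | ez = refl
        ... | no ne = trans (cong cost (m-off (off u ne))) (sym (ℤp.+-identityʳ _))
      heavy : Graph.n G₀ ≡ 7 → Heavy W y y'
      heavy e = record { seven = trans exc-card (cong +_ e)
        ; row = λ {v} v∈ n₁ n₂ → subst (+ 15 ≤_) (cost-old v v∈ n₁ n₂) (exc-row v∈)
        ; row-y = cost-end y∈W off no-edge (cong extra which-forth)
        ; row-y' = cost-end y'∈W off' (trans (m-sym y' y) no-edge) (cong extra (trans (which-flip y y') (cong flip which-forth))) }
        where
        off : ∀ u → u ≢ y' → which y u ≡ neither
        off u ne with which-case y u
        ... | inj₁ e = e
        ... | inj₂ (inj₁ (_ , b)) = ⊥-elim (ne b)
        ... | inj₂ (inj₂ (a , _)) = ⊥-elim (y≢y' a)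
        off' : ∀ u → u ≢ y → which y' u ≡ neither
        off' u ne with which-case y' u
        ... | inj₁ e = e
        ... | inj₂ (inj₁ (a , _)) = ⊥-elim (y≢y' (sym a))
        ... | inj₂ (inj₂ (_ , b)) = ⊥-elim (ne b)
      kite : Graph.n G₀ ≡ 4 → Kite W y y'
      kite e = [ (λ { (p , q) → build e θ θ-inj θ∈ θ-onto joined i j i≢j p q }) , (λ { (p , q) → build e θ θ-inj θ∈ θ-onto joined j i (i≢j ∘ sym) q p }) ]′ ends
        where
        i≢j : i ≢ j
        i≢j refl = true≢false aij (Graph.irrefl G₀ i)
        joined : ∀ {i j} → i ≢ j → 1ℤ ≤ + (m (θ i) (θ j) ℕ.+ extra (which (θ i) (θ j)))
        joined ne = θ-adj (complete e ne)
        build : ∀ {N} → N ≡ 4 → (θ : Fin N → Fin n) → (∀ {i j} → θ i ≡ θ j → i ≡ j) → (∀ i → θ i ∈ W) →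
                (∀ {v} → v ∈ W → ∃[ i ] θ i ≡ v) → (∀ {i j} → i ≢ j → 1ℤ ≤ + (m (θ i) (θ j) ℕ.+ extra (which (θ i) (θ j)))) →
                (i j : Fin N) → i ≢ j → θ i ≡ y → θ j ≡ y' → Kite W y y'
        build refl θ inj θ∈ onto joined i j i≢j ey ey' with others i j i≢j
        ... | k , l , k≢i , k≢j , l≢i , l≢j , k≢l , cover = record
          { a = θ k ; b = θ l ; a∈ = θ∈ k ; b∈ = θ∈ l ; a≢b = k≢l ∘ inj
          ; a≢y = ny k≢i ; a≢y' = ny' k≢j ; b≢y = ny l≢i ; b≢y' = ny' l≢j
          ; all = λ v∈ → every (onto v∈)
          ; ya = subst (λ u → 1ℤ ≤ + m u (θ k)) ey (old (k≢i ∘ sym) (inj₂ (ny k≢i , ny' k≢j)))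
          ; yb = subst (λ u → 1ℤ ≤ + m u (θ l)) ey (old (l≢i ∘ sym) (inj₂ (ny l≢i , ny' l≢j)))
          ; y'a = subst (λ u → 1ℤ ≤ + m u (θ k)) ey' (old (k≢j ∘ sym) (inj₂ (ny k≢i , ny' k≢j)))
          ; y'b = subst (λ u → 1ℤ ≤ + m u (θ l)) ey' (old (l≢j ∘ sym) (inj₂ (ny l≢i , ny' l≢j)))
          ; ab = old k≢l (inj₁ (ny k≢i , ny' k≢j)) ; yy' = no-edge }
          where
          ny : ∀ {k} → k ≢ i → θ k ≢ y
          ny ne e = ne (inj (trans e (sym ey)))
          ny' : ∀ {k} → k ≢ j → θ k ≢ y'
          ny' ne e = ne (inj (trans e (sym ey')))
          old : ∀ {k l} → k ≢ l → ((θ k ≢ y) × (θ k ≢ y')) ⊎ ((θ l ≢ y) × (θ l ≢ y')) → 1ℤ ≤ + m (θ k) (θ l)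
          old {k} {l} ne away = subst (λ t → 1ℤ ≤ + t) (m-off (neither′ away)) (joined ne)
            where
            neither′ : ((θ k ≢ y) × (θ k ≢ y')) ⊎ ((θ l ≢ y) × (θ l ≢ y')) → which (θ k) (θ l) ≡ neither
            neither′ away with which-case (θ k) (θ l) | away
            ... | inj₁ e | _ = e
            ... | inj₂ (inj₁ (a , _)) | inj₁ (n , _) = ⊥-elim (n a)
            ... | inj₂ (inj₁ (_ , b)) | inj₂ (_ , n) = ⊥-elim (n b)
            ... | inj₂ (inj₂ (a , _)) | inj₁ (_ , n) = ⊥-elim (n a)
            ... | inj₂ (inj₂ (_ , b)) | inj₂ (n , _) = ⊥-elim (n b)
          every : ∀ {v} → ∃[ x ] θ x ≡ v → (v ≡ y) ⊎ (v ≡ y') ⊎ (v ≡ θ k) ⊎ (v ≡ θ l)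
          every (x , eq) with cover x
          ... | inj₁ e = inj₁ (trans (sym eq) (trans (cong θ e) ey))
          ... | inj₂ (inj₁ e) = inj₂ (inj₁ (trans (sym eq) (trans (cong θ e) ey')))
          ... | inj₂ (inj₂ (inj₁ e)) = inj₂ (inj₂ (inj₁ (trans (sym eq) (cong θ e))))
          ... | inj₂ (inj₂ (inj₂ e)) = inj₂ (inj₂ (inj₂ (trans (sym eq) (cong θ e))))
      new : (∃[ v ] v ∈ W × (p (L v) ≤ + 4)) ⊎ (∀ {v} → v ∈ W → Full (L v)) → R
      -- A missing colour lowers the potential by at least 4, and `|W| ≥ 4` gives
      -- `3 ρ ≤ 25 - 4 - 12`.
      new (inj₁ (v , v∈ , q)) = gap W wb w∈ (lin (ρ L W ∷ ∣ W ∣ ∷ []) (λ r w → 3 ⊙ r ≼ # 25 ⊖ w ⊖ 3 ⊙ # 4 ⟹ # 4 ≼ w ⟹ r ≼ # 3)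
        (bound (+ 4) (sum-p-short {L = L} v∈ q)) four≤)
      new (inj₂ f) = link W (record { W⊆ = wb ; y∈ = y∈W ; y'∈ = y'∈W ; all-full = f ; kind = kind′ size })
        where
        kind′ : (Graph.n G₀ ≡ 4) ⊎ (Graph.n G₀ ≡ 7) ⊎ (Graph.n G₀ ≡ 10) → (Kite W y y' × ρ L W ≤ + 7) ⊎ (Heavy W y y' × ρ L W ≤ + 6) ⊎ (ρ L W ≤ + 5)
        kind′ (inj₁ e) = inj₁ (kite e , at≤ 4 (+ 7) e (ℤp.≤ᵇ⇒≤ _))
        kind′ (inj₂ (inj₁ e)) = inj₂ (inj₁ (heavy e , at≤ 7 (+ 6) e (ℤp.≤ᵇ⇒≤ _)))
        kind′ (inj₂ (inj₂ e)) = inj₂ (inj₂ (at≤ 10 (+ 5) e (ℤp.≤ᵇ⇒≤ _)))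

    addEdge : R
    addEdge with IH Γ⁺ L B (proper-card ba r∈ r∉)
    ... | inj₁ φ = good (record { col = P⁺.col φ ; col∈ = P⁺.col∈ φ
                                ; proper = λ {u} {v} u∈ v∈ → not-in (λ q → absurd∈ (∪ˡ {A = M u (P⁺.col φ u) v} q) (P⁺.proper φ u∈ v∈)) })
                   (λ eq → absurd∈ (∪ʳ {A = M y (P⁺.col φ y) y'} (subst (λ w → P⁺.col φ y' ∈ extraM w (P⁺.col φ y)) (sym which-forth)
                      (subst (_∈ ⟨ Permutation.to π (P⁺.col φ y) ⟩) (sym eq) ∈⟨⟩))) (P⁺.proper φ y∈B y'∈B))
    ... | inj₂ (W , wb , (w , w∈) , inj₂ (inj₂ x)) = exceptional W wb w∈ x
    ... | inj₂ (W , wb , (w , w∈) , inj₁ h) with both W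
    ...   | inj₁ miss = small-out (ba ∘ wb) w∈ (subst (λ t → t + + 3 ≤ 0ℤ) (ρ-misses L W miss) h)
    ...   | inj₂ _ = gap W wb w∈ (lin (ρ L W ∷ P⁺.ρ L W ∷ []) (λ a b → a ≼ b ⊕ # 6 ⟹ b ⊕ # 3 ≼ # 0 ⟹ a ≼ # 3) (plus6 L W) h)
    addEdge | inj₂ (W , wb , (w , w∈) , inj₂ (inj₁ (f , h))) with both W
    ...   | inj₁ miss = out (W , ba ∘ wb , (w , w∈) , inj₂ (inj₁ (f , subst (λ t → t + 1ℤ ≤ 0ℤ) (ρ-misses L W miss) h)))
    ...   | inj₂ (a , b) = link W (record { W⊆ = wb ; y∈ = a ; y'∈ = b ; all-full = f
              ; kind = inj₂ (inj₂ (lin (ρ L W ∷ P⁺.ρ L W ∷ []) (λ a b → a ≼ b ⊕ # 6 ⟹ b ⊕ # 1 ≼ # 0 ⟹ a ≼ # 5) (plus6 L W) h)) })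

-- Low vertices

opaque
  others₃ : ∀ (c : Colour) → ∃[ a ] ∃[ b ] (∀ x → x ≢ c → (x ≡ a) ⊎ (x ≡ b))
  others₃ = toWitness {a? = Finp.all? λ c → Finp.any? λ a → Finp.any? λ b → Finp.all? λ x →
    ¬? (x Finp.≟ c) →-dec ((x Finp.≟ a) ⊎-dec (x Finp.≟ b))} _

private
  table : Fin 6 → Colour → Colour
  table 0F 0F = 0F
  table 0F 1F = 1F
  table 0F 2F = 2F
  table 1F 0F = 0F
  table 1F 1F = 2F
  table 1F 2F = 1F
  table 2F 0F = 1F
  table 2F 1F = 0F
  table 2F 2F = 2F
  table 3F 0F = 2F
  table 3F 1F = 1F
  table 3F 2F = 0F
  table (suc (suc (suc (suc zero)))) 0F = 1F
  table (suc (suc (suc (suc zero)))) 1F = 2F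
  table (suc (suc (suc (suc zero)))) 2F = 0F
  table (suc (suc (suc (suc (suc zero))))) 0F = 2F
  table (suc (suc (suc (suc (suc zero))))) 1F = 0F
  table (suc (suc (suc (suc (suc zero))))) 2F = 1F

  inverse : Fin 6 → Fin 6
  inverse (suc (suc (suc (suc zero)))) = suc (suc (suc (suc (suc zero))))
  inverse (suc (suc (suc (suc (suc zero))))) = suc (suc (suc (suc zero)))
  inverse i = i

  permutation : Fin 6 → Permutation
  permutation i = record
    { to = table i ; from = table (inverse i)
    ; from-to = toWitness {a? = Finp.all? λ i → Finp.all? λ c → table (inverse i) (table i c) Finp.≟ c} _ i
    ; to-from = toWitness {a? = Finp.all? λ i → Finp.all? λ c → table i (table (inverse i) c) Finp.≟ c} _ i }

  -- The partial injection sends c to d when its code is inject₁ d and is undefined when the code is 3.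
  agrees : Fin 4 → Colour → Set
  agrees i d = (i ≡ 3F) ⊎ (i ≡ Fin.inject₁ d)

  apart₄ : Fin 4 → Fin 4 → Set
  apart₄ i j = (i ≡ 3F) ⊎ (i ≢ j)

  extend-injection : ∀ i j k → apart₄ i j → apart₄ i k → apart₄ j k →
                     ∃[ s ] (agrees i (table s 0F) × agrees j (table s 1F) × agrees k (table s 2F))
  extend-injection = toWitness {a? = Finp.all? λ i → Finp.all? λ j → Finp.all? λ k →
    apart₄? i j →-dec (apart₄? i k →-dec (apart₄? j k →-dec Finp.any? λ s →
      agrees? i (table s 0F) ×-dec agrees? j (table s 1F) ×-dec agrees? k (table s 2F)))} _
    where
    agrees? : ∀ i d → Dec (agrees i d)
    agrees? i d = (i Finp.≟ 3F) ⊎-dec (i Finp.≟ Fin.inject₁ d)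
    apart₄? : ∀ i j → Dec (apart₄ i j)
    apart₄? i j = (i Finp.≟ 3F) ⊎-dec ¬? (i Finp.≟ j)

opaque
  -- Every partial injection on three colours extends to a permutation, which is checked over all
  -- codes. Forbidding more pairs on a simple edge only makes colouring harder, and permutations
  -- allow blocked colours to be carried along edges.
  complete-matching : (r : Colour → VSet 3) → (∀ c → ∣ r c ∣ ≤ 1ℤ) → (∀ {a b d} → d ∈ r a → d ∈ r b → a ≡ b) →
                      Σ Permutation λ π → ∀ {c d} → d ∈ r c → d ≡ Permutation.to π c
  complete-matching r rows cols =
    let (s , a₀ , a₁ , a₂) = extend-injection (code 0F) (code 1F) (code 2F) (far (λ ())) (far (λ ())) (far (λ ()))
    in permutation s , λ { {0F} → agree a₀ ; {1F} → agree a₁ ; {2F} → agree a₂ }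
    where
    find : ∀ c → (∃[ d ] d ∈ r c) ⊎ (∀ {d} → d ∉ r c)
    find c with dec≤ ∣ r c ∣ 0ℤ
    ... | inj₂ h = inj₁ (card-find h)
    ... | inj₁ h = inj₂ (not-in (λ q → lin (∣ r c ∣ ∷ []) (λ x → x ≼ # 0 ⟹ # 1 ≼ x ⟹ contra) h (card-pos q)))
    code : Colour → Fin 4
    code c with find c
    ... | inj₁ (d , _) = Fin.inject₁ d
    ... | inj₂ _ = 3F
    far : ∀ {a b} → a ≢ b → apart₄ (code a) (code b)
    far {a} {b} ne with find a | find b
    ... | inj₂ _ | _ = inj₁ refl
    ... | inj₁ (d , d∈) | inj₁ (e , e∈) = inj₂ (λ q → ne (cols d∈ (subst (_∈ r b) (sym (Finp.inject₁-injective q)) e∈)))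
    ... | inj₁ (d , d∈) | inj₂ _ = inj₂ (Finp.fromℕ≢inject₁ {n = 3} {d} ∘ sym)
    agree : ∀ {c e d} → agrees (code c) e → d ∈ r c → d ≡ e
    agree {c} ag d∈ with find c
    ... | inj₂ none′ = absurd∈ d∈ none′
    agree {c} (inj₁ q) d∈ | inj₁ (d' , d'∈) = ⊥-elim (Finp.fromℕ≢inject₁ {n = 3} {d'} (sym q))
    agree {c} (inj₂ q) d∈ | inj₁ (d' , d'∈) = trans (card≤1-unique (rows c) d∈ d'∈) (Finp.inject₁-injective q)

module LowVertices {n : ℕ} (st : State n) where
  open State st
  open Gap₃ st
  open EdgeLemma st

  private
    variable
      S B X W : VSet n

  unique-nbr : ∀ {v x s} → deg v S ≤ 1ℤ → x ∈ S → 1ℤ ≤ + m v x → s ∈ S → 1ℤ ≤ + m v s → s ≡ x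
  unique-nbr {S} {v} {x} {s} d x∈ mx s∈ ms with s Finp.≟ x
  ... | yes eq = eq
  ... | no ne = ⊥-elim (lin (deg v S ∷ deg v (⟨ s ⟩ ∪ ⟨ x ⟩) ∷ deg v ⟨ s ⟩ ∷ deg v ⟨ x ⟩ ∷ + m v x ∷ + m v s ∷ [])
          (λ d u a b x s → d ≼ # 1 ⟹ u ≼ d ⟹ u ≐ a ⊕ b ⟹ a ≐ s ⟹ b ≐ x ⟹ # 1 ≼ x ⟹ # 1 ≼ s ⟹ contra)
          d (deg-⊆ (λ q → [ ⟨⟩-⊆ s∈ , ⟨⟩-⊆ x∈ ]′ (∪-elim {A = ⟨ s ⟩} q)))
          (S-∪ (disjoint-⟨⟩ (∉⟨⟩ (ne ∘ sym))) (λ u → + m v u)) (S-point s _) (S-point x _) mx ms)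

  three-nbrs : ∀ {v s₁ s₂ s₃} → deg v S ≤ + 3 → s₁ ∈ S → s₂ ∈ S → s₃ ∈ S → s₁ ≢ s₂ → s₁ ≢ s₃ → s₂ ≢ s₃ →
               1ℤ ≤ + m v s₁ → 1ℤ ≤ + m v s₂ → 1ℤ ≤ + m v s₃ →
               (∀ {u} → u ∈ S → 1ℤ ≤ + m v u → (u ≡ s₁) ⊎ (u ≡ s₂) ⊎ (u ≡ s₃)) × (+ m v s₁ ≤ 1ℤ) × (+ m v s₂ ≤ 1ℤ)
  three-nbrs {S} {v} {s₁} {s₂} {s₃} d i₁ i₂ i₃ n₁₂ n₁₃ n₂₃ m₁ m₂ m₃ = only ,
      lin (deg v S ∷ deg v Z ∷ + m v s₁ ∷ + m v s₂ ∷ + m v s₃ ∷ []) (λ d t a b c → d ≼ # 3 ⟹ t ≼ d ⟹ t ≐ a ⊕ (b ⊕ c) ⟹ # 1 ≼ b ⟹ # 1 ≼ c ⟹ a ≼ # 1) d (deg-⊆ Z⊆) sum m₂ m₃ ,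
      lin (deg v S ∷ deg v Z ∷ + m v s₁ ∷ + m v s₂ ∷ + m v s₃ ∷ []) (λ d t a b c → d ≼ # 3 ⟹ t ≼ d ⟹ t ≐ a ⊕ (b ⊕ c) ⟹ # 1 ≼ a ⟹ # 1 ≼ c ⟹ b ≼ # 1) d (deg-⊆ Z⊆) sum m₁ m₃
    where
    Z : VSet n
    Z = ⟨ s₁ ⟩ ∪ (⟨ s₂ ⟩ ∪ ⟨ s₃ ⟩)
    Z⊆ : Z ⊆ S
    Z⊆ q = [ ⟨⟩-⊆ i₁ , (λ q → [ ⟨⟩-⊆ i₂ , ⟨⟩-⊆ i₃ ]′ (∪-elim {A = ⟨ s₂ ⟩} q)) ]′ (∪-elim {A = ⟨ s₁ ⟩} q)
    sum : deg v Z ≡ + m v s₁ + (+ m v s₂ + + m v s₃)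
    sum = trans (S-∪ (⟨⟩-disjoint (not-in (λ q → [ (λ e → n₁₂ (⟨⟩-elim e)) , (λ e → n₁₃ (⟨⟩-elim e)) ]′ (∪-elim {A = ⟨ s₂ ⟩} q)))) _)
      (cong₂ _+_ (S-point s₁ _) (trans (S-∪ (⟨⟩-disjoint (∉⟨⟩ n₂₃)) _) (cong₂ _+_ (S-point s₂ _) (S-point s₃ _))))
    only : ∀ {u} → u ∈ S → 1ℤ ≤ + m v u → (u ≡ s₁) ⊎ (u ≡ s₂) ⊎ (u ≡ s₃)
    only {u} u∈ mu with dec∈ u Z
    ... | inj₁ q = [ (λ e → inj₁ (⟨⟩-elim e)) , (λ q → [ (λ e → inj₂ (inj₁ (⟨⟩-elim e))) , (λ e → inj₂ (inj₂ (⟨⟩-elim e))) ]′ (∪-elim {A = ⟨ s₂ ⟩} q)) ]′ (∪-elim {A = ⟨ s₁ ⟩} q)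
    ... | inj₂ u∉ = ⊥-elim (lin (deg v S ∷ deg v (⟨ u ⟩ ∪ Z) ∷ deg v ⟨ u ⟩ ∷ deg v Z ∷ + m v u ∷ + m v s₁ ∷ + m v s₂ ∷ + m v s₃ ∷ [])
            (λ d t o z x a b c → d ≼ # 3 ⟹ t ≼ d ⟹ t ≐ o ⊕ z ⟹ o ≐ x ⟹ z ≐ a ⊕ (b ⊕ c) ⟹ # 1 ≼ x ⟹ # 1 ≼ a ⟹ # 1 ≼ b ⟹ # 1 ≼ c ⟹ contra)
            d (deg-⊆ (λ q → [ ⟨⟩-⊆ u∈ , Z⊆ ]′ (∪-elim {A = ⟨ u ⟩} q))) (S-∪ (⟨⟩-disjoint u∉) _) (S-point u _) sum mu m₁ m₂ m₃)

  matching : ∀ {u v} → + m u v ≤ 1ℤ → Σ Permutation λ π → ∀ {c d} → d ∈ M u c v → d ≡ Permutation.to π c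
  matching {u} {v} h = complete-matching (λ c → M u c v) (λ c → ℤp.≤-trans (M-deg u c v) h)
    (λ {a} {b} {d} p q → card≤1-unique (ℤp.≤-trans (M-deg v d u) (subst (λ k → + k ≤ 1ℤ) (m-sym u v) h)) (M-sym p) (M-sym q))

  deg-split : ∀ v → X ⊆ A → deg v A ≡ deg v X + deg v (A ∖ X)
  deg-split {X} v xa = lin (deg v A ∷ deg v (A ∩ X) ∷ deg v X ∷ deg v (A ∖ X) ∷ [])
    (λ a i x d → a ≐ i ⊕ d ⟹ i ≐ x ⟹ a ≐ x ⊕ d)
    (S-split A X (λ u → + m v u)) (S-ext⊆ {A = A ∩ X} {X} (∩ʳ {A = A}) (λ q → ∩-intro (xa q) q))

  nonself : ∀ {u v} → 1ℤ ≤ + m u v → u ≢ v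
  nonself {u} h refl = lin (+ m u u ∷ []) (λ x → # 1 ≼ x ⟹ x ≐ # 0 ⟹ contra) h (cong +_ (m-irr u))

  complement : X ⊆ A → A ⊆ A ∖ X ∪ X
  complement {X} xa {v} h with dec∈ v X
  ... | inj₁ q = ∪ʳ {A = A ∖ X} q
  ... | inj₂ q = ∪ˡ {A = A ∖ X} (∖-intro h q)

  colourOutside : ∀ {x} → X ⊆ A → x ∈ X → (Colouring L (A ∖ X) → R) → R
  colourOutside xa x∈ = colourOf (∖ˡ {A = A}) (xa x∈) (not-in (λ q → absurd∈ x∈ (∖ʳ {A = A} q)))

  finish : X ⊆ A → (φ : Colouring L (A ∖ X)) → Colouring (residual L (A ∖ X) (col φ)) X → R
  finish xa φ ψ = done (restrict (λ _ c → c) (complement xa) (combine φ (λ h → ∖ʳ {A = A} h) ψ))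

  -- A vertex with more colours than edges can be coloured last.
  minDegree : ∀ {v} → v ∈ A → (∣ L v ∣ ≤ deg v A → R) → R
  minDegree {v} v∈ k with dec≤ ∣ L v ∣ (deg v A)
  ... | inj₁ h = k h
  ... | inj₂ h = colourOutside (⟨⟩-⊆ v∈) ∈⟨⟩ λ φ → done (restrict (λ _ c → c) remove-cover
        (extendPoint φ (not-in (λ q → absurd∈ ∈⟨⟩ (∖ʳ {A = A} q)))
          (lin (deg v A ∷ deg v (A ∖ ⟨ v ⟩) ∷ ∣ L v ∣ ∷ []) (λ a b l → a ⊕ # 1 ≼ l ⟹ b ≼ a ⟹ b ⊕ # 1 ≼ l) h (deg-⊆ (∖ˡ {A = A})))))

  Low : Fin n → Set
  Low v = (v ∈ A) × (deg v A ≡ ∣ L v ∣)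

  -- Two low vertices joined by a double edge, the first one with a full list: if a colouring of the rest does
  -- not extend, then recolouring the third neighbour of x₁ makes it extend.
  module DoubleEdge {x₁ x₂} (low₁ : Low x₁) (low₂ : Low x₂) (m=2 : + m x₁ x₂ ≡ + 2) (f₁ : Full (L x₁)) where
    pair : VSet n
    pair = ⟨ x₁ ⟩ ∪ ⟨ x₂ ⟩

    x₁≢x₂ : x₁ ≢ x₂
    x₁≢x₂ = nonself (subst (1ℤ ≤_) (sym m=2) (+≤+ (ℕ.s≤s ℕ.z≤n)))

    pair⊆ : pair ⊆ A
    pair⊆ q = [ ⟨⟩-⊆ (proj₁ low₁) , ⟨⟩-⊆ (proj₁ low₂) ]′ (∪-elim {A = ⟨ x₁ ⟩} q)

    Out° : VSet n
    Out° = A ∖ pair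

    x₁∈ : x₁ ∈ pair
    x₁∈ = ∪ˡ {A = ⟨ x₁ ⟩} ∈⟨⟩
    x₂∈ : x₂ ∈ pair
    x₂∈ = ∪ʳ {A = ⟨ x₁ ⟩} ∈⟨⟩

    outdeg : ∀ {x x'} → x ≢ x' → (∀ {v} → v ∈ ⟨ x ⟩ ∪ ⟨ x' ⟩ → v ∈ pair) → Low x → + m x x' ≡ + 2 → deg x Out° + + 2 ≤ ∣ L x ∣
    outdeg {x} {x'} ne sub lo e = lin (deg x A ∷ deg x pair ∷ deg x Out° ∷ + m x x' ∷ ∣ L x ∣ ∷ [])
      (λ a p o m l → a ≐ p ⊕ o ⟹ m ≼ p ⟹ m ≐ # 2 ⟹ a ≐ l ⟹ o ⊕ # 2 ≼ l)
      (deg-split x pair⊆) (deg-term (sub (∪ʳ {A = ⟨ x ⟩} ∈⟨⟩))) e (proj₂ lo)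

    out₁ : deg x₁ Out° + + 2 ≤ ∣ L x₁ ∣
    out₁ = outdeg x₁≢x₂ (λ q → q) low₁ m=2
    out₂ : deg x₂ Out° + + 2 ≤ ∣ L x₂ ∣
    out₂ = outdeg (x₁≢x₂ ∘ sym) (λ q → [ (λ z → ∪ʳ {A = ⟨ x₁ ⟩} z) , (λ z → ∪ˡ {A = ⟨ x₁ ⟩} z) ]′ (∪-elim {A = ⟨ x₂ ⟩} q)) low₂
             (trans (cong +_ (m-sym x₂ x₁)) m=2)

    extendPair : (φ : Colouring L Out°) → ∀ {α β} → α ∈ residual L Out° (col φ) x₁ → β ∈ residual L Out° (col φ) x₂ →
                 β ∉ M x₁ α x₂ → R
    extendPair φ {α} {β} α∈ β∈ free = finish pair⊆ φ (combine (colourPoint α∈) (disjoint-⟨⟩ (∉⟨⟩ (x₁≢x₂ ∘ sym)))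
      (colourPoint {c = β} (∖-intro β∈ (not-in (λ q → clash (blocked-elim {⟨ x₁ ⟩} q))))))
      where
      clash : ∃[ s ] s ∈ ⟨ x₁ ⟩ × β ∈ M s α x₂ → ⊥
      clash (s , s∈ , q) = absurd∈ (subst (λ s → β ∈ M s α x₂) (⟨⟩-elim s∈) q) free

    two≤ : ∀ {x} (φ : Colouring L Out°) → deg x Out° + + 2 ≤ ∣ L x ∣ → + 2 ≤ ∣ residual L Out° (col φ) x ∣
    two≤ {x} φ h = lin (deg x Out° ∷ ∣ L x ∣ ∷ ∣ residual L Out° (col φ) x ∣ ∷ [])
      (λ d l r → d ⊕ # 2 ≼ l ⟹ l ≼ r ⊕ d ⟹ # 2 ≼ r) h (residual-card L Out° (col φ) x)

    resolve : R
    resolve = colourOutside pair⊆ x₁∈ first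
      where
      first : Colouring L Out° → R
      first φ with search (residual L Out° (col φ) x₁) {λ α → ∃[ β ] β ∈ residual L Out° (col φ) x₂ × β ∉ M x₁ α x₂}
                     {λ α → residual L Out° (col φ) x₂ ⊆ M x₁ α x₂} (λ α → ⊎-search (residual L Out° (col φ) x₂) (M x₁ α x₂))
      ... | inj₁ (α , α∈ , β , β∈ , free) = extendPair φ α∈ β∈ free
      ... | inj₂ all with full? (residual L Out° (col φ) x₁)
      ...   | inj₁ f = ⊥-elim (let (β , β∈) = card-find {A = residual L Out° (col φ) x₂} (ℤp.≤-trans (+≤+ (ℕ.s≤s ℕ.z≤n)) (two≤ {x₂} φ out₂)) in
                lin (∣ M x₂ β x₁ ∣ ∷ ∣ residual L Out° (col φ) x₁ ∣ ∷ + m x₂ x₁ ∷ + m x₁ x₂ ∷ [])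
                  (λ a b c d → a ≼ c ⟹ c ≐ d ⟹ d ≐ # 2 ⟹ b ≼ a ⟹ b ≐ # 3 ⟹ contra)
                  (M-deg x₂ β x₁) (cong +_ (m-sym x₂ x₁)) m=2 (card-mono (λ {α} α∈ → M-sym (all α∈ β∈))) (full-card f))
      ...   | inj₂ (_ , _ , c , c∉) = blocker (blocked-elim {Out°} {v = x₁} (in-blocked c∉))
        where
        in-blocked : ∀ {c} → c ∉ residual L Out° (col φ) x₁ → c ∈ blocked Out° (col φ) x₁
        in-blocked {c} h with dec∈ c (blocked Out° (col φ) x₁)
        ... | inj₁ q = q
        ... | inj₂ q = absurd∈ (∖-intro f₁ q) h
        out≤1 : deg x₁ Out° ≤ 1ℤ
        out≤1 = lin (deg x₁ Out° ∷ ∣ L x₁ ∣ ∷ []) (λ d l → d ⊕ # 2 ≼ l ⟹ l ≼ # 3 ⟹ d ≼ # 1) out₁ (card≤3 (L x₁))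
        blocker : ∃[ y ] y ∈ Out° × c ∈ M y (col φ y) x₁ → R
        blocker (y , y∈ , q) = recolour y (col φ y) (∖ˡ {A = A}) (proj₁ low₁) (not-in (λ z → absurd∈ x₁∈ (∖ʳ {A = A} z))) second
          where
          second : (φ' : Colouring L Out°) → (y ∈ Out° → col φ' y ≢ col φ y) → R
          second φ' differ with ⊎-search (residual L Out° (col φ') x₂) (M x₁ c x₂)
          ... | inj₁ (β , β∈ , free) = extendPair φ' (∖-intro f₁ (not-in (λ z → still (blocked-elim {Out°} z)))) β∈ free
            where
            still : ∃[ s ] s ∈ Out° × c ∈ M s (col φ' s) x₁ → ⊥
            still (s , s∈ , z) = same (unique-nbr out≤1 y∈ (M-pos (M-sym q)) s∈ (M-pos (M-sym z))) z
              where
              same : ∀ {s} → s ≡ y → c ∈ M s (col φ' s) x₁ → ⊥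
              same refl z = differ y∈ (card≤1-unique (ℤp.≤-trans (M-deg x₁ c y) (ℤp.≤-trans (deg-term {A = Out°} y∈) out≤1)) (M-sym z) (M-sym q))
          -- Each colouring leaves two colours at `x₂`, so they share some `β`. It would be adjacent
          -- to two colours left at `x₁` by `φ` and to `c` as well: three colours across a double
          -- edge.
          ... | inj₂ sub = ⊥-elim (let (β , β∈) = common in
              lin (∣ M x₂ β x₁ ∣ ∷ ∣ residual L Out° (col φ) x₁ ∪ ⟨ c ⟩ ∣ ∷ ∣ residual L Out° (col φ) x₁ ∣ ∷ ∣ ⟨ c ⟩ ∣ ∷ + m x₂ x₁ ∷ + m x₁ x₂ ∷ [])
                (λ a u b o e d → a ≼ e ⟹ e ≐ d ⟹ d ≐ # 2 ⟹ u ≼ a ⟹ u ≐ b ⊕ o ⟹ o ≐ # 1 ⟹ # 2 ≼ b ⟹ contra)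
                (M-deg x₂ β x₁) (cong +_ (m-sym x₂ x₁)) m=2
                (card-mono (λ {α} z → [ (λ α∈ → M-sym (all α∈ (∩ˡ {A = residual L Out° (col φ) x₂} β∈))) ,
                   (λ α∈ → subst (_∈ M x₂ β x₁) (sym (⟨⟩-elim α∈)) (M-sym (sub (∩ʳ {A = residual L Out° (col φ) x₂} β∈)))) ]′
                   (∪-elim {A = residual L Out° (col φ) x₁} z)))
                (card-∪ (disjoint-⟨⟩ c∉)) (card-point c) (two≤ {x₁} φ out₁))
            where
            P Q : VSet 3
            P = residual L Out° (col φ) x₂
            Q = residual L Out° (col φ') x₂
            common : ∃[ β ] β ∈ P ∩ Q
            common = card-find (lin (∣ P ∣ ∷ ∣ P ∩ Q ∣ ∷ ∣ P ∖ Q ∣ ∷ ∣ Q ∣ ∷ ∣ P ∖ Q ∪ Q ∣ ∷ [])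
              (λ p i d q u → p ≐ i ⊕ d ⟹ # 2 ≼ p ⟹ # 2 ≼ q ⟹ u ≐ d ⊕ q ⟹ u ≼ # 3 ⟹ # 1 ≼ i)
              (card-split P Q) (two≤ {x₂} φ out₂) (two≤ {x₂} φ' out₂) (card-∪ (λ z → ∖ʳ {A = P} z)) (card≤3 (P ∖ Q ∪ Q)))

  pair-ρ : ∀ {x₁ x₂} → x₁ ≢ x₂ → ρ L (⟨ x₁ ⟩ ∪ ⟨ x₂ ⟩) ≡ p (L x₁) + p (L x₂) - cost (m x₁ x₂)
  pair-ρ {x₁} {x₂} ne = trans (ρ-insert L (∉⟨⟩ ne)) (cong₂ (λ s t → p (L x₁) + s - t) (ρ-point L x₂) (S-point x₂ _))

  -- Two two-colour lists give at most 4 + 4 - 11 = -3, and a triple edge between full lists gives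
  -- at most 16 - 17 = -1. If just one list is full, the degree of the other vertex bounds the
  -- multiplicity by 2. What remains is a double edge with a full end.
  multiple : ∀ {x₁ x₂} → Low x₁ → Low x₂ → + 2 ≤ + m x₁ x₂ → R
  multiple {x₁} {x₂} low₁ low₂ h = lists (proj₁ low₁) (λ f₁ → lists (proj₁ low₂) (λ f₂ → triple f₁ f₂) (λ c₂ _ → DoubleEdge.resolve low₁ low₂ (exact low₂ (ℤp.≤-trans (deg-term {A = A} (proj₁ low₁)) (ℤp.≤-reflexive (trans (proj₂ low₂) c₂)))) f₁))
                                                 (λ c₁ q₁ → lists (proj₁ low₂) (λ f₂ → DoubleEdge.resolve low₂ low₁ (trans (cong +_ (m-sym x₂ x₁)) (ℤp.≤-antisym (≤2 c₁) h)) f₂) (λ c₂ q₂ → small-out in-A (∪ˡ {A = ⟨ x₁ ⟩} ∈⟨⟩)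
                                                    (lin (ρ L (⟨ x₁ ⟩ ∪ ⟨ x₂ ⟩) ∷ p (L x₁) ∷ p (L x₂) ∷ cost (m x₁ x₂) ∷ + m x₁ x₂ ∷ [])
                                                      (λ r a b c m → r ≐ a ⊕ b ⊖ c ⟹ a ≐ # 4 ⟹ b ≐ # 4 ⟹ c ≐ 6 ⊙ m ⊖ # 1 ⟹ # 2 ≼ m ⟹ r ⊕ # 3 ≼ # 0)
                                                      (pair-ρ x≢) q₁ q₂ (cost≡6m-1 (m x₁ x₂) m≥1) h)))
    where
    m≥1 : 1ℤ ≤ + m x₁ x₂
    m≥1 = ℤp.≤-trans (+≤+ (ℕ.s≤s ℕ.z≤n)) h
    x≢ : x₁ ≢ x₂
    x≢ = nonself m≥1
    in-A : ⟨ x₁ ⟩ ∪ ⟨ x₂ ⟩ ⊆ A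
    in-A q = [ ⟨⟩-⊆ (proj₁ low₁) , ⟨⟩-⊆ (proj₁ low₂) ]′ (∪-elim {A = ⟨ x₁ ⟩} q)
    ≤2 : ∣ L x₁ ∣ ≡ + 2 → + m x₁ x₂ ≤ + 2
    ≤2 c = ℤp.≤-trans (deg-term {A = A} (proj₁ low₂)) (ℤp.≤-reflexive (trans (proj₂ low₁) c))
    exact : Low x₂ → + m x₂ x₁ ≤ + 2 → + m x₁ x₂ ≡ + 2
    exact _ q = ℤp.≤-antisym (subst (λ k → + k ≤ + 2) (m-sym x₂ x₁) q) h
    triple : Full (L x₁) → Full (L x₂) → R
    triple f₁ f₂ with dec≤ (+ m x₁ x₂) (+ 2)
    ... | inj₁ q = DoubleEdge.resolve low₁ low₂ (ℤp.≤-antisym q h) f₁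
    ... | inj₂ q = out (⟨ x₁ ⟩ ∪ ⟨ x₂ ⟩ , in-A , (x₁ , ∪ˡ {A = ⟨ x₁ ⟩} ∈⟨⟩) , inj₂ (inj₁
          ((λ {v} z → [ (λ e → subst (λ w → Full (L w)) (sym (⟨⟩-elim e)) f₁) , (λ e → subst (λ w → Full (L w)) (sym (⟨⟩-elim e)) f₂) ]′ (∪-elim {A = ⟨ x₁ ⟩} z)) ,
          lin (ρ L (⟨ x₁ ⟩ ∪ ⟨ x₂ ⟩) ∷ p (L x₁) ∷ p (L x₂) ∷ cost (m x₁ x₂) ∷ + m x₁ x₂ ∷ [])
            (λ r a b c m → r ≐ a ⊕ b ⊖ c ⟹ a ≼ # 8 ⟹ b ≼ # 8 ⟹ c ≐ 6 ⊙ m ⊖ # 1 ⟹ # 3 ≼ m ⟹ r ⊕ # 1 ≼ # 0)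
            (pair-ρ x≢) (p≤8 (L x₁)) (p≤8 (L x₂)) (cost≡6m-1 (m x₁ x₂) m≥1) q)))

-- Rings of low vertices

module Rings {n : ℕ} (st : State n) where
  open State st
  open Gap₃ st
  open EdgeLemma st
  open LowVertices st

  private
    variable
      S B X W : VSet n

  -- A minimal set of low vertices spanning at least as many edges as vertices; it induces a cycle.
  record Ring (X : VSet n) : Set where
    field
      X⊆     : X ⊆ A
      x₀     : Fin n
      x₀∈    : x₀ ∈ X
      low-x  : ∀ {x} → x ∈ X → deg x A ≡ ∣ L x ∣
      two-x  : ∀ {x} → x ∈ X → deg x X ≡ + 2
      simple : ∀ {x x'} → x ∈ X → x' ∈ X → + m x x' ≤ 1ℤ
      sparse : ∀ {Z z x} → Z ⊆ X → z ∈ Z → x ∈ X → x ∉ Z → + 2 * ∣ Z ∣ ≤ ∑S Z (λ z → deg z Z) + 1ℤ → R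

  module OnRing {X : VSet n} (ring : Ring X) where
    open Ring ring

    rest : VSet n
    rest = A ∖ X

    rest-proper : x₀ ∉ rest
    rest-proper = not-in (λ q → absurd∈ x₀∈ (∖ʳ {A = A} q))

    outdeg : ∀ {x} → x ∈ X → deg x rest + + 2 ≡ ∣ L x ∣
    outdeg {x} x∈ = lin (deg x A ∷ deg x X ∷ deg x rest ∷ ∣ L x ∣ ∷ [])
      (λ a b c l → a ≐ b ⊕ c ⟹ b ≐ # 2 ⟹ a ≐ l ⟹ c ⊕ # 2 ≐ l) (deg-split x X⊆) (two-x x∈) (low-x x∈)

    two-left : ∀ (φ : Fin n → Colour) {x} → x ∈ X → + 2 ≤ ∣ residual L rest φ x ∣
    two-left φ {x} x∈ = lin (deg x rest ∷ ∣ L x ∣ ∷ ∣ residual L rest φ x ∣ ∷ [])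
      (λ d l r → d ⊕ # 2 ≐ l ⟹ l ≼ r ⊕ d ⟹ # 2 ≼ r) (outdeg x∈) (residual-card L rest φ x)

    -- Colour x by α and then the rest of the cycle, ending at x', where α takes nothing away.
    ringColour : ∀ (K : Lists) {x x' α} → (∀ {v} → v ∈ X → + 2 ≤ ∣ K v ∣) → x ∈ X → x' ∈ X → 1ℤ ≤ + m x x' → α ∈ K x →
                 (∀ {β} → β ∈ K x' → β ∉ M x α x') → (Colouring K X → R) → R
    ringColour K {x} {x'} {α} big x∈ x'∈ adjacent α∈ free k = go (degenerate _ K° Y₀ (ℤp.≤-reflexive (sym (ℤp.0≤i⇒+∣i∣≡i card-nonneg))))
      where
      φ : Colouring K ⟨ x ⟩
      φ = colourPoint α∈
      K° : Lists
      K° = residual K ⟨ x ⟩ (col φ)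
      Y₀ : VSet n
      Y₀ = X ∖ ⟨ x ⟩
      cover : X ⊆ ⟨ x ⟩ ∪ Y₀
      cover {v} h with dec∈ v ⟨ x ⟩
      ... | inj₁ q = ∪ˡ {A = ⟨ x ⟩} q
      ... | inj₂ q = ∪ʳ {A = ⟨ x ⟩} (∖-intro h q)
      left : ∀ {v} → v ∈ X → + 2 ≤ ∣ K° v ∣ + + m v x
      left {v} v∈ = lin (∣ K v ∣ ∷ ∣ K° v ∣ ∷ deg v ⟨ x ⟩ ∷ + m v x ∷ [])
        (λ a b d e → # 2 ≼ a ⟹ a ≼ b ⊕ d ⟹ d ≐ e ⟹ # 2 ≼ b ⊕ e) (big v∈) (residual-card K ⟨ x ⟩ (col φ) v) (S-point x _)
      keeps : K x' ⊆ K° x'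
      keeps {β} β∈ = ∖-intro β∈ (not-in (λ q → clash (blocked-elim {⟨ x ⟩} q)))
        where
        clash : ∃[ s ] s ∈ ⟨ x ⟩ × β ∈ M s α x' → ⊥
        clash (s , s∈ , q) = absurd∈ (subst (λ s → β ∈ M s α x') (⟨⟩-elim s∈) q) (free β∈)
      x'∈Y₀ : x' ∈ Y₀
      x'∈Y₀ = ∖-intro x'∈ (∉⟨⟩ (nonself adjacent ∘ sym))
      Y₀-deg : ∀ v → v ∈ X → deg v Y₀ + + m v x ≡ + 2
      Y₀-deg v v∈ = lin (deg v X ∷ deg v (X ∩ ⟨ x ⟩) ∷ deg v Y₀ ∷ deg v ⟨ x ⟩ ∷ + m v x ∷ [])
        (λ a i b o e → a ≐ # 2 ⟹ a ≐ i ⊕ b ⟹ i ≐ o ⟹ o ≐ e ⟹ b ⊕ e ≐ # 2)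
        (two-x v∈) (S-split X ⟨ x ⟩ (λ u → + m v u)) (S-ext⊆ {A = X ∩ ⟨ x ⟩} {⟨ x ⟩} (∩ʳ {A = X}) (λ q → ∩-intro (⟨⟩-⊆ x∈ q) q)) (S-point x _)
      go : Colouring K° Y₀ ⊎ (∃[ Y ] Y ⊆ Y₀ × (∃[ y ] y ∈ Y) × (∀ {v} → v ∈ Y → ∣ K° v ∣ ≤ deg v Y)) → R
      go (inj₁ ψ) = k (restrict (λ _ c → c) cover (combine φ (λ q → not-in (λ z → absurd∈ q (∖ʳ {A = X} z))) ψ))
      -- Greedy colouring is stuck on `Y`. Every vertex there has at least two edges to `Y` and `x`
      -- together, while `x` has at most one edge to `Y` because `x'` kept its whole list and is not
      -- in `Y`. So `Y` has as many edges as vertices, against `sparse`.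
      go (inj₂ (Y , Y⊆ , (y , y∈) , short)) = sparse (λ q → ∖ˡ {A = X} (Y⊆ q)) y∈ x'∈ x'∉Y
        (lin (∣ Y ∣ ∷ ∑S Y (λ z → deg z Y) ∷ ∑S Y (λ z → deg z Y + + m z x) ∷ ∑S Y (λ z → + m z x) ∷ deg x Y ∷ deg x Y₀ ∷ + m x x ∷ + m x x' ∷ deg x (Y ∪ ⟨ x' ⟩) ∷ deg x ⟨ x' ⟩ ∷ ∑S Y (λ _ → + 2 * 1ℤ) ∷ [])
          (λ c s t u d d₀ z e w o cc → cc ≐ 2 ⊙ c ⟹ cc ≼ t ⟹ t ≐ s ⊕ u ⟹ u ≐ d ⟹ w ≐ d ⊕ o ⟹ o ≐ e ⟹ w ≼ d₀ ⟹ d₀ ⊕ z ≐ # 2 ⟹ z ≐ # 0 ⟹ # 1 ≼ e ⟹ 2 ⊙ c ≼ s ⊕ # 1)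
          (trans (S-* Y (+ 2) (λ _ → 1ℤ)) (cong (λ t → + 2 * t) (sym (card-sum Y))))
          (S-mono {A = Y} (λ {v} v∈ → lin (∣ K° v ∣ ∷ deg v Y ∷ + m v x ∷ []) (λ a d e → # 2 ≼ a ⊕ e ⟹ a ≼ d ⟹ # 2 ≼ d ⊕ e) (left (∖ˡ {A = X} (Y⊆ v∈))) (short v∈)))
          (S-+ Y (λ z → deg z Y) (λ z → + m z x))
          (S-cong {A = Y} (λ {z} _ → cong +_ (m-sym z x)))
          (S-∪ (disjoint-⟨⟩ x'∉Y) (λ u → + m x u)) (S-point x' _)
          (deg-⊆ (λ q → [ Y⊆ , ⟨⟩-⊆ x'∈Y₀ ]′ (∪-elim {A = Y} q))) (Y₀-deg x x∈) (cong +_ (m-irr x)) adjacent)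
        where
        x'∉Y : x' ∉ Y
        x'∉Y = not-in (λ q → lin (∣ K x' ∣ ∷ ∣ K° x' ∣ ∷ deg x' Y ∷ deg x' Y₀ ∷ + m x' x ∷ + m x x' ∷ [])
          (λ a b d d₀ e e' → # 2 ≼ a ⟹ a ≼ b ⟹ b ≼ d ⟹ d ≼ d₀ ⟹ d₀ ⊕ e ≐ # 2 ⟹ e ≐ e' ⟹ # 1 ≼ e' ⟹ contra)
          (big x'∈) (card-mono keeps) (short q) (deg-⊆ Y⊆) (Y₀-deg x' x'∈) (cong +_ (m-sym x' x)) adjacent)

    -- Connectedness of the ring: if no edge left `Z`, the inner degrees would add up to `2 |Z|`,
    -- and `Z` would be as dense as the whole ring.
    crossing : ∀ {Z z x} → Z ⊆ X → z ∈ Z → x ∈ X → x ∉ Z → (∀ {u v} → u ∈ Z → v ∈ X → v ∉ Z → 1ℤ ≤ + m u v → R) → R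
    crossing {Z} {z} {x} zx z∈ x∈ x∉ k with dec≤ (+ 2 * ∣ Z ∣) (∑S Z (λ z → deg z Z) + 1ℤ)
    ... | inj₁ h = sparse zx z∈ x∈ x∉ h
    ... | inj₂ h = found (S-find {A = Z} {f = λ z → deg z (X ∖ Z)} (lin
            (∣ Z ∣ ∷ ∑S Z (λ z → deg z Z) ∷ ∑S Z (λ z → deg z (X ∖ Z)) ∷ ∑S Z (λ z → deg z Z + deg z (X ∖ Z)) ∷ ∑S Z (λ _ → + 2 * 1ℤ) ∷ [])
            (λ c s d t cc → cc ≐ 2 ⊙ c ⟹ cc ≐ t ⟹ t ≐ s ⊕ d ⟹ s ⊕ # 1 ⊕ # 1 ≼ 2 ⊙ c ⟹ # 1 ≼ d)
            (trans (S-* Z (+ 2) (λ _ → 1ℤ)) (cong (λ t → + 2 * t) (sym (card-sum Z))))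
            (S-cong {A = Z} {f = λ _ → + 2 * 1ℤ} {g = λ z → deg z Z + deg z (X ∖ Z)} (λ {v} v∈ → lin (deg v X ∷ deg v (X ∩ Z) ∷ deg v Z ∷ deg v (X ∖ Z) ∷ [])
              (λ a i z d → a ≐ # 2 ⟹ a ≐ i ⊕ d ⟹ i ≐ z ⟹ # 2 ≐ z ⊕ d)
              (two-x (zx v∈)) (S-split X Z (λ u → + m v u)) (S-ext⊆ {A = X ∩ Z} {Z} (∩ʳ {A = X}) (λ q → ∩-intro (zx q) q))))
            (S-+ Z (λ z → deg z Z) (λ z → deg z (X ∖ Z))) h))
      where
      found : (∃[ u ] u ∈ Z × 1ℤ ≤ deg u (X ∖ Z)) → R
      found (u , u∈ , d) with S-find {A = X ∖ Z} d
      ... | v , v∈ , e = k u∈ (∖ˡ {A = X} v∈) (∖ʳ {A = X} v∈) e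

    e-ring : Mu.e X ≡ ∣ X ∣
    e-ring = lin (Mu.e X ∷ Mu.D X X ∷ ∑S X (λ v → deg v X) ∷ ∑S X (λ _ → + 2 * 1ℤ) ∷ ∣ X ∣ ∷ [])
      (λ e d s t c → 2 ⊙ e ≐ d ⟹ d ≐ s ⟹ s ≐ t ⟹ t ≐ 2 ⊙ c ⟹ e ≐ c)
      (Mu.e-double X) (D-deg X X) (S-cong {A = X} two-x) (trans (S-* X (+ 2) (λ _ → 1ℤ)) (cong (λ t → + 2 * t) (sym (card-sum X))))

    three≤ : + 3 ≤ ∣ X ∣
    three≤ = lin (∣ X ∣ ∷ ∣ X ∖ ⟨ x₀ ⟩ ∣ ∷ deg x₀ X ∷ deg x₀ (X ∩ ⟨ x₀ ⟩) ∷ deg x₀ (X ∖ ⟨ x₀ ⟩) ∷ deg x₀ ⟨ x₀ ⟩ ∷ + m x₀ x₀ ∷ [])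
      (λ c d a i b o z → c ≐ d ⊕ # 1 ⟹ a ≐ # 2 ⟹ a ≐ i ⊕ b ⟹ i ≼ o ⟹ o ≐ z ⟹ z ≐ # 0 ⟹ b ≼ d ⟹ # 3 ≼ c)
      (card-remove x₀∈) (two-x x₀∈) (S-split X ⟨ x₀ ⟩ (λ u → + m x₀ u)) (deg-⊆ (∩ʳ {A = X})) (S-point x₀ _) (cong +_ (m-irr x₀))
      (subst (deg x₀ (X ∖ ⟨ x₀ ⟩) ≤_) (sym (card-sum (X ∖ ⟨ x₀ ⟩))) (S-mono {A = X ∖ ⟨ x₀ ⟩} (λ v∈ → simple x₀∈ (∖ˡ {A = X} v∈))))

    ρ-ring : ∀ {P} → ∑S X (λ v → p (L v)) ≤ P → ρ L X ≤ P - + 5 * ∣ X ∣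
    ρ-ring {P} h = lin (∑S X (λ v → p (L v)) ∷ Co.e X ∷ Mu.e X ∷ ∣ X ∣ ∷ P ∷ [])
      (λ s e f c P → s ≼ P ⟹ 5 ⊙ f ≼ e ⟹ f ≐ c ⟹ s ⊖ e ≼ P ⊖ 5 ⊙ c) h (5e≤ X) e-ring

    isFull : VSet n
    isFull v = [ (λ _ → true) , (λ _ → false) ]′ (full? (L v))

    isFull-elim : ∀ {v} → v ∈ isFull → Full (L v)
    isFull-elim {v} (mk∈ h) with full? (L v)
    ... | inj₁ f = f

    notFull-elim : ∀ {v} → v ∉ isFull → p (L v) ≤ + 4 × (∣ L v ∣ ≤ + 2) × ∃[ c ] c ∉ L v
    notFull-elim {v} (mk∉ h) with full? (L v)
    ... | inj₂ f = f

    -- Next to a vertex x' with two colours, x has a colour γ that takes nothing from x';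
    -- it suffices that the outer neighbour of x leaves γ to x.
    mixed : ∀ {x x'} → x ∈ X → x' ∈ X → 1ℤ ≤ + m x x' → Full (L x) → (∃[ c ] c ∉ L x') → R
    mixed {x} {x'} x∈ x'∈ adjacent f (c , c∉) =
      let (β₁ , β₂ , only) = others₃ c
          (γ , γ∉₁ , γ∉₂) = avoid (M x' β₁ x) (M x' β₂ x) (light β₁) (light β₂)
      in outer only γ∉₁ γ∉₂ (S-find {A = rest} {f = λ u → + m x u} (ℤp.≤-reflexive (sym out≡1)))
      where
      light : ∀ β → ∣ M x' β x ∣ ≤ 1ℤ
      light β = ℤp.≤-trans (M-deg x' β x) (simple x'∈ x∈)
      out≡1 : deg x rest ≡ 1ℤ
      out≡1 = lin (deg x rest ∷ ∣ L x ∣ ∷ []) (λ d l → d ⊕ # 2 ≐ l ⟹ l ≐ # 3 ⟹ d ≐ # 1) (outdeg x∈) (full-card f)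
      outer : ∀ {β₁ β₂ γ} → (∀ b → b ≢ c → (b ≡ β₁) ⊎ (b ≡ β₂)) → γ ∉ M x' β₁ x → γ ∉ M x' β₂ x →
              (∃[ y ] y ∈ rest × 1ℤ ≤ + m x y) → R
      outer {β₁} {β₂} {γ} only γ∉₁ γ∉₂ (y , y∈ , my) =
        recolour y (killer (dec≤ ∣ M x γ y ∣ 0ℤ)) (∖ˡ {A = A}) (X⊆ x₀∈) rest-proper λ φ safe →
          ringColour (residual L rest (col φ)) (two-left (col φ)) x∈ x'∈ adjacent
            (∖-intro f (not-in (λ q → unkilled φ safe (blocked-elim {rest} q))))
            (λ {β} β∈ → not-in (λ q → clear β∈ q (only β (λ { refl → absurd∈ (∖ˡ {A = L x'} β∈) c∉ }))))
            (finish X⊆ φ)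
        where
        killer : (∣ M x γ y ∣ ≤ 0ℤ) ⊎ (0ℤ + 1ℤ ≤ ∣ M x γ y ∣) → Colour
        killer (inj₁ _) = 0F
        killer (inj₂ h) = proj₁ (card-find h)
        killer-spec : ∀ {d} q → d ∈ M x γ y → d ≡ killer q
        killer-spec (inj₁ h) d∈ = ⊥-elim (lin (∣ M x γ y ∣ ∷ []) (λ a → a ≼ # 0 ⟹ # 1 ≼ a ⟹ contra) h (card-pos d∈))
        killer-spec (inj₂ h) d∈ = card≤1-unique (ℤp.≤-trans (M-deg x γ y) (ℤp.≤-trans (deg-term {A = rest} y∈) (ℤp.≤-reflexive out≡1))) d∈ (proj₂ (card-find h))
        unkilled : ∀ (φ : Colouring L rest) → (y ∈ rest → col φ y ≢ killer (dec≤ ∣ M x γ y ∣ 0ℤ)) → ∃[ s ] s ∈ rest × γ ∈ M s (col φ s) x → ⊥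
        unkilled φ safe (s , s∈ , q) = at (unique-nbr (ℤp.≤-reflexive out≡1) y∈ my s∈ (M-pos (M-sym q))) q
          where
          at : ∀ {s} → s ≡ y → γ ∈ M s (col φ s) x → ⊥
          at refl q = safe y∈ (killer-spec (dec≤ ∣ M x γ y ∣ 0ℤ) (M-sym q))
        clear : ∀ {L' : VSet 3} {β} → β ∈ L' → β ∈ M x γ x' → (β ≡ β₁) ⊎ (β ≡ β₂) → ⊥
        clear _ q (inj₁ refl) = absurd∈ (M-sym q) γ∉₁
        clear _ q (inj₂ refl) = absurd∈ (M-sym q) γ∉₂

    -- If both kinds of lists occur, somewhere along the ring a full list is next to a shorter one,
    -- and `mixed` applies. If no list is full, the ring has potential at most `4 |X| - 5 |X|`,
    -- hence at most -3.
    allFull : ((∀ {x} → x ∈ X → Full (L x)) → R) → R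
    allFull k with ⊎-search X isFull
    ... | inj₂ h = k (λ x∈ → isFull-elim (h x∈))
    ... | inj₁ (x' , x'∈ , x'∉) with search X {λ v → v ∈ isFull} {λ v → v ∉ isFull} (λ v → dec∈ v isFull)
    ...   | inj₁ (x , x∈ , f) = crossing {X ∩ isFull} (∩ˡ {A = X}) (∩-intro x∈ f) x'∈ (not-in (λ q → absurd∈ (∩ʳ {A = X} q) x'∉))
            (λ {u} {v} u∈ v∈ v∉ e → mixed (∩ˡ {A = X} u∈) v∈ e (isFull-elim (∩ʳ {A = X} u∈))
              (proj₂ (proj₂ (notFull-elim (not-in (λ q → absurd∈ (∩-intro v∈ q) v∉))))))
    ...   | inj₂ h = small-out X⊆ x₀∈ (lin (ρ L X ∷ ∣ X ∣ ∷ []) (λ r c → r ≼ 4 ⊙ c ⊖ 5 ⊙ c ⟹ # 3 ≼ c ⟹ r ⊕ # 3 ≼ # 0)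
              (ρ-ring (subst (∑S X (λ v → p (L v)) ≤_) (trans (S-* X (+ 4) (λ _ → 1ℤ)) (cong (λ t → + 4 * t) (sym (card-sum X))))
                 (S-mono {A = X} (λ x∈ → proj₁ (notFull-elim (h x∈)))))) three≤)

    module AllFull (full-x : ∀ {x} → x ∈ X → Full (L x)) where
      out≡1 : ∀ {x} → x ∈ X → deg x rest ≡ 1ℤ
      out≡1 {x} x∈ = lin (deg x rest ∷ ∣ L x ∣ ∷ []) (λ d l → d ⊕ # 2 ≐ l ⟹ l ≐ # 3 ⟹ d ≐ # 1) (outdeg x∈) (full-card (full-x x∈))

      opaque
        nbr : Fin n → Fin n
        nbr x = [ proj₁ , (λ _ → x) ]′ (search rest {λ y → 1ℤ ≤ + m x y} {λ y → + m x y ≤ 0ℤ} (λ y → [ inj₂ , inj₁ ]′ (dec≤ (+ m x y) 0ℤ)))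

        nbr-spec : ∀ {x} → x ∈ X → (nbr x ∈ rest) × (1ℤ ≤ + m x (nbr x))
        nbr-spec {x} x∈ with search rest {λ y → 1ℤ ≤ + m x y} {λ y → + m x y ≤ 0ℤ} (λ y → [ inj₂ , inj₁ ]′ (dec≤ (+ m x y) 0ℤ))
        ... | inj₁ (y , y∈ , e) = y∈ , e
        ... | inj₂ h = ⊥-elim (lin (deg x rest ∷ ∑S rest (λ _ → 0ℤ) ∷ []) (λ d z → d ≐ # 1 ⟹ d ≼ z ⟹ z ≐ # 0 ⟹ contra)
                  (out≡1 x∈) (S-mono {A = rest} h) (S-zero {A = rest}))

      nbr∈ : ∀ {x} → x ∈ X → nbr x ∈ rest
      nbr∈ x∈ = proj₁ (nbr-spec x∈)

      nbr-unique : ∀ {x s} → x ∈ X → s ∈ rest → 1ℤ ≤ + m x s → s ≡ nbr x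
      nbr-unique x∈ = unique-nbr (ℤp.≤-reflexive (out≡1 x∈)) (nbr∈ x∈) (proj₂ (nbr-spec x∈))

      light : ∀ {x y} → x ∈ X → y ∈ rest → + m x y ≤ 1ℤ
      light x∈ y∈ = ℤp.≤-trans (deg-term y∈) (ℤp.≤-reflexive (out≡1 x∈))

      outer-matching : ∀ {x} → x ∈ X → Σ Permutation λ π → ∀ {c d} → d ∈ M (nbr x) c x → d ≡ Permutation.to π c
      outer-matching {x} x∈ = matching (subst (λ k → + k ≤ 1ℤ) (m-sym x (nbr x)) (light x∈ (nbr∈ x∈)))

      open Permutation

      others-card : ∀ (c : Colour) → ∣ All₃ ∖ ⟨ c ⟩ ∣ ≡ + 2
      others-card c = lin (∣ All₃ ∣ ∷ ∣ All₃ ∖ ⟨ c ⟩ ∣ ∷ []) (λ a b → a ≐ # 3 ⟹ a ≐ b ⊕ # 1 ⟹ b ≐ # 2) (full-card {All₃} (mk∈ refl)) (card-remove (mk∈ refl))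

      only-blocks : ∀ {x φ γ} (x∈ : x ∈ X) → γ ∈ blocked rest φ x → γ ≡ to (proj₁ (outer-matching x∈)) (φ (nbr x))
      only-blocks {x} {φ} {γ} x∈ h = at (blocked-elim {rest} h)
        where
        at : ∃[ s ] s ∈ rest × γ ∈ M s (φ s) x → γ ≡ to (proj₁ (outer-matching x∈)) (φ (nbr x))
        at (s , s∈ , q) = proj₂ (outer-matching x∈) (subst (λ s → γ ∈ M s (φ s) x) (nbr-unique x∈ s∈ (M-pos (M-sym q))) q)

      -- Sends a colour of `nbr x` to the only colour of `nbr x'` that is dangerous: the one for
      -- which the colours blocked at `x` and at `x'` are partners on the edge `x x'`.
      transfer : ∀ {x x'} → x ∈ X → x' ∈ X → Permutation
      transfer x∈ x'∈ = compose (compose (proj₁ (outer-matching x∈)) (proj₁ (matching (simple x∈ x'∈)))) (invert (proj₁ (outer-matching x'∈)))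
        where
        compose : Permutation → Permutation → Permutation
        compose σ τ = record { to = λ c → to τ (to σ c) ; from = λ c → from σ (from τ c)
          ; from-to = λ c → trans (cong (from σ) (from-to τ (to σ c))) (from-to σ c)
          ; to-from = λ c → trans (cong (to τ) (to-from σ (from τ c))) (to-from τ c) }
        invert : Permutation → Permutation
        invert σ = record { to = from σ ; from = to σ ; from-to = to-from σ ; to-from = from-to σ }

      module _ {x x'} (x∈ : x ∈ X) (x'∈ : x' ∈ X) (adjacent : 1ℤ ≤ + m x x') (φ : Colouring L rest)
               (differ : col φ (nbr x') ≢ to (transfer x∈ x'∈) (col φ (nbr x))) where
        private
          τ π π' : Permutation
          τ = proj₁ (matching (simple x∈ x'∈))
          π = proj₁ (outer-matching x∈)
          π' = proj₁ (outer-matching x'∈)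

          y y' d α : Colour
          y = col φ (nbr x)
          y' = col φ (nbr x')
          d = to π' y'
          α = from τ d

          α-free : α ≢ to π y
          α-free eq = differ (trans (sym (from-to π' y')) (cong (from π') (trans (sym (to-from τ d)) (cong (to τ) eq))))

          K₀ K : Lists
          K₀ = residual L rest (col φ)
          -- `π'` completes a partial matching, so the actual edge need not block `d`; it is removed
          -- here to leave exactly two colours.
          K = upd K₀ x' (All₃ ∖ ⟨ d ⟩)

          α∈ : α ∈ K x
          α∈ = subst (α ∈_) (sym (upd-off {L = K₀} {x'} {x} (nonself adjacent)))
                 (∖-intro (full-x x∈) (not-in (λ q → α-free (only-blocks x∈ q))))

          away : ∀ {β} → β ∈ K x' → β ≢ d
          away {β} β∈ = ∉⟨⟩-elim (∖ʳ {A = All₃} (subst (β ∈_) (upd-at {L = K₀} {x'}) β∈))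

          free : ∀ {β} → β ∈ K x' → β ∉ M x α x'
          free β∈ = not-in (λ q → away β∈ (trans (proj₂ (matching (simple x∈ x'∈)) q) (to-from τ d)))

          shorter : ∀ v → K v ⊆ K₀ v
          shorter = upd-⊆ {L = K₀} {x'} (λ {γ} γ∈ → ∖-intro (full-x x'∈)
            (not-in (λ q → ∉⟨⟩-elim (∖ʳ {A = All₃} γ∈) (only-blocks x'∈ q))))

          big : ∀ {v} → v ∈ X → + 2 ≤ ∣ K v ∣
          big {v} v∈ = upd-elim {L = K₀} {x'} {All₃ ∖ ⟨ d ⟩} (λ Z → + 2 ≤ ∣ Z ∣) v (ℤp.≤-reflexive (sym (others-card d))) (two-left (col φ) v∈)

        -- `x` receives `α`, the partner of the colour `d` that is given up at `x'` anyway. It is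
        -- available because the outer neighbours are not related by `transfer`, and it takes
        -- nothing further from `x'`.
        extends : R
        extends = ringColour K big x∈ x'∈ adjacent α∈ free (λ ψ → finish X⊆ φ (restrict (λ {v} _ → shorter v) (λ q → q) ψ))

      link : ∀ {x x'} → x ∈ X → x' ∈ X → 1ℤ ≤ + m x x' → nbr x ≢ nbr x' → (∀ W → Linked rest W (nbr x) (nbr x') → R) → R
      link x∈ x'∈ adjacent ne k = Add.addEdge (∖ˡ {A = A}) (X⊆ x₀∈) rest-proper (nbr∈ x∈) (nbr∈ x'∈) ne (transfer x∈ x'∈)
        (extends x∈ x'∈ adjacent) k

      inside : VSet n → VSet n
      inside U = X ∩ (λ x → U (nbr x))

      -- A ring of full lists has as many edges as vertices, so its potential is at most `3 |X|`;
      -- each of its vertices with outer neighbour in `U` contributes an edge to `U`.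
      ρ-with : ∀ {U} → U ⊆ rest → ρ L (U ∪ X) ≤ ρ L U + + 3 * ∣ X ∣ - + 5 * ∣ inside U ∣
      ρ-with {U} ur = lin (ρ L (U ∪ X) ∷ ρ L U ∷ ρ L X ∷ Mu.D X U ∷ ∣ X ∣ ∷ ∣ inside U ∣ ∷ ∑S (inside U) (λ x → deg x U) ∷ ∑S X (λ x → deg x U) ∷ [])
        (λ a b r d c i s t → a ≼ b ⊕ r ⊖ 5 ⊙ d ⟹ r ≼ 8 ⊙ c ⊖ 5 ⊙ c ⟹ d ≐ t ⟹ i ≼ s ⟹ s ≼ t ⟹ a ≼ b ⊕ 3 ⊙ c ⊖ 5 ⊙ i)
        (ρ-join L (λ u → ∖ʳ {A = A} (ur u))) (ρ-ring (sum-p≤ {L = L} {X})) (D-deg X U)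
        (subst (_≤ ∑S (inside U) (λ x → deg x U)) (sym (card-sum (inside U)))
          (S-mono {A = inside U} (λ {x} x∈ → ℤp.≤-trans (proj₂ (nbr-spec (∩ˡ {A = X} x∈))) (deg-term {A = U} (mk∈ (un∈ (∩ʳ {A = X} x∈)))))))
        (S-⊆ {A = inside U} {X} (∩ˡ {A = X}) (λ _ → deg≥0))

-- K₄ and kites

K₄ : Graph
K₄ = record { n = 4 ; adj = λ i j → not (i ≡ᵇ j) ; sym = λ i j → cong not (≡ᵇ-sym i j) ; irrefl = λ i → cong not (≡ᵇ-refl i) }

K₄-complete : ∀ {i j : Fin 4} → i ≢ j → adj K₄ i j ≡ true
K₄-complete ne = cong not (≡ᵇ-≢ ne)

K₄-exceptional : ∀ {n} (Γ : Cover n) (θ : Fin 4 → Fin n) {B : VSet n} → (∀ {i j} → θ i ≡ θ j → i ≡ j) → (∀ i → θ i ∈ B) →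
                 (∀ {v} → v ∈ B → ∃[ i ] θ i ≡ v) → (∀ {i j} → i ≢ j → 1ℤ ≤ + Cover.m Γ (θ i) (θ j)) → Exceptional Γ B
K₄-exceptional Γ θ inj θ∈ onto joined = record
  { G₀ = K₄ ; ore = ore-K4 (refl , λ i j → K₄-complete) ; θ = θ ; θ-inj = inj ; θ∈ = θ∈ ; θ-onto = onto
  ; θ-adj = λ {i} {j} h → joined (λ { refl → true≢false h (Graph.irrefl K₄ i) })
  ; size = inj₁ refl ; edges = twelve ; rows = three ; complete = λ _ → K₄-complete }
  where
  opaque
    unfolding ∑
    twelve : + 3 * ∑ (λ i → ∑ (λ j → χ (adj K₄ i j))) ≡ + 10 * + 4 - + 4
    twelve = refl
    three : ∀ i → + 3 ≤ ∑ (λ j → χ (adj K₄ i j))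
    three 0F = ℤp.≤-refl
    three 1F = ℤp.≤-refl
    three 2F = ℤp.≤-refl
    three 3F = ℤp.≤-refl

module Kites {n : ℕ} (st : State n) where
  open State st
  open EdgeLemma st

  module KiteFacts {W : VSet n} {y y' : Fin n} (y∈ : y ∈ W) (y'∈ : y' ∈ W) (y≢y' : y ≢ y') (κ : Kite W y y')
                   (f : ∀ {v} → v ∈ W → Full (L v)) where
    open Kite κ public

    flat : VSet n
    flat = ⟨ y' ⟩ ∪ (⟨ y ⟩ ∪ (⟨ a ⟩ ∪ ⟨ b ⟩))

    b∉a : a ∉ ⟨ b ⟩
    b∉a = ∉⟨⟩ a≢b
    y∉ : y ∉ ⟨ a ⟩ ∪ ⟨ b ⟩
    y∉ = not-in (λ q → [ (λ e → a≢y (sym (⟨⟩-elim e))) , (λ e → b≢y (sym (⟨⟩-elim e))) ]′ (∪-elim {A = ⟨ a ⟩} q))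
    y'∉ : y' ∉ ⟨ y ⟩ ∪ (⟨ a ⟩ ∪ ⟨ b ⟩)
    y'∉ = not-in (λ q → [ (λ e → y≢y' (sym (⟨⟩-elim e))) , (λ q → [ (λ e → a≢y' (sym (⟨⟩-elim e))) , (λ e → b≢y' (sym (⟨⟩-elim e))) ]′ (∪-elim {A = ⟨ a ⟩} q)) ]′ (∪-elim {A = ⟨ y ⟩} q))

    c : Fin n → Fin n → ℤ
    c u v = cost (m u v)

    sum-ab : ∀ (g : Fin n → ℤ) → ∑S (⟨ a ⟩ ∪ ⟨ b ⟩) g ≡ g a + g b
    sum-ab g = trans (S-∪ (⟨⟩-disjoint b∉a) g) (cong₂ _+_ (S-point a g) (S-point b g))

    sum-yab : ∀ (g : Fin n → ℤ) → ∑S (⟨ y ⟩ ∪ (⟨ a ⟩ ∪ ⟨ b ⟩)) g ≡ g y + (g a + g b)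
    sum-yab g = trans (S-∪ (⟨⟩-disjoint y∉) g) (cong₂ _+_ (S-point y g) (sum-ab g))

    ρ-ab : ρ L (⟨ a ⟩ ∪ ⟨ b ⟩) ≡ + 16 - c a b
    ρ-ab = trans (ρ-insert L b∉a) (trans (cong₂ _-_ (cong₂ _+_ (full-p (f a∈)) (trans (ρ-point L b) (full-p (f b∈)))) (S-point b (c a))) refl)

    ρ-yab : ρ L (⟨ y ⟩ ∪ (⟨ a ⟩ ∪ ⟨ b ⟩)) ≡ + 24 - c a b - (c y a + c y b)
    ρ-yab = lin (ρ L (⟨ y ⟩ ∪ (⟨ a ⟩ ∪ ⟨ b ⟩)) ∷ p (L y) ∷ ρ L (⟨ a ⟩ ∪ ⟨ b ⟩) ∷ ∑S (⟨ a ⟩ ∪ ⟨ b ⟩) (c y) ∷ c a b ∷ c y a ∷ c y b ∷ [])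
      (λ r q s t ab ya yb → r ≐ q ⊕ s ⊖ t ⟹ q ≐ # 8 ⟹ s ≐ # 16 ⊖ ab ⟹ t ≐ ya ⊕ yb ⟹ r ≐ # 24 ⊖ ab ⊖ (ya ⊕ yb))
      (ρ-insert L y∉) (full-p (f y∈)) ρ-ab (sum-ab (c y))

    ρ-W : ρ L W ≡ + 32 - c a b - (c y a + c y b) - (c y' y + (c y' a + c y' b))
    ρ-W = trans (ρ-ext W⊆ ⊆W) (lin (ρ L flat ∷ p (L y') ∷ ρ L (⟨ y ⟩ ∪ (⟨ a ⟩ ∪ ⟨ b ⟩)) ∷ ∑S (⟨ y ⟩ ∪ (⟨ a ⟩ ∪ ⟨ b ⟩)) (c y') ∷ c a b ∷ c y a ∷ c y b ∷ c y' y ∷ c y' a ∷ c y' b ∷ [])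
      (λ r q s t ab ya yb yy y'a y'b → r ≐ q ⊕ s ⊖ t ⟹ q ≐ # 8 ⟹ s ≐ # 24 ⊖ ab ⊖ (ya ⊕ yb) ⟹ t ≐ yy ⊕ (y'a ⊕ y'b) ⟹
         r ≐ # 32 ⊖ ab ⊖ (ya ⊕ yb) ⊖ (yy ⊕ (y'a ⊕ y'b)))
      (ρ-insert L y'∉) (full-p (f y'∈)) ρ-yab (sum-yab (c y')))
      where
      W⊆ : W ⊆ flat
      W⊆ v∈ with all v∈
      ... | inj₁ refl = ∪ʳ {A = ⟨ y' ⟩} (∪ˡ {A = ⟨ y ⟩} ∈⟨⟩)
      ... | inj₂ (inj₁ refl) = ∪ˡ {A = ⟨ y' ⟩} ∈⟨⟩
      ... | inj₂ (inj₂ (inj₁ refl)) = ∪ʳ {A = ⟨ y' ⟩} (∪ʳ {A = ⟨ y ⟩} (∪ˡ {A = ⟨ a ⟩} ∈⟨⟩))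
      ... | inj₂ (inj₂ (inj₂ refl)) = ∪ʳ {A = ⟨ y' ⟩} (∪ʳ {A = ⟨ y ⟩} (∪ʳ {A = ⟨ a ⟩} ∈⟨⟩))
      ⊆W : flat ⊆ W
      ⊆W q with ∪-elim {A = ⟨ y' ⟩} q
      ... | inj₁ e = ⟨⟩-⊆ y'∈ e
      ... | inj₂ q with ∪-elim {A = ⟨ y ⟩} q
      ...   | inj₁ e = ⟨⟩-⊆ y∈ e
      ...   | inj₂ q = [ ⟨⟩-⊆ a∈ , ⟨⟩-⊆ b∈ ]′ (∪-elim {A = ⟨ a ⟩} q)

    c≥5 : ∀ {u v} → 1ℤ ≤ + m u v → + 5 ≤ c u v
    c≥5 {u} {v} h = lin (+ m u v ∷ c u v ∷ []) (λ x y → # 1 ≼ x ⟹ 5 ⊙ x ≼ y ⟹ # 5 ≼ y) h (cost≥5m (m u v))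

    -- Four full lists and five edges give at most 32 - 25 = 7, so potential 7 leaves no room for an
    -- edge of cost above 5.
    module Exact (h : + 7 ≤ ρ L W) where
      private
        tight : ∀ t → (+ 7 ≤ + 32 - c a b - (c y a + c y b) - (c y' y + (c y' a + c y' b)) → + 5 ≤ c a b → + 5 ≤ c y a → + 5 ≤ c y b →
                  + 5 ≤ c y' a → + 5 ≤ c y' b → 0ℤ ≤ c y' y → t ≤ + 5) → t ≤ + 5
        tight t k = k (subst (+ 7 ≤_) ρ-W h) (c≥5 ab) (c≥5 ya) (c≥5 yb) (c≥5 y'a) (c≥5 y'b) (cost≥0 (m y' y))

      ab≤ : c a b ≤ + 5
      ab≤ = tight _ (lin (c a b ∷ c y a ∷ c y b ∷ c y' y ∷ c y' a ∷ c y' b ∷ []) (λ ab ya yb z y'a y'b →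
        # 7 ≼ # 32 ⊖ ab ⊖ (ya ⊕ yb) ⊖ (z ⊕ (y'a ⊕ y'b)) ⟹ # 5 ≼ ab ⟹ # 5 ≼ ya ⟹ # 5 ≼ yb ⟹ # 5 ≼ y'a ⟹ # 5 ≼ y'b ⟹ # 0 ≼ z ⟹ ab ≼ # 5))
      ya≤ : c y a ≤ + 5
      ya≤ = tight _ (lin (c a b ∷ c y a ∷ c y b ∷ c y' y ∷ c y' a ∷ c y' b ∷ []) (λ ab ya yb z y'a y'b →
        # 7 ≼ # 32 ⊖ ab ⊖ (ya ⊕ yb) ⊖ (z ⊕ (y'a ⊕ y'b)) ⟹ # 5 ≼ ab ⟹ # 5 ≼ ya ⟹ # 5 ≼ yb ⟹ # 5 ≼ y'a ⟹ # 5 ≼ y'b ⟹ # 0 ≼ z ⟹ ya ≼ # 5))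
      yb≤ : c y b ≤ + 5
      yb≤ = tight _ (lin (c a b ∷ c y a ∷ c y b ∷ c y' y ∷ c y' a ∷ c y' b ∷ []) (λ ab ya yb z y'a y'b →
        # 7 ≼ # 32 ⊖ ab ⊖ (ya ⊕ yb) ⊖ (z ⊕ (y'a ⊕ y'b)) ⟹ # 5 ≼ ab ⟹ # 5 ≼ ya ⟹ # 5 ≼ yb ⟹ # 5 ≼ y'a ⟹ # 5 ≼ y'b ⟹ # 0 ≼ z ⟹ yb ≼ # 5))

      -- The part of W in a set that contains y but not y' is {y}, {y,a}, {y,b} or {y,a,b}.
      part : ∀ {Z} → Z ⊆ W → y ∈ Z → y' ∉ Z → (Z ⊆ ⟨ y ⟩ × ρ L Z ≡ + 8) ⊎ (+ 9 ≤ ρ L Z)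
      part {Z} zw y∈Z y'∉Z with dec∈ a Z | dec∈ b Z
      ... | inj₂ a∉ | inj₂ b∉ = inj₁ (only , trans (ρ-ext only (⟨⟩-⊆ y∈Z)) (trans (ρ-point L y) (full-p (f y∈))))
        where
        only : Z ⊆ ⟨ y ⟩
        only v∈ with all (zw v∈)
        ... | inj₁ refl = ∈⟨⟩
        ... | inj₂ (inj₁ refl) = absurd∈ v∈ y'∉Z
        ... | inj₂ (inj₂ (inj₁ refl)) = absurd∈ v∈ a∉
        ... | inj₂ (inj₂ (inj₂ refl)) = absurd∈ v∈ b∉
      ... | inj₁ a∈Z | inj₁ b∈Z = inj₂ (lin (ρ L Z ∷ ρ L (⟨ y ⟩ ∪ (⟨ a ⟩ ∪ ⟨ b ⟩)) ∷ c a b ∷ c y a ∷ c y b ∷ [])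
            (λ z r ab ya yb → z ≐ r ⟹ r ≐ # 24 ⊖ ab ⊖ (ya ⊕ yb) ⟹ ab ≼ # 5 ⟹ ya ≼ # 5 ⟹ yb ≼ # 5 ⟹ # 9 ≼ z) (ρ-ext only back) ρ-yab ab≤ ya≤ yb≤)
        where
        only : Z ⊆ ⟨ y ⟩ ∪ (⟨ a ⟩ ∪ ⟨ b ⟩)
        only v∈ with all (zw v∈)
        ... | inj₁ refl = ∪ˡ {A = ⟨ y ⟩} ∈⟨⟩
        ... | inj₂ (inj₁ refl) = absurd∈ v∈ y'∉Z
        ... | inj₂ (inj₂ (inj₁ refl)) = ∪ʳ {A = ⟨ y ⟩} (∪ˡ {A = ⟨ a ⟩} ∈⟨⟩)
        ... | inj₂ (inj₂ (inj₂ refl)) = ∪ʳ {A = ⟨ y ⟩} (∪ʳ {A = ⟨ a ⟩} ∈⟨⟩)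
        back : ⟨ y ⟩ ∪ (⟨ a ⟩ ∪ ⟨ b ⟩) ⊆ Z
        back q = [ ⟨⟩-⊆ y∈Z , (λ q → [ ⟨⟩-⊆ a∈Z , ⟨⟩-⊆ b∈Z ]′ (∪-elim {A = ⟨ a ⟩} q)) ]′ (∪-elim {A = ⟨ y ⟩} q)
      ... | inj₁ a∈Z | inj₂ b∉ = inj₂ (two-points a≢y a∈Z a∈ ya≤ only)
        where
        only : Z ⊆ ⟨ y ⟩ ∪ ⟨ a ⟩
        only v∈ with all (zw v∈)
        ... | inj₁ refl = ∪ˡ {A = ⟨ y ⟩} ∈⟨⟩
        ... | inj₂ (inj₁ refl) = absurd∈ v∈ y'∉Z
        ... | inj₂ (inj₂ (inj₁ refl)) = ∪ʳ {A = ⟨ y ⟩} ∈⟨⟩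
        ... | inj₂ (inj₂ (inj₂ refl)) = absurd∈ v∈ b∉
        two-points : ∀ {a} → a ≢ y → a ∈ Z → a ∈ W → c y a ≤ + 5 → Z ⊆ ⟨ y ⟩ ∪ ⟨ a ⟩ → + 9 ≤ ρ L Z
        two-points {a} ne a∈Z a∈W q only = lin (ρ L Z ∷ ρ L (⟨ y ⟩ ∪ ⟨ a ⟩) ∷ p (L y) ∷ ρ L ⟨ a ⟩ ∷ p (L a) ∷ ∑S ⟨ a ⟩ (c y) ∷ c y a ∷ [])
          (λ z r py ra pa s ya → z ≐ r ⟹ r ≐ py ⊕ ra ⊖ s ⟹ py ≐ # 8 ⟹ ra ≐ pa ⟹ pa ≐ # 8 ⟹ s ≐ ya ⟹ ya ≼ # 5 ⟹ # 9 ≼ z)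
          (ρ-ext only (λ q → [ ⟨⟩-⊆ y∈Z , ⟨⟩-⊆ a∈Z ]′ (∪-elim {A = ⟨ y ⟩} q))) (ρ-insert L (∉⟨⟩ (ne ∘ sym))) (full-p (f y∈)) (ρ-point L a) (full-p (f a∈W)) (S-point a (c y)) q
      ... | inj₂ a∉ | inj₁ b∈Z = inj₂ (two-points b≢y b∈Z b∈ yb≤ only)
        where
        only : Z ⊆ ⟨ y ⟩ ∪ ⟨ b ⟩
        only v∈ with all (zw v∈)
        ... | inj₁ refl = ∪ˡ {A = ⟨ y ⟩} ∈⟨⟩
        ... | inj₂ (inj₁ refl) = absurd∈ v∈ y'∉Z
        ... | inj₂ (inj₂ (inj₁ refl)) = absurd∈ v∈ a∉
        ... | inj₂ (inj₂ (inj₂ refl)) = ∪ʳ {A = ⟨ y ⟩} ∈⟨⟩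
        two-points : ∀ {a} → a ≢ y → a ∈ Z → a ∈ W → c y a ≤ + 5 → Z ⊆ ⟨ y ⟩ ∪ ⟨ a ⟩ → + 9 ≤ ρ L Z
        two-points {a} ne a∈Z a∈W q only = lin (ρ L Z ∷ ρ L (⟨ y ⟩ ∪ ⟨ a ⟩) ∷ p (L y) ∷ ρ L ⟨ a ⟩ ∷ p (L a) ∷ ∑S ⟨ a ⟩ (c y) ∷ c y a ∷ [])
          (λ z r py ra pa s ya → z ≐ r ⟹ r ≐ py ⊕ ra ⊖ s ⟹ py ≐ # 8 ⟹ ra ≐ pa ⟹ pa ≐ # 8 ⟹ s ≐ ya ⟹ ya ≼ # 5 ⟹ # 9 ≼ z)
          (ρ-ext only (λ q → [ ⟨⟩-⊆ y∈Z , ⟨⟩-⊆ a∈Z ]′ (∪-elim {A = ⟨ y ⟩} q))) (ρ-insert L (∉⟨⟩ (ne ∘ sym))) (full-p (f y∈)) (ρ-point L a) (full-p (f a∈W)) (S-point a (c y)) q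

-- Linked sets chained around a ring

module RingChain {n : ℕ} (st : State n) where
  open State st
  open Gap₃ st
  open EdgeLemma st
  open LowVertices st
  open Rings st
  open Kites st

  module Chain {X : VSet n} (ring : Ring X) (full-x : ∀ {x} → x ∈ X → Full (L x)) where
    open Ring ring
    open OnRing ring public
    open AllFull full-x public

    in-rest : ∀ {Z z} → Z ⊆ rest → z ∈ Z → ρ L Z ≤ μ + + 5 → R
    in-rest zr z∈ h = gap₃ (λ q → ∖ˡ {A = A} (zr q)) z∈ (X⊆ x₀∈) (not-in (λ q → absurd∈ x₀∈ (∖ʳ {A = A} (zr q)))) h

    -- Gluing W (linked at y ∈ U and y' ∉ U) to U raises the potential by at most −μ.
    glue : ∀ {U W y y'} → U ⊆ rest → y ∈ U → y' ∉ U → Linked rest W y y' → (ρ L (U ∪ W) ≤ ρ L U - μ ⊎ (ρ L (U ∪ W) + 1ℤ ≤ ρ L U) → R) → R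
    glue {U} {W} {y} {y'} ur y∈U y'∉U link k = go (dec≤ (ρ L W) (+ 6))
      where
      open Linked link
      y∈∩ : y ∈ U ∩ W
      y∈∩ = ∩-intro y∈U y∈
      go : (ρ L W ≤ + 6) ⊎ (+ 6 + 1ℤ ≤ ρ L W) → R
      -- The intersection avoids the ring and is thus a proper subset, so `gap₃` leaves only
      -- potential at least `μ + 6`, which offsets the potential of `W` up to `-μ`.
      go (inj₁ h) with dec≤ (ρ L (U ∩ W)) (μ + + 5)
      ... | inj₁ low-∩ = in-rest (λ q → ur (∩ˡ {A = U} q)) y∈∩ low-∩
      ... | inj₂ high = k (inj₁ (lin (ρ L (U ∪ W) ∷ ρ L (U ∩ W) ∷ ρ L U ∷ ρ L W ∷ μ ∷ [])
              (λ j i u w μ → j ⊕ i ≼ u ⊕ w ⟹ w ≼ # 6 ⟹ μ ⊕ # 5 ⊕ # 1 ≼ i ⟹ j ≼ u ⊖ μ) (ρ-submodular L U W) h high))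
      go (inj₂ h) with kind
      ... | inj₂ (inj₁ (_ , q)) = ⊥-elim (lin (ρ L W ∷ []) (λ w → w ≼ # 6 ⟹ # 7 ≼ w ⟹ contra) q h)
      ... | inj₂ (inj₂ q) = ⊥-elim (lin (ρ L W ∷ []) (λ w → w ≼ # 5 ⟹ # 7 ≼ w ⟹ contra) q h)
      -- An exact kite has potential 7, one more than the gap can absorb. But its part inside `U`
      -- contains `y` and not `y'`, and such parts have potential at least 8.
      ... | inj₁ (κ , q) = k (inj₂ (lin (ρ L (U ∪ W) ∷ ρ L (U ∩ W) ∷ ρ L U ∷ ρ L W ∷ [])
              (λ j i u w → j ⊕ i ≼ u ⊕ w ⟹ w ≼ # 7 ⟹ # 8 ≼ i ⟹ j ⊕ # 1 ≼ u) (ρ-submodular L U W) q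
              ([ (λ z → ℤp.≤-reflexive (sym (proj₂ z))) , ℤp.≤-trans (+≤+ (ℕ.s≤s (ℕ.s≤s (ℕ.s≤s (ℕ.s≤s (ℕ.s≤s (ℕ.s≤s (ℕ.s≤s (ℕ.s≤s ℕ.z≤n))))))))) ]′
                 (KiteFacts.Exact.part y∈ y'∈ (λ { refl → absurd∈ y∈U y'∉U }) κ all-full h (∩ʳ {A = U}) y∈∩ (not-in (λ z → absurd∈ (∩ˡ {A = U} z) y'∉U))))))

    -- s bounds −μ; the union of the linked sets reached so far keeps ρ L U ≤ 7 + s (q − 2), q = ∣ inside U ∣.
    module _ (s : ℕ) (s≥ : 0ℤ ≤ μ + + s) where
      grow : ∀ k U → U ⊆ rest → (∀ {v} → v ∈ U → Full (L v)) → + 2 ≤ ∣ inside U ∣ → ρ L U + + 2 * + s ≤ + 7 + + s * ∣ inside U ∣ → ∣ X ∣ ≤ ∣ inside U ∣ + + k →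
             (∀ U → U ⊆ rest → (∀ {v} → v ∈ U → Full (L v)) → X ⊆ inside U → ρ L U + + 2 * + s ≤ + 7 + + s * ∣ X ∣ → R) → R
      grow k U ur uf two≤ bound fuel done′ = go k fuel (⊎-search X (inside U))
        where
        go : ∀ k → ∣ X ∣ ≤ ∣ inside U ∣ + + k → (∃[ v ] v ∈ X × v ∉ inside U) ⊎ (X ⊆ inside U) → R
        go k fuel (inj₂ all-in) = done′ U ur uf all-in (subst (λ t → ρ L U + + 2 * + s ≤ + 7 + + s * t)
          (ℤp.≤-antisym (card-mono (∩ˡ {A = X})) (card-mono all-in)) bound)
        go zero fuel (inj₁ (v , v∈ , v∉)) = ⊥-elim (lin (∣ X ∣ ∷ ∣ inside U ∣ ∷ []) (λ x i → x ≼ i ⊕ # 0 ⟹ i ⊕ # 1 ≼ x ⟹ contra)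
          fuel (proper-card (∩ˡ {A = X}) v∈ v∉))
        go (suc k) fuel (inj₁ (v , v∈ , v∉)) = start (card-find (ℤp.≤-trans (+≤+ (ℕ.s≤s ℕ.z≤n)) two≤))
          where
          start : ∃[ u ] u ∈ inside U → R
          start (u , u∈) = crossing (∩ˡ {A = X}) u∈ v∈ v∉ λ {a} {b} a∈ b∈ b∉ adjacent →
            let nb∉ = not-in {A = U} {nbr b} (λ q → absurd∈ (∩-intro b∈ (mk∈ (un∈ q))) b∉)
                na∈ = mk∈ {v = nbr a} {A = U} (un∈ (∩ʳ {A = X} a∈))
            in link (∩ˡ {A = X} a∈) b∈ adjacent (∈-≢ na∈ nb∉) λ W linked →
                 glue ur na∈ nb∉ linked λ step → next W linked b∈ b∉ step
            where
            next : ∀ W {a b} → Linked rest W (nbr a) (nbr b) → b ∈ X → b ∉ inside U →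
                   (ρ L (U ∪ W) ≤ ρ L U - μ) ⊎ (ρ L (U ∪ W) + 1ℤ ≤ ρ L U) → R
            next W {a} {b} linked b∈ b∉ step = grow k (U ∪ W) (λ q → [ ur , Linked.W⊆ linked ]′ (∪-elim {A = U} q))
              (λ q → [ uf , Linked.all-full linked ]′ (∪-elim {A = U} q))
              (ℤp.≤-trans two≤ (card-mono wider))
              (lin (ρ L (U ∪ W) ∷ ρ L U ∷ + s ∷ + s * ∣ inside U ∣ ∷ + s * ∣ inside (U ∪ W) ∣ ∷ [])
                (λ j u s q q' → j ≼ u ⊕ s ⟹ u ⊕ 2 ⊙ s ≼ # 7 ⊕ q ⟹ q ⊕ s ≼ q' ⟹ j ⊕ 2 ⊙ s ≼ # 7 ⊕ q') raise bound rise)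
              (lin (∣ X ∣ ∷ ∣ inside U ∣ ∷ ∣ inside (U ∪ W) ∣ ∷ + k ∷ []) (λ x i i' k → x ≼ i ⊕ (# 1 ⊕ k) ⟹ i ⊕ # 1 ≼ i' ⟹ x ≼ i' ⊕ k) fuel more) done′
              where
              wider : inside U ⊆ inside (U ∪ W)
              wider {x} q = ∩-intro (∩ˡ {A = X} q) (mk∈ (un∈ (∪ˡ {A = U} {W} {nbr x} (mk∈ (un∈ (∩ʳ {A = X} q))))))
              more : ∣ inside U ∣ + 1ℤ ≤ ∣ inside (U ∪ W) ∣
              more = proper-card wider (∩-intro b∈ (mk∈ (un∈ (∪ʳ {A = U} {W} {nbr b} (Linked.y'∈ linked))))) b∉
              rise : + s * ∣ inside U ∣ + + s ≤ + s * ∣ inside (U ∪ W) ∣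
              rise = subst (_≤ + s * ∣ inside (U ∪ W) ∣) (trans (ℤp.*-distribˡ-+ (+ s) ∣ inside U ∣ 1ℤ) (cong (λ t → + s * ∣ inside U ∣ + t) (ℤp.*-identityʳ (+ s))))
                (ℤp.*-monoˡ-≤-nonNeg (+ s) more)
              raise : ρ L (U ∪ W) ≤ ρ L U + + s
              raise = [ (λ h → lin (ρ L (U ∪ W) ∷ ρ L U ∷ μ ∷ + s ∷ []) (λ j u μ s → j ≼ u ⊖ μ ⟹ # 0 ≼ μ ⊕ s ⟹ j ≼ u ⊕ s) h s≥) ,
                        (λ h → lin (ρ L (U ∪ W) ∷ ρ L U ∷ + s ∷ []) (λ j u s → j ⊕ # 1 ≼ u ⟹ # 0 ≼ s ⟹ j ≼ u ⊕ s) h (+≤+ ℕ.z≤n)) ]′ step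

      module _ (reached : ∀ U → U ⊆ rest → (∀ {v} → v ∈ U → Full (L v)) → X ⊆ inside U → ρ L U + + 2 * + s ≤ + 7 + + s * ∣ X ∣ → R)
               (wheel : ∀ y → y ∈ rest → (∀ {x} → x ∈ X → nbr x ≡ y) → R) where
        -- Either all ring vertices have the same outer neighbour, which gives a wheel, or two
        -- adjacent ones have different outer neighbours and yield a first linked set, of potential
        -- at most 7 and serving at least two ring vertices.
        chain : R
        chain with search X {λ x → nbr x ≢ nbr x₀} {λ x → nbr x ≡ nbr x₀} (λ x → [ inj₂ , inj₁ ]′ (eq? x))
          where
          eq? : ∀ x → (nbr x ≡ nbr x₀) ⊎ (nbr x ≢ nbr x₀)
          eq? x with nbr x Finp.≟ nbr x₀
          ... | yes e = inj₁ e
          ... | no ne = inj₂ ne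
        ... | inj₂ same = wheel (nbr x₀) (nbr∈ x₀∈) same
        ... | inj₁ (x , x∈ , differ) = crossing {inside ⟨ nbr x₀ ⟩} (∩ˡ {A = X}) (∩-intro x₀∈ (mk∈ (un∈ (∈⟨⟩ {a = nbr x₀})))) x∈
                (not-in (λ q → differ (⟨⟩-elim (mk∈ {A = ⟨ nbr x₀ ⟩} (un∈ (∩ʳ {A = X} q))))))
                λ {a} {b} a∈ b∈ b∉ adjacent → begin-link a∈ b∈ b∉ adjacent
          where
          begin-link : ∀ {a b} → a ∈ inside ⟨ nbr x₀ ⟩ → b ∈ X → b ∉ inside ⟨ nbr x₀ ⟩ → 1ℤ ≤ + m a b → R
          begin-link {a} {b} a∈ b∈ b∉ adjacent = link (∩ˡ {A = X} a∈) b∈ adjacent ne λ W linked →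
            grow _ W (Linked.W⊆ linked) (Linked.all-full linked) (two-inside W linked)
              (lin (ρ L W ∷ + s ∷ + s * ∣ inside W ∣ ∷ [])
                (λ w s q → w ≼ # 7 ⟹ 2 ⊙ s ≼ q ⟹ w ⊕ 2 ⊙ s ≼ # 7 ⊕ q) (seven linked)
                (subst (_≤ + s * ∣ inside W ∣) (ℤp.*-comm (+ s) (+ 2)) (ℤp.*-monoˡ-≤-nonNeg (+ s) (two-inside W linked))))
              (lin (∣ X ∣ ∷ ∣ inside W ∣ ∷ + ℤ.∣ ∣ X ∣ ∣ ∷ []) (λ x i k → # 0 ≼ i ⟹ k ≐ x ⟹ x ≼ i ⊕ k) (card-nonneg {A = inside W}) (ℤp.0≤i⇒+∣i∣≡i card-nonneg))
              reached
            where
            ne : nbr a ≢ nbr b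
            ne e = absurd∈ (∩-intro b∈ (mk∈ (un∈ (subst (_∈ ⟨ nbr x₀ ⟩) e (mk∈ {v = nbr a} (un∈ (∩ʳ {A = X} a∈))))))) b∉
            seven : ∀ {W} → Linked rest W (nbr a) (nbr b) → ρ L W ≤ + 7
            seven linked with Linked.kind linked
            ... | inj₁ (_ , q) = q
            ... | inj₂ (inj₁ (_ , q)) = ℤp.≤-trans q (ℤp.≤ᵇ⇒≤ _)
            ... | inj₂ (inj₂ q) = ℤp.≤-trans q (ℤp.≤ᵇ⇒≤ _)
            two-inside : ∀ W → Linked rest W (nbr a) (nbr b) → + 2 ≤ ∣ inside W ∣
            two-inside W linked = ℤp.≤-trans (ℤp.≤-reflexive (sym (trans (card-∪ (disjoint-⟨⟩ (∉⟨⟩ (λ e → ne (cong nbr (sym e)))))) (cong₂ _+_ (card-point a) (card-point b)))))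
              (card-mono {A = ⟨ a ⟩ ∪ ⟨ b ⟩} (λ q → [ ⟨⟩-⊆ (∩-intro (∩ˡ {A = X} a∈) (mk∈ (un∈ (Linked.y∈ linked)))) , ⟨⟩-⊆ (∩-intro b∈ (mk∈ (un∈ (Linked.y'∈ linked)))) ]′ (∪-elim {A = ⟨ a ⟩} q)))

    ρ-closed : ∀ {U} → U ⊆ rest → X ⊆ inside U → ρ L (U ∪ X) ≤ ρ L U - + 2 * ∣ X ∣
    ρ-closed {U} ur all-in = lin (ρ L (U ∪ X) ∷ ρ L U ∷ ∣ X ∣ ∷ ∣ inside U ∣ ∷ [])
      (λ a b x i → a ≼ b ⊕ 3 ⊙ x ⊖ 5 ⊙ i ⟹ x ≼ i ⟹ a ≼ b ⊖ 2 ⊙ x) (ρ-with ur) (card-mono all-in)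

-- Wheels and the exclusion of rings

module RingWorlds {n : ℕ} (st : State n) where
  open State st
  open Gap₃ st
  open EdgeLemma st
  open LowVertices st
  open Rings st
  open Kites st
  open RingChain st

  K₄-out : ∀ {a b c d} → a ∈ A → b ∈ A → c ∈ A → d ∈ A → 1ℤ ≤ + m a b → 1ℤ ≤ + m a c → 1ℤ ≤ + m a d →
           1ℤ ≤ + m b c → 1ℤ ≤ + m b d → 1ℤ ≤ + m c d → R
  K₄-out {a} {b} {c} {d} a∈ b∈ c∈ d∈ ab ac ad bc bd cd =
    out (B , B⊆ , (a , ∪ˡ {A = ⟨ a ⟩} ∈⟨⟩) , inj₂ (inj₂ (K₄-exceptional Γ θ inj θ∈ onto joined)))
    where
    B : VSet n
    B = ⟨ a ⟩ ∪ (⟨ b ⟩ ∪ (⟨ c ⟩ ∪ ⟨ d ⟩))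
    θ : Fin 4 → Fin n
    θ 0F = a
    θ 1F = b
    θ 2F = c
    θ 3F = d
    θ∈ : ∀ i → θ i ∈ B
    θ∈ 0F = ∪ˡ {A = ⟨ a ⟩} ∈⟨⟩
    θ∈ 1F = ∪ʳ {A = ⟨ a ⟩} (∪ˡ {A = ⟨ b ⟩} ∈⟨⟩)
    θ∈ 2F = ∪ʳ {A = ⟨ a ⟩} (∪ʳ {A = ⟨ b ⟩} (∪ˡ {A = ⟨ c ⟩} ∈⟨⟩))
    θ∈ 3F = ∪ʳ {A = ⟨ a ⟩} (∪ʳ {A = ⟨ b ⟩} (∪ʳ {A = ⟨ c ⟩} ∈⟨⟩))
    onto : ∀ {v} → v ∈ B → ∃[ i ] θ i ≡ v
    onto q with ∪-elim {A = ⟨ a ⟩} q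
    ... | inj₁ e = 0F , sym (⟨⟩-elim e)
    ... | inj₂ q with ∪-elim {A = ⟨ b ⟩} q
    ...   | inj₁ e = 1F , sym (⟨⟩-elim e)
    ...   | inj₂ q with ∪-elim {A = ⟨ c ⟩} q
    ...     | inj₁ e = 2F , sym (⟨⟩-elim e)
    ...     | inj₂ e = 3F , sym (⟨⟩-elim e)
    B⊆ : B ⊆ A
    B⊆ q with onto q
    ... | 0F , refl = a∈
    ... | 1F , refl = b∈
    ... | 2F , refl = c∈
    ... | 3F , refl = d∈
    rev : ∀ {u v} → 1ℤ ≤ + m u v → 1ℤ ≤ + m v u
    rev {u} {v} = subst (λ k → 1ℤ ≤ + k) (m-sym u v)
    joined : ∀ {i j} → i ≢ j → 1ℤ ≤ + m (θ i) (θ j)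
    joined {0F} {0F} ne = ⊥-elim (ne refl)
    joined {0F} {1F} _ = ab
    joined {0F} {2F} _ = ac
    joined {0F} {3F} _ = ad
    joined {1F} {0F} _ = rev ab
    joined {1F} {1F} ne = ⊥-elim (ne refl)
    joined {1F} {2F} _ = bc
    joined {1F} {3F} _ = bd
    joined {2F} {0F} _ = rev ac
    joined {2F} {1F} _ = rev bc
    joined {2F} {2F} ne = ⊥-elim (ne refl)
    joined {2F} {3F} _ = cd
    joined {3F} {0F} _ = rev ad
    joined {3F} {1F} _ = rev bd
    joined {3F} {2F} _ = rev cd
    joined {3F} {3F} ne = ⊥-elim (ne refl)
    inj : ∀ {i j} → θ i ≡ θ j → i ≡ j
    inj {i} {j} e with i Finp.≟ j
    ... | yes q = q
    ... | no ne = ⊥-elim (nonself (joined ne) e)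

  module ShortRing {X : VSet n} (ring : Ring X) (short : ∣ X ∣ ≤ + 3) where
    open Ring ring
    open OnRing ring

    -- A ring vertex has two simple edges and only two other vertices to send them to.
    pairwise : ∀ {u v} → u ∈ X → v ∈ X → u ≢ v → 1ℤ ≤ + m u v
    pairwise {u} {v} u∈ v∈ ne = lin
      (∣ X ∣ ∷ ∣ X ∖ ⟨ u ⟩ ∣ ∷ ∣ X ∖ ⟨ u ⟩ ∖ ⟨ v ⟩ ∣ ∷ deg u X ∷ deg u (X ∩ ⟨ u ⟩) ∷ deg u (X ∖ ⟨ u ⟩) ∷ deg u ((X ∖ ⟨ u ⟩) ∩ ⟨ v ⟩) ∷ deg u (X ∖ ⟨ u ⟩ ∖ ⟨ v ⟩)
        ∷ deg u ⟨ u ⟩ ∷ deg u ⟨ v ⟩ ∷ + m u u ∷ + m u v ∷ [])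
      (λ c c' c'' d i d' i' d'' ou ov uu uv → c ≼ # 3 ⟹ c ≐ c' ⊕ # 1 ⟹ c' ≐ c'' ⊕ # 1 ⟹ d ≐ # 2 ⟹ d ≐ i ⊕ d' ⟹ d' ≐ i' ⊕ d'' ⟹ i ≼ ou ⟹ ou ≐ uu ⟹ uu ≐ # 0 ⟹
         i' ≼ ov ⟹ ov ≐ uv ⟹ d'' ≼ c'' ⟹ # 1 ≼ uv)
      short (card-remove u∈) (card-remove (∖-intro v∈ (∉⟨⟩ (ne ∘ sym)))) (two-x u∈) (S-split X ⟨ u ⟩ (λ w → + m u w)) (S-split (X ∖ ⟨ u ⟩) ⟨ v ⟩ (λ w → + m u w))
      (deg-⊆ (∩ʳ {A = X})) (S-point u _) (cong +_ (m-irr u)) (deg-⊆ (∩ʳ {A = X ∖ ⟨ u ⟩})) (S-point v _)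
      (subst (deg u (X ∖ ⟨ u ⟩ ∖ ⟨ v ⟩) ≤_) (sym (card-sum (X ∖ ⟨ u ⟩ ∖ ⟨ v ⟩)))
        (S-mono {A = X ∖ ⟨ u ⟩ ∖ ⟨ v ⟩} (λ w∈ → simple u∈ (∖ˡ {A = X} (∖ˡ {A = X ∖ ⟨ u ⟩} w∈)))))

    record Corners : Set where
      field
        x₁ x₂ : Fin n
        x₁∈ : x₁ ∈ X
        x₂∈ : x₂ ∈ X
        x₁≢x₀ : x₁ ≢ x₀
        x₂≢x₀ : x₂ ≢ x₀
        x₂≢x₁ : x₂ ≢ x₁
        corner : ∀ {x} → x ∈ X → (x ≡ x₀) ⊎ (x ≡ x₁) ⊎ (x ≡ x₂)

    corners : Corners
    corners = record { x₁ = proj₁ f₁ ; x₂ = proj₁ f₂ ; x₁∈ = ∖ˡ {A = X} x₁∈ ; x₂∈ = ∖ˡ {A = X} (∖ˡ {A = X ∖ ⟨ x₀ ⟩} x₂∈)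
      ; x₁≢x₀ = ∉⟨⟩-elim (∖ʳ {A = X} x₁∈) ; x₂≢x₀ = ∉⟨⟩-elim (∖ʳ {A = X} (∖ˡ {A = X ∖ ⟨ x₀ ⟩} x₂∈)) ; x₂≢x₁ = ∉⟨⟩-elim (∖ʳ {A = X ∖ ⟨ x₀ ⟩} x₂∈)
      ; corner = which }
      where
      f₁ : ∃[ v ] v ∈ X ∖ ⟨ x₀ ⟩
      f₁ = card-find (lin (∣ X ∣ ∷ ∣ X ∖ ⟨ x₀ ⟩ ∣ ∷ []) (λ a b → # 3 ≼ a ⟹ a ≐ b ⊕ # 1 ⟹ # 1 ≼ b) three≤ (card-remove x₀∈))
      x₁∈ = proj₂ f₁
      f₂ : ∃[ v ] v ∈ X ∖ ⟨ x₀ ⟩ ∖ ⟨ proj₁ f₁ ⟩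
      f₂ = card-find (lin (∣ X ∣ ∷ ∣ X ∖ ⟨ x₀ ⟩ ∣ ∷ ∣ X ∖ ⟨ x₀ ⟩ ∖ ⟨ proj₁ f₁ ⟩ ∣ ∷ []) (λ a b c → # 3 ≼ a ⟹ a ≐ b ⊕ # 1 ⟹ b ≐ c ⊕ # 1 ⟹ # 1 ≼ c)
             three≤ (card-remove x₀∈) (card-remove x₁∈))
      x₂∈ = proj₂ f₂
      which : ∀ {x} → x ∈ X → (x ≡ x₀) ⊎ (x ≡ proj₁ f₁) ⊎ (x ≡ proj₁ f₂)
      which {x} x∈ = decide (x Finp.≟ x₀) (x Finp.≟ proj₁ f₁) (x Finp.≟ proj₁ f₂)
        where
        decide : Dec (x ≡ x₀) → Dec (x ≡ proj₁ f₁) → Dec (x ≡ proj₁ f₂) → (x ≡ x₀) ⊎ (x ≡ proj₁ f₁) ⊎ (x ≡ proj₁ f₂)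
        decide (yes e) _ _ = inj₁ e
        decide (no _) (yes e) _ = inj₂ (inj₁ e)
        decide (no _) (no _) (yes e) = inj₂ (inj₂ e)
        decide (no n₀) (no n₁) (no n₂) = ⊥-elim (lin (∣ X ∣ ∷ ∣ X ∖ ⟨ x₀ ⟩ ∣ ∷ ∣ X ∖ ⟨ x₀ ⟩ ∖ ⟨ proj₁ f₁ ⟩ ∣ ∷ ∣ X ∖ ⟨ x₀ ⟩ ∖ ⟨ proj₁ f₁ ⟩ ∖ ⟨ proj₁ f₂ ⟩ ∣ ∷ [])
              (λ a b c d → a ≼ # 3 ⟹ a ≐ b ⊕ # 1 ⟹ b ≐ c ⊕ # 1 ⟹ c ≐ d ⊕ # 1 ⟹ # 1 ≼ d ⟹ contra)
              short (card-remove x₀∈) (card-remove x₁∈) (card-remove x₂∈)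
              (card-pos (∖-intro (∖-intro (∖-intro x∈ (∉⟨⟩ n₀)) (∉⟨⟩ n₁)) (∉⟨⟩ n₂))))

    open Corners corners public

    shortWheel : ∀ {y} → y ∈ A → (∀ {x} → x ∈ X → 1ℤ ≤ + m x y) → R
    shortWheel y∈ spoke = K₄-out (X⊆ x₀∈) (X⊆ x₁∈) (X⊆ x₂∈) y∈ (pairwise x₀∈ x₁∈ (x₁≢x₀ ∘ sym)) (pairwise x₀∈ x₂∈ (x₂≢x₀ ∘ sym)) (spoke x₀∈)
      (pairwise x₁∈ x₂∈ (x₂≢x₁ ∘ sym)) (spoke x₁∈) (spoke x₂∈)

  module Wheel {X : VSet n} (ring : Ring X) (full-x : ∀ {x} → x ∈ X → Full (L x)) {y} (y∈ : y ∈ OnRing.rest ring)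
               (hub : ∀ {x} → x ∈ X → OnRing.AllFull.nbr ring full-x x ≡ y) where
    open Ring ring
    open Chain ring full-x

    spoke : ∀ {x} → x ∈ X → 1ℤ ≤ + m x y
    spoke {x} x∈ = subst (λ w → 1ℤ ≤ + m x w) (hub x∈) (proj₂ (nbr-spec x∈))

    y∈A : y ∈ A
    y∈A = ∖ˡ {A = A} y∈

    wheel⊆ : ⟨ y ⟩ ∪ X ⊆ A
    wheel⊆ q = [ ⟨⟩-⊆ y∈A , X⊆ ]′ (∪-elim {A = ⟨ y ⟩} q)

    y∈w : y ∈ ⟨ y ⟩ ∪ X
    y∈w = ∪ˡ {A = ⟨ y ⟩} ∈⟨⟩

    ρ-wheel : ρ L (⟨ y ⟩ ∪ X) ≤ p (L y) - + 2 * ∣ X ∣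
    ρ-wheel = subst (λ t → ρ L (⟨ y ⟩ ∪ X) ≤ t - + 2 * ∣ X ∣) (ρ-point L y)
      (ρ-closed (⟨⟩-⊆ y∈) (λ x∈ → ∩-intro x∈ (mk∈ (un∈ (subst (_∈ ⟨ y ⟩) (sym (hub x∈)) ∈⟨⟩)))))

    k3 : ∣ X ∣ ≤ + 3 → R
    k3 h = ShortRing.shortWheel ring h y∈A spoke

  module Deficient (v₀ : Fin n) (v₀∈ : v₀ ∈ A) (v₀-not : ∃[ c ] c ∉ L v₀) where
    -- All sets produced by the chain have full lists, so `v₀` lies outside and `gap₃` applies:
    -- together with the ring they have potential at most 7 - 4 = 3. A wheel with full hub has at
    -- most 8 - 6 = 2. If the hub has two colours, three spokes form K₄ and four or more give at
    -- most 4 - 8.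
    noRing : ∀ {X} → Ring X → R
    noRing {X} ring = OnRing.allFull ring withFull
      where
      open Ring ring
      withFull : (∀ {x} → x ∈ X → Full (L x)) → R
      withFull full-x = chain 2 μ≥ reached wheel
        where
        open Chain ring full-x
        reached : ∀ U → U ⊆ rest → (∀ {v} → v ∈ U → Full (L v)) → X ⊆ inside U → ρ L U + + 2 * + 2 ≤ + 7 + + 2 * ∣ X ∣ → R
        reached U ur uf all-in h = gap₃ (λ q → [ (λ u → ∖ˡ {A = A} (ur u)) , X⊆ ]′ (∪-elim {A = U} q)) (∪ʳ {A = U} x₀∈) v₀∈
          (not-in (λ q → absurd∈ ([ (λ u → uf u) , (λ x → full-x x) ]′ (∪-elim {A = U} q)) (proj₂ v₀-not)))
          (lin (ρ L (U ∪ X) ∷ ρ L U ∷ ∣ X ∣ ∷ μ ∷ []) (λ a b x μ → a ≼ b ⊖ 2 ⊙ x ⟹ b ⊕ # 4 ≼ # 7 ⊕ 2 ⊙ x ⟹ # 0 ≼ μ ⊕ # 2 ⟹ a ≼ μ ⊕ # 5)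
            (ρ-closed ur all-in) h μ≥)
        wheel : ∀ y → y ∈ rest → (∀ {x} → x ∈ X → nbr x ≡ y) → R
        wheel y y∈ hub = lists (∖ˡ {A = A} y∈)
          (λ f → gap₃ wheel⊆ y∈w v₀∈ (not-in (λ q → absurd∈ ([ (λ e → subst (λ w → Full (L w)) (sym (⟨⟩-elim e)) f) , (λ x → full-x x) ]′ (∪-elim {A = ⟨ y ⟩} q)) (proj₂ v₀-not)))
            (lin (ρ L (⟨ y ⟩ ∪ X) ∷ p (L y) ∷ ∣ X ∣ ∷ μ ∷ []) (λ a q x μ → a ≼ q ⊖ 2 ⊙ x ⟹ q ≼ # 8 ⟹ # 3 ≼ x ⟹ # 0 ≼ μ ⊕ # 2 ⟹ a ≼ μ ⊕ # 5) ρ-wheel (p≤8 (L y)) three≤ μ≥))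
          (λ _ q → case dec≤ ∣ X ∣ (+ 3) of λ
            { (inj₁ h) → k3 h
            ; (inj₂ h) → small-out wheel⊆ y∈w (lin (ρ L (⟨ y ⟩ ∪ X) ∷ p (L y) ∷ ∣ X ∣ ∷ []) (λ a q x → a ≼ q ⊖ 2 ⊙ x ⟹ q ≐ # 4 ⟹ # 4 ≼ x ⟹ a ⊕ # 3 ≼ # 0) ρ-wheel q h) })
          where open Wheel ring full-x y∈ hub

  module AllLists (μ≡0 : μ ≡ 0ℤ) (fullA : ∀ {v} → v ∈ A → Full (L v)) where
    negative : ∀ {B b} → B ⊆ A → b ∈ B → ρ L B + 1ℤ ≤ 0ℤ → R
    negative ba b∈ h = out (_ , ba , (_ , b∈) , inj₂ (inj₁ ((λ v∈ → fullA (ba v∈)) , h)))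

    -- The wheel with four spokes: every cover is equivalent to the one given by equality of labels, and
    -- W₄ has a proper 3-colouring.
    module FourSpokes {X : VSet n} (ring : Ring X) (full-x : ∀ {x} → x ∈ X → Full (L x)) {y} (y∈ : y ∈ OnRing.rest ring)
                      (hub : ∀ {x} → x ∈ X → OnRing.AllFull.nbr ring full-x x ≡ y)
                      (four : ∣ X ∣ ≡ + 4) (all : A ⊆ ⟨ y ⟩ ∪ X) where
      open Ring ring
      open Chain ring full-x
      open Wheel ring full-x y∈ hub
      open Permutation

      rest-point : rest ⊆ ⟨ y ⟩
      rest-point q with ∪-elim {A = ⟨ y ⟩} (all (∖ˡ {A = A} q))
      ... | inj₁ e = e
      ... | inj₂ x = absurd∈ x (∖ʳ {A = A} q)

      π : ∀ {x} → x ∈ X → Permutation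
      π x∈ = proj₁ (outer-matching x∈)

      -- The hub is the outer neighbour of both vertices. If `transfer` moves `c`, colouring the hub
      -- with `c` already satisfies the condition of `extends`.
      consistent : ∀ {x x'} (x∈ : x ∈ X) (x'∈ : x' ∈ X) → 1ℤ ≤ + m x x' → ∀ c → (to (transfer x∈ x'∈) c ≡ c → R) → R
      consistent x∈ x'∈ adjacent c k with to (transfer x∈ x'∈) c Finp.≟ c
      ... | yes e = k e
      ... | no ne = extends x∈ x'∈ adjacent (restrict (λ _ q → q) rest-point (colourPoint {a = y} {c = c} (fullA y∈A))) (ne ∘ sym)

      -- The 2-colouring of the 4-cycle: `x₀` and the opposite vertex get 1, the neighbours of `x₀`
      -- get 2. Colour 0 is left for the hub.
      label : Fin n → Colour
      label x = if x ≡ᵇ x₀ then 1F else (if ⌊ 1ℤ ℤ.≤? + m x₀ x ⌋ then 2F else 1F)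
        where open import Relation.Nullary.Decidable using (⌊_⌋)

      label-spec : ∀ x → ((label x ≡ 2F) × (1ℤ ≤ + m x₀ x)) ⊎ ((label x ≡ 1F) × ((x ≡ x₀) ⊎ (+ m x₀ x ≤ 0ℤ)))
      label-spec x with x Finp.≟ x₀ | 1ℤ ℤ.≤? + m x₀ x
      ... | yes e | _ = inj₂ (refl , inj₁ e)
      ... | no _ | yes h = inj₁ (refl , h)
      ... | no _ | no h = inj₂ (refl , inj₂ (ℤp.≮⇒≥ (h ∘ ℤp.i<j⇒suc[i]≤j)))

      -- Two adjacent vertices labelled 2 would form a triangle with `x₀`, a proper subset as dense
      -- as the ring. Two adjacent vertices labelled 1 and different from `x₀` would leave `x₀` only
      -- one possible neighbour.
      labels-differ : ∀ {x x'} → x ∈ X → x' ∈ X → 1ℤ ≤ + m x x' → (label x ≢ label x' → R) → R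
      labels-differ {x} {x'} x∈ x'∈ adjacent k with label-spec x | label-spec x'
      ... | inj₁ (e , _) | inj₂ (e' , _) = k (λ q → case trans (sym e) (trans q e') of λ ())
      ... | inj₂ (e , _) | inj₁ (e' , _) = k (λ q → case trans (sym e) (trans q e') of λ ())
      ... | inj₁ (_ , h) | inj₁ (_ , h') = triangle (card-find outside≥)
        where
        Δ : VSet n
        Δ = ⟨ x₀ ⟩ ∪ (⟨ x ⟩ ∪ ⟨ x' ⟩)
        x∉ : x ∉ ⟨ x' ⟩
        x∉ = ∉⟨⟩ (nonself adjacent)
        x₀∉ : x₀ ∉ ⟨ x ⟩ ∪ ⟨ x' ⟩
        x₀∉ = not-in (λ q → [ (λ e → nonself h (⟨⟩-elim e)) , (λ e → nonself h' (⟨⟩-elim e)) ]′ (∪-elim {A = ⟨ x ⟩} q))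
        sum3 : ∀ (g : Fin n → ℤ) → ∑S Δ g ≡ g x₀ + (g x + g x')
        sum3 g = trans (S-∪ (⟨⟩-disjoint x₀∉) g) (cong₂ _+_ (S-point x₀ g) (trans (S-∪ (⟨⟩-disjoint x∉) g) (cong₂ _+_ (S-point x g) (S-point x' g))))
        Δ⊆ : Δ ⊆ X
        Δ⊆ q = [ ⟨⟩-⊆ x₀∈ , (λ q → [ ⟨⟩-⊆ x∈ , ⟨⟩-⊆ x'∈ ]′ (∪-elim {A = ⟨ x ⟩} q)) ]′ (∪-elim {A = ⟨ x₀ ⟩} q)
        outside≥ : 1ℤ ≤ ∣ X ∖ Δ ∣
        outside≥ = lin (∣ X ∣ ∷ ∣ X ∩ Δ ∣ ∷ ∣ X ∖ Δ ∣ ∷ ∣ Δ ∣ ∷ []) (λ x i d t → x ≐ # 4 ⟹ x ≐ i ⊕ d ⟹ i ≼ t ⟹ t ≐ # 1 ⊕ (# 1 ⊕ # 1) ⟹ # 1 ≼ d)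
          four (card-split X Δ) (card-mono (∩ʳ {A = X})) (trans (card-sum Δ) (sum3 (λ _ → 1ℤ)))
        triangle : ∃[ v ] v ∈ X ∖ Δ → R
        triangle (v , v∈) = sparse Δ⊆ (∪ˡ {A = ⟨ x₀ ⟩} ∈⟨⟩) (∖ˡ {A = X} v∈) (∖ʳ {A = X} v∈)
          (lin (∣ Δ ∣ ∷ ∑S Δ (λ z → deg z Δ) ∷ deg x₀ Δ ∷ deg x Δ ∷ deg x' Δ ∷ + m x₀ x ∷ + m x₀ x' ∷ + m x x₀ ∷ + m x x' ∷ + m x' x₀ ∷ + m x' x ∷ + m x₀ x₀ ∷ + m x x ∷ + m x' x' ∷ [])
            (λ t s a b c ox ox' xo xx' x'o x'x z₀ z₁ z₂ → t ≐ # 1 ⊕ (# 1 ⊕ # 1) ⟹ s ≐ a ⊕ (b ⊕ c) ⟹ a ≐ z₀ ⊕ (ox ⊕ ox') ⟹ b ≐ xo ⊕ (z₁ ⊕ xx') ⟹ c ≐ x'o ⊕ (x'x ⊕ z₂) ⟹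
              ox ≐ xo ⟹ ox' ≐ x'o ⟹ xx' ≐ x'x ⟹ # 1 ≼ ox ⟹ # 1 ≼ ox' ⟹ # 1 ≼ xx' ⟹ # 0 ≼ z₀ ⟹ # 0 ≼ z₁ ⟹ # 0 ≼ z₂ ⟹ 2 ⊙ t ≼ s ⊕ # 1)
            (trans (card-sum Δ) (sum3 (λ _ → 1ℤ))) (sum3 (λ z → deg z Δ)) (sum3 _) (sum3 _) (sum3 _)
            (cong +_ (m-sym x₀ x)) (cong +_ (m-sym x₀ x')) (cong +_ (m-sym x x')) h h' adjacent (+≤+ ℕ.z≤n) (+≤+ ℕ.z≤n) (+≤+ ℕ.z≤n))
      ... | inj₂ (_ , inj₁ refl) | inj₂ (_ , inj₁ refl) = ⊥-elim (nonself adjacent refl)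
      ... | inj₂ (_ , inj₁ refl) | inj₂ (_ , inj₂ h') = ⊥-elim (lin (+ m x₀ x' ∷ []) (λ a → a ≼ # 0 ⟹ # 1 ≼ a ⟹ contra) h' adjacent)
      ... | inj₂ (_ , inj₂ h) | inj₂ (_ , inj₁ refl) = ⊥-elim (lin (+ m x₀ x ∷ + m x x₀ ∷ []) (λ a b → a ≼ # 0 ⟹ # 1 ≼ b ⟹ a ≐ b ⟹ contra) h adjacent (cong +_ (m-sym x₀ x)))
      ... | inj₂ (_ , inj₂ h) | inj₂ (_ , inj₂ h') = ⊥-elim (away (x₀ Finp.≟ x) (x₀ Finp.≟ x'))
        where
        away : Dec (x₀ ≡ x) → Dec (x₀ ≡ x') → ⊥
        away (yes refl) _ = lin (+ m x₀ x' ∷ []) (λ a → a ≼ # 0 ⟹ # 1 ≼ a ⟹ contra) h' adjacent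
        away (no _) (yes refl) = lin (+ m x₀ x ∷ + m x x₀ ∷ []) (λ a b → a ≼ # 0 ⟹ # 1 ≼ b ⟹ a ≐ b ⟹ contra) h adjacent (cong +_ (m-sym x₀ x))
        away (no n₁) (no n₂) = lin
          (∣ X ∣ ∷ ∣ X ∖ ⟨ x₀ ⟩ ∣ ∷ ∣ X ∖ ⟨ x₀ ⟩ ∖ ⟨ x ⟩ ∣ ∷ ∣ Y ∣ ∷ deg x₀ X ∷ deg x₀ (X ∩ ⟨ x₀ ⟩) ∷ deg x₀ (X ∖ ⟨ x₀ ⟩) ∷ deg x₀ ((X ∖ ⟨ x₀ ⟩) ∩ ⟨ x ⟩) ∷ deg x₀ (X ∖ ⟨ x₀ ⟩ ∖ ⟨ x ⟩)
            ∷ deg x₀ ((X ∖ ⟨ x₀ ⟩ ∖ ⟨ x ⟩) ∩ ⟨ x' ⟩) ∷ deg x₀ Y ∷ + m x₀ x₀ ∷ + m x₀ x ∷ + m x₀ x' ∷ deg x₀ ⟨ x₀ ⟩ ∷ deg x₀ ⟨ x ⟩ ∷ deg x₀ ⟨ x' ⟩ ∷ [])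
          (λ c c₁ c₂ c₃ d i₀ d₁ i₁ d₂ i₂ d₃ m₀ m₁ m₂ p₀ p₁ p₂ → c ≐ # 4 ⟹ c ≐ c₁ ⊕ # 1 ⟹ c₁ ≐ c₂ ⊕ # 1 ⟹ c₂ ≐ c₃ ⊕ # 1 ⟹ d ≐ # 2 ⟹ d ≐ i₀ ⊕ d₁ ⟹ d₁ ≐ i₁ ⊕ d₂ ⟹ d₂ ≐ i₂ ⊕ d₃ ⟹
            i₀ ≼ p₀ ⟹ p₀ ≐ m₀ ⟹ m₀ ≐ # 0 ⟹ i₁ ≼ p₁ ⟹ p₁ ≐ m₁ ⟹ m₁ ≼ # 0 ⟹ i₂ ≼ p₂ ⟹ p₂ ≐ m₂ ⟹ m₂ ≼ # 0 ⟹ d₃ ≼ c₃ ⟹ contra)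
          four (card-remove x₀∈) (card-remove (∖-intro x∈ (∉⟨⟩ (n₁ ∘ sym)))) (card-remove (∖-intro (∖-intro x'∈ (∉⟨⟩ (n₂ ∘ sym))) (∉⟨⟩ (nonself adjacent ∘ sym))))
          (two-x x₀∈) (S-split X ⟨ x₀ ⟩ (λ w → + m x₀ w)) (S-split (X ∖ ⟨ x₀ ⟩) ⟨ x ⟩ (λ w → + m x₀ w)) (S-split (X ∖ ⟨ x₀ ⟩ ∖ ⟨ x ⟩) ⟨ x' ⟩ (λ w → + m x₀ w))
          (deg-⊆ (∩ʳ {A = X})) (S-point x₀ _) (cong +_ (m-irr x₀)) (deg-⊆ (∩ʳ {A = X ∖ ⟨ x₀ ⟩})) (S-point x _) h (deg-⊆ (∩ʳ {A = X ∖ ⟨ x₀ ⟩ ∖ ⟨ x ⟩})) (S-point x' _) h'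
          (subst (deg x₀ Y ≤_) (sym (card-sum Y)) (S-mono {A = Y} (λ w∈ → simple x₀∈ (∖ˡ {A = X} (∖ˡ {A = X ∖ ⟨ x₀ ⟩} (∖ˡ {A = X ∖ ⟨ x₀ ⟩ ∖ ⟨ x ⟩} w∈))))))
          where
          Y : VSet n
          Y = X ∖ ⟨ x₀ ⟩ ∖ ⟨ x ⟩ ∖ ⟨ x' ⟩

      -- The membership proof is an argument because the permutation `π` depends on it; `colour-at`
      -- returns the proof that was used.
      shade : ∀ v → (v ∈ X) ⊎ (v ∉ X) → Colour
      shade v (inj₁ v∈) = to (π v∈) (label v)
      shade v (inj₂ _) = 0F

      colour : Fin n → Colour
      colour v = shade v (dec∈ v X)

      colour-at : ∀ {v} → v ∈ X → Σ (v ∈ X) λ v∈ → colour v ≡ to (π v∈) (label v)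
      colour-at {v} v∈ = at (dec∈ v X)
        where
        at : ∀ d → Σ (v ∈ X) λ v∈ → shade v d ≡ to (π v∈) (label v)
        at (inj₁ v∈') = v∈' , refl
        at (inj₂ v∉) = absurd∈ v∈ v∉

      colour-y : colour y ≡ 0F
      colour-y = at (dec∈ y X)
        where
        at : ∀ d → shade y d ≡ 0F
        at (inj₁ y∈X) = absurd∈ y∈X (∖ʳ {A = A} y∈)
        at (inj₂ _) = refl

      label≢0 : ∀ x → label x ≢ 0F
      label≢0 x e with label-spec x
      ... | inj₁ (e' , _) = case trans (sym e) e' of λ ()
      ... | inj₂ (e' , _) = case trans (sym e) e' of λ ()

      to-injective : ∀ (σ : Permutation) {c d} → to σ c ≡ to σ d → c ≡ d
      to-injective σ {c} {d} e = trans (sym (from-to σ c)) (trans (cong (from σ) e) (from-to σ d))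

      spoke-ok : ∀ {x} → x ∈ X → colour x ∉ M y (colour y) x
      spoke-ok {x} x∈ = not-in (λ q → label≢0 x (to-injective (π x∈')
          (proj₂ (outer-matching x∈') (subst (λ w → to (π x∈') (label x) ∈ M w 0F x) (sym (hub x∈'))
            (subst (λ c → to (π x∈') (label x) ∈ M y c x) colour-y (subst (_∈ M y (colour y) x) eq q))))))
        where
        x∈' : x ∈ X
        x∈' = proj₁ (colour-at x∈)
        eq : colour x ≡ to (π x∈') (label x)
        eq = proj₂ (colour-at x∈)

      -- Since `transfer` fixes the label of `x`, the rim edge matches the image of that label at
      -- `x` with its image at `x'`. A clash would therefore force equal labels.
      rim-clash : ∀ {x x'} (x∈ : x ∈ X) (x'∈ : x' ∈ X) → to (π x'∈) (label x') ∈ M x (to (π x∈) (label x)) x' → R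
      rim-clash {x} {x'} x∈ x'∈ q = labels-differ x∈ x'∈ (M-pos q) λ differ → consistent x∈ x'∈ (M-pos q) (label x) λ e →
        ⊥-elim (differ (sym (to-injective (π x'∈) (trans (proj₂ (matching (simple x∈ x'∈)) q)
          (trans (sym (to-from (π x'∈) _)) (cong (to (π x'∈)) e))))))

      rim? : ∀ v → (∃[ u ] u ∈ X × v ∈ X × colour v ∈ M u (colour u) v) ⊎ (∀ {u} → u ∈ X → v ∈ X → colour v ∉ M u (colour u) v)
      rim? v = from-search (dec∈ v X) (search X {λ u → colour v ∈ M u (colour u) v} {λ u → colour v ∉ M u (colour u) v} (λ u → dec∈ (colour v) (M u (colour u) v)))
        where
        from-search : (v ∈ X) ⊎ (v ∉ X) → (∃[ u ] u ∈ X × colour v ∈ M u (colour u) v) ⊎ (∀ {u} → u ∈ X → colour v ∉ M u (colour u) v) →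
                      (∃[ u ] u ∈ X × v ∈ X × colour v ∈ M u (colour u) v) ⊎ (∀ {u} → u ∈ X → v ∈ X → colour v ∉ M u (colour u) v)
        from-search (inj₂ v∉) _ = inj₂ (λ _ v∈ → absurd∈ v∈ v∉)
        from-search (inj₁ v∈) (inj₁ (u , u∈ , q)) = inj₁ (u , u∈ , v∈ , q)
        from-search (inj₁ v∈) (inj₂ h) = inj₂ (λ u∈ _ → h u∈)

      resolve : R
      resolve with search X {λ v → ∃[ u ] u ∈ X × v ∈ X × colour v ∈ M u (colour u) v} {λ v → ∀ {u} → u ∈ X → v ∈ X → colour v ∉ M u (colour u) v} rim?
      ... | inj₁ (v , _ , u , u∈ , v∈ , q) = clash v u u∈ v∈ q
        where
        clash : ∀ v u → u ∈ X → v ∈ X → colour v ∈ M u (colour u) v → R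
        clash v u u∈ v∈ q = rim-clash (proj₁ (colour-at u∈)) (proj₁ (colour-at v∈))
          (subst (_∈ M u (to (π (proj₁ (colour-at u∈))) (label u)) v) (proj₂ (colour-at v∈))
            (subst (λ c → colour v ∈ M u c v) (proj₂ (colour-at u∈)) q))
      ... | inj₂ rim = done (restrict (λ _ q → q) all (record { col = colour ; col∈ = λ v∈ → fullA (wheel⊆ v∈) ; proper = ok }))
        where
        ok : ∀ {u v} → u ∈ ⟨ y ⟩ ∪ X → v ∈ ⟨ y ⟩ ∪ X → colour v ∉ M u (colour u) v
        ok {u} {v} hu hv with ∪-elim {A = ⟨ y ⟩} hu | ∪-elim {A = ⟨ y ⟩} hv
        ... | inj₂ u∈ | inj₂ v∈ = rim v∈ u∈ v∈
        ... | inj₁ e | inj₂ v∈ = subst (λ w → colour v ∉ M w (colour w) v) (sym (⟨⟩-elim e)) (spoke-ok v∈)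
        ... | inj₂ u∈ | inj₁ e = not-in (λ q → absurd∈ (subst (λ w → colour u ∈ M w (colour w) u) (⟨⟩-elim e) (M-sym q)) (spoke-ok u∈))
        ... | inj₁ e | inj₁ e' = M-zero (trans (cong₂ m (⟨⟩-elim e) (⟨⟩-elim e')) (m-irr y))

    module LongRing {X : VSet n} (ring : Ring X) (long : + 4 ≤ ∣ X ∣) where
      open Ring ring

      -- With `μ = 0` the chain and the ring together have potential at most 7 - 8 = -1. A wheel has
      -- at most `8 - 2 |X|`, which is negative from five spokes on; with four spokes the bound is
      -- 0, so the wheel must be all of `A` and is coloured explicitly.
      noRing : R
      noRing = chain 0 (subst (λ t → 0ℤ ≤ t + 0ℤ) (sym μ≡0) ℤp.≤-refl) reached wheel
        where
        full-x : ∀ {x} → x ∈ X → Full (L x)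
        full-x x∈ = fullA (X⊆ x∈)
        open Chain ring full-x
        reached : ∀ U → U ⊆ rest → (∀ {v} → v ∈ U → Full (L v)) → X ⊆ inside U → ρ L U + + 2 * + 0 ≤ + 7 + + 0 * ∣ X ∣ → R
        reached U ur uf all-in h = negative {U ∪ X} (λ q → [ (λ u → ∖ˡ {A = A} (ur u)) , X⊆ ]′ (∪-elim {A = U} q)) (∪ʳ {A = U} x₀∈)
          (lin (ρ L (U ∪ X) ∷ ρ L U ∷ ∣ X ∣ ∷ []) (λ a b x → a ≼ b ⊖ 2 ⊙ x ⟹ b ⊕ 2 ⊙ # 0 ≼ # 7 ⊕ 0 ⊙ x ⟹ # 4 ≼ x ⟹ a ⊕ # 1 ≼ # 0) (ρ-closed ur all-in) h long)
        wheel : ∀ y → y ∈ rest → (∀ {x} → x ∈ X → nbr x ≡ y) → R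
        wheel y y∈ hub with dec≤ (+ 5) ∣ X ∣ | ⊎-search A (⟨ y ⟩ ∪ X)
        ... | inj₁ h | _ = negative wheel⊆ y∈w (lin (ρ L (⟨ y ⟩ ∪ X) ∷ p (L y) ∷ ∣ X ∣ ∷ []) (λ a q x → a ≼ q ⊖ 2 ⊙ x ⟹ q ≼ # 8 ⟹ # 5 ≼ x ⟹ a ⊕ # 1 ≼ # 0) ρ-wheel (p≤8 (L y)) h)
          where open Wheel ring full-x y∈ hub
        ... | inj₂ h | inj₁ (r , r∈ , r∉) = gap₃ wheel⊆ y∈w r∈ r∉ (lin (ρ L (⟨ y ⟩ ∪ X) ∷ p (L y) ∷ ∣ X ∣ ∷ μ ∷ [])
                (λ a q x μ → a ≼ q ⊖ 2 ⊙ x ⟹ q ≼ # 8 ⟹ # 4 ≼ x ⟹ # 0 ≼ μ ⊕ # 2 ⟹ a ≼ μ ⊕ # 5) ρ-wheel (p≤8 (L y)) long μ≥)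
          where open Wheel ring full-x y∈ hub
        ... | inj₂ h | inj₂ all = FourSpokes.resolve ring full-x y∈ hub
                (ℤp.≤-antisym (lin (∣ X ∣ ∷ []) (λ x → x ⊕ # 1 ≼ # 5 ⟹ x ≼ # 4) h) long) all

-- Identifying the ends of a diamond

-- The DHGO-composition of K₄, from which the edge between vertices 0 and 1 is deleted, with G₀, in which z is split.
module Composite (G₀ : Graph) (z : Fin (Graph.n G₀)) (part : Fin (Graph.n G₀) → Bool)
                 (one-side : ∃[ c ] (adj G₀ z c ≡ true × part c ≡ true))
                 (other-side : ∃[ c ] (adj G₀ z c ≡ true × part c ≡ false)) where
  open Graph G₀ using () renaming (n to k; adj to adj₀; sym to sym₀; irrefl to irrefl₀)

  -- `G₀` with `z` reduced to its neighbours on the `true` side. The index of `z` is reused for one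
  -- half of the split vertex, and the new vertex `0F` is the other half.
  core : Fin k → Fin k → Bool
  core i j = if i ≡ᵇ z then adj₀ z j ∧ part j else (if j ≡ᵇ z then adj₀ z i ∧ part i else adj₀ i j)

  pattern old i = suc (suc (suc i))

  adj′ : Fin (3 ℕ.+ k) → Fin (3 ℕ.+ k) → Bool
  adj′ 0F 0F = false
  adj′ 0F 1F = true
  adj′ 0F 2F = true
  adj′ 0F (old j) = adj₀ z j ∧ not (part j)
  adj′ 1F 0F = true
  adj′ 1F 1F = false
  adj′ 1F 2F = true
  adj′ 1F (old j) = j ≡ᵇ z
  adj′ 2F 0F = true
  adj′ 2F 1F = true
  adj′ 2F 2F = false
  adj′ 2F (old j) = j ≡ᵇ z
  adj′ (old i) 0F = adj₀ z i ∧ not (part i)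
  adj′ (old i) 1F = i ≡ᵇ z
  adj′ (old i) 2F = i ≡ᵇ z
  adj′ (old i) (old j) = core i j

  core-zz : core z z ≡ false
  core-zz rewrite ≡ᵇ-refl z | irrefl₀ z = refl

  core-zˡ : ∀ j → core z j ≡ adj₀ z j ∧ part j
  core-zˡ j rewrite ≡ᵇ-refl z = refl

  core-off : ∀ {i j} → i ≢ z → j ≢ z → core i j ≡ adj₀ i j
  core-off ni nj rewrite ≡ᵇ-≢ ni | ≡ᵇ-≢ nj = refl

  core-sym : ∀ i j → core i j ≡ core j i
  core-sym i j with i Finp.≟ z | j Finp.≟ z
  ... | yes refl | yes refl = refl
  ... | yes refl | no nj = refl
  ... | no ni | yes refl = refl
  ... | no ni | no nj = sym₀ i j

  core-irr : ∀ i → core i i ≡ false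
  core-irr i with i Finp.≟ z
  ... | yes refl rewrite irrefl₀ z = refl
  ... | no _ = irrefl₀ i

  composite : Graph
  composite = record { n = 3 ℕ.+ k ; adj = adj′ ; sym = sym′ ; irrefl = irr′ }
    where
    sym′ : ∀ i j → adj′ i j ≡ adj′ j i
    sym′ 0F 0F = refl
    sym′ 0F 1F = refl
    sym′ 0F 2F = refl
    sym′ 0F (old j) = refl
    sym′ 1F 0F = refl
    sym′ 1F 1F = refl
    sym′ 1F 2F = refl
    sym′ 1F (old j) = refl
    sym′ 2F 0F = refl
    sym′ 2F 1F = refl
    sym′ 2F 2F = refl
    sym′ 2F (old j) = refl
    sym′ (old i) 0F = refl
    sym′ (old i) 1F = refl
    sym′ (old i) 2F = refl
    sym′ (old i) (old j) = core-sym i j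
    irr′ : ∀ i → adj′ i i ≡ false
    irr′ 0F = refl
    irr′ 1F = refl
    irr′ 2F = refl
    irr′ (old i) = core-irr i

  ∧-true : ∀ {a b} → a ∧ b ≡ true → a ≡ true × b ≡ true
  ∧-true {true} {true} _ = refl , refl

  not-true : ∀ {b} → not b ≡ true → b ≡ false
  not-true {false} _ = refl

  -- The ends 0 and 1 of the deleted edge are identified with the two halves of the split vertex,
  -- `old z` and `0F`.
  α : Fin 4 → Fin (3 ℕ.+ k)
  α 0F = old z
  α 1F = 0F
  α 2F = 1F
  α 3F = 2F

  dhgo : DHGO K₄ G₀ composite
  dhgo = record
    { x = 0F ; y = 1F ; xy-edge = refl ; z = z ; part = part ; U₁-ne = one-side ; U₂-ne = other-side
    ; α = α ; β = λ c → old c ; α-inj = α-inj ; β-inj = λ { c .c _ _ refl → refl } ; αβ-disj = disj ; cover = cover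
    ; adj-αα = λ a b → αα a b , αα′ a b ; adj-ββ = λ c d nc nd → core-off nc nd ; adj-αβ = λ a c nc → αβ a c nc , αβ′ a c nc }
    where
    α-inj : ∀ a b → α a ≡ α b → a ≡ b
    α-inj 0F 0F _ = refl
    α-inj 1F 1F _ = refl
    α-inj 2F 2F _ = refl
    α-inj 3F 3F _ = refl
    α-inj 0F 1F ()
    α-inj 0F 2F ()
    α-inj 0F 3F ()
    α-inj 1F 0F ()
    α-inj 1F 2F ()
    α-inj 1F 3F ()
    α-inj 2F 0F ()
    α-inj 2F 1F ()
    α-inj 2F 3F ()
    α-inj 3F 0F ()
    α-inj 3F 1F ()
    α-inj 3F 2F ()
    disj : ∀ a c → c ≢ z → α a ≢ old c
    disj 0F c ne refl = ne refl
    disj 1F c ne ()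
    disj 2F c ne ()
    disj 3F c ne ()
    cover : ∀ w → (∃[ a ] α a ≡ w) ⊎ (∃[ c ] (c ≢ z × old c ≡ w))
    cover 0F = inj₁ (1F , refl)
    cover 1F = inj₁ (2F , refl)
    cover 2F = inj₁ (3F , refl)
    cover (old i) with i Finp.≟ z
    ... | yes refl = inj₁ (0F , refl)
    ... | no ne = inj₂ (i , ne , refl)
    Deleted : Fin 4 → Fin 4 → Set
    Deleted a b = (a ≡ 0F × b ≡ 1F) ⊎ (a ≡ 1F × b ≡ 0F)
    zz : adj₀ z z ∧ not (part z) ≡ true → ⊥
    zz h = true≢false (proj₁ (∧-true h)) (irrefl₀ z)
    αα : ∀ a b → adj′ (α a) (α b) ≡ true → adj K₄ a b ≡ true × ¬ Deleted a b
    αα 0F 0F h = true≢false h core-zz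
    αα 0F 1F h = ⊥-elim (zz h)
    αα 0F 2F h = refl , λ { (inj₁ (_ , ())) ; (inj₂ (() , _)) }
    αα 0F 3F h = refl , λ { (inj₁ (_ , ())) ; (inj₂ (() , _)) }
    αα 1F 0F h = ⊥-elim (zz h)
    αα 1F 2F h = refl , λ { (inj₁ (() , _)) ; (inj₂ (_ , ())) }
    αα 1F 3F h = refl , λ { (inj₁ (() , _)) ; (inj₂ (_ , ())) }
    αα 2F 0F h = refl , λ { (inj₁ (() , _)) ; (inj₂ (() , _)) }
    αα 2F 1F h = refl , λ { (inj₁ (() , _)) ; (inj₂ (() , _)) }
    αα 2F 3F h = refl , λ { (inj₁ (() , _)) ; (inj₂ (() , _)) }
    αα 3F 0F h = refl , λ { (inj₁ (() , _)) ; (inj₂ (() , _)) }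
    αα 3F 1F h = refl , λ { (inj₁ (() , _)) ; (inj₂ (() , _)) }
    αα 3F 2F h = refl , λ { (inj₁ (() , _)) ; (inj₂ (() , _)) }
    αα 3F 3F ()
    αα′ : ∀ a b → adj K₄ a b ≡ true × ¬ Deleted a b → adj′ (α a) (α b) ≡ true
    αα′ 0F 1F (_ , nd) = ⊥-elim (nd (inj₁ (refl , refl)))
    αα′ 0F 2F _ = ≡ᵇ-refl z
    αα′ 0F 3F _ = ≡ᵇ-refl z
    αα′ 1F 0F (_ , nd) = ⊥-elim (nd (inj₂ (refl , refl)))
    αα′ 1F 2F _ = refl
    αα′ 1F 3F _ = refl
    αα′ 2F 0F _ = ≡ᵇ-refl z
    αα′ 2F 1F _ = refl
    αα′ 2F 3F _ = refl
    αα′ 3F 0F _ = ≡ᵇ-refl z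
    αα′ 3F 1F _ = refl
    αα′ 3F 2F _ = refl
    αα′ 3F 3F (() , _)
    αβ : ∀ a c → c ≢ z → adj′ (α a) (old c) ≡ true →
         (a ≡ 0F × adj₀ z c ≡ true × part c ≡ true) ⊎ (a ≡ 1F × adj₀ z c ≡ true × part c ≡ false)
    αβ 0F c nc h = let (p , q) = ∧-true (trans (sym (core-zˡ c)) h) in inj₁ (refl , p , q)
    αβ 1F c nc h = let (p , q) = ∧-true h in inj₂ (refl , p , not-true q)
    αβ 2F c nc h = ⊥-elim (nc (≡ᵇ⇒≡ h))
    αβ 3F c nc h = ⊥-elim (nc (≡ᵇ⇒≡ h))
    αβ′ : ∀ a c → c ≢ z → (a ≡ 0F × adj₀ z c ≡ true × part c ≡ true) ⊎ (a ≡ 1F × adj₀ z c ≡ true × part c ≡ false) →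
          adj′ (α a) (old c) ≡ true
    αβ′ .0F c nc (inj₁ (refl , p , q)) = trans (core-zˡ c) (cong₂ _∧_ p q)
    αβ′ .1F c nc (inj₂ (refl , p , q)) = cong₂ (λ x y → x ∧ not y) p q

  ore-composite : Ore4 G₀ → Ore4 composite
  ore-composite o = ore-comp {K₄} {G₀} {composite} (ore-K4 (refl , λ i j → K₄-complete)) o dhgo

  private
    opaque
      unfolding ∑
      ∑-old : ∀ (f : Fin (3 ℕ.+ k) → ℤ) → ∑ f ≡ f 0F + (f 1F + (f 2F + ∑ (λ i → f (old i))))
      ∑-old f = refl

    lost kept : Fin k → ℤ
    lost i = χ (adj₀ z i ∧ not (part i))
    kept i = χ (adj₀ z i ∧ part i)

    is-z : ∑ (λ i → χ (i ≡ᵇ z)) ≡ 1ℤ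
    is-z = ∑-point z (λ _ → 1ℤ)

    core-χ : ∀ i j → χ (core i j) + ((i ≡ᵇ z) ▹ lost j + (j ≡ᵇ z) ▹ lost i) ≡ χ (adj₀ i j)
    core-χ i j with i Finp.≟ z | j Finp.≟ z
    ... | yes refl | yes refl rewrite irrefl₀ z = refl
    ... | yes refl | no _ with adj₀ z j | part j
    ...   | false | _ = refl
    ...   | true | true = refl
    ...   | true | false = refl
    core-χ i j | no _ | yes refl rewrite sym₀ i z with adj₀ z i | part i
    ...   | false | _ = refl
    ...   | true | true = refl
    ...   | true | false = refl
    core-χ i j | no _ | no _ = ℤp.+-identityʳ _

    core-row : ∀ i → ∑ (λ j → χ (core i j)) + ((i ≡ᵇ z) ▹ ∑ lost + lost i) ≡ ∑ (λ j → χ (adj₀ i j))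
    core-row i = sym (begin
      ∑ (λ j → χ (adj₀ i j)) ≡⟨ ∑-cong (λ j → sym (core-χ i j)) ⟩
      ∑ (λ j → χ (core i j) + ((i ≡ᵇ z) ▹ lost j + (j ≡ᵇ z) ▹ lost i)) ≡⟨ ∑-+ _ _ ⟩
      ∑ (λ j → χ (core i j)) + ∑ (λ j → (i ≡ᵇ z) ▹ lost j + (j ≡ᵇ z) ▹ lost i)
        ≡⟨ cong (λ t → ∑ (λ j → χ (core i j)) + t) (trans (∑-+ _ _) (cong₂ _+_ (pull (i ≡ᵇ z)) (∑-point z (λ _ → lost i)))) ⟩
      ∑ (λ j → χ (core i j)) + ((i ≡ᵇ z) ▹ ∑ lost + lost i) ∎)
      where
      open ≡-Reasoning
      pull : ∀ b → ∑ (λ j → b ▹ lost j) ≡ b ▹ ∑ lost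
      pull true = refl
      pull false = ∑-zero {k}

    row-old : ∀ i → ∑ (λ j → χ (adj′ (old i) j)) ≡ lost i + (χ (i ≡ᵇ z) + (χ (i ≡ᵇ z) + ∑ (λ j → χ (core i j))))
    row-old i = ∑-old _

    total-core : ∑ (λ i → ∑ (λ j → χ (core i j))) + (∑ lost + ∑ lost) ≡ ∑ (λ i → ∑ (λ j → χ (adj₀ i j)))
    total-core = sym (begin
      ∑ (λ i → ∑ (λ j → χ (adj₀ i j))) ≡⟨ ∑-cong (λ i → sym (core-row i)) ⟩
      ∑ (λ i → ∑ (λ j → χ (core i j)) + ((i ≡ᵇ z) ▹ ∑ lost + lost i)) ≡⟨ ∑-+ _ _ ⟩
      ∑ (λ i → ∑ (λ j → χ (core i j))) + ∑ (λ i → (i ≡ᵇ z) ▹ ∑ lost + lost i)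
        ≡⟨ cong (λ t → ∑ (λ i → ∑ (λ j → χ (core i j))) + t) (trans (∑-+ _ _) (cong (λ t → t + ∑ lost) (∑-point z (λ _ → ∑ lost)))) ⟩
      ∑ (λ i → ∑ (λ j → χ (core i j))) + (∑ lost + ∑ lost) ∎)
      where open ≡-Reasoning

    ∑≥1 : ∀ (b : Fin k → Bool) c → b c ≡ true → 1ℤ ≤ ∑ (λ i → χ (b i))
    ∑≥1 b c h = lin (∑ (λ i → χ (b i)) ∷ 1ℤ ∷ ∑ (λ i → (i ≡ᵇ c) ▹ 1ℤ) ∷ []) (λ s o t → t ≐ # 1 ⟹ t ≼ s ⟹ # 1 ≼ s)
      (∑-point c (λ _ → 1ℤ)) (∑-mono below)
      where
      below : ∀ i → (i ≡ᵇ c) ▹ 1ℤ ≤ χ (b i)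
      below i with i Finp.≟ c
      ... | yes refl rewrite h = ℤp.≤-refl
      ... | no _ with b i
      ...   | true = +≤+ ℕ.z≤n
      ...   | false = ℤp.≤-refl

  composite-rows : (∀ i → + 3 ≤ ∑ (λ j → χ (adj₀ i j))) → ∀ i → + 3 ≤ ∑ (λ j → χ (adj′ i j))
  composite-rows rows 0F = lin (∑ (λ j → χ (adj′ 0F j)) ∷ ∑ lost ∷ [])
    (λ s l → s ≐ # 0 ⊕ (# 1 ⊕ (# 1 ⊕ l)) ⟹ # 1 ≼ l ⟹ # 3 ≼ s) (∑-old _)
    (∑≥1 (λ i → adj₀ z i ∧ not (part i)) (proj₁ other-side) (cong₂ (λ x y → x ∧ not y) (proj₁ (proj₂ other-side)) (proj₂ (proj₂ other-side))))
  composite-rows rows 1F = lin (∑ (λ j → χ (adj′ 1F j)) ∷ ∑ (λ i → χ (i ≡ᵇ z)) ∷ [])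
    (λ s l → s ≐ # 1 ⊕ (# 0 ⊕ (# 1 ⊕ l)) ⟹ l ≐ # 1 ⟹ # 3 ≼ s) (∑-old _) is-z
  composite-rows rows 2F = lin (∑ (λ j → χ (adj′ 2F j)) ∷ ∑ (λ i → χ (i ≡ᵇ z)) ∷ [])
    (λ s l → s ≐ # 1 ⊕ (# 1 ⊕ (# 0 ⊕ l)) ⟹ l ≐ # 1 ⟹ # 3 ≼ s) (∑-old _) is-z
  composite-rows rows (old i) = go (i Finp.≟ z)
    where
    go : Dec (i ≡ z) → + 3 ≤ ∑ (λ j → χ (adj′ (old i) j))
    go (yes refl) = lin (∑ (λ j → χ (adj′ (old z) j)) ∷ lost z ∷ χ (z ≡ᵇ z) ∷ ∑ (λ j → χ (core z j)) ∷ ∑ kept ∷ [])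
      (λ s l o c k → s ≐ l ⊕ (o ⊕ (o ⊕ c)) ⟹ l ≐ # 0 ⟹ o ≐ # 1 ⟹ c ≐ k ⟹ # 1 ≼ k ⟹ # 3 ≼ s)
      (row-old z) (cong (λ b → χ (b ∧ not (part z))) (irrefl₀ z)) (cong χ (≡ᵇ-refl z)) (∑-cong (λ j → cong χ (core-zˡ j)))
      (∑≥1 (λ i → adj₀ z i ∧ part i) (proj₁ one-side) (cong₂ _∧_ (proj₁ (proj₂ one-side)) (proj₂ (proj₂ one-side))))
    go (no ne) = lin (∑ (λ j → χ (adj′ (old i) j)) ∷ lost i ∷ χ (i ≡ᵇ z) ∷ ∑ (λ j → χ (core i j)) ∷ (i ≡ᵇ z) ▹ ∑ lost ∷ ∑ (λ j → χ (adj₀ i j)) ∷ [])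
      (λ s l o c b r → s ≐ l ⊕ (o ⊕ (o ⊕ c)) ⟹ o ≐ # 0 ⟹ c ⊕ (b ⊕ l) ≐ r ⟹ b ≐ # 0 ⟹ # 3 ≼ r ⟹ # 3 ≼ s)
      (row-old i) (cong χ (≡ᵇ-≢ ne)) (core-row i) (▹-false _ (≡ᵇ-≢ ne)) (rows i)

  -- Splitting `z` preserves the number of edges, and K₄ minus an edge brings five. Three new
  -- vertices thus raise the degree sum by 10, the slope in the edge count of 4-Ore graphs.
  composite-edges : + 3 * ∑ (λ i → ∑ (λ j → χ (adj₀ i j))) ≡ + 10 * + k - + 4 →
                    + 3 * ∑ (λ i → ∑ (λ j → χ (adj′ i j))) ≡ + 10 * + (3 ℕ.+ k) - + 4
  composite-edges h = lin
    (∑ (λ i → ∑ (λ j → χ (adj′ i j))) ∷ ∑ (λ j → χ (adj′ 0F j)) ∷ ∑ (λ j → χ (adj′ 1F j)) ∷ ∑ (λ j → χ (adj′ 2F j)) ∷ ∑ (λ i → ∑ (λ j → χ (adj′ (old i) j)))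
      ∷ ∑ lost ∷ ∑ (λ i → χ (i ≡ᵇ z)) ∷ ∑ (λ i → ∑ (λ j → χ (core i j))) ∷ ∑ (λ i → ∑ (λ j → χ (adj₀ i j))) ∷ + k ∷ + (3 ℕ.+ k) ∷ [])
    (λ t r₀ r₁ r₂ s l o c a k k' → t ≐ r₀ ⊕ (r₁ ⊕ (r₂ ⊕ s)) ⟹ r₀ ≐ # 0 ⊕ (# 1 ⊕ (# 1 ⊕ l)) ⟹ r₁ ≐ # 1 ⊕ (# 0 ⊕ (# 1 ⊕ o)) ⟹ r₂ ≐ # 1 ⊕ (# 1 ⊕ (# 0 ⊕ o)) ⟹
      s ≐ l ⊕ (o ⊕ (o ⊕ c)) ⟹ o ≐ # 1 ⟹ c ⊕ (l ⊕ l) ≐ a ⟹ 3 ⊙ a ≐ 10 ⊙ k ⊖ # 4 ⟹ k' ≐ # 3 ⊕ k ⟹ 3 ⊙ t ≐ 10 ⊙ k' ⊖ # 4)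
    (∑-old _) (∑-old _) (∑-old _) (∑-old _)
    (trans (∑-cong row-old) (trans (∑-+ _ _) (cong (λ t → ∑ lost + t) (trans (∑-+ _ _) (cong (λ t → ∑ (λ i → χ (i ≡ᵇ z)) + t) (∑-+ _ _))))))
    is-z total-core h refl

∣∘∣ : ∀ (σ : Permutation) (Z : VSet 3) → ∣ (λ c → Z (Permutation.to σ c)) ∣ ≡ ∣ Z ∣
∣∘∣ σ Z = begin
  ∣ (λ c → Z (to c)) ∣ ≡⟨ card-sum _ ⟩
  ∑S (λ c → Z (to c)) (λ _ → 1ℤ) ≡⟨ unfold ⟩
  ∑ (λ c → Z (to c) ▹ 1ℤ) ≡⟨ sym (S-reindex {B = All₃} to inj (λ _ → mk∈ refl) (λ {v} _ → from v , to-from v) (λ c → Z c ▹ 1ℤ)) ⟩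
  ∑S All₃ (λ c → Z c ▹ 1ℤ) ≡⟨ ∑S-All₃ Z (λ _ → 1ℤ) ⟩
  ∑S Z (λ _ → 1ℤ) ≡⟨ sym (card-sum Z) ⟩
  ∣ Z ∣ ∎
  where
  open Permutation σ
  open ≡-Reasoning
  inj : ∀ {i j} → to i ≡ to j → i ≡ j
  inj {i} {j} e = trans (sym (from-to i)) (trans (cong from e) (from-to j))
  opaque
    unfolding ∑S
    unfold : ∑S (λ c → Z (to c)) (λ _ → 1ℤ) ≡ ∑ (λ c → Z (to c) ▹ 1ℤ)
    unfold = refl

-- The cover obtained by identifying y with z along σ; y itself keeps its old edges but is not used afterwards.
module Contract {n : ℕ} (Γ : Cover n) (z y : Fin n) (σ : Permutation) where
  open Cover Γ
  open Permutation σ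

  m′ : Fin n → Fin n → ℕ
  m′ u v = if u ≡ᵇ z then (if v ≡ᵇ z then 0 else m z v ℕ.+ m y v) else (if v ≡ᵇ z then m u z ℕ.+ m u y else m u v)

  M′ : Fin n → Colour → Fin n → VSet 3
  M′ u c v = if u ≡ᵇ z then (if v ≡ᵇ z then (λ _ → false) else M z c v ∪ M y (to c) v)
             else (if v ≡ᵇ z then M u c z ∪ (λ d → M u c y (to d)) else M u c v)

  Γ′ : Cover n
  Γ′ = record { m = m′ ; m-sym = m′-sym ; m-irr = m′-irr ; M = M′ ; M-sym = λ {u} {c} {v} {d} → M′-sym u c v d ; M-deg = M′-deg }
    where
    m′-sym : ∀ u v → m′ u v ≡ m′ v u
    m′-sym u v with u Finp.≟ z | v Finp.≟ z
    ... | yes _ | yes _ = refl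
    ... | yes _ | no _ = cong₂ ℕ._+_ (m-sym z v) (m-sym y v)
    ... | no _ | yes _ = cong₂ ℕ._+_ (m-sym u z) (m-sym u y)
    ... | no _ | no _ = m-sym u v
    m′-irr : ∀ v → m′ v v ≡ 0
    m′-irr v with v Finp.≟ z
    ... | yes _ = refl
    ... | no _ = m-irr v
    M′-sym : ∀ u c v d → d ∈ M′ u c v → c ∈ M′ v d u
    M′-sym u c v d h with u Finp.≟ z | v Finp.≟ z
    ... | yes _ | yes _ = mk∈ (un∈ h)
    ... | yes _ | no _ = [ (λ q → ∪ˡ {A = M v d z} (M-sym q)) , (λ q → ∪ʳ {A = M v d z} (mk∈ (un∈ (M-sym q)))) ]′ (∪-elim {A = M z c v} h)
    ... | no _ | yes _ = [ (λ q → ∪ˡ {A = M z d u} (M-sym q)) , (λ q → ∪ʳ {A = M z d u} (M-sym (mk∈ {A = M u c y} (un∈ q)))) ]′ (∪-elim {A = M u c z} h)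
    ... | no _ | no _ = M-sym h
    M′-deg : ∀ u c v → ∣ M′ u c v ∣ ≤ + m′ u v
    M′-deg u c v with u Finp.≟ z | v Finp.≟ z
    ... | yes _ | yes _ = ℤp.≤-reflexive (trans (card₃ (λ _ → false)) refl)
    ... | yes _ | no _ = ℤp.≤-trans (card-∪≤ (M z c v) (M y (to c) v)) (ℤp.+-mono-≤ (M-deg z c v) (M-deg y (to c) v))
    ... | no _ | yes _ = ℤp.≤-trans (card-∪≤ (M u c z) _) (ℤp.+-mono-≤ (M-deg u c z) (ℤp.≤-trans (ℤp.≤-reflexive (∣∘∣ σ (M u c y))) (M-deg u c y)))
    ... | no _ | no _ = M-deg u c v

  m′-off : ∀ {u v} → u ≢ z → v ≢ z → m′ u v ≡ m u v
  m′-off nu nv rewrite ≡ᵇ-≢ nu | ≡ᵇ-≢ nv = refl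

  m′-z : ∀ {v} → v ≢ z → m′ z v ≡ m z v ℕ.+ m y v
  m′-z nv rewrite ≡ᵇ-refl z | ≡ᵇ-≢ nv = refl

  M′-off : ∀ {u c v} → u ≢ z → v ≢ z → M′ u c v ≡ M u c v
  M′-off nu nv rewrite ≡ᵇ-≢ nu | ≡ᵇ-≢ nv = refl

  M′-z : ∀ {c v} → v ≢ z → M′ z c v ≡ M z c v ∪ M y (to c) v
  M′-z nv rewrite ≡ᵇ-refl z | ≡ᵇ-≢ nv = refl

module DiamondLemma {n : ℕ} (st : State n) where
  open State st
  open Gap₃ st
  open EdgeLemma st
  open LowVertices st
  open RingWorlds st

  -- The degree bounds make the listed edges at `a` and `b` simple and leave these two vertices no
  -- other edge in `A`.
  record Diamond : Set where
    field
      z y a b : Fin n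
      z∈ : z ∈ A
      y∈ : y ∈ A
      a∈ : a ∈ A
      b∈ : b ∈ A
      z≢y : z ≢ y
      za : 1ℤ ≤ + m z a
      zb : 1ℤ ≤ + m z b
      ya : 1ℤ ≤ + m y a
      yb : 1ℤ ≤ + m y b
      ab : 1ℤ ≤ + m a b
      da : deg a A ≤ + 3
      db : deg b A ≤ + 3

  module NoDiamond (μ≡0 : μ ≡ 0ℤ) (fullA : ∀ {v} → v ∈ A → Full (L v)) (dia : Diamond) where
    open Diamond dia
    open AllLists μ≡0 fullA using (negative)

    rev : ∀ {u v} → 1ℤ ≤ + m u v → 1ℤ ≤ + m v u
    rev {u} {v} = subst (λ k → 1ℤ ≤ + k) (m-sym u v)

    z≢a = nonself za
    z≢b = nonself zb
    y≢a = nonself ya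
    y≢b = nonself yb
    a≢b = nonself ab

    nbr-a : (∀ {u} → u ∈ A → 1ℤ ≤ + m a u → (u ≡ z) ⊎ (u ≡ y) ⊎ (u ≡ b)) × (+ m a z ≤ 1ℤ) × (+ m a y ≤ 1ℤ)
    nbr-a = three-nbrs da z∈ y∈ b∈ z≢y z≢b y≢b (rev za) (rev ya) ab
    nbr-b : (∀ {u} → u ∈ A → 1ℤ ≤ + m b u → (u ≡ z) ⊎ (u ≡ y) ⊎ (u ≡ a)) × (+ m b z ≤ 1ℤ) × (+ m b y ≤ 1ℤ)
    nbr-b = three-nbrs db z∈ y∈ a∈ z≢y z≢a y≢a (rev zb) (rev yb) (rev ab)

    π₁ π₂ σ : Permutation
    π₁ = proj₁ (matching (subst (λ k → + k ≤ 1ℤ) (m-sym a z) (proj₁ (proj₂ nbr-a))))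
    π₂ = proj₁ (matching (subst (λ k → + k ≤ 1ℤ) (m-sym a y) (proj₂ (proj₂ nbr-a))))
    -- A colour of `z` is paired with the colour of `y` that blocks the same colour at `a`. After
    -- the identification `z` and `y` together take at most one colour from `a`.
    σ = record { to = λ c → from π₂ (to π₁ c) ; from = λ c → from π₁ (to π₂ c)
      ; from-to = λ c → trans (cong (from π₁) (to-from π₂ (to π₁ c))) (from-to π₁ c)
      ; to-from = λ c → trans (cong (from π₂) (to-from π₁ (to π₂ c))) (from-to π₂ c) }
      where open Permutation

    open Permutation

    A₃ A₂ A₁ : VSet n
    A₁ = A ∖ ⟨ a ⟩
    A₂ = A₁ ∖ ⟨ b ⟩
    A₃ = A₂ ∖ ⟨ y ⟩

    A₃⊆ : A₃ ⊆ A
    A₃⊆ q = ∖ˡ {A = A} (∖ˡ {A = A₁} (∖ˡ {A = A₂} q))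

    ≢y : ∀ {v} → v ∈ A₃ → v ≢ y
    ≢y q = ∉⟨⟩-elim (∖ʳ {A = A₂} q)
    ≢b : ∀ {v} → v ∈ A₃ → v ≢ b
    ≢b q = ∉⟨⟩-elim (∖ʳ {A = A₁} (∖ˡ {A = A₂} q))
    ≢a : ∀ {v} → v ∈ A₃ → v ≢ a
    ≢a q = ∉⟨⟩-elim (∖ʳ {A = A} (∖ˡ {A = A₁} (∖ˡ {A = A₂} q)))

    z∈₃ : z ∈ A₃
    z∈₃ = ∖-intro (∖-intro (∖-intro z∈ (∉⟨⟩ z≢a)) (∉⟨⟩ z≢b)) (∉⟨⟩ z≢y)

    open Contract Γ z y σ
    module P′ = Potentials Γ′

    module Unjoined (zy : m z y ≡ 0) where
      yz : m y z ≡ 0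
      yz = trans (m-sym y z) zy

      module Extend (ψ : P′.Colouring L A₃) where
        col′ : Fin n → Colour
        col′ = P′.col ψ

        base : ∀ {u v} → u ∈ A₃ → v ∈ A₃ → col′ v ∉ M u (col′ u) v
        base {u} {v} u∈ v∈ = decide (u Finp.≟ z) (v Finp.≟ z)
          where
          from-z : ∀ {v} → v ∈ A₃ → v ≢ z → col′ v ∉ M z (col′ z) v
          from-z {v} v∈ nv = not-in (λ q → absurd∈ (subst (col′ v ∈_) (sym (M′-z nv)) (∪ˡ {A = M z (col′ z) v} q)) (P′.proper ψ z∈₃ v∈))
          decide : Dec (u ≡ z) → Dec (v ≡ z) → col′ v ∉ M u (col′ u) v
          decide (yes e) (yes e') = M-zero (trans (cong₂ m e e') (m-irr z))
          decide (yes refl) (no nv) = from-z v∈ nv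
          decide (no nu) (yes refl) = not-in (λ q → absurd∈ (M-sym q) (from-z u∈ nu))
          decide (no nu) (no nv) = not-in (λ q → absurd∈ (subst (col′ v ∈_) (sym (M′-off nu nv)) q) (P′.proper ψ u∈ v∈))

        col₂ : Fin n → Colour
        col₂ v = if v ≡ᵇ y then to σ (col′ z) else col′ v

        col₂-y : col₂ y ≡ to σ (col′ z)
        col₂-y rewrite ≡ᵇ-refl y = refl
        col₂-off : ∀ {v} → v ≢ y → col₂ v ≡ col′ v
        col₂-off nv rewrite ≡ᵇ-≢ nv = refl

        from-y : ∀ {v} → v ∈ A₂ → v ≢ y → col₂ v ∉ M y (col₂ y) v
        from-y {v} v∈ nv = decide (v Finp.≟ z)
          where
          decide : Dec (v ≡ z) → col₂ v ∉ M y (col₂ y) v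
          decide (yes refl) = M-zero yz
          decide (no nz) = not-in (λ q → absurd∈ (subst (col′ v ∈_) (sym (M′-z nz)) (∪ʳ {A = M z (col′ z) v}
            (subst (λ c → col′ v ∈ M y c v) col₂-y (subst (_∈ M y (col₂ y) v) (col₂-off nv) q)))) (P′.proper ψ z∈₃ (∖-intro v∈ (∉⟨⟩ nv))))

        φ₂ : Colouring L A₂
        φ₂ = record { col = col₂ ; col∈ = λ v∈ → fullA (∖ˡ {A = A} (∖ˡ {A = A₁} v∈)) ; proper = λ {u} {v} u∈ v∈ → ok u∈ v∈ (u Finp.≟ y) (v Finp.≟ y) }
          where
          ok : ∀ {u v} → u ∈ A₂ → v ∈ A₂ → Dec (u ≡ y) → Dec (v ≡ y) → col₂ v ∉ M u (col₂ u) v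
          ok u∈ v∈ (yes e) (yes e') = M-zero (trans (cong₂ m e e') (m-irr y))
          ok u∈ v∈ (yes refl) (no nv) = from-y v∈ nv
          ok u∈ v∈ (no nu) (yes refl) = not-in (λ q → absurd∈ (M-sym q) (from-y u∈ nu))
          ok {u} {v} u∈ v∈ (no nu) (no nv) rewrite col₂-off nu | col₂-off nv = base (∖-intro u∈ (∉⟨⟩ nu)) (∖-intro v∈ (∉⟨⟩ nv))

        b∉ : b ∉ A₂
        b∉ = not-in (λ q → absurd∈ ∈⟨⟩ (∖ʳ {A = A₁} q))

        -- `b` is coloured before `a`, so at most two of its three edges lead to coloured vertices.
        room : deg b A₂ + 1ℤ ≤ ∣ L b ∣
        room = lin (deg b A ∷ deg b (A₂ ∪ ⟨ a ⟩) ∷ deg b A₂ ∷ deg b ⟨ a ⟩ ∷ + m b a ∷ ∣ L b ∣ ∷ [])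
          (λ d u e o x l → d ≼ # 3 ⟹ u ≼ d ⟹ u ≐ e ⊕ o ⟹ o ≐ x ⟹ # 1 ≼ x ⟹ l ≐ # 3 ⟹ e ⊕ # 1 ≼ l)
          db (deg-⊆ (λ q → [ (λ q → ∖ˡ {A = A} (∖ˡ {A = A₁} q)) , ⟨⟩-⊆ a∈ ]′ (∪-elim {A = A₂} q)))
          (S-∪ (disjoint-⟨⟩ (not-in (λ q → absurd∈ ∈⟨⟩ (∖ʳ {A = A} (∖ˡ {A = A₁} q))))) _) (S-point a _) (rev ab) (full-card (fullA b∈))

        φ₁ : Colouring L A₁
        φ₁ = restrict (λ _ q → q) remove-cover (extendPoint φ₂ b∉ room)

        φ₁-col : ∀ {v} → v ∈ A₂ → col φ₁ v ≡ col₂ v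
        φ₁-col v∈ = extendPoint-col φ₂ b∉ room v∈

        z∈₂ : z ∈ A₂
        z∈₂ = ∖ˡ {A = A₂} z∈₃
        y∈₂ : y ∈ A₂
        y∈₂ = ∖-intro (∖-intro y∈ (∉⟨⟩ y≢a)) (∉⟨⟩ y≢b)

        -- z and y block the same colour of a.
        result : R
        result = last (avoid ⟨ to π₁ (col′ z) ⟩ (M b (col φ₁ b) a) (ℤp.≤-reflexive (card-point _))
                   (ℤp.≤-trans (M-deg b _ a) (ℤp.≤-reflexive (ℤp.≤-antisym light-ab (rev ab)))))
          where
          light-ab : + m b a ≤ 1ℤ
          light-ab = subst (λ k → + k ≤ 1ℤ) (m-sym a b) (proj₁ (proj₂ (three-nbrs da b∈ y∈ z∈ (y≢b ∘ sym) (z≢b ∘ sym) (z≢y ∘ sym) ab (rev ya) (rev za))))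
          last : ∃[ c ] c ∉ ⟨ to π₁ (col′ z) ⟩ × c ∉ M b (col φ₁ b) a → R
          last (c , c∉₁ , c∉₂) = done (restrict (λ _ q → q) remove-cover (combine φ₁ (disjoint-⟨⟩ (not-in (λ q → absurd∈ ∈⟨⟩ (∖ʳ {A = A} q))))
            (colourPoint {c = c} (∖-intro (fullA a∈) (not-in (λ q → clash (blocked-elim {A₁} q)))))))
            where
            clash : ∃[ s ] s ∈ A₁ × c ∈ M s (col φ₁ s) a → ⊥
            clash (s , s∈ , q) = at (proj₁ nbr-a (∖ˡ {A = A} s∈) (M-pos (M-sym q)))
              where
              at : (s ≡ z) ⊎ (s ≡ y) ⊎ (s ≡ b) → ⊥
              at (inj₁ refl) = ∉⟨⟩-elim c∉₁ (trans (proj₂ (matching (subst (λ k → + k ≤ 1ℤ) (m-sym a z) (proj₁ (proj₂ nbr-a)))) q)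
                (cong (to π₁) (trans (φ₁-col z∈₂) (col₂-off z≢y))))
              at (inj₂ (inj₁ refl)) = ∉⟨⟩-elim c∉₁ (trans (proj₂ (matching (subst (λ k → + k ≤ 1ℤ) (m-sym a y) (proj₂ (proj₂ nbr-a)))) q)
                (trans (cong (to π₂) (trans (φ₁-col y∈₂) col₂-y)) (to-from π₂ (to π₁ (col′ z)))))
              at (inj₂ (inj₂ refl)) = absurd∈ q c∉₂

      -- A common neighbour of z and y outside the diamond would give a set of small potential.
      common : ∀ {w} → w ∈ A₃ → 1ℤ ≤ + m z w → 1ℤ ≤ + m y w → R
      common {w} w∈₃ zw yw = go (⊎-search A S₅)
        where
        w∈ = A₃⊆ w∈₃
        zy-pair abzy S₅ : VSet n
        zy-pair = ⟨ z ⟩ ∪ ⟨ y ⟩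
        abzy = ⟨ a ⟩ ∪ (⟨ b ⟩ ∪ zy-pair)
        S₅ = ⟨ w ⟩ ∪ abzy
        c : Fin n → Fin n → ℤ
        c u v = cost (m u v)
        c≥5 : ∀ {u v} → 1ℤ ≤ + m u v → + 5 ≤ c u v
        c≥5 {u} {v} h = lin (+ m u v ∷ c u v ∷ []) (λ x y → # 1 ≼ x ⟹ 5 ⊙ x ≼ y ⟹ # 5 ≼ y) h (cost≥5m (m u v))
        notpair : ∀ {v} → v ≢ z → v ≢ y → v ∉ zy-pair
        notpair nz ny = not-in (λ q → [ (λ e → nz (⟨⟩-elim e)) , (λ e → ny (⟨⟩-elim e)) ]′ (∪-elim {A = ⟨ z ⟩} q))
        b∉ : b ∉ zy-pair
        b∉ = notpair (z≢b ∘ sym) (y≢b ∘ sym)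
        a∉ : a ∉ ⟨ b ⟩ ∪ zy-pair
        a∉ = not-in (λ q → [ (λ e → a≢b (⟨⟩-elim e)) , (λ q → absurd∈ q (notpair (z≢a ∘ sym) (y≢a ∘ sym))) ]′ (∪-elim {A = ⟨ b ⟩} q))
        w∉ : w ∉ abzy
        w∉ = not-in (λ q → [ (λ e → ≢a w∈₃ (⟨⟩-elim e)) , (λ q → [ (λ e → ≢b w∈₃ (⟨⟩-elim e)) ,
               (λ q → absurd∈ q (notpair (nonself zw ∘ sym) (≢y w∈₃))) ]′ (∪-elim {A = ⟨ b ⟩} q)) ]′ (∪-elim {A = ⟨ a ⟩} q))
        sum-zy : ∀ g → ∑S zy-pair g ≡ g z + g y
        sum-zy g = trans (S-∪ (⟨⟩-disjoint (∉⟨⟩ z≢y)) g) (cong₂ _+_ (S-point z g) (S-point y g))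
        sum-4 : ∀ g → ∑S abzy g ≡ g a + (g b + (g z + g y))
        sum-4 g = trans (S-∪ (⟨⟩-disjoint a∉) g) (cong₂ _+_ (S-point a g) (trans (S-∪ (⟨⟩-disjoint b∉) g) (cong₂ _+_ (S-point b g) (sum-zy g))))
        ρ₅ : ρ L S₅ ≤ + 15 - c w z - c w y
        ρ₅ = lin (ρ L S₅ ∷ ρ L abzy ∷ ρ L (⟨ b ⟩ ∪ zy-pair) ∷ ρ L zy-pair ∷ ρ L ⟨ y ⟩ ∷ p (L w) ∷ p (L a) ∷ p (L b) ∷ p (L z) ∷ p (L y)
            ∷ ∑S abzy (c w) ∷ ∑S (⟨ b ⟩ ∪ zy-pair) (c a) ∷ ∑S zy-pair (c b) ∷ ∑S ⟨ y ⟩ (c z) ∷ c w a ∷ c w b ∷ c w z ∷ c w y ∷ c a b ∷ c a z ∷ c a y ∷ c b z ∷ c b y ∷ c z y ∷ [])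
          (λ r₅ r₄ r₃ r₂ r₁ pw pa pb pz py sw sa sb sz wa wb wz wy ab az ay bz by zy →
            r₅ ≐ pw ⊕ r₄ ⊖ sw ⟹ r₄ ≐ pa ⊕ r₃ ⊖ sa ⟹ r₃ ≐ pb ⊕ r₂ ⊖ sb ⟹ r₂ ≐ pz ⊕ r₁ ⊖ sz ⟹ r₁ ≐ py ⟹
            sw ≐ wa ⊕ (wb ⊕ (wz ⊕ wy)) ⟹ sa ≐ ab ⊕ (az ⊕ ay) ⟹ sb ≐ bz ⊕ by ⟹ sz ≐ zy ⟹
            pw ≼ # 8 ⟹ pa ≼ # 8 ⟹ pb ≼ # 8 ⟹ pz ≼ # 8 ⟹ py ≼ # 8 ⟹ # 0 ≼ wa ⟹ # 0 ≼ wb ⟹ # 5 ≼ ab ⟹ # 5 ≼ az ⟹ # 5 ≼ ay ⟹ # 5 ≼ bz ⟹ # 5 ≼ by ⟹ # 0 ≼ zy ⟹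
            r₅ ≼ # 15 ⊖ wz ⊖ wy)
          (ρ-insert L w∉) (ρ-insert L a∉) (ρ-insert L b∉) (ρ-insert L (∉⟨⟩ z≢y)) (ρ-point L y)
          (sum-4 (c w)) (trans (S-∪ (⟨⟩-disjoint b∉) (c a)) (cong₂ _+_ (S-point b (c a)) (sum-zy (c a)))) (sum-zy (c b)) (S-point y (c z))
          (p≤8 (L w)) (p≤8 (L a)) (p≤8 (L b)) (p≤8 (L z)) (p≤8 (L y)) (cost≥0 (m w a)) (cost≥0 (m w b))
          (c≥5 ab) (c≥5 (rev za)) (c≥5 (rev ya)) (c≥5 (rev zb)) (c≥5 (rev yb)) (cost≥0 (m z y))
        S₅⊆ : S₅ ⊆ A
        S₅⊆ q = [ ⟨⟩-⊆ w∈ , (λ q → [ ⟨⟩-⊆ a∈ , (λ q → [ ⟨⟩-⊆ b∈ , (λ q → [ ⟨⟩-⊆ z∈ , ⟨⟩-⊆ y∈ ]′ (∪-elim {A = ⟨ z ⟩} q)) ]′ (∪-elim {A = ⟨ b ⟩} q)) ]′ (∪-elim {A = ⟨ a ⟩} q)) ]′ (∪-elim {A = ⟨ w ⟩} q)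
        zero-of : ∀ {u v} → (1ℤ ≤ + m u v → ⊥) → + m u v ≡ 0ℤ
        zero-of {u} {v} h = ℤp.≤-antisym (ℤp.≮⇒≥ (h ∘ ℤp.i<j⇒suc[i]≤j)) (+≤+ ℕ.z≤n)
        go : (∃[ r ] r ∈ A × r ∉ S₅) ⊎ (A ⊆ S₅) → R
        go (inj₁ (r , r∈ , r∉)) = gap₃ S₅⊆ (∪ˡ {A = ⟨ w ⟩} ∈⟨⟩) r∈ r∉ (lin (ρ L S₅ ∷ c w z ∷ c w y ∷ μ ∷ [])
          (λ r x y μ → r ≼ # 15 ⊖ x ⊖ y ⟹ # 5 ≼ x ⟹ # 5 ≼ y ⟹ μ ≐ # 0 ⟹ r ≼ μ ⊕ # 5) ρ₅ (c≥5 (rev zw)) (c≥5 (rev yw)) μ≡0)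
        -- Nothing else is left, so all edges of `w`, at least three, end at `z` and `y`. They cost
        -- at least 6 * 3 - 2 = 16, which is more than 15.
        go (inj₂ all) = minDegree w∈ λ d → negative {S₅} S₅⊆ (∪ˡ {A = ⟨ w ⟩} ∈⟨⟩)
          (lin (ρ L S₅ ∷ c w z ∷ c w y ∷ ∣ L w ∣ ∷ deg w A ∷ deg w S₅ ∷ deg w ⟨ w ⟩ ∷ deg w abzy ∷ + m w w ∷ + m w a ∷ + m w b ∷ + m w z ∷ + m w y ∷ [])
            (λ r x y l d e o f ww wa wb wz wy → r ≼ # 15 ⊖ x ⊖ y ⟹ l ≼ d ⟹ l ≐ # 3 ⟹ d ≼ e ⟹ e ≐ o ⊕ f ⟹ o ≐ ww ⟹ ww ≐ # 0 ⟹ f ≐ wa ⊕ (wb ⊕ (wz ⊕ wy)) ⟹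
              wa ≐ # 0 ⟹ wb ≐ # 0 ⟹ x ≐ 6 ⊙ wz ⊖ # 1 ⟹ y ≐ 6 ⊙ wy ⊖ # 1 ⟹ r ⊕ # 1 ≼ # 0)
            ρ₅ d (full-card (fullA w∈)) (deg-⊆ all) (S-∪ (⟨⟩-disjoint w∉) _) (S-point w _) (cong +_ (m-irr w)) (sum-4 (λ v → + m w v))
            (zero-of (λ h → [ (λ e → nonself zw (sym e)) , (λ q → [ ≢y w∈₃ , ≢b w∈₃ ]′ q) ]′ (proj₁ nbr-a w∈ (rev h))))
            (zero-of (λ h → [ (λ e → nonself zw (sym e)) , (λ q → [ ≢y w∈₃ , ≢a w∈₃ ]′ q) ]′ (proj₁ nbr-b w∈ (rev h))))
            (cost≡6m-1 (m w z) (rev zw)) (cost≡6m-1 (m w y) (rev yw)))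

      ρ-off : ∀ {W} → z ∉ W → P′.ρ L W ≡ ρ L W
      ρ-off {W} z∉ = ρ-agree Γ′ Γ L W (λ u∈ v∈ → m′-off (∈-≢ u∈ z∉) (∈-≢ v∈ z∉))

      Exceptional-old : ∀ {W} → W ⊆ A → (x : Exceptional Γ′ W) →
                        (∀ {i j} → adj (Exceptional.G₀ x) i j ≡ true → 1ℤ ≤ + m (Exceptional.θ x i) (Exceptional.θ x j)) → ∀ {w} → w ∈ W → R
      Exceptional-old wa x joined w∈ = out (_ , wa , (_ , w∈) , inj₂ (inj₂ (record
        { G₀ = G₀ ; ore = ore ; θ = θ ; θ-inj = θ-inj ; θ∈ = θ∈ ; θ-onto = θ-onto ; θ-adj = joined
        ; size = size ; edges = edges ; rows = rows ; complete = complete })))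
        where open Exceptional x

      module Through (separate : ∀ {w} → w ∈ A₃ → (m z w ≡ 0) ⊎ (m y w ≡ 0)) {W : VSet n} (W⊆ : W ⊆ A₃) (z∈W : z ∈ W) where
        W₀ W⁺ : VSet n
        W₀ = W ∖ ⟨ z ⟩
        W⁺ = ⟨ a ⟩ ∪ (⟨ b ⟩ ∪ (⟨ y ⟩ ∪ W))

        y∉W : y ∉ W
        y∉W = not-in (λ q → ≢y (W⊆ q) refl)
        b∉yW : b ∉ ⟨ y ⟩ ∪ W
        b∉yW = not-in (λ q → [ (λ e → y≢b (sym (⟨⟩-elim e))) , (λ q → ≢b (W⊆ q) refl) ]′ (∪-elim {A = ⟨ y ⟩} q))
        a∉byW : a ∉ ⟨ b ⟩ ∪ (⟨ y ⟩ ∪ W)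
        a∉byW = not-in (λ q → [ (λ e → a≢b (⟨⟩-elim e)) , (λ q → [ (λ e → y≢a (sym (⟨⟩-elim e))) , (λ q → ≢a (W⊆ q) refl) ]′ (∪-elim {A = ⟨ y ⟩} q)) ]′ (∪-elim {A = ⟨ b ⟩} q))

        z∉W₀ : z ∉ W₀
        z∉W₀ = not-in (λ q → absurd∈ ∈⟨⟩ (∖ʳ {A = W} q))
        W≈ : W ⊆ ⟨ z ⟩ ∪ W₀
        W≈ {v} q with dec∈ v ⟨ z ⟩
        ... | inj₁ e = ∪ˡ {A = ⟨ z ⟩} e
        ... | inj₂ ne = ∪ʳ {A = ⟨ z ⟩} (∖-intro q ne)
        ≈W : ⟨ z ⟩ ∪ W₀ ⊆ W
        ≈W q = [ ⟨⟩-⊆ z∈W , ∖ˡ {A = W} ]′ (∪-elim {A = ⟨ z ⟩} q)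

        -- A bundle merged from two nonempty bundles would cost one more than both together;
        -- `separate` says that no such merging occurs.
        cost-split : ∀ {v} → v ∈ W₀ → cost (m′ z v) ≡ cost (m z v) + cost (m y v)
        cost-split {v} v∈ = trans (cong cost (m′-z (∉⟨⟩-elim (∖ʳ {A = W} v∈)))) (go (separate (W⊆ (∖ˡ {A = W} v∈))))
          where
          go : (m z v ≡ 0) ⊎ (m y v ≡ 0) → cost (m z v ℕ.+ m y v) ≡ cost (m z v) + cost (m y v)
          go (inj₁ e) rewrite e = sym (ℤp.+-identityˡ _)
          go (inj₂ e) rewrite e = trans (cong cost (ℕp.+-identityʳ (m z v))) (sym (ℤp.+-identityʳ _))

        ρ′-W : P′.ρ L W ≡ ρ L W - ∑S W (λ v → cost (m y v))
        ρ′-W = lin (P′.ρ L W ∷ P′.ρ L (⟨ z ⟩ ∪ W₀) ∷ ρ L W ∷ ρ L (⟨ z ⟩ ∪ W₀) ∷ P′.ρ L W₀ ∷ ρ L W₀ ∷ p (L z) ∷ ∑S W₀ (λ v → cost (m′ z v)) ∷ ∑S W₀ (λ v → cost (m z v))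
            ∷ ∑S W₀ (λ v → cost (m y v)) ∷ ∑S W (λ v → cost (m y v)) ∷ ∑S (⟨ z ⟩ ∪ W₀) (λ v → cost (m y v)) ∷ ∑S ⟨ z ⟩ (λ v → cost (m y v)) ∷ cost (m y z) ∷ [])
          (λ r' r'z r rz r'₀ r₀ q s' s t u uz o c → r' ≐ r'z ⟹ r ≐ rz ⟹ r'z ≐ q ⊕ r'₀ ⊖ s' ⟹ rz ≐ q ⊕ r₀ ⊖ s ⟹ r'₀ ≐ r₀ ⟹ s' ≐ s ⊕ t ⟹ u ≐ uz ⟹ uz ≐ o ⊕ t ⟹ o ≐ c ⟹ c ≐ # 0 ⟹ r' ≐ r ⊖ u)
          (P′.ρ-ext W≈ ≈W) (ρ-ext W≈ ≈W) (P′.ρ-insert L z∉W₀) (ρ-insert L z∉W₀) (ρ-off z∉W₀)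
          (trans (S-cong {A = W₀} cost-split) (S-+ W₀ _ _)) (S-ext⊆ {A = W} {⟨ z ⟩ ∪ W₀} W≈ ≈W) (S-∪ (⟨⟩-disjoint z∉W₀) _) (S-point z _) (cong cost yz)

        -- Undoing the identification adds `y`, `a`, `b` with potential at most 24 and the five
        -- edges of the diamond with cost at least 25.
        ρ⁺ : ρ L W⁺ + 1ℤ ≤ P′.ρ L W
        ρ⁺ = lin (ρ L W⁺ ∷ ρ L (⟨ b ⟩ ∪ (⟨ y ⟩ ∪ W)) ∷ ρ L (⟨ y ⟩ ∪ W) ∷ ρ L W ∷ P′.ρ L W ∷ p (L a) ∷ p (L b) ∷ p (L y)
            ∷ ∑S (⟨ b ⟩ ∪ (⟨ y ⟩ ∪ W)) (λ v → cost (m a v)) ∷ ∑S (⟨ y ⟩ ∪ W) (λ v → cost (m b v)) ∷ ∑S W (λ v → cost (m y v)) ∷ [])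
          (λ r₃ r₂ r₁ r r' pa pb py sa sb sy → r₃ ≐ pa ⊕ r₂ ⊖ sa ⟹ r₂ ≐ pb ⊕ r₁ ⊖ sb ⟹ r₁ ≐ py ⊕ r ⊖ sy ⟹ r' ≐ r ⊖ sy ⟹ pa ≼ # 8 ⟹ pb ≼ # 8 ⟹ py ≼ # 8 ⟹ # 15 ≼ sa ⟹ # 10 ≼ sb ⟹ r₃ ⊕ # 1 ≼ r')
          (ρ-insert L a∉byW) (ρ-insert L b∉yW) (ρ-insert L y∉W) ρ′-W (p≤8 (L a)) (p≤8 (L b)) (p≤8 (L y))
          (lin (∑S (⟨ b ⟩ ∪ (⟨ y ⟩ ∪ W)) (c a) ∷ ∑S ⟨ b ⟩ (c a) ∷ ∑S (⟨ y ⟩ ∪ W) (c a) ∷ ∑S ⟨ y ⟩ (c a) ∷ ∑S W (c a) ∷ c a b ∷ c a y ∷ c a z ∷ [])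
            (λ s sb t sy u b y z → s ≐ sb ⊕ t ⟹ sb ≐ b ⟹ t ≐ sy ⊕ u ⟹ sy ≐ y ⟹ z ≼ u ⟹ # 5 ≼ b ⟹ # 5 ≼ y ⟹ # 5 ≼ z ⟹ # 15 ≼ s)
            (S-∪ (⟨⟩-disjoint b∉yW) _) (S-point b _) (S-∪ (⟨⟩-disjoint y∉W) _) (S-point y _) (S-term {A = W} z∈W (λ {w} _ → cost≥0 (m a w))) (c≥5 ab) (c≥5 (rev ya)) (c≥5 (rev za)))
          (lin (∑S (⟨ y ⟩ ∪ W) (c b) ∷ ∑S ⟨ y ⟩ (c b) ∷ ∑S W (c b) ∷ c b y ∷ c b z ∷ [])
            (λ t sy u y z → t ≐ sy ⊕ u ⟹ sy ≐ y ⟹ z ≼ u ⟹ # 5 ≼ y ⟹ # 5 ≼ z ⟹ # 10 ≼ t)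
            (S-∪ (⟨⟩-disjoint y∉W) _) (S-point y _) (S-term {A = W} z∈W (λ {w} _ → cost≥0 (m b w))) (c≥5 (rev yb)) (c≥5 (rev zb)))
          where
          c : Fin n → Fin n → ℤ
          c u v = cost (m u v)
          c≥5 : ∀ {u v} → 1ℤ ≤ + m u v → + 5 ≤ c u v
          c≥5 {u} {v} h = lin (+ m u v ∷ c u v ∷ []) (λ x y → # 1 ≼ x ⟹ 5 ⊙ x ≼ y ⟹ # 5 ≼ y) h (cost≥5m (m u v))

        W⁺⊆ : W⁺ ⊆ A
        W⁺⊆ q = [ ⟨⟩-⊆ a∈ , (λ q → [ ⟨⟩-⊆ b∈ , (λ q → [ ⟨⟩-⊆ y∈ , (λ q → A₃⊆ (W⊆ q)) ]′ (∪-elim {A = ⟨ y ⟩} q)) ]′ (∪-elim {A = ⟨ b ⟩} q)) ]′ (∪-elim {A = ⟨ a ⟩} q)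

        small : P′.ρ L W ≤ 0ℤ → R
        small h = negative {W⁺} W⁺⊆ (∪ˡ {A = ⟨ a ⟩} ∈⟨⟩) (lin (ρ L W⁺ ∷ P′.ρ L W ∷ []) (λ r s → r ⊕ # 1 ≼ s ⟹ s ≼ # 0 ⟹ r ⊕ # 1 ≼ # 0) ρ⁺ h)

        module Ore (x : Exceptional Γ′ W) where
          open Exceptional x
          k : ℕ
          k = Graph.n G₀
          iz : Fin k
          iz = proj₁ (θ-onto z∈W)
          θ-iz : θ iz ≡ z
          θ-iz = proj₂ (θ-onto z∈W)
          θ≢z : ∀ {i} → i ≢ iz → θ i ≢ z
          θ≢z ne e = ne (θ-inj (trans e (sym θ-iz)))

          -- Marks the neighbours that the contracted vertex inherits from `z`; each of the others
          -- comes from `y`.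
          part : Fin k → Bool
          part j = does (1ℤ ℤ.≤? + m z (θ j))

          part-true : ∀ {j} → part j ≡ true → 1ℤ ≤ + m z (θ j)
          part-true {j} h = does-true (1ℤ ℤ.≤? + m z (θ j)) h

          at-z : ∀ {j} → adj G₀ iz j ≡ true → 1ℤ ≤ + (m z (θ j) ℕ.+ m y (θ j))
          at-z {j} h = subst (λ t → 1ℤ ≤ + t) (trans (cong (λ u → m′ u (θ j)) θ-iz) (m′-z (θ≢z (λ { refl → true≢false h (Graph.irrefl G₀ iz) })))) (θ-adj h)

          part-false : ∀ {j} → adj G₀ iz j ≡ true → part j ≡ false → 1ℤ ≤ + m y (θ j)
          part-false {j} h q = lin (+ m z (θ j) ∷ + m y (θ j) ∷ + (m z (θ j) ℕ.+ m y (θ j)) ∷ []) (λ a b s → a ≼ # 0 ⟹ s ≐ a ⊕ b ⟹ # 1 ≼ s ⟹ # 1 ≼ b)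
            (ℤp.≮⇒≥ (does-false (1ℤ ℤ.≤? + m z (θ j)) q ∘ ℤp.i<j⇒suc[i]≤j)) refl (at-z h)

          away : ∀ {i j} → i ≢ iz → j ≢ iz → adj G₀ i j ≡ true → 1ℤ ≤ + m (θ i) (θ j)
          away ni nj h = subst (λ t → 1ℤ ≤ + t) (m′-off (θ≢z ni) (θ≢z nj)) (θ-adj h)

          adj-sym : ∀ {i j} → adj G₀ i j ≡ true → adj G₀ j i ≡ true
          adj-sym {i} {j} h = trans (sym (Graph.sym G₀ i j)) h

          sides : ∀ b → (∃[ c ] (adj G₀ iz c ≡ true × part c ≡ b)) ⊎ (∀ {c} → adj G₀ iz c ≡ true → part c ≡ not b)
          sides b with search (λ _ → true) {λ c → adj G₀ iz c ≡ true × part c ≡ b} {λ c → adj G₀ iz c ≡ true → part c ≡ not b} cell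
            where
            cell : ∀ c → (adj G₀ iz c ≡ true × part c ≡ b) ⊎ (adj G₀ iz c ≡ true → part c ≡ not b)
            cell c = go (adj G₀ iz c) (part c) b
              where
              go : ∀ x y b → (x ≡ true × y ≡ b) ⊎ (x ≡ true → y ≡ not b)
              go false _ _ = inj₂ (λ ())
              go true true true = inj₁ (refl , refl)
              go true false false = inj₁ (refl , refl)
              go true true false = inj₂ (λ _ → refl)
              go true false true = inj₂ (λ _ → refl)
          ... | inj₁ (c , _ , q) = inj₁ (c , q)
          ... | inj₂ h = inj₂ (λ {c} → h {c} (mk∈ refl))

          all-from-z : (∀ {c} → adj G₀ iz c ≡ true → part c ≡ true) → R
          all-from-z h = Exceptional-old (λ q → A₃⊆ (W⊆ q)) x (λ {i} {j} e → joined (i Finp.≟ iz) (j Finp.≟ iz) e) z∈W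
            where
            joined : ∀ {i j} → Dec (i ≡ iz) → Dec (j ≡ iz) → adj G₀ i j ≡ true → 1ℤ ≤ + m (θ i) (θ j)
            joined {i} {j} (yes refl) _ e = subst (λ u → 1ℤ ≤ + m u (θ j)) (sym θ-iz) (part-true (h e))
            joined {i} {j} (no _) (yes refl) e = rev (subst (λ u → 1ℤ ≤ + m u (θ i)) (sym θ-iz) (part-true (h (adj-sym e))))
            joined (no ni) (no nj) e = away ni nj e

          -- The 4-Ore graph is already present with `y` in the place of `z`.
          all-from-y : (∀ {c} → adj G₀ iz c ≡ true → part c ≡ false) → R
          all-from-y h = out (B₂ , B₂⊆ , (y , ∪ˡ {A = ⟨ y ⟩} ∈⟨⟩) , inj₂ (inj₂ (record
            { G₀ = G₀ ; ore = ore ; θ = θ₂ ; θ-inj = λ {i} {j} → inj₂′ (i Finp.≟ iz) (j Finp.≟ iz) ; θ∈ = λ i → in₂ i (i Finp.≟ iz) ; θ-onto = onto₂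
            ; θ-adj = λ {i} {j} e → joined (i Finp.≟ iz) (j Finp.≟ iz) e ; size = size ; edges = edges ; rows = rows ; complete = complete })))
            where
            B₂ : VSet n
            B₂ = ⟨ y ⟩ ∪ W₀
            B₂⊆ : B₂ ⊆ A
            B₂⊆ q = [ ⟨⟩-⊆ y∈ , (λ q → A₃⊆ (W⊆ (∖ˡ {A = W} q))) ]′ (∪-elim {A = ⟨ y ⟩} q)
            θ₂ : Fin k → Fin n
            θ₂ i = if i ≡ᵇ iz then y else θ i
            θ₂-z : θ₂ iz ≡ y
            θ₂-z rewrite ≡ᵇ-refl iz = refl
            θ₂-off : ∀ {i} → i ≢ iz → θ₂ i ≡ θ i
            θ₂-off ne rewrite ≡ᵇ-≢ ne = refl
            θ≢y : ∀ {i} → θ i ≢ y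
            θ≢y {i} e = absurd∈ (subst (_∈ W) e (θ∈ i)) y∉W
            inj₂′ : ∀ {i j} → Dec (i ≡ iz) → Dec (j ≡ iz) → θ₂ i ≡ θ₂ j → i ≡ j
            inj₂′ (yes refl) (yes refl) e = refl
            inj₂′ (yes refl) (no nj) e = ⊥-elim (θ≢y (trans (sym (θ₂-off nj)) (trans (sym e) θ₂-z)))
            inj₂′ (no ni) (yes refl) e = ⊥-elim (θ≢y (trans (sym (θ₂-off ni)) (trans e θ₂-z)))
            inj₂′ (no ni) (no nj) e = θ-inj (trans (sym (θ₂-off ni)) (trans e (θ₂-off nj)))
            in₂ : ∀ i → Dec (i ≡ iz) → θ₂ i ∈ B₂
            in₂ i (yes refl) = subst (_∈ B₂) (sym θ₂-z) (∪ˡ {A = ⟨ y ⟩} ∈⟨⟩)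
            in₂ i (no ni) = subst (_∈ B₂) (sym (θ₂-off ni)) (∪ʳ {A = ⟨ y ⟩} (∖-intro (θ∈ i) (∉⟨⟩ (θ≢z ni))))
            onto₂ : ∀ {v} → v ∈ B₂ → ∃[ i ] θ₂ i ≡ v
            onto₂ q with ∪-elim {A = ⟨ y ⟩} q
            ... | inj₁ e = iz , trans θ₂-z (sym (⟨⟩-elim e))
            ... | inj₂ q = let (i , e) = θ-onto (∖ˡ {A = W} q) in
                i , trans (θ₂-off (λ eq → ∉⟨⟩-elim (∖ʳ {A = W} q) (trans (sym e) (trans (cong θ eq) θ-iz)))) e
            joined : ∀ {i j} → Dec (i ≡ iz) → Dec (j ≡ iz) → adj G₀ i j ≡ true → 1ℤ ≤ + m (θ₂ i) (θ₂ j)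
            joined {i} {j} (yes refl) (yes refl) e = true≢false e (Graph.irrefl G₀ iz)
            joined {i} {j} (yes refl) (no nj) e = subst (1ℤ ≤_) (cong +_ (sym (cong₂ m θ₂-z (θ₂-off nj)))) (part-false e (h e))
            joined {i} {j} (no ni) (yes refl) e = rev (subst (1ℤ ≤_) (cong +_ (sym (cong₂ m θ₂-z (θ₂-off ni)))) (part-false (adj-sym e) (h (adj-sym e))))
            joined (no ni) (no nj) e = subst (1ℤ ≤_) (cong +_ (sym (cong₂ m (θ₂-off ni) (θ₂-off nj)))) (away ni nj e)

          module Both (one-side : ∃[ c ] (adj G₀ iz c ≡ true × part c ≡ true)) (other-side : ∃[ c ] (adj G₀ iz c ≡ true × part c ≡ false)) where
            open Composite G₀ iz part one-side other-side

            θ⁺ : Fin (3 ℕ.+ k) → Fin n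
            θ⁺ 0F = y
            θ⁺ 1F = a
            θ⁺ 2F = b
            θ⁺ (suc (suc (suc i))) = θ i

            θ⁺∈ : ∀ i → θ⁺ i ∈ W⁺
            θ⁺∈ 0F = ∪ʳ {A = ⟨ a ⟩} (∪ʳ {A = ⟨ b ⟩} (∪ˡ {A = ⟨ y ⟩} ∈⟨⟩))
            θ⁺∈ 1F = ∪ˡ {A = ⟨ a ⟩} ∈⟨⟩
            θ⁺∈ 2F = ∪ʳ {A = ⟨ a ⟩} (∪ˡ {A = ⟨ b ⟩} ∈⟨⟩)
            θ⁺∈ (suc (suc (suc i))) = ∪ʳ {A = ⟨ a ⟩} (∪ʳ {A = ⟨ b ⟩} (∪ʳ {A = ⟨ y ⟩} (θ∈ i)))

            onto⁺ : ∀ {v} → v ∈ W⁺ → ∃[ i ] θ⁺ i ≡ v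
            onto⁺ q with ∪-elim {A = ⟨ a ⟩} q
            ... | inj₁ e = 1F , sym (⟨⟩-elim e)
            ... | inj₂ q with ∪-elim {A = ⟨ b ⟩} q
            ...   | inj₁ e = 2F , sym (⟨⟩-elim e)
            ...   | inj₂ q with ∪-elim {A = ⟨ y ⟩} q
            ...     | inj₁ e = 0F , sym (⟨⟩-elim e)
            ...     | inj₂ q = let (i , e) = θ-onto q in suc (suc (suc i)) , e

            θA₃ : ∀ i → θ i ∈ A₃
            θA₃ i = W⊆ (θ∈ i)

            inj⁺ : ∀ {i j} → θ⁺ i ≡ θ⁺ j → i ≡ j
            inj⁺ {0F} {0F} e = refl
            inj⁺ {0F} {1F} e = ⊥-elim (y≢a e)
            inj⁺ {0F} {2F} e = ⊥-elim (y≢b e)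
            inj⁺ {0F} {suc (suc (suc j))} e = ⊥-elim (≢y (θA₃ j) (sym e))
            inj⁺ {1F} {0F} e = ⊥-elim (y≢a (sym e))
            inj⁺ {1F} {1F} e = refl
            inj⁺ {1F} {2F} e = ⊥-elim (a≢b e)
            inj⁺ {1F} {suc (suc (suc j))} e = ⊥-elim (≢a (θA₃ j) (sym e))
            inj⁺ {2F} {0F} e = ⊥-elim (y≢b (sym e))
            inj⁺ {2F} {1F} e = ⊥-elim (a≢b (sym e))
            inj⁺ {2F} {2F} e = refl
            inj⁺ {2F} {suc (suc (suc j))} e = ⊥-elim (≢b (θA₃ j) (sym e))
            inj⁺ {suc (suc (suc i))} {0F} e = ⊥-elim (≢y (θA₃ i) e)
            inj⁺ {suc (suc (suc i))} {1F} e = ⊥-elim (≢a (θA₃ i) e)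
            inj⁺ {suc (suc (suc i))} {2F} e = ⊥-elim (≢b (θA₃ i) e)
            inj⁺ {suc (suc (suc i))} {suc (suc (suc j))} e = cong (λ i → suc (suc (suc i))) (θ-inj e)

            to-y : ∀ j → adj G₀ iz j ∧ not (part j) ≡ true → 1ℤ ≤ + m y (θ j)
            to-y j h = let (p , q) = ∧-true h in part-false p (not-true q)
            to-z : ∀ {v} → 1ℤ ≤ + m v z → ∀ j → (j ≡ᵇ iz) ≡ true → 1ℤ ≤ + m v (θ j)
            to-z {v} h j e = subst (λ u → 1ℤ ≤ + m v u) (sym (trans (cong θ (≡ᵇ⇒≡ e)) θ-iz)) h
            core-joined : ∀ {i j} → Dec (i ≡ iz) → Dec (j ≡ iz) → core i j ≡ true → 1ℤ ≤ + m (θ i) (θ j)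
            core-joined {i} {j} (yes refl) _ e = subst (λ u → 1ℤ ≤ + m u (θ j)) (sym θ-iz) (part-true (proj₂ (∧-true (trans (sym (core-zˡ j)) e))))
            core-joined {i} {j} (no _) (yes refl) e = rev (subst (λ u → 1ℤ ≤ + m u (θ i)) (sym θ-iz) (part-true (proj₂ (∧-true (trans (sym (core-zˡ i)) (trans (core-sym iz i) e))))))
            core-joined (no ni) (no nj) e = away ni nj (trans (sym (core-off ni nj)) e)

            joined⁺ : ∀ {i j} → adj′ i j ≡ true → 1ℤ ≤ + m (θ⁺ i) (θ⁺ j)
            joined⁺ {0F} {1F} _ = ya
            joined⁺ {0F} {2F} _ = yb
            joined⁺ {0F} {suc (suc (suc j))} e = to-y j e
            joined⁺ {1F} {0F} _ = rev ya
            joined⁺ {1F} {2F} _ = ab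
            joined⁺ {1F} {suc (suc (suc j))} e = to-z (rev za) j e
            joined⁺ {2F} {0F} _ = rev yb
            joined⁺ {2F} {1F} _ = rev ab
            joined⁺ {2F} {suc (suc (suc j))} e = to-z (rev zb) j e
            joined⁺ {suc (suc (suc i))} {0F} e = rev (to-y i e)
            joined⁺ {suc (suc (suc i))} {1F} e = rev (to-z (rev za) i e)
            joined⁺ {suc (suc (suc i))} {2F} e = rev (to-z (rev zb) i e)
            joined⁺ {suc (suc (suc i))} {suc (suc (suc j))} e = core-joined (i Finp.≟ iz) (j Finp.≟ iz) e

            compose : (k ≡ 4) ⊎ (k ≡ 7) → R
            compose s = out (W⁺ , W⁺⊆ , (a , ∪ˡ {A = ⟨ a ⟩} ∈⟨⟩) , inj₂ (inj₂ (record
              { G₀ = composite ; ore = ore-composite ore ; θ = θ⁺ ; θ-inj = inj⁺ ; θ∈ = θ⁺∈ ; θ-onto = onto⁺ ; θ-adj = λ {i} {j} → joined⁺ {i} {j}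
              ; size = inj₂ ([ (λ e → inj₁ (cong (3 ℕ.+_) e)) , (λ e → inj₂ (cong (3 ℕ.+_) e)) ]′ s)
              ; edges = composite-edges edges ; rows = composite-rows rows
              ; complete = λ e → ⊥-elim (bad e s) })))
              where
              bad : 3 ℕ.+ k ≡ 4 → (k ≡ 4) ⊎ (k ≡ 7) → ⊥
              bad e (inj₁ q) with trans (sym e) (cong (3 ℕ.+_) q)
              ... | ()
              bad e (inj₂ q) with trans (sym e) (cong (3 ℕ.+_) q)
              ... | ()

          -- If edges at the contracted vertex come from both `z` and `y`, undoing the contraction
          -- is a composition with K₄ and adds three vertices. Starting from ten vertices this would
          -- exceed the permitted sizes, but there the contracted potential is at most 0, so `W⁺`
          -- has negative potential.
          resolve : R
          resolve with sides true | sides false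
          ... | inj₂ h | _ = all-from-y h
          ... | _ | inj₂ h = all-from-z h
          ... | inj₁ one-side | inj₁ other-side = by-size size
            where
            by-size : (k ≡ 4) ⊎ (k ≡ 7) ⊎ (k ≡ 10) → R
            by-size (inj₁ e) = Both.compose one-side other-side (inj₁ e)
            by-size (inj₂ (inj₁ e)) = Both.compose one-side other-side (inj₂ e)
            by-size (inj₂ (inj₂ e)) = small (lin (P′.ρ L W ∷ ∑S W (λ v → p (L v)) ∷ ∣ W ∣ ∷ [])
              (λ r s w → 3 ⊙ r ≼ 3 ⊙ (s ⊖ 8 ⊙ w) ⊕ # 10 ⊖ w ⟹ s ≼ 8 ⊙ w ⟹ w ≐ # 10 ⟹ r ≼ # 0)
              (ExceptionalBounds.exc-ρ x L) (sum-p≤ {L = L} {W}) (trans (ExceptionalBounds.exc-card x) (cong +_ e)))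

      noDiamond′ : R
      noDiamond′ = go (search A₃ {λ w → (1ℤ ≤ + m z w) × (1ℤ ≤ + m y w)} {λ w → (m z w ≡ 0) ⊎ (m y w ≡ 0)} (λ w → both (m z w) (m y w)))
        where
        both : ∀ p q → ((1ℤ ≤ + p) × (1ℤ ≤ + q)) ⊎ ((p ≡ 0) ⊎ (q ≡ 0))
        both zero _ = inj₂ (inj₁ refl)
        both (suc _) zero = inj₂ (inj₂ refl)
        both (suc _) (suc _) = inj₁ (+≤+ (ℕ.s≤s ℕ.z≤n) , +≤+ (ℕ.s≤s ℕ.z≤n))
        go : (∃[ w ] w ∈ A₃ × (1ℤ ≤ + m z w) × (1ℤ ≤ + m y w)) ⊎ (∀ {w} → w ∈ A₃ → (m z w ≡ 0) ⊎ (m y w ≡ 0)) → R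
        go (inj₁ (w , w∈ , zw , yw)) = common w∈ zw yw
        go (inj₂ separate) with IH Γ′ L A₃ (proper-card A₃⊆ y∈ (not-in (λ q → ≢y q refl)))
        ... | inj₁ ψ = Extend.result ψ
        ... | inj₂ (W , wb , (w , w∈) , o) = outcome (dec∈ z W) o
          where
          wa : W ⊆ A
          wa q = A₃⊆ (wb q)
          outcome : (z ∈ W) ⊎ (z ∉ W) → Outcome Γ′ L W → R
          outcome (inj₁ z∈W) (inj₁ h) = Through.small separate wb z∈W (lin (P′.ρ L W ∷ []) (λ r → r ⊕ # 3 ≼ # 0 ⟹ r ≼ # 0) h)
          outcome (inj₁ z∈W) (inj₂ (inj₁ (_ , h))) = Through.small separate wb z∈W (lin (P′.ρ L W ∷ []) (λ r → r ⊕ # 1 ≼ # 0 ⟹ r ≼ # 0) h)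
          outcome (inj₁ z∈W) (inj₂ (inj₂ x)) = Through.Ore.resolve separate wb z∈W x
          outcome (inj₂ z∉W) (inj₁ h) = small-out wa w∈ (subst (λ t → t + + 3 ≤ 0ℤ) (ρ-off z∉W) h)
          outcome (inj₂ z∉W) (inj₂ (inj₁ (_ , h))) = negative wa w∈ (subst (λ t → t + 1ℤ ≤ 0ℤ) (ρ-off z∉W) h)
          outcome (inj₂ z∉W) (inj₂ (inj₂ x)) = Exceptional-old wa x
            (λ {i} {j} e → subst (λ t → 1ℤ ≤ + t) (m′-off (∈-≢ (Exceptional.θ∈ x i) z∉W) (∈-≢ (Exceptional.θ∈ x j) z∉W)) (Exceptional.θ-adj x e)) w∈

    noDiamond : R
    noDiamond with dec≤ (+ m z y) 0ℤ
    ... | inj₂ h = K₄-out z∈ y∈ a∈ b∈ h za zb ya yb ab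
    ... | inj₁ h = Unjoined.noDiamond′ (ℤp.+-injective (ℤp.≤-antisym h (+≤+ ℕ.z≤n)))

-- Triangles of low vertices

module Triangles {n : ℕ} (st : State n) where
  open State st
  open Gap₃ st
  open EdgeLemma st
  open LowVertices st
  open Rings st
  open Kites st
  open RingChain st
  open RingWorlds st
  open DiamondLemma st

  flipKite : ∀ {W y y'} → Kite W y y' → Kite W y' y
  flipKite {W} {y} {y'} κ = record
    { a = a ; b = b ; a∈ = a∈ ; b∈ = b∈ ; a≢b = a≢b ; a≢y = a≢y' ; a≢y' = a≢y ; b≢y = b≢y' ; b≢y' = b≢y
    ; all = λ v∈ → [ (λ e → inj₂ (inj₁ e)) , [ inj₁ , (λ q → inj₂ (inj₂ q)) ]′ ]′ (all v∈)
    ; ya = y'a ; yb = y'b ; y'a = ya ; y'b = yb ; ab = ab ; yy' = trans (m-sym y' y) yy' }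
    where open Kite κ

  kite-card : ∀ {W y y'} → Kite W y y' → ∣ W ∣ ≤ + 4
  kite-card {W} {y} {y'} κ = lin (∣ W ∣ ∷ ∣ Z ∣ ∷ ∣ ⟨ y' ⟩ ∪ (⟨ a ⟩ ∪ ⟨ b ⟩) ∣ ∷ ∣ ⟨ a ⟩ ∪ ⟨ b ⟩ ∣ ∷ ∣ ⟨ y ⟩ ∣ ∷ ∣ ⟨ y' ⟩ ∣ ∷ ∣ ⟨ a ⟩ ∣ ∷ ∣ ⟨ b ⟩ ∣ ∷ [])
    (λ w z z' z'' p q r s → w ≼ z ⟹ z ≼ p ⊕ z' ⟹ z' ≼ q ⊕ z'' ⟹ z'' ≼ r ⊕ s ⟹ p ≐ # 1 ⟹ q ≐ # 1 ⟹ r ≐ # 1 ⟹ s ≐ # 1 ⟹ w ≼ # 4)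
    (card-mono (λ v∈ → go (all v∈))) (card-∪≤ _ _) (card-∪≤ _ _) (card-∪≤ _ _) (card-point y) (card-point y') (card-point a) (card-point b)
    where
    open Kite κ
    Z : VSet n
    Z = ⟨ y ⟩ ∪ (⟨ y' ⟩ ∪ (⟨ a ⟩ ∪ ⟨ b ⟩))
    go : ∀ {v} → (v ≡ y) ⊎ (v ≡ y') ⊎ (v ≡ a) ⊎ (v ≡ b) → v ∈ Z
    go (inj₁ refl) = ∪ˡ {A = ⟨ y ⟩} ∈⟨⟩
    go (inj₂ (inj₁ refl)) = ∪ʳ {A = ⟨ y ⟩} (∪ˡ {A = ⟨ y' ⟩} ∈⟨⟩)
    go (inj₂ (inj₂ (inj₁ refl))) = ∪ʳ {A = ⟨ y ⟩} (∪ʳ {A = ⟨ y' ⟩} (∪ˡ {A = ⟨ a ⟩} ∈⟨⟩))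
    go (inj₂ (inj₂ (inj₂ refl))) = ∪ʳ {A = ⟨ y ⟩} (∪ʳ {A = ⟨ y' ⟩} (∪ʳ {A = ⟨ a ⟩} ∈⟨⟩))

  module Triangle (μ≡0 : μ ≡ 0ℤ) (fullA : ∀ {v} → v ∈ A → Full (L v)) {X : VSet n} (ring : Ring X) (short : ∣ X ∣ ≤ + 3) where
    open Ring ring
    open Chain ring (λ x∈ → fullA (X⊆ x∈))
    open ShortRing ring short using (pairwise; Corners; corners)

    diamond : Diamond → R
    diamond = NoDiamond.noDiamond μ≡0 fullA

    in-gap : ∀ {Z z} → Z ⊆ rest → z ∈ Z → ρ L Z ≤ + 5 → R
    in-gap {Z} zr z∈ h = in-rest zr z∈ (subst (λ t → ρ L Z ≤ t + + 5) (sym μ≡0) h)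

    deg≤3 : ∀ {x} → x ∈ X → deg x A ≤ + 3
    deg≤3 {x} x∈ = ℤp.≤-trans (ℤp.≤-reflexive (low-x x∈)) (card≤3 (L x))

    rev : ∀ {u v} → 1ℤ ≤ + m u v → 1ℤ ≤ + m v u
    rev {u} {v} = subst (λ k → 1ℤ ≤ + k) (m-sym u v)

    -- The common outer neighbour and the third vertex of the triangle are the ends of a diamond
    -- with middle vertices `u` and `v`.
    same-nbr : ∀ {u v w} → u ∈ X → v ∈ X → w ∈ X → u ≢ v → u ≢ w → v ≢ w → nbr u ≡ nbr v → R
    same-nbr {u} {v} {w} u∈ v∈ w∈ uv uw vw e = diamond record
      { z = nbr u ; y = w ; a = u ; b = v ; z∈ = ∖ˡ {A = A} (nbr∈ u∈) ; y∈ = X⊆ w∈ ; a∈ = X⊆ u∈ ; b∈ = X⊆ v∈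
      ; z≢y = λ q → absurd∈ (subst (_∈ X) (sym q) w∈) (∖ʳ {A = A} (nbr∈ u∈))
      ; za = rev (proj₂ (nbr-spec u∈)) ; zb = rev (subst (λ t → 1ℤ ≤ + m v t) (sym e) (proj₂ (nbr-spec v∈)))
      ; ya = pairwise w∈ u∈ (uw ∘ sym) ; yb = pairwise w∈ v∈ (vw ∘ sym) ; ab = pairwise u∈ v∈ uv ; da = deg≤3 u∈ ; db = deg≤3 v∈ }

    record Labelled (u v w : Fin n) : Set where
      field
        u∈ : u ∈ X
        v∈ : v ∈ X
        w∈ : w ∈ X
        u≢v : u ≢ v
        nu≢nv : nbr u ≢ nbr v
        nu≢nw : nbr u ≢ nbr w
        nv≢nw : nbr v ≢ nbr w
        every : ∀ {x} → x ∈ X → (x ≡ u) ⊎ (x ≡ v) ⊎ (x ≡ w)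

    rotate : ∀ {u v w} → Labelled u v w → Labelled v w u
    rotate l = record { u∈ = v∈ ; v∈ = w∈ ; w∈ = u∈ ; u≢v = λ { refl → nv≢nw refl } ; nu≢nv = nv≢nw ; nu≢nw = nu≢nv ∘ sym ; nv≢nw = nu≢nw ∘ sym
      ; every = λ x∈ → [ (λ e → inj₂ (inj₂ e)) , [ inj₁ , (λ e → inj₂ (inj₁ e)) ]′ ]′ (every x∈) }
      where open Labelled l

    swap : ∀ {u v w} → Labelled u v w → Labelled v u w
    swap l = record { u∈ = v∈ ; v∈ = u∈ ; w∈ = w∈ ; u≢v = u≢v ∘ sym ; nu≢nv = nu≢nv ∘ sym ; nu≢nw = nv≢nw ; nv≢nw = nu≢nw
      ; every = λ x∈ → [ (λ e → inj₂ (inj₁ e)) , [ inj₁ , (λ e → inj₂ (inj₂ e)) ]′ ]′ (every x∈) }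
      where open Labelled l

    row : Fin n → ℤ
    row t = ∑S rest (λ s → cost (m t s))

    -- What is left of `Linked` when `μ = 0`. Potential at most 5 is excluded by `gap₃`; a kite has
    -- potential exactly 7 and misses `nbr w`, and a heavy set is all of `rest`.
    data Pair (u v w : Fin n) : Set where
      kitePair  : ∀ W → W ⊆ rest → nbr u ∈ W → nbr v ∈ W → nbr w ∉ W → Kite W (nbr u) (nbr v) → + 7 ≤ ρ L W → ρ L W ≤ + 7 → Pair u v w
      heavyPair : ∣ rest ∣ ≡ + 7 → ρ L rest ≤ + 6 → (∀ {t} → t ∈ rest → t ≢ nbr u → t ≢ nbr v → + 15 ≤ row t) →
                  + 10 ≤ row (nbr u) → + 10 ≤ row (nbr v) → Pair u v w

    full-rest : ∀ {W} → W ⊆ rest → ∀ {v} → v ∈ W → Full (L v)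
    full-rest wr v∈ = fullA (∖ˡ {A = A} (wr v∈))

    inner : ∀ {U} → (∀ {x} → x ∈ X → nbr x ∈ U) → X ⊆ inside U
    inner {U} h x∈ = ∩-intro x∈ (mk∈ (un∈ (h x∈)))

    -- Adding the triangle leaves at most 7 - 6 = 1, so by `gap₃` the set together with the triangle
    -- exhausts `A`.
    everything : ∀ {U} → U ⊆ rest → (∀ {x} → x ∈ X → nbr x ∈ U) → ρ L U ≤ + 7 → (rest ⊆ U → R) → R
    everything {U} ur all-in h k = go (⊎-search A (U ∪ X))
      where
      go : (∃[ r ] r ∈ A × r ∉ U ∪ X) ⊎ (A ⊆ U ∪ X) → R
      go (inj₁ (r , r∈ , r∉)) = gap₃ (λ q → [ (λ q → ∖ˡ {A = A} (ur q)) , X⊆ ]′ (∪-elim {A = U} q)) (∪ʳ {A = U} x₀∈) r∈ r∉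
        (lin (ρ L (U ∪ X) ∷ ρ L U ∷ ∣ X ∣ ∷ μ ∷ []) (λ a b x μ → a ≼ b ⊖ 2 ⊙ x ⟹ b ≼ # 7 ⟹ # 3 ≼ x ⟹ μ ≐ # 0 ⟹ a ≼ μ ⊕ # 5)
          (ρ-closed ur (inner all-in)) h three≤ μ≡0)
      go (inj₂ all) = k (λ q → [ (λ u → u) , (λ x → absurd∈ x (∖ʳ {A = A} q)) ]′ (∪-elim {A = U} (all (∖ˡ {A = A} q))))

    -- A sixth edge would have to be parallel to another one and costs 6, so a kite of potential
    -- below 7 has at most 1.
    kite-exact : ∀ {W y y'} (y∈ : y ∈ W) (y'∈ : y' ∈ W) (ne : y ≢ y') (wr : W ⊆ rest) (κ : Kite W y y') → (+ 7 ≤ ρ L W → R) → R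
    kite-exact {W} {y} {y'} y∈ y'∈ ne wr κ k with dec≤ (+ 7) (ρ L W)
    ... | inj₁ h = k h
    ... | inj₂ h = in-gap wr y∈ (lin
          (ρ L W ∷ c a b ∷ c y a ∷ c y b ∷ c y' y ∷ c y' a ∷ c y' b ∷ + m a b ∷ + m y a ∷ + m y b ∷ + m y' a ∷ + m y' b ∷ [])
          (λ r ab ya yb yy y'a y'b ab' ya' yb' y'a' y'b' → r ≐ # 32 ⊖ ab ⊖ (ya ⊕ yb) ⊖ (yy ⊕ (y'a ⊕ y'b)) ⟹ # 0 ≼ yy ⟹
            ab ≐ 6 ⊙ ab' ⊖ # 1 ⟹ ya ≐ 6 ⊙ ya' ⊖ # 1 ⟹ yb ≐ 6 ⊙ yb' ⊖ # 1 ⟹ y'a ≐ 6 ⊙ y'a' ⊖ # 1 ⟹ y'b ≐ 6 ⊙ y'b' ⊖ # 1 ⟹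
            # 6 ≼ ab' ⊕ ya' ⊕ yb' ⊕ y'a' ⊕ y'b' ⟹ r ≼ # 5)
          ρ-W (cost≥0 (m y' y)) (e ab) (e ya) (e yb) (e y'a) (e y'b) more)
      where
      open KiteFacts y∈ y'∈ ne κ (full-rest wr)
      e : ∀ {u v} → 1ℤ ≤ + m u v → c u v ≡ + 6 * + m u v - 1ℤ
      e {u} {v} = cost≡6m-1 (m u v)
      more : + 6 ≤ + m a b + + m y a + + m y b + + m y' a + + m y' b
      more = lin (ρ L W ∷ c a b ∷ c y a ∷ c y b ∷ c y' y ∷ c y' a ∷ c y' b ∷ + m a b ∷ + m y a ∷ + m y b ∷ + m y' a ∷ + m y' b ∷ [])
          (λ r ab ya yb yy y'a y'b ab' ya' yb' y'a' y'b' → r ≐ # 32 ⊖ ab ⊖ (ya ⊕ yb) ⊖ (yy ⊕ (y'a ⊕ y'b)) ⟹ yy ≐ # 0 ⟹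
            ab ≐ 6 ⊙ ab' ⊖ # 1 ⟹ ya ≐ 6 ⊙ ya' ⊖ # 1 ⟹ yb ≐ 6 ⊙ yb' ⊖ # 1 ⟹ y'a ≐ 6 ⊙ y'a' ⊖ # 1 ⟹ y'b ≐ 6 ⊙ y'b' ⊖ # 1 ⟹
            r ⊕ # 1 ≼ # 7 ⟹ # 6 ≼ ab' ⊕ ya' ⊕ yb' ⊕ y'a' ⊕ y'b')
          ρ-W (cong cost (trans (m-sym y' y) yy')) (e ab) (e ya) (e yb) (e y'a) (e y'b) h

    module Three {u v w} (l : Labelled u v w) where
      open Labelled l

      heavyCase : ∀ W → W ⊆ rest → nbr u ∈ W → nbr v ∈ W → Heavy W (nbr u) (nbr v) → ρ L W ≤ + 6 → (Pair u v w → R) → R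
      heavyCase W wr nu∈ nv∈ hv h k with dec∈ (nbr w) W
      -- Two of the three outer edges end in `W`, which gives at most 6 + 9 - 10 = 5, and `nbr w`
      -- lies outside.
      ... | inj₂ w∉ = gap₃ (λ q → [ (λ q → ∖ˡ {A = A} (wr q)) , X⊆ ]′ (∪-elim {A = W} q)) (∪ʳ {A = W} x₀∈) (∖ˡ {A = A} (nbr∈ w∈))
              (not-in (λ q → [ (λ q → absurd∈ q w∉) , (λ q → absurd∈ q (∖ʳ {A = A} (nbr∈ w∈))) ]′ (∪-elim {A = W} q)))
              (lin (ρ L (W ∪ X) ∷ ρ L W ∷ ∣ X ∣ ∷ ∣ inside W ∣ ∷ μ ∷ []) (λ a b x i μ → a ≼ b ⊕ 3 ⊙ x ⊖ 5 ⊙ i ⟹ b ≼ # 6 ⟹ x ≼ # 3 ⟹ # 2 ≼ i ⟹ μ ≐ # 0 ⟹ a ≼ μ ⊕ # 5)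
                (ρ-with wr) h short two-in μ≡0)
        where
        two-in : + 2 ≤ ∣ inside W ∣
        two-in = ℤp.≤-trans (ℤp.≤-reflexive (sym (trans (card-∪ (disjoint-⟨⟩ (∉⟨⟩ (u≢v ∘ sym)))) (cong₂ _+_ (card-point u) (card-point v)))))
          (card-mono {A = ⟨ u ⟩ ∪ ⟨ v ⟩} (λ q → [ ⟨⟩-⊆ (∩-intro u∈ (mk∈ (un∈ nu∈))) , ⟨⟩-⊆ (∩-intro v∈ (mk∈ (un∈ nv∈))) ]′ (∪-elim {A = ⟨ u ⟩} q)))
      ... | inj₁ w∈′ = everything wr all-in (ℤp.≤-trans h (ℤp.≤ᵇ⇒≤ _)) λ rw → k (heavyPair
              (trans (ℤp.≤-antisym (card-mono rw) (card-mono wr)) seven) (subst (_≤ + 6) (ρ-ext wr rw) h)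
              (λ {t} t∈ a b → subst (+ 15 ≤_) (S-ext⊆ {A = W} {rest} wr rw) (Heavy.row hv (rw t∈) a b))
              (subst (+ 10 ≤_) (S-ext⊆ {A = W} {rest} wr rw) row-y) (subst (+ 10 ≤_) (S-ext⊆ {A = W} {rest} wr rw) row-y'))
        where
        open Heavy hv using (seven; row-y; row-y')
        all-in : ∀ {x} → x ∈ X → nbr x ∈ W
        all-in x∈ with every x∈
        ... | inj₁ refl = nu∈
        ... | inj₂ (inj₁ refl) = nv∈
        ... | inj₂ (inj₂ refl) = w∈′

      -- If the kite for u, v also contains the outer neighbour of w, then that neighbour is adjacent to nbr v,
      -- and nothing inside the kite can link nbr v to nbr w.
      kiteCase : ∀ W → W ⊆ rest → nbr u ∈ W → nbr v ∈ W → Kite W (nbr u) (nbr v) → ρ L W ≤ + 7 → (Pair u v w → R) → R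
      kiteCase W wr nu∈ nv∈ κ h k with dec∈ (nbr w) W
      ... | inj₂ w∉ = kite-exact nu∈ nv∈ nu≢nv wr κ λ l → k (kitePair W wr nu∈ nv∈ w∉ κ l h)
      ... | inj₁ w∈′ = everything wr all-in h λ rw → link v∈ w∈ (pairwise v∈ w∈ (λ { refl → nv≢nw refl })) nv≢nw λ W' linked → second rw W' linked (Linked.kind linked)
        where
        all-in : ∀ {x} → x ∈ X → nbr x ∈ W
        all-in x∈ with every x∈
        ... | inj₁ refl = nu∈
        ... | inj₂ (inj₁ refl) = nv∈
        ... | inj₂ (inj₂ refl) = w∈′
        adjacent : (nbr w ≡ nbr u) ⊎ (nbr w ≡ nbr v) ⊎ (nbr w ≡ Kite.a κ) ⊎ (nbr w ≡ Kite.b κ) → 1ℤ ≤ + m (nbr v) (nbr w)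
        adjacent (inj₁ e) = ⊥-elim (nu≢nw (sym e))
        adjacent (inj₂ (inj₁ e)) = ⊥-elim (nv≢nw (sym e))
        adjacent (inj₂ (inj₂ (inj₁ e))) = subst (λ t → 1ℤ ≤ + m (nbr v) t) (sym e) (Kite.y'a κ)
        adjacent (inj₂ (inj₂ (inj₂ e))) = subst (λ t → 1ℤ ≤ + m (nbr v) t) (sym e) (Kite.y'b κ)
        second : rest ⊆ W → ∀ W' → Linked rest W' (nbr v) (nbr w) → (Kite W' (nbr v) (nbr w) × ρ L W' ≤ + 7) ⊎ (Heavy W' (nbr v) (nbr w) × ρ L W' ≤ + 6) ⊎ (ρ L W' ≤ + 5) → R
        second rw W' linked (inj₁ (κ' , _)) = ⊥-elim (lin (+ m (nbr v) (nbr w) ∷ []) (λ x → # 1 ≼ x ⟹ x ≐ # 0 ⟹ contra) (adjacent (Kite.all κ w∈′)) (cong +_ (Kite.yy' κ')))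
        second rw W' linked (inj₂ (inj₁ (hv , _))) = ⊥-elim (lin (∣ W' ∣ ∷ ∣ W ∣ ∷ []) (λ a b → a ≐ # 7 ⟹ a ≼ b ⟹ b ≼ # 4 ⟹ contra)
          (Heavy.seven hv) (card-mono (λ q → rw (Linked.W⊆ linked q))) (kite-card κ))
        second rw W' linked (inj₂ (inj₂ q)) = in-gap (Linked.W⊆ linked) (Linked.y∈ linked) q

      pair : (Pair u v w → R) → R
      pair k = link u∈ v∈ (pairwise u∈ v∈ u≢v) nu≢nv λ W linked → go W linked (Linked.kind linked)
        where
        go : ∀ W → Linked rest W (nbr u) (nbr v) → (Kite W (nbr u) (nbr v) × ρ L W ≤ + 7) ⊎ (Heavy W (nbr u) (nbr v) × ρ L W ≤ + 6) ⊎ (ρ L W ≤ + 5) → R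
        go W linked (inj₁ (κ , h)) = kiteCase W (Linked.W⊆ linked) (Linked.y∈ linked) (Linked.y'∈ linked) κ h k
        go W linked (inj₂ (inj₁ (hv , h))) = heavyCase W (Linked.W⊆ linked) (Linked.y∈ linked) (Linked.y'∈ linked) hv h k
        go W linked (inj₂ (inj₂ q)) = in-gap (Linked.W⊆ linked) (Linked.y∈ linked) q

      off-ring : ∀ {t} → t ∈ rest → t ≢ nbr u → t ≢ nbr v → t ≢ nbr w → deg t X ≤ 0ℤ
      off-ring {t} t∈ nu nv nw = subst (deg t X ≤_) (S-zero {A = X}) (S-mono {A = X} (λ {x} x∈ → ℤp.≮⇒≥ (λ q → not-nbr x∈ (every x∈) (ℤp.i<j⇒suc[i]≤j q))))
        where
        not-nbr : ∀ {x} → x ∈ X → (x ≡ u) ⊎ (x ≡ v) ⊎ (x ≡ w) → 1ℤ ≤ + m t x → ⊥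
        not-nbr {x} x∈ e q with nbr-unique x∈ t∈ (rev q)
        ... | eq = [ (λ { refl → nu eq }) , [ (λ { refl → nv eq }) , (λ { refl → nw eq }) ]′ ]′ e

      kite-diamond : ∀ {W} (wr : W ⊆ rest) (u∈W : nbr u ∈ W) (v∈W : nbr v ∈ W) (κ : Kite W (nbr u) (nbr v)) →
                     deg (Kite.a κ) A ≤ + 3 → deg (Kite.b κ) A ≤ + 3 → R
      kite-diamond wr u∈W v∈W κ da db = diamond record
        { z = nbr u ; y = nbr v ; a = a ; b = b ; z∈ = ∖ˡ {A = A} (wr u∈W) ; y∈ = ∖ˡ {A = A} (wr v∈W) ; a∈ = ∖ˡ {A = A} (wr a∈) ; b∈ = ∖ˡ {A = A} (wr b∈)
        ; z≢y = nu≢nv ; za = ya ; zb = yb ; ya = y'a ; yb = y'b ; ab = ab ; da = da ; db = db }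
        where open Kite κ

      -- The intersection contains `nbr u` but not `nbr v`. If its potential is at least 9, the
      -- union has at most 14 - 9 = 5. Otherwise it is `nbr u` alone, the two kites make up `rest`,
      -- and the middle vertices of the first one have no fourth edge, so that kite is a diamond.
      twoKites : ∀ W₁ W₂ → W₁ ⊆ rest → W₂ ⊆ rest → nbr u ∈ W₁ → nbr v ∈ W₁ → nbr w ∉ W₁ → Kite W₁ (nbr u) (nbr v) → + 7 ≤ ρ L W₁ → ρ L W₁ ≤ + 7 →
                 nbr u ∈ W₂ → nbr w ∈ W₂ → nbr v ∉ W₂ → ρ L W₂ ≤ + 7 → R
      twoKites W₁ W₂ wr₁ wr₂ u∈₁ v∈₁ w∉₁ κ l₁ h₁ u∈₂ w∈₂ v∉₂ h₂ =
        from-part (part (∩ˡ {A = W₁} {W₂}) (∩-intro u∈₁ u∈₂) (not-in (λ q → absurd∈ (∩ʳ {A = W₁} q) v∉₂)))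
        where
        open KiteFacts u∈₁ v∈₁ nu≢nv κ (full-rest wr₁)
        open Exact l₁
        U I D₂ : VSet n
        U = W₁ ∪ W₂
        I = W₁ ∩ W₂
        D₂ = W₂ ∖ W₁
        ur : U ⊆ rest
        ur q = [ wr₁ , wr₂ ]′ (∪-elim {A = W₁} q)
        all-in : ∀ {x} → x ∈ X → nbr x ∈ U
        all-in x∈ with every x∈
        ... | inj₁ refl = ∪ˡ {A = W₁} u∈₁
        ... | inj₂ (inj₁ refl) = ∪ˡ {A = W₁} v∈₁
        ... | inj₂ (inj₂ refl) = ∪ʳ {A = W₁} w∈₂
        from-part : (I ⊆ ⟨ nbr u ⟩ × ρ L I ≡ + 8) ⊎ (+ 9 ≤ ρ L I) → R
        from-part (inj₂ h) = in-gap ur (∪ˡ {A = W₁} u∈₁) (lin (ρ L U ∷ ρ L I ∷ ρ L W₁ ∷ ρ L W₂ ∷ [])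
          (λ j i a b → j ⊕ i ≼ a ⊕ b ⟹ a ≼ # 7 ⟹ b ≼ # 7 ⟹ # 9 ≼ i ⟹ j ≼ # 5) (ρ-submodular L W₁ W₂) h₁ h₂ h)
        from-part (inj₁ (single , ρI)) = everything ur all-in (lin (ρ L U ∷ ρ L I ∷ ρ L W₁ ∷ ρ L W₂ ∷ [])
          (λ j i a b → j ⊕ i ≼ a ⊕ b ⟹ a ≼ # 7 ⟹ b ≼ # 7 ⟹ i ≐ # 8 ⟹ j ≼ # 7) (ρ-submodular L W₁ W₂) h₁ h₂ ρI) λ ru →
            middle ru a∈ a≢y a≢y' ya≤ y'a≤ ab≤ (λ q → q) λ da →
            middle ru b∈ b≢y b≢y' yb≤ y'b≤ (subst (λ k → cost k ≤ + 5) (m-sym a b) ab≤)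
              (λ q → [ inj₁ , [ (λ e → inj₂ (inj₁ e)) , [ (λ e → inj₂ (inj₂ (inj₂ e))) , (λ e → inj₂ (inj₂ (inj₁ e))) ]′ ]′ ]′ q) λ db →
            kite-diamond wr₁ u∈₁ v∈₁ κ da db
          where
          y'a≤ : c (nbr v) a ≤ + 5
          y'a≤ = lin (c a b ∷ c (nbr u) a ∷ c (nbr u) b ∷ c (nbr v) (nbr u) ∷ c (nbr v) a ∷ c (nbr v) b ∷ ρ L W₁ ∷ []) (λ ab ya yb z y'a y'b r →
            r ≐ # 32 ⊖ ab ⊖ (ya ⊕ yb) ⊖ (z ⊕ (y'a ⊕ y'b)) ⟹ # 7 ≼ r ⟹ # 5 ≼ ab ⟹ # 5 ≼ ya ⟹ # 5 ≼ yb ⟹ # 5 ≼ y'b ⟹ # 0 ≼ z ⟹ y'a ≼ # 5)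
            ρ-W l₁ (c≥5 ab) (c≥5 ya) (c≥5 yb) (c≥5 y'b) (cost≥0 (m (nbr v) (nbr u)))
          y'b≤ : c (nbr v) b ≤ + 5
          y'b≤ = lin (c a b ∷ c (nbr u) a ∷ c (nbr u) b ∷ c (nbr v) (nbr u) ∷ c (nbr v) a ∷ c (nbr v) b ∷ ρ L W₁ ∷ []) (λ ab ya yb z y'a y'b r →
            r ≐ # 32 ⊖ ab ⊖ (ya ⊕ yb) ⊖ (z ⊕ (y'a ⊕ y'b)) ⟹ # 7 ≼ r ⟹ # 5 ≼ ab ⟹ # 5 ≼ ya ⟹ # 5 ≼ yb ⟹ # 5 ≼ y'a ⟹ # 0 ≼ z ⟹ y'b ≼ # 5)
            ρ-W l₁ (c≥5 ab) (c≥5 ya) (c≥5 yb) (c≥5 y'a) (cost≥0 (m (nbr v) (nbr u)))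
          once : ∀ {s t} → c s t ≤ + 5 → + m t s ≤ 1ℤ
          once {s} {t} h = subst (λ k → + k ≤ 1ℤ) (m-sym s t) (go (dec≤ (+ m s t) 0ℤ))
            where
            go : (+ m s t ≤ 0ℤ) ⊎ (0ℤ + 1ℤ ≤ + m s t) → + m s t ≤ 1ℤ
            go (inj₁ q) = ℤp.≤-trans q (+≤+ ℕ.z≤n)
            go (inj₂ q) = lin (c s t ∷ + m s t ∷ []) (λ c m → c ≐ 6 ⊙ m ⊖ # 1 ⟹ c ≼ # 5 ⟹ m ≼ # 1) (cost≡6m-1 (m s t) q) h
          -- An edge from t to W₂ outside W₁ would make the potential of the union too small.
          middle : ∀ {t t'} → rest ⊆ U → t ∈ W₁ → t ≢ nbr u → t ≢ nbr v → c (nbr u) t ≤ + 5 → c (nbr v) t ≤ + 5 → c t t' ≤ + 5 →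
                   (∀ {s} → (s ≡ nbr u) ⊎ (s ≡ nbr v) ⊎ (s ≡ a) ⊎ (s ≡ b) → (s ≡ nbr u) ⊎ (s ≡ nbr v) ⊎ (s ≡ t) ⊎ (s ≡ t')) →
                   (deg t A ≤ + 3 → R) → R
          middle {t} {t'} ru t∈ nu nv ut vt tt' others k = go (dec≤ (deg t D₂) 0ℤ)
            where
            t∉I : t ∉ I
            t∉I = not-in (λ q → nu (⟨⟩-elim (single q)))
            go : (deg t D₂ ≤ 0ℤ) ⊎ (0ℤ + 1ℤ ≤ deg t D₂) → R
            go (inj₂ h) = let (s , s∈ , ts) = S-find {A = D₂} h in
              in-gap {W₁ ∪ D₂} (λ q → [ wr₁ , (λ q → wr₂ (∖ˡ {A = W₂} q)) ]′ (∪-elim {A = W₁} q)) (∪ˡ {A = W₁} u∈₁)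
                (lin (ρ L (W₁ ∪ D₂) ∷ ρ L W₁ ∷ ρ L D₂ ∷ ρ L W₂ ∷ ρ L (I ∪ D₂) ∷ ρ L I ∷ Co.D W₁ D₂ ∷ Co.D I D₂ ∷ Co.D (I ∪ ⟨ t ⟩) D₂ ∷ Co.D ⟨ t ⟩ D₂ ∷ ∑S D₂ (λ s → cost (m t s)) ∷ cost (m t s) ∷ [])
                  (λ x w₁ d w₂ id i dw di dit dt st ct → x ≐ w₁ ⊕ d ⊖ dw ⟹ w₂ ≐ id ⟹ id ≐ i ⊕ d ⊖ di ⟹ dit ≼ dw ⟹ dit ≐ di ⊕ dt ⟹ dt ≐ st ⟹ ct ≼ st ⟹ # 5 ≼ ct ⟹ w₁ ≼ # 7 ⟹ w₂ ≼ # 7 ⟹ i ≐ # 8 ⟹ x ≼ # 5)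
                  (ρ-∪ (λ q → not-in (λ z → absurd∈ q (∖ʳ {A = W₂} z))) L) (ρ-ext there back) (ρ-∪ (λ q → not-in (λ z → absurd∈ (∩ˡ {A = W₁} q) (∖ʳ {A = W₂} z))) L)
                  (Co.D-⊆ {A = I ∪ ⟨ t ⟩} {W₁} {D₂} {D₂} (λ q → [ ∩ˡ {A = W₁} , ⟨⟩-⊆ t∈ ]′ (∪-elim {A = I} q)) (λ q → q)) (Co.D-∪ˡ (disjoint-⟨⟩ t∉I) D₂) (Co.D-pointˡ t D₂)
                  (S-term {A = D₂} s∈ (λ {s} _ → cost≥0 (m t s))) (c≥5 ts) h₁ h₂ ρI)
              where
              there : W₂ ⊆ I ∪ D₂
              there {x} q with dec∈ x W₁
              ... | inj₁ z = ∪ˡ {A = I} (∩-intro z q)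
              ... | inj₂ z = ∪ʳ {A = I} (∖-intro q z)
              back : I ∪ D₂ ⊆ W₂
              back q = [ ∩ʳ {A = W₁} , ∖ˡ {A = W₂} ]′ (∪-elim {A = I} q)
            go (inj₁ h) = k (lin
              (deg t A ∷ deg t (W₁ ∪ (D₂ ∪ X)) ∷ deg t W₁ ∷ deg t (D₂ ∪ X) ∷ deg t D₂ ∷ deg t X ∷ deg t Z ∷ deg t (⟨ nbr v ⟩ ∪ (⟨ t ⟩ ∪ ⟨ t' ⟩)) ∷ deg t (⟨ t ⟩ ∪ ⟨ t' ⟩) ∷ deg t ⟨ nbr u ⟩ ∷ deg t ⟨ nbr v ⟩ ∷ deg t ⟨ t ⟩ ∷ deg t ⟨ t' ⟩
                ∷ + m t (nbr u) ∷ + m t (nbr v) ∷ + m t t ∷ + m t t' ∷ [])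
              (λ a all w dx d x z z₁ z₂ pu pv pt pt' mu mv mt mt' → a ≼ all ⟹ all ≼ w ⊕ dx ⟹ dx ≼ d ⊕ x ⟹ d ≼ # 0 ⟹ x ≼ # 0 ⟹ w ≼ z ⟹ z ≼ pu ⊕ z₁ ⟹ z₁ ≼ pv ⊕ z₂ ⟹ z₂ ≼ pt ⊕ pt' ⟹
                 pu ≐ mu ⟹ pv ≐ mv ⟹ pt ≐ mt ⟹ pt' ≐ mt' ⟹ mu ≼ # 1 ⟹ mv ≼ # 1 ⟹ mt ≐ # 0 ⟹ mt' ≼ # 1 ⟹ a ≼ # 3)
              (deg-⊆ cover) (deg-∪≤ t W₁ _) (deg-∪≤ t D₂ X) h (off-ring (wr₁ t∈) nu nv (∈-≢ t∈ w∉₁)) (deg-⊆ inZ) (deg-∪≤ t _ _) (deg-∪≤ t _ _) (deg-∪≤ t _ _)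
              (S-point (nbr u) _) (S-point (nbr v) _) (S-point t _) (S-point t' _) (once ut) (once vt) (cong +_ (m-irr t)) (subst (λ k → + k ≤ 1ℤ) (m-sym t' t) (once tt')))
              where
              Z : VSet n
              Z = ⟨ nbr u ⟩ ∪ (⟨ nbr v ⟩ ∪ (⟨ t ⟩ ∪ ⟨ t' ⟩))
              inZ : W₁ ⊆ Z
              inZ q with others (all q)
              ... | inj₁ refl = ∪ˡ {A = ⟨ nbr u ⟩} ∈⟨⟩
              ... | inj₂ (inj₁ refl) = ∪ʳ {A = ⟨ nbr u ⟩} (∪ˡ {A = ⟨ nbr v ⟩} ∈⟨⟩)
              ... | inj₂ (inj₂ (inj₁ refl)) = ∪ʳ {A = ⟨ nbr u ⟩} (∪ʳ {A = ⟨ nbr v ⟩} (∪ˡ {A = ⟨ t ⟩} ∈⟨⟩))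
              ... | inj₂ (inj₂ (inj₂ refl)) = ∪ʳ {A = ⟨ nbr u ⟩} (∪ʳ {A = ⟨ nbr v ⟩} (∪ʳ {A = ⟨ t ⟩} ∈⟨⟩))
              cover : A ⊆ W₁ ∪ (D₂ ∪ X)
              cover {x} q with dec∈ x X | dec∈ x W₁
              ... | inj₁ z | _ = ∪ʳ {A = W₁} (∪ʳ {A = D₂} z)
              ... | inj₂ _ | inj₁ z = ∪ˡ {A = W₁} z
              ... | inj₂ nx | inj₂ nz = [ (λ z → absurd∈ z nz) , (λ z → ∪ʳ {A = W₁} (∪ˡ {A = D₂} (∖-intro z nz))) ]′ (∪-elim {A = W₁} (ru (∖-intro q nx)))

      -- Seven lists have potential at most 56, so `ρ ≥ 6` leaves 50 for the edges, each of which is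
      -- counted in two rows.
      D-rest : + 6 ≤ ρ L rest → ∣ rest ∣ ≡ + 7 → ∑S rest row ≤ + 100
      D-rest h c = lin (ρ L rest ∷ ∑S rest (λ v → p (L v)) ∷ Co.e rest ∷ Co.D rest rest ∷ ∑S rest row ∷ ∣ rest ∣ ∷ [])
        (λ r s e d t k → r ≐ s ⊖ e ⟹ 2 ⊙ e ≐ d ⟹ d ≐ t ⟹ # 6 ≼ r ⟹ s ≼ 8 ⊙ k ⟹ k ≐ # 7 ⟹ t ≼ # 100)
        refl (Co.e-double rest) D-row h (sum-p≤ {L = L} {rest}) c
        where
        opaque
          unfolding Co.D
          D-row : Co.D rest rest ≡ ∑S rest row
          D-row = refl

      rest-gap : (+ 6 ≤ ρ L rest → R) → R
      rest-gap k with dec≤ (+ 6) (ρ L rest)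
      ... | inj₁ h = k h
      ... | inj₂ h = in-gap (λ q → q) (nbr∈ u∈) (lin (ρ L rest ∷ []) (λ r → r ⊕ # 1 ≼ # 6 ⟹ r ≼ # 5) h)

      fifteen : ∀ (Z : VSet n) → ∑S Z (λ _ → + 15) ≡ + 15 * ∣ Z ∣
      fifteen Z = trans (S-* Z (+ 15) (λ _ → 1ℤ)) (cong (λ t → + 15 * t) (sym (card-sum Z)))

      -- Seven rows of at least 15 sum to 105, more than the 100 available.
      threeHeavy : ∣ rest ∣ ≡ + 7 → (∀ {t} → t ∈ rest → + 15 ≤ row t) → R
      threeHeavy c rows = rest-gap λ h → ⊥-elim (lin (∑S rest row ∷ ∑S rest (λ _ → + 15) ∷ ∣ rest ∣ ∷ [])
        (λ s f k → s ≼ # 100 ⟹ f ≼ s ⟹ f ≐ 15 ⊙ k ⟹ k ≐ # 7 ⟹ contra) (D-rest h c) (S-mono {A = rest} rows) (fifteen rest) c)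

      -- All rows are at least 15 except that of nbr w, which is at least 10, and they sum to at most 100.
      kiteHeavy : ∀ {W} (wr : W ⊆ rest) (u∈W : nbr u ∈ W) (v∈W : nbr v ∈ W) (w∉W : nbr w ∉ W) (κ : Kite W (nbr u) (nbr v)) →
                  ∣ rest ∣ ≡ + 7 → (∀ {t} → t ∈ rest → t ≢ nbr w → + 15 ≤ row t) → + 10 ≤ row (nbr w) → R
      kiteHeavy {W} wr u∈W v∈W w∉W κ c rows row-w = rest-gap λ h → kite-diamond wr u∈W v∈W κ (thin h a∈ a≢y a≢y') (thin h b∈ b≢y b≢y')
        where
        open Kite κ
        thin : + 6 ≤ ρ L rest → ∀ {t} → t ∈ W → t ≢ nbr u → t ≢ nbr v → deg t A ≤ + 3
        thin h {t} t∈ nu nv = lin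
          (∑S rest row ∷ row t ∷ row (nbr w) ∷ ∑S (rest ∖ ⟨ t ⟩) row ∷ ∑S (rest ∩ ⟨ t ⟩) row ∷ ∑S (rest ∖ ⟨ t ⟩ ∖ ⟨ nbr w ⟩) row ∷ ∑S ((rest ∖ ⟨ t ⟩) ∩ ⟨ nbr w ⟩) row
            ∷ ∑S (rest ∖ ⟨ t ⟩ ∖ ⟨ nbr w ⟩) (λ _ → + 15) ∷ ∣ rest ∣ ∷ ∣ rest ∖ ⟨ t ⟩ ∣ ∷ ∣ rest ∖ ⟨ t ⟩ ∖ ⟨ nbr w ⟩ ∣ ∷ deg t A ∷ deg t X ∷ deg t rest ∷ ∑S rest (λ s → + 5 * + m t s) ∷ [])
          (λ s rt rw s₁ i₁ s₂ i₂ f k k₁ k₂ dA dX dr d5 → s ≼ # 100 ⟹ s ≐ i₁ ⊕ s₁ ⟹ s₁ ≐ i₂ ⊕ s₂ ⟹ rt ≼ i₁ ⟹ rw ≼ i₂ ⟹ f ≼ s₂ ⟹ f ≐ 15 ⊙ k₂ ⟹ k ≐ # 7 ⟹ k ≐ k₁ ⊕ # 1 ⟹ k₁ ≐ k₂ ⊕ # 1 ⟹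
            # 10 ≼ rw ⟹ dA ≐ dX ⊕ dr ⟹ dX ≼ # 0 ⟹ d5 ≐ 5 ⊙ dr ⟹ d5 ≼ rt ⟹ dA ≼ # 3)
          (D-rest h c) (S-split rest ⟨ t ⟩ row) (S-split (rest ∖ ⟨ t ⟩) ⟨ nbr w ⟩ row)
          (S-term {A = rest ∩ ⟨ t ⟩} (∩-intro (wr t∈) ∈⟨⟩) (λ {x} _ → row≥0 x)) (S-term {A = (rest ∖ ⟨ t ⟩) ∩ ⟨ nbr w ⟩} (∩-intro w∈₁ ∈⟨⟩) (λ {x} _ → row≥0 x))
          (S-mono {A = rest ∖ ⟨ t ⟩ ∖ ⟨ nbr w ⟩} (λ {x} x∈ → rows (∖ˡ {A = rest} (∖ˡ {A = rest ∖ ⟨ t ⟩} x∈)) (∉⟨⟩-elim (∖ʳ {A = rest ∖ ⟨ t ⟩} x∈))))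
          (fifteen (rest ∖ ⟨ t ⟩ ∖ ⟨ nbr w ⟩)) c (card-remove (wr t∈)) (card-remove w∈₁) row-w (deg-split t X⊆) (off-ring (wr t∈) nu nv (∈-≢ t∈ w∉W))
          (S-* rest (+ 5) (λ s → + m t s)) (S-mono {A = rest} (λ {s} _ → cost≥5m (m t s)))
          where
          row≥0 : ∀ x → 0ℤ ≤ row x
          row≥0 x = S-nonneg {A = rest} (λ {s} _ → cost≥0 (m x s))
          w∈₁ : nbr w ∈ rest ∖ ⟨ t ⟩
          w∈₁ = ∖-intro (nbr∈ w∈) (∉⟨⟩ (λ e → absurd∈ (subst (_∈ W) (sym e) t∈) w∉W))

    oneKite : ∀ {u v w} → Labelled u v w → ∀ {W} → W ⊆ rest → nbr u ∈ W → nbr v ∈ W → nbr w ∉ W → Kite W (nbr u) (nbr v) → ∣ rest ∣ ≡ + 7 →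
              (∀ {t} → t ∈ rest → t ≢ nbr v → t ≢ nbr w → + 15 ≤ row t) → (∀ {t} → t ∈ rest → t ≢ nbr u → t ≢ nbr w → + 15 ≤ row t) → + 10 ≤ row (nbr w) → R
    oneKite {u} {v} {w} l wr u∈ v∈ w∉ κ c r r' rw = Three.kiteHeavy l wr u∈ v∈ w∉ κ c (λ {t} t∈ nw → rows t∈ nw (t Finp.≟ nbr v)) rw
      where
      rows : ∀ {t} → t ∈ rest → t ≢ nbr w → Dec (t ≡ nbr v) → + 15 ≤ row t
      rows t∈ nw (no nv) = r t∈ nv nw
      rows t∈ nw (yes e) = r' t∈ (λ e' → Labelled.nu≢nv l (trans (sym e') e)) nw

    -- Any two of the three pairs share a ring vertex, so two kites always meet in an outer
    -- neighbour. With one kite, the two heavy pairs bound every row by 15 except that of the outer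
    -- neighbour missed by the kite; with none, all rows are at least 15.
    finalCase : ∀ {u v w} → Labelled u v w → Pair u v w → Pair v w u → Pair u w v → R
    finalCase l (kitePair W wr u∈ v∈ w∉ κ lo hi) (heavyPair c _ r _ rw) (heavyPair _ _ r' _ _) = oneKite l wr u∈ v∈ w∉ κ c r r' rw
    finalCase l (heavyPair c _ r ru _) (kitePair W wr v∈ w∈ u∉ κ lo hi) (heavyPair _ _ r' _ _) =
      oneKite (rotate l) wr v∈ w∈ u∉ κ c (λ t∈ nw nu → r' t∈ nu nw) (λ t∈ nv nu → r t∈ nu nv) ru
    finalCase l (heavyPair c _ r _ rv) (heavyPair _ _ r' _ _) (kitePair W wr u∈ w∈ v∉ κ lo hi) =
      oneKite (swap (rotate (rotate l))) wr u∈ w∈ v∉ κ c (λ t∈ nw nv → r' t∈ nv nw) r rv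
    finalCase l (kitePair W wr u∈ v∈ w∉ κ lo hi) (kitePair W' wr' v∈' w∈' u∉' κ' lo' hi') p =
      Three.twoKites (swap l) W W' wr wr' v∈ u∈ w∉ (flipKite κ) lo hi v∈' w∈' u∉' hi'
    finalCase l (kitePair W wr u∈ v∈ w∉ κ lo hi) (heavyPair _ _ _ _ _) (kitePair W' wr' u∈' w∈' v∉' κ' lo' hi') =
      Three.twoKites l W W' wr wr' u∈ v∈ w∉ κ lo hi u∈' w∈' v∉' hi'
    finalCase l (heavyPair _ _ _ _ _) (kitePair W wr v∈ w∈ u∉ κ lo hi) (kitePair W' wr' u∈' w∈' v∉' κ' lo' hi') =
      Three.twoKites (swap (rotate l)) W W' wr wr' w∈ v∈ u∉ (flipKite κ) lo hi w∈' u∈' v∉' hi'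
    finalCase {u} {v} l (heavyPair c _ r _ _) (heavyPair _ _ r' _ _) (heavyPair _ _ r'' _ _) =
      Three.threeHeavy l c (λ {t} t∈ → rows t∈ (t Finp.≟ nbr u) (t Finp.≟ nbr v))
      where
      open Labelled l using (nu≢nv; nu≢nw; nv≢nw)
      rows : ∀ {t} → t ∈ rest → Dec (t ≡ nbr u) → Dec (t ≡ nbr v) → + 15 ≤ row t
      rows t∈ (yes refl) _ = r' t∈ nu≢nv nu≢nw
      rows t∈ (no nu) (yes refl) = r'' t∈ nu nv≢nw
      rows t∈ (no nu) (no nv) = r t∈ nu nv

    noTriangle : R
    noTriangle = distinct (nbr x₀ Finp.≟ nbr x₁) (nbr x₀ Finp.≟ nbr x₂) (nbr x₁ Finp.≟ nbr x₂)
      where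
      open Corners corners
      distinct : Dec (nbr x₀ ≡ nbr x₁) → Dec (nbr x₀ ≡ nbr x₂) → Dec (nbr x₁ ≡ nbr x₂) → R
      distinct (yes e) _ _ = same-nbr x₀∈ x₁∈ x₂∈ (x₁≢x₀ ∘ sym) (x₂≢x₀ ∘ sym) (x₂≢x₁ ∘ sym) e
      distinct (no _) (yes e) _ = same-nbr x₀∈ x₂∈ x₁∈ (x₂≢x₀ ∘ sym) (x₁≢x₀ ∘ sym) x₂≢x₁ e
      distinct (no _) (no _) (yes e) = same-nbr x₁∈ x₂∈ x₀∈ (x₂≢x₁ ∘ sym) x₁≢x₀ x₂≢x₀ e
      distinct (no n₀₁) (no n₀₂) (no n₁₂) = Three.pair l λ p → Three.pair (rotate l) λ q → Three.pair (swap (rotate (rotate l))) λ r → finalCase l p q r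
        where
        l : Labelled x₀ x₁ x₂
        l = record { u∈ = x₀∈ ; v∈ = x₁∈ ; w∈ = x₂∈ ; u≢v = x₁≢x₀ ∘ sym ; nu≢nv = n₀₁ ; nu≢nw = n₀₂ ; nv≢nw = n₁₂ ; every = corner }

-- Discharging

module Forests {n : ℕ} (st : State n) where
  open State st
  open Gap₃ st
  open LowVertices st
  open Rings st

  edges+ : ∀ {X x} → x ∈ X → Mu.e X ≡ Mu.e (X ∖ ⟨ x ⟩) + deg x X
  edges+ {X} {x} x∈ = lin
    (Mu.e X ∷ Mu.e (⟨ x ⟩ ∪ X ∖ ⟨ x ⟩) ∷ Mu.e ⟨ x ⟩ ∷ Mu.e (X ∖ ⟨ x ⟩) ∷ Mu.D ⟨ x ⟩ (X ∖ ⟨ x ⟩) ∷ deg x (X ∖ ⟨ x ⟩) ∷ deg x X ∷ deg x (X ∩ ⟨ x ⟩) ∷ deg x ⟨ x ⟩ ∷ + m x x ∷ [])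
    (λ a b c d e f g i o z → a ≐ b ⟹ b ≐ c ⊕ d ⊕ e ⟹ c ≐ # 0 ⟹ e ≐ f ⟹ g ≐ i ⊕ f ⟹ i ≐ o ⟹ o ≐ z ⟹ z ≐ # 0 ⟹ a ≐ d ⊕ g)
    (Mu.e-ext there back) (Mu.e-∪ (⟨⟩-disjoint (not-in (λ q → absurd∈ ∈⟨⟩ (∖ʳ {A = X} q))))) (Mu.e-point x) (Mu.D-pointˡ x (X ∖ ⟨ x ⟩))
    (S-split X ⟨ x ⟩ (λ u → + m x u)) (S-ext⊆ {A = X ∩ ⟨ x ⟩} {⟨ x ⟩} (∩ʳ {A = X}) (λ q → ∩-intro (⟨⟩-⊆ x∈ q) q)) (S-point x _) (cong +_ (m-irr x))
    where
    there : X ⊆ ⟨ x ⟩ ∪ X ∖ ⟨ x ⟩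
    there {v} q with dec∈ v ⟨ x ⟩
    ... | inj₁ e = ∪ˡ {A = ⟨ x ⟩} e
    ... | inj₂ ne = ∪ʳ {A = ⟨ x ⟩} (∖-intro q ne)
    back : ⟨ x ⟩ ∪ X ∖ ⟨ x ⟩ ⊆ X
    back q = [ ⟨⟩-⊆ x∈ , ∖ˡ {A = X} ]′ (∪-elim {A = ⟨ x ⟩} q)

  degrees-sum : ∀ X → ∑S X (λ v → deg v X) ≡ + 2 * Mu.e X
  degrees-sum X = trans (sym (D-deg X X)) (sym (Mu.e-double X))

  module Acyclic (noRing : ∀ {X} → Ring X → R) where
    -- A vertex is deleted as long as the set keeps at least as many edges as vertices. When this is
    -- no longer possible, every degree is at least `e - |X| + 2`, and since low vertices have
    -- degree at most 3 the set is 2-regular, hence a ring.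
    forest : ∀ k {X x} → (∀ {v} → v ∈ X → Low v) → x ∈ X → ∣ X ∣ ≤ + k → ∣ X ∣ ≤ Mu.e X → R
    forest zero low x∈ size _ = ⊥-elim (lin (∣ _ ∣ ∷ []) (λ a → # 1 ≼ a ⟹ a ≼ # 0 ⟹ contra) (card-pos x∈) size)
    forest (suc k) {X} {x} low x∈ size dense = simpleOr (search X {λ u → ∃[ v ] v ∈ X × + 2 ≤ + m u v} {λ u → ∀ {v} → v ∈ X → + m u v ≤ 1ℤ} heavy?)
      where
      heavy? : ∀ u → (∃[ v ] v ∈ X × + 2 ≤ + m u v) ⊎ (∀ {v} → v ∈ X → + m u v ≤ 1ℤ)
      heavy? u = search X (λ v → [ inj₂ , inj₁ ]′ (dec≤ (+ m u v) 1ℤ))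
      smaller : ∀ {Z z v} → Z ⊆ X → z ∈ Z → v ∈ X → v ∉ Z → ∣ Z ∣ ≤ Mu.e Z → R
      smaller {Z} zx z∈ v∈ v∉ = forest k (λ q → low (zx q)) z∈ (lin (∣ Z ∣ ∷ ∣ X ∣ ∷ + k ∷ []) (λ z x k → z ⊕ # 1 ≼ x ⟹ x ≼ # 1 ⊕ k ⟹ z ≼ k) (proper-card zx v∈ v∉) size)
      simpleOr : (∃[ u ] u ∈ X × ∃[ v ] v ∈ X × + 2 ≤ + m u v) ⊎ (∀ {u} → u ∈ X → ∀ {v} → v ∈ X → + m u v ≤ 1ℤ) → R
      simpleOr (inj₁ (u , u∈ , v , v∈ , h)) = multiple (low u∈) (low v∈) h
      simpleOr (inj₂ simple) = degreesOr (search X (λ v → [ inj₂ , inj₁ ]′ (dec≤ (Mu.e X + + 2) (deg v X + ∣ X ∣))))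
        where
        degreesOr : (∃[ v ] v ∈ X × deg v X + ∣ X ∣ + 1ℤ ≤ Mu.e X + + 2) ⊎ (∀ {v} → v ∈ X → Mu.e X + + 2 ≤ deg v X + ∣ X ∣) → R
        degreesOr (inj₁ (v , v∈ , h)) = go (dec≤ ∣ X ∖ ⟨ v ⟩ ∣ 0ℤ)
          where
          go : (∣ X ∖ ⟨ v ⟩ ∣ ≤ 0ℤ) ⊎ (0ℤ + 1ℤ ≤ ∣ X ∖ ⟨ v ⟩ ∣) → R
          go (inj₂ q) = smaller (∖ˡ {A = X}) (proj₂ (card-find q)) v∈ (not-in (λ z → absurd∈ ∈⟨⟩ (∖ʳ {A = X} z)))
            (lin (Mu.e X ∷ Mu.e (X ∖ ⟨ v ⟩) ∷ deg v X ∷ ∣ X ∣ ∷ ∣ X ∖ ⟨ v ⟩ ∣ ∷ []) (λ e e' d c c' → e ≐ e' ⊕ d ⟹ c ≐ c' ⊕ # 1 ⟹ d ⊕ c ⊕ # 1 ≼ e ⊕ # 2 ⟹ c' ≼ e') (edges+ v∈) (card-remove v∈) h)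
          go (inj₁ q) = ⊥-elim (lin (Mu.e X ∷ Mu.e (X ∖ ⟨ v ⟩) ∷ deg v X ∷ deg v (X ∩ ⟨ v ⟩) ∷ deg v (X ∖ ⟨ v ⟩) ∷ deg v ⟨ v ⟩ ∷ + m v v ∷ ∣ X ∣ ∷ ∣ X ∖ ⟨ v ⟩ ∣ ∷ ∑S (X ∖ ⟨ v ⟩) (λ u → deg u (X ∖ ⟨ v ⟩)) ∷ [])
              (λ e e' d i d' o z c c' s → # 1 ≼ c ⟹ e ≐ e' ⊕ d ⟹ c ≐ c' ⊕ # 1 ⟹ c' ≼ # 0 ⟹ c ≼ e ⟹ d ≐ i ⊕ d' ⟹ i ≼ o ⟹ o ≐ z ⟹ z ≐ # 0 ⟹ d' ≼ # 0 ⟹ s ≐ 2 ⊙ e' ⟹ s ≼ # 0 ⟹ contra)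
              (card-pos v∈) (edges+ v∈) (card-remove v∈) q dense (S-split X ⟨ v ⟩ (λ u → + m v u)) (deg-⊆ (∩ʳ {A = X})) (S-point v _) (cong +_ (m-irr v)) (empty (λ u → + m v u)) (degrees-sum (X ∖ ⟨ v ⟩)) (empty (λ u → deg u (X ∖ ⟨ v ⟩))))
            where
            empty : ∀ f → ∑S (X ∖ ⟨ v ⟩) f ≤ 0ℤ
            empty f = subst (∑S (X ∖ ⟨ v ⟩) f ≤_) (S-zero {A = X ∖ ⟨ v ⟩}) (S-mono {A = X ∖ ⟨ v ⟩} (λ {u} u∈ → ⊥-elim (lin (∣ X ∖ ⟨ v ⟩ ∣ ∷ []) (λ a → a ≼ # 0 ⟹ # 1 ≼ a ⟹ contra) q (card-pos u∈))))
        degreesOr (inj₂ big) = noRing record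
          { X⊆ = λ q → proj₁ (low q) ; x₀ = x ; x₀∈ = x∈ ; low-x = λ q → proj₂ (low q) ; two-x = degree-two
          ; simple = λ u∈ v∈ → simple u∈ v∈
          ; sparse = λ {Z} zx z∈ v∈ v∉ h → smaller zx z∈ v∈ v∉ (lin (∣ Z ∣ ∷ ∑S Z (λ z → deg z Z) ∷ Mu.e Z ∷ []) (λ c s e → 2 ⊙ c ≼ s ⊕ # 1 ⟹ s ≐ 2 ⊙ e ⟹ c ≼ e) h (degrees-sum Z)) }
          where
          deg≤3 : ∀ {v} → v ∈ X → deg v X ≤ + 3
          deg≤3 {v} v∈ = ℤp.≤-trans (deg-⊆ (λ q → proj₁ (low q))) (ℤp.≤-trans (ℤp.≤-reflexive (proj₂ (low v∈))) (card≤3 (L v)))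
          constant : ∀ (Z : VSet n) k → ∑S Z (λ _ → + k) ≡ + k * ∣ Z ∣
          constant Z k = trans (S-cong {A = Z} (λ _ → sym (ℤp.*-identityʳ (+ k)))) (trans (S-* Z (+ k) (λ _ → 1ℤ)) (cong (λ t → + k * t) (sym (card-sum Z))))
          light : ∀ {v} → v ∈ X → deg v X ≤ ∣ X ∖ ⟨ v ⟩ ∣
          light {v} v∈ = lin (deg v X ∷ deg v (X ∩ ⟨ v ⟩) ∷ deg v (X ∖ ⟨ v ⟩) ∷ deg v ⟨ v ⟩ ∷ + m v v ∷ ∣ X ∖ ⟨ v ⟩ ∣ ∷ [])
            (λ d i d' o z c → d ≐ i ⊕ d' ⟹ i ≼ o ⟹ o ≐ z ⟹ z ≐ # 0 ⟹ d' ≼ c ⟹ d ≼ c)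
            (S-split X ⟨ v ⟩ (λ u → + m v u)) (deg-⊆ (∩ʳ {A = X})) (S-point v _) (cong +_ (m-irr v))
            (subst (deg v (X ∖ ⟨ v ⟩) ≤_) (sym (card-sum (X ∖ ⟨ v ⟩))) (S-mono {A = X ∖ ⟨ v ⟩} (λ u∈ → simple v∈ (∖ˡ {A = X} u∈))))
          e≤ : Mu.e X ≤ ∣ X ∣
          e≤ with dec≤ (Mu.e X) ∣ X ∣
          ... | inj₁ q = q
          -- All degrees would be 3 and `e` at most `|X| + 1`, so `3 |X| ≤ 2 |X| + 2`; but three
          -- simple edges at a vertex need `|X| ≥ 4`.
          ... | inj₂ q = ⊥-elim (lin (Mu.e X ∷ ∣ X ∣ ∷ deg x X ∷ ∣ X ∖ ⟨ x ⟩ ∣ ∷ ∑S X (λ v → deg v X) ∷ ∑S X (λ _ → + 3) ∷ [])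
            (λ e c d c' s t → c ⊕ # 1 ≼ e ⟹ e ⊕ # 2 ≼ d ⊕ c ⟹ d ≼ # 3 ⟹ d ≼ c' ⟹ c ≐ c' ⊕ # 1 ⟹ s ≐ 2 ⊙ e ⟹ t ≼ s ⟹ t ≐ 3 ⊙ c ⟹ contra)
            q (big x∈) (deg≤3 x∈) (light x∈) (card-remove x∈) (degrees-sum X)
            (S-mono {A = X} (λ {u} u∈ → lin (Mu.e X ∷ ∣ X ∣ ∷ deg u X ∷ []) (λ e c d → e ⊕ # 2 ≼ d ⊕ c ⟹ c ⊕ # 1 ≼ e ⟹ # 3 ≼ d) (big u∈) q)) (constant X 3))
          degree-two : ∀ {v} → v ∈ X → deg v X ≡ + 2
          degree-two {v} v∈ = lin (Mu.e X ∷ ∣ X ∣ ∷ deg v X ∷ ∑S X f ∷ ∑S (X ∩ ⟨ v ⟩) f ∷ ∑S (X ∖ ⟨ v ⟩) f ∷ ∑S (X ∖ ⟨ v ⟩) (λ _ → + 2) ∷ ∣ X ∖ ⟨ v ⟩ ∣ ∷ [])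
            (λ e c d s i s' t c' → e ⊕ # 2 ≼ d ⊕ c ⟹ e ≼ c ⟹ c ≼ e ⟹ s ≐ 2 ⊙ e ⟹ s ≐ i ⊕ s' ⟹ d ≼ i ⟹ t ≼ s' ⟹ t ≐ 2 ⊙ c' ⟹ c ≐ c' ⊕ # 1 ⟹ d ≐ # 2)
            (big v∈) e≤ dense (degrees-sum X) (S-split X ⟨ v ⟩ f) (S-term {A = X ∩ ⟨ v ⟩} (∩-intro v∈ ∈⟨⟩) (λ _ → deg≥0))
            (S-mono {A = X ∖ ⟨ v ⟩} (λ {u} u∈ → lin (Mu.e X ∷ ∣ X ∣ ∷ deg u X ∷ []) (λ e c d → e ⊕ # 2 ≼ d ⊕ c ⟹ c ≼ e ⟹ # 2 ≼ d) (big (∖ˡ {A = X} u∈)) dense))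
            (constant (X ∖ ⟨ v ⟩) 2) (card-remove v∈)
            where
            f : Fin n → ℤ
            f u = deg u X

    acyclic : ∀ {X x} → (∀ {v} → v ∈ X → Low v) → x ∈ X → (Mu.e X + 1ℤ ≤ ∣ X ∣ → R) → R
    acyclic {X} low x∈ k with dec≤ ∣ X ∣ (Mu.e X)
    ... | inj₂ h = k h
    ... | inj₁ h = forest ℤ.∣ ∣ X ∣ ∣ low x∈ (ℤp.≤-reflexive (sym (ℤp.0≤i⇒+∣i∣≡i card-nonneg))) h

    -- Low vertices F span a forest, and every other vertex has degree at least |list| + 1.
    module Discharging (lists≥2 : ∀ {v} → v ∈ A → + 2 ≤ ∣ L v ∣) (degrees : ∀ {v} → v ∈ A → ∣ L v ∣ ≤ deg v A) where
      F H : VSet n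
      F v = A v ∧ does (deg v A ℤ.≤? ∣ L v ∣)
      H = A ∖ F

      F⊆ : F ⊆ A
      F⊆ = ∩ˡ {A = A}
      low-F : ∀ {v} → v ∈ F → Low v
      low-F {v} q = F⊆ q , ℤp.≤-antisym (does-true (deg v A ℤ.≤? ∣ L v ∣) (un∈ (∩ʳ {A = A} q))) (degrees (F⊆ q))
      high-H : ∀ {v} → v ∈ H → ∣ L v ∣ + 1ℤ ≤ deg v A
      high-H {v} q with dec≤ (deg v A) ∣ L v ∣
      ... | inj₂ h = h
      ... | inj₁ h = absurd∈ (∩-intro (∖ˡ {A = A} q) (mk∈ (dec-true (deg v A ℤ.≤? ∣ L v ∣) h))) (∖ʳ {A = A} q)
        where open import Relation.Nullary.Decidable using (dec-true)

      FH : Disjoint F H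
      FH q = not-in (λ z → absurd∈ q (∖ʳ {A = A} z))

      A≈ : A ⊆ F ∪ H
      A≈ {v} q with dec∈ v F
      ... | inj₁ z = ∪ˡ {A = F} z
      ... | inj₂ z = ∪ʳ {A = F} (∖-intro q z)
      ≈A : F ∪ H ⊆ A
      ≈A q = [ F⊆ , ∖ˡ {A = A} ]′ (∪-elim {A = F} q)

      h : Fin n → ℤ
      h v = ∣ L v ∣

      p-linear : ∀ {v} → v ∈ A → p (L v) ≡ + 4 * h v + - (+ 4)
      p-linear {v} v∈ with cardView (L v)
      ... | full _ e q rewrite e | q = refl
      ... | two _ e q rewrite e | q = refl
      ... | one _ e q = ⊥-elim (lin (h v ∷ []) (λ a → a ≐ # 1 ⟹ # 2 ≼ a ⟹ contra) e (lists≥2 v∈))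
      ... | none _ e q = ⊥-elim (lin (h v ∷ []) (λ a → a ≐ # 0 ⟹ # 2 ≼ a ⟹ contra) e (lists≥2 v∈))

      sum-p : ∀ {Z} → Z ⊆ A → ∑S Z (λ v → p (L v)) ≡ + 4 * ∑S Z h - + 4 * ∣ Z ∣
      sum-p {Z} za = lin (∑S Z (λ v → p (L v)) ∷ ∑S Z (λ v → + 4 * h v + - (+ 4)) ∷ ∑S Z (λ v → + 4 * h v) ∷ ∑S Z h ∷ ∑S Z (λ _ → - (+ 4)) ∷ - (+ 4) * ∑S Z (λ _ → 1ℤ) ∷ ∑S Z (λ _ → 1ℤ) ∷ ∣ Z ∣ ∷ [])
        (λ s t u g c c' o k → s ≐ t ⟹ t ≐ u ⊕ c ⟹ u ≐ 4 ⊙ g ⟹ c ≐ c' ⟹ c' ≐ # 0 ⊖ 4 ⊙ o ⟹ k ≐ o ⟹ s ≐ 4 ⊙ g ⊖ 4 ⊙ k)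
        (S-cong {A = Z} (λ v∈ → p-linear (za v∈))) (S-+ Z (λ v → + 4 * h v) (λ _ → - (+ 4))) (S-* Z (+ 4) h)
        (S-* Z (- (+ 4)) (λ _ → 1ℤ)) (neg (∑S Z (λ _ → 1ℤ))) (card-sum Z)
        where
        neg : ∀ x → - (+ 4) * x ≡ 0ℤ - + 4 * x
        neg x = trans (sym (ℤp.neg-distribˡ-* (+ 4) x)) (sym (ℤp.+-identityˡ _))

      -- A bundle of `k` parallel edges contributes `k - 1`.
      excess : ℤ
      excess = Co.e A - + 5 * Mu.e A

      deficit : VSet n → ℤ
      deficit Z = ∑S Z (λ v → + 3 - h v)

      deficit-sum : ∀ Z → deficit Z ≡ + 3 * ∣ Z ∣ - ∑S Z h
      deficit-sum Z = lin (∑S Z (λ v → + 3 - h v) ∷ ∑S Z h ∷ ∑S Z (λ v → (+ 3 - h v) + h v) ∷ ∑S Z (λ _ → + 3 * 1ℤ) ∷ ∣ Z ∣ ∷ [])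
        (λ d s t u c → t ≐ d ⊕ s ⟹ t ≐ u ⟹ u ≐ 3 ⊙ c ⟹ d ≐ 3 ⊙ c ⊖ s)
        (S-+ Z (λ v → + 3 - h v) h) (S-cong {A = Z} (λ {v} _ → lin (h v ∷ []) (λ x → # 3 ⊖ x ⊕ x ≐ # 3))) (trans (S-* Z (+ 3) (λ _ → 1ℤ)) (cong (λ t → + 3 * t) (sym (card-sum Z))))

      deficit≥0 : ∀ Z → 0ℤ ≤ deficit Z
      deficit≥0 Z = S-nonneg {A = Z} (λ {v} _ → lin (h v ∷ []) (λ x → x ≼ # 3 ⟹ # 0 ≼ # 3 ⊖ x) (card≤3 (L v)))

      high-degrees : ∑S H h + ∣ H ∣ ≤ ∑S H (λ v → deg v A)
      high-degrees = subst (_≤ ∑S H (λ v → deg v A)) (trans (S-+ H h (λ _ → 1ℤ)) (cong (λ t → ∑S H h + t) (sym (card-sum H)))) (S-mono {A = H} high-H)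

      deg-parts : ∀ Z → ∑S Z (λ v → deg v A) ≡ Mu.D Z F + Mu.D Z H
      deg-parts Z = begin
        ∑S Z (λ v → deg v A) ≡⟨ S-cong {A = Z} (λ {v} _ → trans (S-ext⊆ {A = A} {F ∪ H} A≈ ≈A) (S-∪ FH _)) ⟩
        ∑S Z (λ v → deg v F + deg v H) ≡⟨ S-+ Z (λ v → deg v F) (λ v → deg v H) ⟩
        ∑S Z (λ v → deg v F) + ∑S Z (λ v → deg v H) ≡⟨ cong₂ _+_ (sym (D-deg Z F)) (sym (D-deg Z H)) ⟩
        Mu.D Z F + Mu.D Z H ∎
        where open ≡-Reasoning

      -- Three times the degree equation on `F` plus twice the degree inequality on `H`. An edge
      -- between `F` and `H` is then counted 3 + 2 times, which cancels its cost 5.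
      charge : ρ L A + excess + deficit F + Mu.e H + + 2 * deficit H + ∣ F ∣ ≤ Mu.e F
      charge = lin
        (ρ L A ∷ ∑S A (λ v → p (L v)) ∷ ∑S A h ∷ ∑S (F ∪ H) h ∷ ∑S F h ∷ ∑S H h ∷ ∣ A ∣ ∷ ∣ F ∪ H ∣ ∷ ∣ F ∣ ∷ ∣ H ∣ ∷ Co.e A ∷ Mu.e A ∷ Mu.e (F ∪ H) ∷ Mu.e F ∷ Mu.e H
          ∷ Mu.D F H ∷ Mu.D H F ∷ Mu.D F F ∷ Mu.D H H ∷ ∑S F (λ v → deg v A) ∷ ∑S H (λ v → deg v A) ∷ deficit F ∷ deficit H ∷ [])
        (λ r P hA hA' hF hH a a' f g ce e e' eF eH d d' ff hh sF sH δF δH →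
          r ≐ P ⊖ ce ⟹ P ≐ 4 ⊙ hA ⊖ 4 ⊙ a ⟹ hA ≐ hA' ⟹ hA' ≐ hF ⊕ hH ⟹ a ≐ a' ⟹ a' ≐ f ⊕ g ⟹ e ≐ e' ⟹ e' ≐ eF ⊕ eH ⊕ d ⟹ d ≐ d' ⟹ 2 ⊙ eF ≐ ff ⟹ 2 ⊙ eH ≐ hh ⟹
          sF ≐ hF ⟹ sF ≐ ff ⊕ d ⟹ sH ≐ d' ⊕ hh ⟹ hH ⊕ g ≼ sH ⟹ δF ≐ 3 ⊙ f ⊖ hF ⟹ δH ≐ 3 ⊙ g ⊖ hH ⟹
          r ⊕ (ce ⊖ 5 ⊙ e) ⊕ δF ⊕ eH ⊕ 2 ⊙ δH ⊕ f ≼ eF)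
        refl (sum-p (λ q → q)) (S-ext⊆ {A = A} {F ∪ H} A≈ ≈A) (S-∪ FH h) (ℤp.≤-antisym (card-mono A≈) (card-mono ≈A)) (card-∪ FH)
        (Mu.e-ext A≈ ≈A) (Mu.e-∪ FH) (Mu.D-sym F H) (Mu.e-double F) (Mu.e-double H)
        (S-cong {A = F} (λ q → proj₂ (low-F q))) (deg-parts F) (deg-parts H) high-degrees (deficit-sum F) (deficit-sum H)

      excess≥0 : 0ℤ ≤ excess
      excess≥0 = lin (Co.e A ∷ Mu.e A ∷ []) (λ c e → 5 ⊙ e ≼ c ⟹ # 0 ≼ c ⊖ 5 ⊙ e) (5e≤ A)

      -- Without low vertices every degree is at least |list| + 1 ≥ 3.
      noLow : (∀ {v} → v ∉ F) → ∀ {a} → a ∈ A → ρ L A + + 3 ≤ 0ℤ ⊎ (deficit H ≤ 0ℤ × ρ L A + 1ℤ ≤ 0ℤ)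
      noLow empty {a} a∈ = go (dec≤ (deficit H) 0ℤ)
        where
        F-zero : ∀ f → ∑S F f ≡ 0ℤ
        F-zero f = trans (S-cong {A = F} {f = f} {g = λ _ → 0ℤ} (λ v∈ → absurd∈ v∈ empty)) (S-zero {A = F})
        bound : ρ L A + deficit F + Mu.e H + + 2 * deficit H ≤ 0ℤ
        bound = lin (ρ L A ∷ excess ∷ deficit F ∷ Mu.e H ∷ deficit H ∷ ∣ F ∣ ∷ Mu.e F ∷ ∑S F (λ v → deg v F) ∷ ∑S F (λ _ → 1ℤ) ∷ [])
          (λ r x δF eH δH f eF s o → r ⊕ x ⊕ δF ⊕ eH ⊕ 2 ⊙ δH ⊕ f ≼ eF ⟹ # 0 ≼ x ⟹ s ≐ 2 ⊙ eF ⟹ s ≐ # 0 ⟹ f ≐ o ⟹ o ≐ # 0 ⟹ r ⊕ δF ⊕ eH ⊕ 2 ⊙ δH ≼ # 0)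
          charge excess≥0 (degrees-sum F) (F-zero _) (card-sum F) (F-zero _)
        edges≥2 : + 3 ≤ + 2 * Mu.e H
        edges≥2 = lin (Mu.e H ∷ Mu.D H H ∷ Mu.D H F ∷ ∑S H (λ v → deg v A) ∷ h a ∷ deg a A ∷ Mu.D F H ∷ ∑S F (λ v → deg v H) ∷ [])
          (λ e hh hf s l d fh z → 2 ⊙ e ≐ hh ⟹ s ≐ hf ⊕ hh ⟹ hf ≐ fh ⟹ fh ≐ z ⟹ z ≐ # 0 ⟹ d ≼ s ⟹ l ⊕ # 1 ≼ d ⟹ # 2 ≼ l ⟹ # 3 ≼ 2 ⊙ e)
          (Mu.e-double H) (deg-parts H) (Mu.D-sym H F) (D-deg F H) (F-zero _) (S-term {A = H} a∈H (λ _ → deg≥0)) (high-H a∈H) (lists≥2 a∈)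
          where
          a∈H : a ∈ H
          a∈H = ∖-intro a∈ empty
        go : (deficit H ≤ 0ℤ) ⊎ (0ℤ + 1ℤ ≤ deficit H) → ρ L A + + 3 ≤ 0ℤ ⊎ (deficit H ≤ 0ℤ × ρ L A + 1ℤ ≤ 0ℤ)
        go (inj₁ z) = inj₂ (z , lin (ρ L A ∷ deficit F ∷ Mu.e H ∷ deficit H ∷ []) (λ r δF e δH → r ⊕ δF ⊕ e ⊕ 2 ⊙ δH ≼ # 0 ⟹ # 0 ≼ δF ⟹ # 0 ≼ δH ⟹ # 3 ≼ 2 ⊙ e ⟹ r ⊕ # 1 ≼ # 0) bound (deficit≥0 F) (deficit≥0 H) edges≥2)
        go (inj₂ z) = inj₁ (lin (ρ L A ∷ deficit F ∷ Mu.e H ∷ deficit H ∷ []) (λ r δF e δH → r ⊕ δF ⊕ e ⊕ 2 ⊙ δH ≼ # 0 ⟹ # 0 ≼ δF ⟹ # 1 ≼ δH ⟹ # 3 ≼ 2 ⊙ e ⟹ r ⊕ # 3 ≼ # 0) bound (deficit≥0 F) z edges≥2)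

card-zero : ∀ {n} {A : VSet n} → ∣ A ∣ ≤ 0ℤ → ∀ {v} → v ∉ A
card-zero {A = A} z = not-in (λ q → lin (∣ A ∣ ∷ []) (λ a → a ≼ # 0 ⟹ # 1 ≼ a ⟹ contra) z (card-pos q))

-- Completing the count and the induction

module Conclusion {n : ℕ} (st : State n) where
  open State st
  open Gap₃ st
  open LowVertices st
  open Rings st
  open RingWorlds st
  open Forests st

  withDegrees : ((∀ {v} → v ∈ A → + 2 ≤ ∣ L v ∣) → (∀ {v} → v ∈ A → ∣ L v ∣ ≤ deg v A) → R) → R
  withDegrees k = go (search A (λ v → dec≤ ∣ L v ∣ 1ℤ)) (search A (λ v → [ inj₂ , inj₁ ]′ (dec≤ ∣ L v ∣ (deg v A))))
    where
    go : (∃[ v ] v ∈ A × ∣ L v ∣ ≤ 1ℤ) ⊎ (∀ {v} → v ∈ A → 1ℤ + 1ℤ ≤ ∣ L v ∣) →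
         (∃[ v ] v ∈ A × deg v A + 1ℤ ≤ ∣ L v ∣) ⊎ (∀ {v} → v ∈ A → ∣ L v ∣ ≤ deg v A) → R
    go (inj₁ (v , v∈ , h)) _ = short-list v∈ h
    go (inj₂ _) (inj₁ (v , v∈ , h)) = minDegree v∈ (λ q → ⊥-elim (lin (∣ L v ∣ ∷ deg v A ∷ []) (λ l d → d ⊕ # 1 ≼ l ⟹ l ≼ d ⟹ contra) h q))
    go (inj₂ l) (inj₂ d) = k l d

  edges≥0 : ∀ Z → 0ℤ ≤ Mu.e Z
  edges≥0 Z = lin (Mu.e Z ∷ Mu.D Z Z ∷ []) (λ e d → 2 ⊙ e ≐ d ⟹ # 0 ≼ d ⟹ # 0 ≼ e) (Mu.e-double Z) Mu.D-nonneg

  simple-of-excess : Co.e A - + 5 * Mu.e A ≤ 0ℤ → ∀ {u v} → u ∈ A → v ∈ A → + m u v ≤ 1ℤ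
  simple-of-excess h {u} {v} u∈ v∈ with dec≤ (+ m u v) 1ℤ
  ... | inj₁ q = q
  ... | inj₂ q = ⊥-elim (lin (Co.e A ∷ Mu.e A ∷ Co.D A A ∷ Mu.D A A ∷ ∑S A (λ u → ∑S A (s u)) ∷ ∑S A (s u) ∷ cost (m u v) ∷ + m u v ∷ [])
      (λ ce e cd d t r c m → ce ⊖ 5 ⊙ e ≼ # 0 ⟹ 2 ⊙ ce ≐ cd ⟹ 2 ⊙ e ≐ d ⟹ cd ≐ t ⊕ 5 ⊙ d ⟹ r ≼ t ⟹ c ⊖ 5 ⊙ m ≼ r ⟹ c ≐ 6 ⊙ m ⊖ # 1 ⟹ # 2 ≼ m ⟹ contra)
      h (Co.e-double A) (Mu.e-double A) split-cost (S-term {A = A} u∈ (λ {w} _ → S-nonneg {A = A} (λ {x} _ → s≥0 w x)))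
      (S-term {A = A} v∈ (λ {x} _ → s≥0 u x)) (cost≡6m-1 (m u v) (ℤp.≤-trans (+≤+ (ℕ.s≤s ℕ.z≤n)) q)) q)
    where
    s : Fin n → Fin n → ℤ
    s u v = cost (m u v) - + 5 * + m u v
    s≥0 : ∀ u v → 0ℤ ≤ s u v
    s≥0 u v = lin (cost (m u v) ∷ + m u v ∷ []) (λ c m → 5 ⊙ m ≼ c ⟹ # 0 ≼ c ⊖ 5 ⊙ m) (cost≥5m (m u v))
    row : ∀ u → ∑S A (λ v → cost (m u v)) ≡ ∑S A (s u) + + 5 * ∑S A (λ v → + m u v)
    row u = trans (S-cong {A = A} (λ {v} _ → lin (cost (m u v) ∷ + m u v ∷ []) (λ c m → c ≐ c ⊖ 5 ⊙ m ⊕ 5 ⊙ m)))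
      (trans (S-+ A (s u) (λ v → + 5 * + m u v)) (cong (λ t → ∑S A (s u) + t) (S-* A (+ 5) _)))
    opaque
      unfolding Mu.D Co.D
      split-cost : Co.D A A ≡ ∑S A (λ u → ∑S A (s u)) + + 5 * Mu.D A A
      split-cost = trans (S-cong {A = A} (λ {u} _ → row u)) (trans (S-+ A (λ u → ∑S A (s u)) (λ u → + 5 * ∑S A (λ v → + m u v)))
        (cong (λ t → ∑S A (λ u → ∑S A (s u)) + t) (S-* A (+ 5) _)))

  -- If low vertices exist, they form a forest, and `charge` gives `ρ L A ≤ e F - |F| ≤ -1`; if none
  -- exist, `noLow` suffices.
  fullWorld : μ ≡ 0ℤ → (∀ {v} → v ∈ A → Full (L v)) → ∀ {a} → a ∈ A → R
  fullWorld μ≡0 fullA {a} a∈ = withDegrees λ lists≥2 degrees → go lists≥2 degrees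
    where
    open AllLists μ≡0 fullA using (negative; module LongRing)
    noRing : ∀ {X} → Ring X → R
    noRing {X} ring = [ (λ h → Triangles.Triangle.noTriangle st μ≡0 fullA ring h) , (λ h → LongRing.noRing ring h) ]′ (dec≤ ∣ X ∣ (+ 3))
    go : (∀ {v} → v ∈ A → + 2 ≤ ∣ L v ∣) → (∀ {v} → v ∈ A → ∣ L v ∣ ≤ deg v A) → R
    go lists≥2 degrees = byLow (dec≤ ∣ F ∣ 0ℤ)
      where
      open Acyclic noRing
      open Discharging lists≥2 degrees
      byLow : (∣ F ∣ ≤ 0ℤ) ⊎ (0ℤ + 1ℤ ≤ ∣ F ∣) → R
      byLow (inj₁ z) = [ (λ q → small-out (λ x → x) a∈ q) , (λ q → negative (λ x → x) a∈ (proj₂ q)) ]′ (noLow (card-zero z) a∈)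
      byLow (inj₂ pos) = let (f , f∈) = card-find {A = F} pos in acyclic low-F f∈ λ h → negative (λ x → x) a∈
        (lin (ρ L A ∷ excess ∷ deficit F ∷ Mu.e H ∷ deficit H ∷ ∣ F ∣ ∷ Mu.e F ∷ [])
          (λ r x δF eH δH f eF → r ⊕ x ⊕ δF ⊕ eH ⊕ 2 ⊙ δH ⊕ f ≼ eF ⟹ eF ⊕ # 1 ≼ f ⟹ # 0 ≼ x ⟹ # 0 ≼ δF ⟹ # 0 ≼ eH ⟹ # 0 ≼ δH ⟹ r ⊕ # 1 ≼ # 0)
          charge h excess≥0 (deficit≥0 F) (edges≥0 H) (deficit≥0 H))

  module DeficientWorld (v₀ : Fin n) (v₀∈ : v₀ ∈ A) (v₀-not : ∃[ c ] c ∉ L v₀)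
                        (lists≥2 : ∀ {v} → v ∈ A → + 2 ≤ ∣ L v ∣) (degrees : ∀ {v} → v ∈ A → ∣ L v ∣ ≤ deg v A) where
    open Deficient v₀ v₀∈ v₀-not using (noRing)
    open Acyclic noRing
    open Discharging lists≥2 degrees

    h≤3 : ∀ v → 0ℤ ≤ + 3 - h v
    h≤3 v = lin (h v ∷ []) (λ x → x ≼ # 3 ⟹ # 0 ≼ # 3 ⊖ x) (card≤3 (L v))

    h₀≤2 : h v₀ ≤ + 2
    h₀≤2 with cardView (L v₀)
    ... | full f _ _ = absurd∈ f (proj₂ v₀-not)
    ... | two _ e _ = ℤp.≤-reflexive e
    ... | one _ e _ = subst (_≤ + 2) (sym e) (+≤+ (ℕ.s≤s ℕ.z≤n))
    ... | none _ e _ = subst (_≤ + 2) (sym e) (+≤+ ℕ.z≤n)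

    deficit-at : ∀ {Z} → v₀ ∈ Z → 1ℤ ≤ deficit Z
    deficit-at {Z} v∈ = lin (h v₀ ∷ deficit Z ∷ []) (λ x d → x ≼ # 2 ⟹ # 3 ⊖ x ≼ d ⟹ # 1 ≼ d) h₀≤2 (S-term {A = Z} v∈ (λ {w} _ → h≤3 w))

    -- A missing colour counts twice on `H` but once on `F`, so for `v₀` in `F` the count alone
    -- stops at -2. Then all its inequalities are equalities: `F` is a tree, `v₀` has the only
    -- missing colour, `H` is independent, and there are no parallel edges. Such a cover can be
    -- coloured.
    module Tight (v₀∈F : v₀ ∈ F) (forest-F : Mu.e F + 1ℤ ≤ ∣ F ∣) (tight : 0ℤ + 1ℤ ≤ ρ L A + + 3) where
      squeeze : (Mu.e F + 1ℤ ≡ ∣ F ∣) × (deficit F ≤ 1ℤ) × (Mu.e H ≤ 0ℤ) × (deficit H ≤ 0ℤ) × (excess ≤ 0ℤ)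
      squeeze =
        lin vars (λ r x δF eH δH f eF → r ⊕ x ⊕ δF ⊕ eH ⊕ 2 ⊙ δH ⊕ f ≼ eF ⟹ eF ⊕ # 1 ≼ f ⟹ # 0 ≼ x ⟹ # 1 ≼ δF ⟹ # 0 ≼ eH ⟹ # 0 ≼ δH ⟹ # 1 ≼ r ⊕ # 3 ⟹ eF ⊕ # 1 ≐ f) charge forest-F excess≥0 (deficit-at v₀∈F) (edges≥0 H) (deficit≥0 H) tight ,
        lin vars (λ r x δF eH δH f eF → r ⊕ x ⊕ δF ⊕ eH ⊕ 2 ⊙ δH ⊕ f ≼ eF ⟹ eF ⊕ # 1 ≼ f ⟹ # 0 ≼ x ⟹ # 1 ≼ δF ⟹ # 0 ≼ eH ⟹ # 0 ≼ δH ⟹ # 1 ≼ r ⊕ # 3 ⟹ δF ≼ # 1) charge forest-F excess≥0 (deficit-at v₀∈F) (edges≥0 H) (deficit≥0 H) tight ,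
        lin vars (λ r x δF eH δH f eF → r ⊕ x ⊕ δF ⊕ eH ⊕ 2 ⊙ δH ⊕ f ≼ eF ⟹ eF ⊕ # 1 ≼ f ⟹ # 0 ≼ x ⟹ # 1 ≼ δF ⟹ # 0 ≼ eH ⟹ # 0 ≼ δH ⟹ # 1 ≼ r ⊕ # 3 ⟹ eH ≼ # 0) charge forest-F excess≥0 (deficit-at v₀∈F) (edges≥0 H) (deficit≥0 H) tight ,
        lin vars (λ r x δF eH δH f eF → r ⊕ x ⊕ δF ⊕ eH ⊕ 2 ⊙ δH ⊕ f ≼ eF ⟹ eF ⊕ # 1 ≼ f ⟹ # 0 ≼ x ⟹ # 1 ≼ δF ⟹ # 0 ≼ eH ⟹ # 0 ≼ δH ⟹ # 1 ≼ r ⊕ # 3 ⟹ δH ≼ # 0) charge forest-F excess≥0 (deficit-at v₀∈F) (edges≥0 H) (deficit≥0 H) tight ,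
        lin vars (λ r x δF eH δH f eF → r ⊕ x ⊕ δF ⊕ eH ⊕ 2 ⊙ δH ⊕ f ≼ eF ⟹ eF ⊕ # 1 ≼ f ⟹ # 0 ≼ x ⟹ # 1 ≼ δF ⟹ # 0 ≼ eH ⟹ # 0 ≼ δH ⟹ # 1 ≼ r ⊕ # 3 ⟹ x ≼ # 0) charge forest-F excess≥0 (deficit-at v₀∈F) (edges≥0 H) (deficit≥0 H) tight
        where
        vars : Vec ℤ 7
        vars = ρ L A ∷ excess ∷ deficit F ∷ Mu.e H ∷ deficit H ∷ ∣ F ∣ ∷ Mu.e F ∷ []

      full-of-3 : ∀ v → + 3 ≤ h v → Full (L v)
      full-of-3 v q with full? (L v)
      ... | inj₁ f = f
      ... | inj₂ (_ , s , _) = ⊥-elim (lin (h v ∷ []) (λ x → # 3 ≼ x ⟹ x ≼ # 2 ⟹ contra) q s)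

      full-H : ∀ {v} → v ∈ H → Full (L v)
      full-H {v} v∈ = full-of-3 v (lin (h v ∷ deficit H ∷ []) (λ x d → # 3 ⊖ x ≼ d ⟹ d ≼ # 0 ⟹ # 3 ≼ x)
        (S-term {A = H} v∈ (λ {w} _ → h≤3 w)) (proj₁ (proj₂ (proj₂ (proj₂ squeeze)))))

      F⁻ : VSet n
      F⁻ = F ∖ ⟨ v₀ ⟩

      full-F : ∀ {v} → v ∈ F⁻ → Full (L v)
      full-F {v} v∈ = full-of-3 v (lin (h v ∷ h v₀ ∷ deficit F ∷ deficit (F ∩ ⟨ v₀ ⟩) ∷ deficit F⁻ ∷ [])
        (λ x x₀ d i r → d ≐ i ⊕ r ⟹ d ≼ # 1 ⟹ # 3 ⊖ x ≼ r ⟹ # 1 ≼ i ⟹ # 3 ≼ x)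
        (S-split F ⟨ v₀ ⟩ _) (proj₁ (proj₂ squeeze)) (S-term {A = F⁻} v∈ (λ {w} _ → h≤3 w)) (deficit-at (∩-intro v₀∈F ∈⟨⟩)))

      independent : ∀ {u v} → u ∈ H → v ∈ H → m u v ≡ 0
      independent {u} {v} u∈ v∈ = ≤0 (m u v) (lin (+ m u v ∷ deg u H ∷ ∑S H (λ u → deg u H) ∷ Mu.e H ∷ [])
           (λ x d s e → x ≼ d ⟹ d ≼ s ⟹ s ≐ 2 ⊙ e ⟹ e ≼ # 0 ⟹ x ≼ # 0) (deg-term {A = H} v∈) (S-term {A = H} u∈ (λ _ → deg≥0)) (degrees-sum H) (proj₁ (proj₂ (proj₂ squeeze))))
        where
        ≤0 : ∀ k → + k ≤ 0ℤ → k ≡ 0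
        ≤0 zero _ = refl
        ≤0 (suc k) (+≤+ ())

      simple : ∀ {u v} → u ∈ A → v ∈ A → + m u v ≤ 1ℤ
      simple = simple-of-excess (proj₂ (proj₂ (proj₂ (proj₂ squeeze))))

      -- The degrees on `F` sum to `3 |F| - deficit F`, of which the tree uses `2 |F| - 2`.
      crossing-edges : Mu.D H F ≡ ∣ F ∣ + + 2 - deficit F
      crossing-edges = lin (Mu.D H F ∷ Mu.D F H ∷ Mu.D F F ∷ Mu.e F ∷ ∑S F (λ v → deg v A) ∷ ∑S F h ∷ deficit F ∷ ∣ F ∣ ∷ [])
        (λ d d' ff e s t δ f → d ≐ d' ⟹ 2 ⊙ e ≐ ff ⟹ s ≐ ff ⊕ d' ⟹ s ≐ t ⟹ δ ≐ 3 ⊙ f ⊖ t ⟹ e ⊕ # 1 ≐ f ⟹ d ≐ f ⊕ # 2 ⊖ δ)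
        (Mu.D-sym H F) (Mu.e-double F) (deg-parts F) (S-cong {A = F} (λ q → proj₂ (low-F q))) (deficit-sum F) (proj₁ squeeze)

      -- If `F` were a single vertex, at most two edges would lead to `H`, but a vertex of the
      -- independent set `H` with full list needs at least four.
      single : ∣ F ∣ ≤ 1ℤ → ⊥
      single small = let (y , y∈ , _) = S-find {A = H} (subst (1ℤ ≤_) (D-deg H F) many) in
        lin (∣ F ∣ ∷ ∣ H ∣ ∷ deficit F ∷ Mu.D H F ∷ Mu.D H H ∷ Mu.e H ∷ ∑S H (λ v → deg v A) ∷ ∑S H h ∷ deficit H ∷ [])
          (λ f g δ d hh e s t δH → f ≼ # 1 ⟹ # 1 ≼ δ ⟹ d ≐ f ⊕ # 2 ⊖ δ ⟹ 2 ⊙ e ≐ hh ⟹ e ≼ # 0 ⟹ s ≐ d ⊕ hh ⟹ t ⊕ g ≼ s ⟹ δH ≐ 3 ⊙ g ⊖ t ⟹ δH ≼ # 0 ⟹ # 1 ≼ g ⟹ contra)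
          small (deficit-at v₀∈F) crossing-edges (Mu.e-double H) (proj₁ (proj₂ (proj₂ squeeze))) (deg-parts H) high-degrees (deficit-sum H)
          (proj₁ (proj₂ (proj₂ (proj₂ squeeze)))) (card-pos y∈)
        where
        many : 1ℤ ≤ Mu.D H F
        many = lin (Mu.D H F ∷ ∣ F ∣ ∷ deficit F ∷ []) (λ d f δ → d ≐ f ⊕ # 2 ⊖ δ ⟹ # 1 ≼ f ⟹ δ ≼ # 1 ⟹ # 1 ≼ d) crossing-edges (card-pos v₀∈F) (proj₁ (proj₂ squeeze))

      -- The leaf ℓ has two neighbours in H; they are coloured so as to block the same colour at ℓ, which leaves
      -- ℓ one colour more than its degree in F.
      module Leaf {ℓ} (ℓ∈ : ℓ ∈ F⁻) (leaf : deg ℓ F ≤ 1ℤ) where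
        ℓ∈F : ℓ ∈ F
        ℓ∈F = ∖ˡ {A = F} ℓ∈

        deg-parts₁ : ∀ v → deg v A ≡ deg v F + deg v H
        deg-parts₁ v = deg-split v F⊆

        deg-H : + 2 ≤ deg ℓ H
        deg-H = lin (deg ℓ A ∷ deg ℓ F ∷ deg ℓ H ∷ h ℓ ∷ []) (λ a f g x → a ≐ f ⊕ g ⟹ f ≼ # 1 ⟹ a ≐ x ⟹ x ≐ # 3 ⟹ # 2 ≼ g)
          (deg-parts₁ ℓ) leaf (proj₂ (low-F ℓ∈F)) (full-card (full-F ℓ∈))

        without : ∀ {Z z} → z ∈ Z → deg ℓ Z ≡ + m ℓ z + deg ℓ (Z ∖ ⟨ z ⟩)
        without {Z} {z} z∈ = trans (S-split Z ⟨ z ⟩ (λ u → + m ℓ u))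
          (cong (λ t → t + deg ℓ (Z ∖ ⟨ z ⟩)) (trans (S-ext⊆ {A = Z ∩ ⟨ z ⟩} (∩ʳ {A = Z}) (λ q → ∩-intro (⟨⟩-⊆ z∈ q) q)) (S-point z _)))

        resolve : R
        resolve = first (S-find {A = H} (ℤp.≤-trans (+≤+ (ℕ.s≤s ℕ.z≤n)) deg-H))
          where
          first : ∃[ y ] y ∈ H × 1ℤ ≤ + m ℓ y → R
          first (y₁ , y₁∈ , m₁) = second (S-find {A = H ∖ ⟨ y₁ ⟩} (lin (deg ℓ H ∷ + m ℓ y₁ ∷ deg ℓ (H ∖ ⟨ y₁ ⟩) ∷ [])
              (λ d x r → d ≐ x ⊕ r ⟹ # 2 ≼ d ⟹ x ≼ # 1 ⟹ # 1 ≼ r) (without y₁∈) deg-H (simple (F⊆ ℓ∈F) (∖ˡ {A = A} y₁∈))))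
            where
            second : ∃[ y ] y ∈ H ∖ ⟨ y₁ ⟩ × 1ℤ ≤ + m ℓ y → R
            second (y₂ , y₂∈ , m₂) = third (matching (simple (∖ˡ {A = A} y₁∈) (F⊆ ℓ∈F))) (matching (simple (∖ˡ {A = A} (∖ˡ {A = H} y₂∈)) (F⊆ ℓ∈F)))
             where
             third : (Σ Permutation λ π → ∀ {c d} → d ∈ M y₁ c ℓ → d ≡ Permutation.to π c) →
                     (Σ Permutation λ π → ∀ {c d} → d ∈ M y₂ c ℓ → d ≡ Permutation.to π c) → R
             third (π₁ , spec₁) (π₂ , spec₂) = byGreedy (degenerate ℤ.∣ ∣ F ∣ ∣ L° F (ℤp.≤-reflexive (sym (ℤp.0≤i⇒+∣i∣≡i card-nonneg))))
              where
              c : Colour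
              c = Permutation.to π₁ 0F
              colour : Fin n → Colour
              -- `H` is independent with full lists, so every assignment is proper and 0 is
              -- arbitrary. The colour of `y₂` is chosen so that its partner at `ℓ` is `c`, the
              -- partner of the colour of `y₁`.
              colour v = if v ≡ᵇ y₂ then Permutation.from π₂ c else 0F
              φ : Colouring L H
              φ = record { col = colour ; col∈ = λ v∈ → full-H v∈ ; proper = λ u∈ v∈ → M-zero (independent u∈ v∈) }
              L° : Lists
              L° = residual L H colour
              at₁ : ∀ {d} → d ∈ M y₁ (colour y₁) ℓ → d ≡ c
              at₁ {d} q = spec₁ (subst (λ x → d ∈ M y₁ x ℓ) (cong (λ b → if b then Permutation.from π₂ c else 0F) (≡ᵇ-≢ (∉⟨⟩-elim (∖ʳ {A = H} y₂∈) ∘ sym))) q)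
              at₂ : ∀ {d} → d ∈ M y₂ (colour y₂) ℓ → d ≡ c
              at₂ {d} q = trans (spec₂ (subst (λ x → d ∈ M y₂ x ℓ) (cong (λ b → if b then Permutation.from π₂ c else 0F) (≡ᵇ-refl y₂)) q)) (Permutation.to-from π₂ c)
              rest : VSet n
              rest = H ∖ ⟨ y₁ ⟩ ∖ ⟨ y₂ ⟩
              sparse-block : blocked H colour ℓ ⊆ ⟨ c ⟩ ∪ blocked rest colour ℓ
              sparse-block {d} q = let (s , s∈ , r) = blocked-elim {H} {colour} {ℓ} q in by s s∈ r (dec∈ s ⟨ y₁ ⟩) (dec∈ s ⟨ y₂ ⟩)
                where
                by : ∀ s → s ∈ H → d ∈ M s (colour s) ℓ → (s ∈ ⟨ y₁ ⟩) ⊎ (s ∉ ⟨ y₁ ⟩) → (s ∈ ⟨ y₂ ⟩) ⊎ (s ∉ ⟨ y₂ ⟩) → d ∈ ⟨ c ⟩ ∪ blocked rest colour ℓ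
                by s s∈ r (inj₁ e) _ = ∪ˡ {A = ⟨ c ⟩} (subst (_∈ ⟨ c ⟩) (sym (at₁ (subst (λ s → d ∈ M s (colour s) ℓ) (⟨⟩-elim e) r))) ∈⟨⟩)
                by s s∈ r (inj₂ _) (inj₁ e) = ∪ˡ {A = ⟨ c ⟩} (subst (_∈ ⟨ c ⟩) (sym (at₂ (subst (λ s → d ∈ M s (colour s) ℓ) (⟨⟩-elim e) r))) ∈⟨⟩)
                by s s∈ r (inj₂ n₁) (inj₂ n₂) = ∪ʳ {A = ⟨ c ⟩} (blocked-intro (∖-intro (∖-intro s∈ n₁) n₂) r)
              at-leaf : deg ℓ F + 1ℤ ≤ ∣ L° ℓ ∣
              at-leaf = lin (∣ L ℓ ∣ ∷ ∣ L ℓ ∩ B ∣ ∷ ∣ L° ℓ ∣ ∷ ∣ ⟨ c ⟩ ∪ B' ∣ ∷ ∣ ⟨ c ⟩ ∣ ∷ ∣ B' ∣ ∷ deg ℓ rest ∷ deg ℓ (H ∖ ⟨ y₁ ⟩) ∷ deg ℓ H ∷ deg ℓ F ∷ deg ℓ A ∷ + m ℓ y₁ ∷ + m ℓ y₂ ∷ [])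
                (λ l i r u o b d₂ d₁ d f a x y → l ≐ i ⊕ r ⟹ i ≼ u ⟹ u ≼ o ⊕ b ⟹ o ≐ # 1 ⟹ b ≼ d₂ ⟹ d₁ ≐ y ⊕ d₂ ⟹ d ≐ x ⊕ d₁ ⟹ # 1 ≼ x ⟹ # 1 ≼ y ⟹ a ≐ f ⊕ d ⟹ a ≐ l ⟹ f ⊕ # 1 ≼ r)
                (card-split (L ℓ) B) (card-mono (λ q → sparse-block (∩ʳ {A = L ℓ} q))) (card-∪≤ ⟨ c ⟩ B') (card-point c) (blocked-card rest colour ℓ)
                (without y₂∈) (without y₁∈) m₁ m₂ (deg-parts₁ ℓ) (proj₂ (low-F ℓ∈F))
                where
                B B' : VSet 3
                B = blocked H colour ℓ
                B' = blocked rest colour ℓ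
              residual-F : ∀ {v} → v ∈ F → deg v F ≤ ∣ L° v ∣
              residual-F {v} v∈ = lin (∣ L v ∣ ∷ ∣ L° v ∣ ∷ deg v H ∷ deg v F ∷ deg v A ∷ []) (λ l r d f a → l ≼ r ⊕ d ⟹ a ≐ f ⊕ d ⟹ a ≐ l ⟹ f ≼ r)
                (residual-card L H colour v) (deg-parts₁ v) (proj₂ (low-F v∈))
              byGreedy : Colouring L° F ⊎ (∃[ Y ] Y ⊆ F × (∃[ y ] y ∈ Y) × (∀ {v} → v ∈ Y → ∣ L° v ∣ ≤ deg v Y)) → R
              byGreedy (inj₁ ψ) = finish F⊆ φ ψ
              -- The remaining set `Y` misses `ℓ`, and its vertices have all their neighbours in `F`
              -- inside `Y`. The tree would fall apart into two nonempty forests with at most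
              -- `|F| - 2` edges.
              byGreedy (inj₂ (Y , Y⊆ , (y , y∈) , short)) = acyclic (λ q → low-F (Y⊆ q)) y∈ λ eY →
                acyclic (λ q → low-F (∖ˡ {A = F} q)) (∖-intro ℓ∈F ℓ∉Y) λ eZ → ⊥-elim
                  (lin (Mu.e F ∷ Mu.e (Y ∪ F ∖ Y) ∷ Mu.e Y ∷ Mu.e (F ∖ Y) ∷ Mu.D Y (F ∖ Y) ∷ ∑S Y (λ v → deg v (F ∖ Y)) ∷ ∣ F ∣ ∷ ∣ F ∩ Y ∣ ∷ ∣ Y ∣ ∷ ∣ F ∖ Y ∣ ∷ [])
                    (λ e e' a b d s f i y z → e ≐ e' ⟹ e' ≐ a ⊕ b ⊕ d ⟹ d ≐ s ⟹ s ≼ # 0 ⟹ f ≐ i ⊕ z ⟹ y ≼ i ⟹ a ⊕ # 1 ≼ y ⟹ b ⊕ # 1 ≼ z ⟹ e ⊕ # 1 ≐ f ⟹ contra)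
                    (Mu.e-ext there back) (Mu.e-∪ apart) (D-deg Y (F ∖ Y)) isolated (card-split F Y)
                    (card-mono (λ q → ∩-intro (Y⊆ q) q)) eY eZ (proj₁ squeeze))
                where
                there : F ⊆ Y ∪ F ∖ Y
                there {v} q with dec∈ v Y
                ... | inj₁ x = ∪ˡ {A = Y} x
                ... | inj₂ x = ∪ʳ {A = Y} (∖-intro q x)
                back : Y ∪ F ∖ Y ⊆ F
                back q = [ Y⊆ , ∖ˡ {A = F} ]′ (∪-elim {A = Y} q)
                apart : Disjoint Y (F ∖ Y)
                apart q = not-in (λ z → absurd∈ q (∖ʳ {A = F} z))
                ℓ∉Y : ℓ ∉ Y
                ℓ∉Y = not-in (λ q → lin (deg ℓ F ∷ deg ℓ Y ∷ ∣ L° ℓ ∣ ∷ []) (λ f y r → f ⊕ # 1 ≼ r ⟹ r ≼ y ⟹ y ≼ f ⟹ contra) at-leaf (short q) (deg-⊆ Y⊆))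
                isolated : ∑S Y (λ v → deg v (F ∖ Y)) ≤ 0ℤ
                isolated = subst (∑S Y (λ v → deg v (F ∖ Y)) ≤_) (S-zero {A = Y}) (S-mono {A = Y} (λ {v} v∈ →
                  lin (deg v F ∷ deg v (F ∩ Y) ∷ deg v (F ∖ Y) ∷ deg v Y ∷ ∣ L° v ∣ ∷ []) (λ f i z y r → f ≐ i ⊕ z ⟹ y ≼ i ⟹ f ≼ r ⟹ r ≼ y ⟹ z ≼ # 0)
                    (S-split F Y (λ u → + m v u)) (deg-⊆ (λ q → ∩-intro (Y⊆ q) q)) (residual-F (Y⊆ v∈)) (short v∈)))

      -- If all other vertices had degree at least 2, the degree sum `2 |F| - 2` would leave nothing
      -- for `v₀`. Removing it would then keep as many edges as there are remaining vertices, too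
      -- many for a forest.
      findLeaf : (∃[ ℓ ] ℓ ∈ F⁻ × deg ℓ F ≤ 1ℤ) ⊎ (∀ {v} → v ∈ F⁻ → 1ℤ + 1ℤ ≤ deg v F) → R
      findLeaf (inj₁ (ℓ , ℓ∈ , leaf)) = Leaf.resolve ℓ∈ leaf
      findLeaf (inj₂ big) = go (dec≤ ∣ F⁻ ∣ 0ℤ)
        where
        isolated : deg v₀ F ≤ 0ℤ
        isolated = lin (deg v₀ F ∷ ∑S F (λ v → deg v F) ∷ ∑S (F ∩ ⟨ v₀ ⟩) (λ v → deg v F) ∷ ∑S F⁻ (λ v → deg v F) ∷ ∑S F⁻ (λ _ → + 2 * 1ℤ) ∷ ∣ F⁻ ∣ ∷ ∣ F ∣ ∷ Mu.e F ∷ ∑S F⁻ (λ _ → 1ℤ) ∷ [])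
          (λ d s i r t c f e o → s ≐ i ⊕ r ⟹ d ≼ i ⟹ t ≼ r ⟹ t ≐ 2 ⊙ o ⟹ c ≐ o ⟹ f ≐ c ⊕ # 1 ⟹ s ≐ 2 ⊙ e ⟹ e ⊕ # 1 ≐ f ⟹ d ≼ # 0)
          (S-split F ⟨ v₀ ⟩ (λ v → deg v F)) (S-term {A = F ∩ ⟨ v₀ ⟩} (∩-intro v₀∈F ∈⟨⟩) (λ _ → deg≥0)) (S-mono {A = F⁻} big) (S-* F⁻ (+ 2) (λ _ → 1ℤ)) (card-sum F⁻)
          (card-remove v₀∈F) (degrees-sum F) (proj₁ squeeze)
        go : (∣ F⁻ ∣ ≤ 0ℤ) ⊎ (0ℤ + 1ℤ ≤ ∣ F⁻ ∣) → R
        go (inj₁ z) = ⊥-elim (single (lin (∣ F ∣ ∷ ∣ F⁻ ∣ ∷ []) (λ f g → f ≐ g ⊕ # 1 ⟹ g ≼ # 0 ⟹ f ≼ # 1) (card-remove v₀∈F) z))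
        go (inj₂ pos) = acyclic (λ q → low-F (∖ˡ {A = F} q)) (proj₂ (card-find {A = F⁻} pos)) λ eF⁻ → ⊥-elim
          (lin (Mu.e F ∷ Mu.e F⁻ ∷ deg v₀ F ∷ ∣ F ∣ ∷ ∣ F⁻ ∣ ∷ []) (λ e e' d f g → e ≐ e' ⊕ d ⟹ d ≼ # 0 ⟹ f ≐ g ⊕ # 1 ⟹ e' ⊕ # 1 ≼ g ⟹ e ⊕ # 1 ≐ f ⟹ contra)
            (edges+ v₀∈F) isolated (card-remove v₀∈F) eF⁻ (proj₁ squeeze))

    resolve : R
    resolve = byLow (dec≤ ∣ F ∣ 0ℤ)
      where
      byLow : (∣ F ∣ ≤ 0ℤ) ⊎ (0ℤ + 1ℤ ≤ ∣ F ∣) → R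
      byLow (inj₁ z) = [ (λ q → small-out (λ x → x) v₀∈ q) , (λ q → ⊥-elim (lin (deficit H ∷ []) (λ d → d ≼ # 0 ⟹ # 1 ≼ d ⟹ contra) (proj₁ q) (deficit-at (∖-intro v₀∈ (card-zero z))))) ]′ (noLow (card-zero z) v₀∈)
      byLow (inj₂ pos) = acyclic low-F (proj₂ (card-find {A = F} pos)) λ eF → bySide eF (dec∈ v₀ F)
        where
        bySide : Mu.e F + 1ℤ ≤ ∣ F ∣ → (v₀ ∈ F) ⊎ (v₀ ∉ F) → R
        bySide eF (inj₂ v₀∉) = small-out (λ x → x) v₀∈
          (lin (ρ L A ∷ excess ∷ deficit F ∷ Mu.e H ∷ deficit H ∷ ∣ F ∣ ∷ Mu.e F ∷ [])
            (λ r x δF eH δH f eF → r ⊕ x ⊕ δF ⊕ eH ⊕ 2 ⊙ δH ⊕ f ≼ eF ⟹ eF ⊕ # 1 ≼ f ⟹ # 0 ≼ x ⟹ # 0 ≼ δF ⟹ # 0 ≼ eH ⟹ # 1 ≼ δH ⟹ r ⊕ # 3 ≼ # 0)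
            charge eF excess≥0 (deficit≥0 F) (edges≥0 H) (deficit-at (∖-intro v₀∈ v₀∉)))
        bySide eF (inj₁ v₀∈F) = byρ (dec≤ (ρ L A + + 3) 0ℤ)
          where
          byρ : (ρ L A + + 3 ≤ 0ℤ) ⊎ (0ℤ + 1ℤ ≤ ρ L A + + 3) → R
          byρ (inj₁ q) = small-out (λ x → x) v₀∈ q
          byρ (inj₂ q) = Tight.findLeaf v₀∈F eF q (search _ (λ v → dec≤ (deg v F) 1ℤ))

  deficientWorld : ∀ {v₀} → v₀ ∈ A → ∃[ c ] c ∉ L v₀ → R
  deficientWorld v₀∈ v₀-not = withDegrees (DeficientWorld.resolve _ v₀∈ v₀-not)

-- The threshold is fixed here: below -2 every subset is the first outcome, whereas below 0 the
-- second outcome needs full lists, so `μ = 0` is used only if all lists on `A` are full.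
colourable-or-outcome : ∀ {n} k (Γ : Cover n) L A → ∣ A ∣ ≤ + k → Covers.Colouring Γ L A ⊎ Out Γ L A
colourable-or-outcome zero Γ L A h = inj₁ (Covers.emptyColouring Γ (card-zero h))
colourable-or-outcome {n} (suc k) Γ L A h = byEmpty (dec≤ ∣ A ∣ 0ℤ)
  where
  open Covers Γ
  Goal′ : Set
  Goal′ = Colouring L A ⊎ Out Γ L A
  IH : ∀ (Γ' : Cover n) L' B → ∣ B ∣ + 1ℤ ≤ ∣ A ∣ → Covers.Colouring Γ' L' B ⊎ Out Γ' L' B
  IH Γ' L' B q = colourable-or-outcome k Γ' L' B (lin (∣ A ∣ ∷ ∣ B ∣ ∷ + k ∷ []) (λ a b k → b ⊕ # 1 ≼ a ⟹ a ≼ # 1 ⊕ k ⟹ b ≼ k) q h)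
  state : (μ : ℤ) → 0ℤ ≤ μ + + 2 → (∀ {B b} → B ⊆ A → b ∈ B → ρ L B + 1ℤ ≤ μ → Goal′) → State n
  state μ μ≥ low = record { Γ = Γ ; L = L ; A = A ; R = Goal′ ; IH = IH ; out = inj₂ ; done = inj₁ ; μ = μ ; μ≥ = μ≥ ; low = low }
  byFull : ∀ {a} → a ∈ A → (∃[ v ] v ∈ A × ∃[ c ] c ∉ L v) ⊎ (∀ {v} → v ∈ A → Full (L v)) → Goal′
  byFull a∈ (inj₁ (v₀ , v₀∈ , v₀-not)) = Conclusion.deficientWorld
    (state (- (+ 2)) ℤp.≤-refl (λ {B} {b} ba b∈ q → inj₂ (B , ba , (b , b∈) , inj₁ (lin (ρ L B ∷ []) (λ r → r ⊕ # 1 ≼ # 0 ⊖ # 2 ⟹ r ⊕ # 3 ≼ # 0) q)))) v₀∈ v₀-not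
  byFull a∈ (inj₂ fullA) = Conclusion.fullWorld
    (state 0ℤ (+≤+ ℕ.z≤n) (λ {B} {b} ba b∈ q → inj₂ (B , ba , (b , b∈) , inj₂ (inj₁ ((λ v∈ → fullA (ba v∈)) , q))))) refl fullA a∈
  byEmpty : (∣ A ∣ ≤ 0ℤ) ⊎ (0ℤ + 1ℤ ≤ ∣ A ∣) → Goal′
  byEmpty (inj₁ z) = inj₁ (emptyColouring (card-zero z))
  byEmpty (inj₂ pos) = byFull (proj₂ (card-find pos)) (search A (λ v → [ inj₂ , (λ q → inj₁ (proj₂ (proj₂ q))) ]′ (full? (L v))))

-- Critical graphs

-- A constructive substitute for excluded middle. That `G` is not DP 3-colourable is only a
-- negation, so a bad cover, and with it the conclusion `R`, has to be found by running through all
-- covers.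
Exhaustible : Set → Set₁
Exhaustible X = ∀ (P : X → Set) {R : Set} → (∀ x → P x ⊎ R) → (∀ x → P x) ⊎ R

exhaust-Bool : Exhaustible Bool
exhaust-Bool P h with h true | h false
... | inj₂ r | _ = inj₂ r
... | inj₁ _ | inj₂ r = inj₂ r
... | inj₁ a | inj₁ b = inj₁ λ { true → a ; false → b }

exhaust-Vec : ∀ {X} n → Exhaustible X → Exhaustible (Vec X n)
exhaust-Vec zero ex P h with h []
... | inj₁ a = inj₁ λ { [] → a }
... | inj₂ r = inj₂ r
exhaust-Vec (suc n) ex P h with ex (λ x → ∀ xs → P (x ∷ xs)) (λ x → exhaust-Vec n ex (λ xs → P (x ∷ xs)) (λ xs → h (x ∷ xs)))
... | inj₁ a = inj₁ λ { (x ∷ xs) → a x xs }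
... | inj₂ r = inj₂ r

∧-elimʳ : ∀ a {b} → a ∧ b ≡ true → b ≡ true
∧-elimʳ true q = q

ProperColouring : Graph → Set
ProperColouring G = Σ (Fin (Graph.n G) → Colour) λ c → ∀ i j → adj G i j ≡ true → c i ≢ c j

-- In the cover that joins equal colours of adjacent vertices, colourings are the ordinary proper
-- ones.
DP⇒proper : ∀ G → DPColorable G 3 → ProperColouring G
DP⇒proper G dp = let (φ , ok) = dp (λ _ → 3) (λ _ → ℕp.≤-refl) same isCover in
  φ , λ i j a q → true≢false (cong₂ _∧_ a (trans (cong (φ i ≡ᵇ_) (sym q)) (≡ᵇ-refl (φ i)))) (ok i j)
  where
  same : Fin (Graph.n G) → Colour → Fin (Graph.n G) → Colour → Bool
  same u c v d = adj G u v ∧ (c ≡ᵇ d)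
  isCover : IsCover G (λ _ → 3) same
  isCover = record
    { M-sym = λ u c v d → cong₂ _∧_ (Graph.sym G u v) (≡ᵇ-sym c d)
    ; M-indep = λ u c d → cong (_∧ (c ≡ᵇ d)) (Graph.irrefl G u)
    ; M-nonadj = λ u v c d _ q → cong (_∧ (c ≡ᵇ d)) q
    ; M-matching = λ u v c d d' _ q r → trans (sym (≡ᵇ⇒≡ {u = c} (∧-elimʳ (adj G u v) q))) (≡ᵇ⇒≡ {u = c} (∧-elimʳ (adj G u v) r)) }

-- If the ends of the deleted edge get different colours, `G₁` is coloured; if they agree, their
-- colour can be given to the vertex `z` and `G₂` is coloured. K₄ fails by the pigeonhole principle.
ore-uncolourable : ∀ {G} → Ore4 G → ¬ ProperColouring G
ore-uncolourable (ore-K4 (n≡4 , all)) (c , ok) =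
  let (i , j , i<j , q) = Finp.pigeonhole (subst (3 ℕ.<_) (sym n≡4) ℕp.≤-refl) c in ok i j (all i j (Finp.<⇒≢ i<j)) q
ore-uncolourable (ore-comp {G₁} {G₂} o₁ o₂ composition) (c , ok) = byEnds (c (α x) Finp.≟ c (α y))
  where
  open DHGO composition
  byEnds : Dec (c (α x) ≡ c (α y)) → ⊥
  byEnds (no ne) = ore-uncolourable o₁ (c ∘ α , ok₁)
    where
    ok₁ : ∀ a b → adj G₁ a b ≡ true → c (α a) ≢ c (α b)
    ok₁ a b q with ((a Finp.≟ x) ×-dec (b Finp.≟ y)) ⊎-dec ((a Finp.≟ y) ×-dec (b Finp.≟ x))
    ... | yes (inj₁ (refl , refl)) = ne
    ... | yes (inj₂ (refl , refl)) = ne ∘ sym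
    ... | no r = ok (α a) (α b) (proj₂ (adj-αα a b) (q , r))
  byEnds (yes eq) = ore-uncolourable o₂ (c₂ , ok₂)
    where
    c₂ : Fin (Graph.n G₂) → Colour
    c₂ v = if v ≡ᵇ z then c (α x) else c (β v)
    at-z : c₂ z ≡ c (α x)
    at-z = cong (λ b → if b then c (α x) else c (β z)) (≡ᵇ-refl z)
    off-z : ∀ {v} → v ≢ z → c₂ v ≡ c (β v)
    off-z {v} ne = cong (λ b → if b then c (α x) else c (β v)) (≡ᵇ-≢ ne)
    spoke : ∀ v → v ≢ z → adj G₂ z v ≡ true → c (α x) ≢ c (β v)
    spoke v ne q with part v in side
    ... | true = ok (α x) (β v) (proj₂ (adj-αβ x v ne) (inj₁ (refl , q , side)))
    ... | false = λ r → ok (α y) (β v) (proj₂ (adj-αβ y v ne) (inj₂ (refl , q , side))) (trans (sym eq) r)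
    ok₂ : ∀ u v → adj G₂ u v ≡ true → c₂ u ≢ c₂ v
    ok₂ u v q r = byZ (u Finp.≟ z) (v Finp.≟ z)
      where
      byZ : Dec (u ≡ z) → Dec (v ≡ z) → ⊥
      byZ (yes refl) (yes refl) = true≢false q (Graph.irrefl G₂ z)
      byZ (yes refl) (no nv) = spoke v nv q (trans (sym at-z) (trans r (off-z nv)))
      byZ (no nu) (yes refl) = spoke u nu (trans (Graph.sym G₂ z u) q) (trans (sym at-z) (trans (sym r) (off-z nu)))
      byZ (no nu) (no nv) = ok (β u) (β v) (trans (adj-ββ u v nu nv) q) (trans (sym (off-z nu)) (trans r (off-z nv)))

-- Only the last composition refers to the vertices of `G₀`, so it suffices to compose its two
-- vertex maps with `θ`; the factors stay as they are.
module Isomorphism {G₀ G : Graph} (θ : Fin (Graph.n G₀) → Fin (Graph.n G)) (θ-inj : ∀ i j → θ i ≡ θ j → i ≡ j)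
                   (onto : ∀ v → ∃[ i ] θ i ≡ v) (same : ∀ i j → adj G (θ i) (θ j) ≡ adj G₀ i j) where
  order : Graph.n G ≡ Graph.n G₀
  order = ℕp.≤-antisym (Finp.injective⇒≤ {f = λ v → proj₁ (onto v)} (λ {u} {v} q → trans (sym (proj₂ (onto u))) (trans (cong θ q) (proj₂ (onto v)))))
    (Finp.injective⇒≤ {f = θ} (θ-inj _ _))

  ore : Ore4 G₀ → Ore4 G
  ore (ore-K4 (n≡4 , all)) = ore-K4 (trans order n≡4 , λ u v ne → subst₂ (λ u v → adj G u v ≡ true) (proj₂ (onto u)) (proj₂ (onto v))
    (trans (same _ _) (all _ _ (λ q → ne (trans (sym (proj₂ (onto u))) (trans (cong θ q) (proj₂ (onto v))))))))
  ore (ore-comp o₁ o₂ composition) = ore-comp o₁ o₂ record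
    { x = x ; y = y ; xy-edge = xy-edge ; z = z ; part = part ; U₁-ne = U₁-ne ; U₂-ne = U₂-ne
    ; α = θ ∘ α ; β = θ ∘ β
    ; α-inj = λ a b q → α-inj a b (θ-inj _ _ q)
    ; β-inj = λ c d nc nd q → β-inj c d nc nd (θ-inj _ _ q)
    ; αβ-disj = λ a c nc q → αβ-disj a c nc (θ-inj _ _ q)
    ; cover = λ w → [ (λ (a , q) → inj₁ (a , trans (cong θ q) (proj₂ (onto w)))) , (λ (c , nc , q) → inj₂ (c , nc , trans (cong θ q) (proj₂ (onto w)))) ]′ (cover (proj₁ (onto w)))
    ; adj-αα = λ a b → (λ q → proj₁ (adj-αα a b) (trans (sym (same _ _)) q)) , (λ q → trans (same _ _) (proj₂ (adj-αα a b) q))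
    ; adj-ββ = λ c d nc nd → trans (same _ _) (adj-ββ c d nc nd)
    ; adj-αβ = λ a c nc → (λ q → proj₁ (adj-αβ a c nc) (trans (sym (same _ _)) q)) , (λ q → trans (same _ _) (proj₂ (adj-αβ a c nc) q)) }
    where open DHGO composition

-- Matching on the record exposes the number of vertices as a successor, which `punchIn` requires.
delete : (G : Graph) → Fin (Graph.n G) → Subgraph G
delete record { n = suc k ; adj = a ; sym = s ; irrefl = i } r = record
  { sub = record { n = k ; adj = λ u v → a (Fin.punchIn r u) (Fin.punchIn r v) ; sym = λ u v → s (Fin.punchIn r u) (Fin.punchIn r v) ; irrefl = λ u → i (Fin.punchIn r u) }
  ; ι = Fin.punchIn r ; ι-inj = Finp.punchIn-injective r ; ι-adj = λ _ _ q → q }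

delete-misses : ∀ G r i → Subgraph.ι (delete G r) i ≢ r
delete-misses record { n = suc k } r i = Finp.punchInᵢ≢i r i

delete-onto : ∀ G r {v} → v ≢ r → ∃[ i ] Subgraph.ι (delete G r) i ≡ v
delete-onto record { n = suc k } r ne = Fin.punchOut (ne ∘ sym) , Finp.punchIn-punchOut (ne ∘ sym)

delete-adj : ∀ G r i j → adj (Subgraph.sub (delete G r)) i j ≡ adj G (Subgraph.ι (delete G r) i) (Subgraph.ι (delete G r) j)
delete-adj record { n = suc k } r i j = refl

opaque
  unfolding ∑ ∑S ∣_∣

  ∑-tabulate : ∀ {n} (f : Fin n → ℕ) → + ListAction.sum (List.tabulate f) ≡ ∑ (λ i → + f i)
  ∑-tabulate {zero} f = refl
  ∑-tabulate {suc n} f = trans (ℤp.pos-+ (f zero) _) (cong (λ t → + f zero + t) (∑-tabulate (f ∘ suc)))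

  card-all : ∀ n → ∣ (λ (_ : Fin n) → true) ∣ ≡ + n
  card-all zero = refl
  card-all (suc n) = trans (cong (λ t → 1ℤ + t) (card-all n)) (sym (ℤp.pos-+ 1 n))

∑-allFin : ∀ {n} (f : Fin n → ℕ) → + ListAction.sum (List.map f (List.allFin n)) ≡ ∑ (λ i → + f i)
∑-allFin f = trans (cong (λ xs → + ListAction.sum xs) (Listp.map-tabulate (λ i → i) f)) (∑-tabulate f)

card≤1 : ∀ {n} (X : VSet n) → (∀ {a b} → a ∈ X → b ∈ X → a ≡ b) → ∣ X ∣ ≤ 1ℤ
card≤1 X unique with dec≤ ∣ X ∣ 1ℤ
... | inj₁ h = h
... | inj₂ h = ⊥-elim (let (a , a∈) = card-find {A = X} (ℤp.≤-trans (+≤+ (ℕ.s≤s ℕ.z≤n)) h)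
                           (b , b∈) = card-find {A = X ∖ ⟨ a ⟩} (lin (∣ X ∣ ∷ ∣ X ∖ ⟨ a ⟩ ∣ ∷ []) (λ x y → # 2 ≼ x ⟹ x ≐ y ⊕ # 1 ⟹ # 1 ≼ y) h (card-remove a∈))
                       in ∉⟨⟩-elim (∖ʳ {A = X} b∈) (unique (∖ˡ {A = X} b∈) a∈))

module Critical (G : Graph) (critical : DPCritical G 4) where
  N : ℕ
  N = Graph.n G

  R : Set
  R = (Ore4 G × N ℕ.≤ 10) ⊎ (8 ℕ.* N ℕ.+ 1 ℕ.≤ 5 ℕ.* numEdges G)

  proper-subgraph : (S : Subgraph G) → IsProper S → DPColorable (Subgraph.sub S) 3
  proper-subgraph S pr f big = let (j , j<4 , colourable , _) = proj₂ critical S pr in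
    colourable f (λ u → ℕp.≤-trans (ℕp.+-cancelʳ-≤ 1 j 3 j<4) (big u))

  mult : Fin N → Fin N → ℕ
  mult u v = if adj G u v then 1 else 0

  adj-of : ∀ u v → 1ℤ ≤ + mult u v → adj G u v ≡ true
  adj-of u v = by (adj G u v)
    where
    by : ∀ b → 1ℤ ≤ + (if b then 1 else 0) → b ≡ true
    by true _ = refl
    by false (+≤+ ())

  everything : VSet N
  everything _ = true

  module FromCover (E : Fin N → Colour → Fin N → Colour → Bool) (isCover : IsCover G (λ _ → 3) E) where
    module C = IsCover isCover

    Γ : Cover N
    Γ = record
      { m = mult
      ; m-sym = λ u v → cong (λ b → if b then 1 else 0) (Graph.sym G u v)
      ; m-irr = λ v → cong (λ b → if b then 1 else 0) (Graph.irrefl G v)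
      ; M = E
      ; M-sym = λ {u} {c} {v} {d} q → mk∈ (trans (sym (C.M-sym u c v d)) (un∈ q))
      ; M-deg = λ u c v → bounded u c v (adj G u v) refl }
      where
      bounded : ∀ u c v b → adj G u v ≡ b → ∣ E u c v ∣ ≤ + (if b then 1 else 0)
      bounded u c v true q = card≤1 (E u c v) (λ {a} {b} x y → C.M-matching u v c a b q (un∈ x) (un∈ y))
      bounded u c v false q with dec≤ ∣ E u c v ∣ 0ℤ
      ... | inj₁ z = z
      ... | inj₂ pos = let (d , d∈) = card-find {A = E u c v} pos in true≢false (un∈ d∈) (nonadjacent d (u Finp.≟ v))
        where
        nonadjacent : ∀ d → Dec (u ≡ v) → E u c v d ≡ false
        nonadjacent d (yes refl) = C.M-indep u c d
        nonadjacent d (no ne) = C.M-nonadj u v c d ne q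

    open Potentials Γ

    all-colours : Lists
    all-colours _ = All₃

    Target : Set
    Target = HasCoverColoring G (λ _ → 3) E ⊎ R

    whole : ∀ {A} → everything ⊆ A → Colouring all-colours A → Target
    whole all φ = inj₁ (col φ , λ u v → un∉ (proper φ (all (mk∈ refl)) (all (mk∈ refl))))

    -- A 4-Ore graph is not 3-colourable, hence not DP 3-colourable, so criticality does not allow
    -- it as a proper subgraph. It therefore uses all vertices and edges of `G`.
    exceptional : ∀ {B} → Exceptional Γ B → R
    exceptional x = byIso (Finp.all? (λ v → Finp.any? (λ i → θ i Finp.≟ v)) ×-dec
        Finp.all? (λ i → Finp.all? (λ j → (adj G (θ i) (θ j) Boolp.≟ true) →-dec (adj G₀ i j Boolp.≟ true))))
      where
      open Exceptional x
      S : Subgraph G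
      S = record { sub = G₀ ; ι = θ ; ι-inj = λ _ _ → θ-inj ; ι-adj = λ i j q → adj-of _ _ (θ-adj q) }
      ≤10 : ∀ k → (k ≡ 4) ⊎ (k ≡ 7) ⊎ (k ≡ 10) → k ℕ.≤ 10
      ≤10 _ (inj₁ refl) = ℕp.m≤m+n 4 6
      ≤10 _ (inj₂ (inj₁ refl)) = ℕp.m≤m+n 7 3
      ≤10 _ (inj₂ (inj₂ refl)) = ℕp.≤-refl
      byIso : Dec ((∀ v → ∃[ i ] θ i ≡ v) × (∀ i j → adj G (θ i) (θ j) ≡ true → adj G₀ i j ≡ true)) → R
      byIso (no q) = ⊥-elim (ore-uncolourable ore (DP⇒proper G₀ (proper-subgraph S q)))
      byIso (yes (onto , induced)) = inj₁ (I.ore ore , subst (ℕ._≤ 10) (sym I.order) (≤10 _ size))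
        where
        both : ∀ a b → (a ≡ true → b ≡ true) → (b ≡ true → a ≡ true) → a ≡ b
        both true true _ _ = refl
        both false false _ _ = refl
        both true false f _ = sym (f refl)
        both false true _ g = g refl
        module I = Isomorphism {G₀} {G} θ (λ _ _ → θ-inj) onto (λ i j → both _ _ (induced i j) (λ q → adj-of _ _ (θ-adj q)))

    colour-avoiding : ∀ {B r} → r ∉ B → Colouring all-colours B
    colour-avoiding {B} {r} r∉ = extended (proper-subgraph S missing (λ _ → 3) (λ _ → ℕp.≤-refl) E′ isCover′)
      where
      S : Subgraph G
      S = delete G r
      open Subgraph S
      missing : IsProper S
      missing (onto , _) = delete-misses G r (proj₁ (onto r)) (proj₂ (onto r))
      E′ : Fin (Graph.n sub) → Colour → Fin (Graph.n sub) → Colour → Bool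
      E′ i c j d = E (ι i) c (ι j) d
      isCover′ : IsCover sub (λ _ → 3) E′
      isCover′ = record
        { M-sym = λ i c j d → C.M-sym (ι i) c (ι j) d
        ; M-indep = λ i c d → C.M-indep (ι i) c d
        ; M-nonadj = λ i j c d ne q → C.M-nonadj (ι i) (ι j) c d (ne ∘ ι-inj i j) (trans (sym (delete-adj G r i j)) q)
        ; M-matching = λ i j c d d' q → C.M-matching (ι i) (ι j) c d d' (trans (sym (delete-adj G r i j)) q) }
      extended : HasCoverColoring sub (λ _ → 3) E′ → Colouring all-colours B
      extended (φ , ok) = record { col = λ v → pick v (v Finp.≟ r) ; col∈ = λ _ → mk∈ refl
        ; proper = λ {u} {v} u∈ v∈ → mk∉ (ok′ u v (∈-≢ u∈ r∉) (∈-≢ v∈ r∉) (u Finp.≟ r) (v Finp.≟ r)) }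
        where
        pick : ∀ v → Dec (v ≡ r) → Colour
        -- `r` lies outside `B`, so its colour is never compared with another one.
        pick v (yes _) = 0F
        pick v (no ne) = φ (proj₁ (delete-onto G r ne))
        ok′ : ∀ u v → u ≢ r → v ≢ r → (du : Dec (u ≡ r)) (dv : Dec (v ≡ r)) → E u (pick u du) v (pick v dv) ≡ false
        ok′ u v nu nv (yes q) _ = ⊥-elim (nu q)
        ok′ u v nu nv (no _) (yes q) = ⊥-elim (nv q)
        ok′ u v _ _ (no nu) (no nv) = subst₂ (λ u′ v′ → E u′ (φ (proj₁ (delete-onto G r nu))) v′ (φ (proj₁ (delete-onto G r nv))) ≡ false)
          (proj₂ (delete-onto G r nu)) (proj₂ (delete-onto G r nv)) (ok _ _)

    ρ-everything : ρ all-colours everything ≡ + 8 * + N - + 5 * + numEdges G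
    ρ-everything = cong₂ _-_ vertices edges
      where
      vertices : ∑S everything (λ _ → p All₃) ≡ + 8 * + N
      vertices = trans (S-cong {A = everything} (λ _ → full-p {All₃} (mk∈ refl))) (trans (S-* everything (+ 8) (λ _ → 1ℤ))
        (cong (λ t → + 8 * t) (trans (sym (card-sum everything)) (card-all N))))
      indicator : Bool → ℕ
      indicator b = if b then 1 else 0
      edge : Fin N → Fin N → Bool
      edge i j = adj G i j ∧ (Fin.toℕ i ℕ.<ᵇ Fin.toℕ j)
      count : + numEdges G ≡ ∑ (λ i → ∑ (λ j → + indicator (edge i j)))
      count = trans (∑-allFin _) (∑-cong (λ i → trans (cong (λ xs → + ListAction.sum xs) (sym (Listp.map-∘ {g = indicator} {f = edge i} (List.allFin N)))) (∑-allFin _)))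
      weight : ∀ a b → b ▹ cost (if a then 1 else 0) ≡ + 5 * + indicator (a ∧ b)
      weight true true = refl
      weight true false = refl
      weight false true = refl
      weight false false = refl
      opaque
        unfolding Co.e ∑S
        edges : Co.e everything ≡ + 5 * + numEdges G
        edges = trans (∑-cong (λ i → trans (∑-cong (λ j → weight (adj G i j) _)) (∑-* (+ 5) _))) (trans (∑-* (+ 5) _) (cong (λ t → + 5 * t) (sym count)))

    inequality : ρ all-colours everything + 1ℤ ≤ 0ℤ → R
    inequality h = inj₂ (ℤp.drop‿+≤+ (subst₂ _≤_ (sym (trans (ℤp.pos-+ (8 ℕ.* N) 1) (cong (λ t → t + 1ℤ) (ℤp.pos-* 8 N)))) (sym (ℤp.pos-* 5 (numEdges G)))
      (lin (ρ all-colours everything ∷ + N ∷ + numEdges G ∷ []) (λ r n k → r ≐ 8 ⊙ n ⊖ 5 ⊙ k ⟹ r ⊕ # 1 ≼ # 0 ⟹ 8 ⊙ n ⊕ # 1 ≼ 5 ⊙ k) ρ-everything h)))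

    -- If the colouring of `B` does not extend, the failing `W` has potential at most `4 D - 3` with
    -- full lists, where `D` counts its edges to `B`, or at most -1 if its residual lists are full.
    -- Joining it to `B` subtracts at least `5 D`, so the union stays negative.
    enlarge : ∀ B {b} → b ∈ B → ρ all-colours B + 1ℤ ≤ 0ℤ →
              (∀ W {w} → W ⊆ everything ∖ B → w ∈ W → ρ all-colours (B ∪ W) + 1ℤ ≤ 0ℤ → Target) → Target
    enlarge B b∈ h larger = byCover (⊎-search everything B)
      where
      byCover : (∃[ v ] v ∈ everything × v ∉ B) ⊎ (everything ⊆ B) → Target
      byCover (inj₂ all) = inj₂ (inequality (subst (λ t → t + 1ℤ ≤ 0ℤ) (ρ-ext {A = B} {everything} (λ _ → mk∈ refl) all) h))
      byCover (inj₁ (r , _ , r∉)) = byRest (colourable-or-outcome ℤ.∣ ∣ rest ∣ ∣ Γ L° rest (ℤp.≤-reflexive (sym (ℤp.0≤i⇒+∣i∣≡i card-nonneg))))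
        where
        rest : VSet N
        rest = everything ∖ B
        φ : Colouring all-colours B
        φ = colour-avoiding r∉
        L° : Lists
        L° = residual all-colours B (col φ)
        apart : Disjoint B rest
        apart q = not-in (λ z → absurd∈ q (∖ʳ {A = everything} z))
        all : everything ⊆ B ∪ rest
        all {v} q with dec∈ v B
        ... | inj₁ x = ∪ˡ {A = B} x
        ... | inj₂ x = ∪ʳ {A = B} (∖-intro q x)
        byRest : Colouring L° rest ⊎ Out Γ L° rest → Target
        byRest (inj₁ ψ) = whole all (combine φ apart ψ)
        byRest (inj₂ (W , _ , _ , inj₂ (inj₂ x))) = inj₂ (exceptional x)
        byRest (inj₂ (W , W⊆ , (w , w∈) , inj₁ q)) = larger W W⊆ w∈
          (lin (ρ all-colours (B ∪ W) ∷ ρ all-colours B ∷ ρ all-colours W ∷ ρ L° W ∷ Mu.D W B ∷ [])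
            (λ u b w w° d → u ≼ b ⊕ w ⊖ 5 ⊙ d ⟹ w ≼ w° ⊕ 4 ⊙ d ⟹ w° ⊕ # 3 ≼ # 0 ⟹ b ⊕ # 1 ≼ # 0 ⟹ # 0 ≼ d ⟹ u ⊕ # 1 ≼ # 0)
            (ρ-join all-colours (λ x → not-in (λ y → absurd∈ (W⊆ y) (not-in (λ z → absurd∈ x (∖ʳ {A = everything} z))))))
            (ρ-residual all-colours B (col φ) W) q h Mu.D-nonneg)
        byRest (inj₂ (W , W⊆ , (w , w∈) , inj₂ (inj₁ (f , q)))) = larger W W⊆ w∈
          (lin (ρ all-colours (B ∪ W) ∷ ρ all-colours B ∷ ρ all-colours W ∷ ρ L° W ∷ Mu.D W B ∷ [])
            (λ u b w w° d → u ≼ b ⊕ w ⊖ 5 ⊙ d ⟹ w ≼ w° ⟹ w° ⊕ # 1 ≼ # 0 ⟹ b ⊕ # 1 ≼ # 0 ⟹ # 0 ≼ d ⟹ u ⊕ # 1 ≼ # 0)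
            (ρ-join all-colours (λ x → not-in (λ y → absurd∈ (W⊆ y) (not-in (λ z → absurd∈ x (∖ʳ {A = everything} z))))))
            (ρ-lists {A = W} {all-colours} {L°} (λ v∈ → p-mono (λ _ → f v∈))) q h Mu.D-nonneg)

    grow : ∀ k B {b} → b ∈ B → ∣ everything ∖ B ∣ ≤ + k → ρ all-colours B + 1ℤ ≤ 0ℤ → Target
    grow zero B b∈ size h = enlarge B b∈ h (λ W W⊆ w∈ _ → absurd∈ (W⊆ w∈) (card-zero size))
    grow (suc k) B b∈ size h = enlarge B b∈ h (λ W W⊆ w∈ h′ → grow k (B ∪ W) (∪ˡ {A = B} b∈)
      (lin (∣ everything ∖ B ∣ ∷ ∣ everything ∖ (B ∪ W) ∣ ∷ + k ∷ []) (λ a b k → a ≼ # 1 ⊕ k ⟹ b ⊕ # 1 ≼ a ⟹ b ≼ k) size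
        (proper-card (λ q → ∖-intro (mk∈ refl) (not-in (λ z → absurd∈ (∪ˡ {A = B} z) (∖ʳ {A = everything} q)))) (W⊆ w∈) (not-in (λ q → absurd∈ (∪ʳ {A = B} w∈) (∖ʳ {A = everything} q))))) h′)

    colourable-or : Target
    colourable-or = byOutcome (colourable-or-outcome ℤ.∣ ∣ everything ∣ ∣ Γ all-colours everything (ℤp.≤-reflexive (sym (ℤp.0≤i⇒+∣i∣≡i card-nonneg))))
      where
      start : ∀ B {b} → b ∈ B → ρ all-colours B + 1ℤ ≤ 0ℤ → Target
      start B b∈ = grow ℤ.∣ ∣ everything ∖ B ∣ ∣ B b∈ (ℤp.≤-reflexive (sym (ℤp.0≤i⇒+∣i∣≡i card-nonneg)))
      byOutcome : Colouring all-colours everything ⊎ Out Γ all-colours everything → Target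
      byOutcome (inj₁ φ) = whole (λ q → q) φ
      byOutcome (inj₂ (B , _ , (b , b∈) , inj₁ q)) = start B b∈ (lin (ρ all-colours B ∷ []) (λ r → r ⊕ # 3 ≼ # 0 ⟹ r ⊕ # 1 ≼ # 0) q)
      byOutcome (inj₂ (B , _ , (b , b∈) , inj₂ (inj₁ (_ , q)))) = start B b∈ q
      byOutcome (inj₂ (B , _ , _ , inj₂ (inj₂ x))) = inj₂ (exceptional x)

  -- Covers given as functions cannot be enumerated, whereas nested vectors of Booleans can;
  -- `decode-encode` relates the two pointwise.
  Table : Set
  Table = Vec (Vec (Vec (Vec Bool 3) N) 3) N

  decode : Table → Fin N → Colour → Fin N → Colour → Bool
  decode t u c v d = Vec.lookup (Vec.lookup (Vec.lookup (Vec.lookup t u) c) v) d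

  encode : (Fin N → Colour → Fin N → Colour → Bool) → Table
  encode E = Vec.tabulate λ u → Vec.tabulate λ c → Vec.tabulate λ v → Vec.tabulate λ d → E u c v d

  decode-encode : ∀ E u c v d → decode (encode E) u c v d ≡ E u c v d
  decode-encode E u c v d = trans (cong (λ t → Vec.lookup (Vec.lookup (Vec.lookup t c) v) d) (Vecp.lookup∘tabulate (λ u → Vec.tabulate λ c → Vec.tabulate λ v → Vec.tabulate (E u c v)) u))
    (trans (cong (λ t → Vec.lookup (Vec.lookup t v) d) (Vecp.lookup∘tabulate (λ c → Vec.tabulate λ v → Vec.tabulate (E u c v)) c))
      (trans (cong (λ t → Vec.lookup t d) (Vecp.lookup∘tabulate (λ v → Vec.tabulate (E u c v)) v)) (Vecp.lookup∘tabulate (E u c v) d)))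

  isCover? : ∀ E → Dec (IsCover G (λ _ → 3) E)
  isCover? E = map′ (λ (s , i , a , m) → record { M-sym = s ; M-indep = i ; M-nonadj = a ; M-matching = m })
    (λ C → IsCover.M-sym C , IsCover.M-indep C , IsCover.M-nonadj C , IsCover.M-matching C)
    (Finp.all? (λ u → Finp.all? λ c → Finp.all? λ v → Finp.all? λ d → E u c v d Boolp.≟ E v d u c) ×-dec
     Finp.all? (λ u → Finp.all? λ c → Finp.all? λ d → E u c u d Boolp.≟ false) ×-dec
     Finp.all? (λ u → Finp.all? λ v → Finp.all? λ c → Finp.all? λ d → ¬? (u Finp.≟ v) →-dec ((adj G u v Boolp.≟ false) →-dec (E u c v d Boolp.≟ false))) ×-dec
     Finp.all? (λ u → Finp.all? λ v → Finp.all? λ c → Finp.all? λ d → Finp.all? λ d' →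
       (adj G u v Boolp.≟ true) →-dec ((E u c v d Boolp.≟ true) →-dec ((E u c v d' Boolp.≟ true) →-dec (d Finp.≟ d')))))

  -- A longer list is cut down to its first three colours; the induced subgraph is again a cover,
  -- and its colourings are colourings of the original one.
  three-lists : (∀ t → IsCover G (λ _ → 3) (decode t) → HasCoverColoring G (λ _ → 3) (decode t)) → DPColorable G 3
  three-lists colour f big E isCover = let (φ , ok) = colour (encode E₃) isCover₃ in
    (λ u → Fin.inject≤ (φ u) (big u)) , λ u v → trans (sym (eq u (φ u) v (φ v))) (ok u v)
    where
    E₃ : Fin N → Colour → Fin N → Colour → Bool
    E₃ u c v d = E u (Fin.inject≤ c (big u)) v (Fin.inject≤ d (big v))
    eq : ∀ u c v d → decode (encode E₃) u c v d ≡ E₃ u c v d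
    eq = decode-encode E₃
    open IsCover isCover
    isCover₃ : IsCover G (λ _ → 3) (decode (encode E₃))
    isCover₃ = record
      { M-sym = λ u c v d → trans (eq u c v d) (trans (M-sym u _ v _) (sym (eq v d u c)))
      ; M-indep = λ u c d → trans (eq u c u d) (M-indep u _ _)
      ; M-nonadj = λ u v c d ne q → trans (eq u c v d) (M-nonadj u v _ _ ne q)
      ; M-matching = λ u v c d d' q x y → Finp.inject≤-injective (big v) (big v) d d'
          (M-matching u v _ _ _ q (trans (sym (eq u c v d)) x) (trans (sym (eq u c v d')) y)) }

  conclusion : R
  conclusion = [ (λ all → ⊥-elim (proj₂ (proj₁ critical) 3 ℕp.≤-refl (three-lists all))) , (λ r → r) ]′
    (exhaust-Vec N (exhaust-Vec 3 (exhaust-Vec N (exhaust-Vec 3 exhaust-Bool))) _ (λ t → try t (isCover? (decode t))))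
    where
    try : ∀ t → Dec (IsCover G (λ _ → 3) (decode t)) → (IsCover G (λ _ → 3) (decode t) → HasCoverColoring G (λ _ → 3) (decode t)) ⊎ R
    try t (no q) = inj₁ (λ C → ⊥-elim (q C))
    try t (yes C) = [ (λ φ → inj₁ (λ _ → φ)) , inj₂ ]′ (FromCover.colourable-or (decode t) C)

theorem1p4 : (G : Graph) → DPCritical G 4 →
  (Ore4 G × Graph.n G ℕ.≤ 10) ⊎ (8 ℕ.* Graph.n G ℕ.+ 1 ℕ.≤ 5 ℕ.* numEdges G)
theorem1p4 G critical = Critical.conclusion G critical
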